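{- Let $H$ be a graph. There are only finitely many (up to isomorphism) $H$-free minimal list-obstructions if and only if $H$ is an induced subgraph of $P_6$, or of $P_4 + kP_1$ for some $k \in \mathbb{N}$.
   Context: All graphs are finite and simple. A graph $G$ is $H$-free if no induced subgraph of $G$ is isomorphic to $H$. A list system $L$ of $G$ assigns to each vertex $v$ a set $L(v)\subseteq\{1,2,3\}$. $(G,L)$ is colorable if there is a proper coloring $c$ of $G$ with $c(v)\in L(v)$ for all $v$. $(G,L)$ is a minimal list-obstruction if $(G,L)$ is not colorable but for every proper induced subgraph $A$ of $G$, $(A,L|_{V(A)})$ is colorable. $P_t$ is the path on $t$ vertices, $+$ denotes disjoint union, and $P_4+kP_1$ is $P_4$ together with $k$ isolated vertices. $H$-freeness of a minimal list-obstruction $(G,L)$ refers to the graph $G$. -}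

module Defs where

open import Data.Nat using (ℕ; zero; suc; _+_; _<_; _≡ᵇ_)
open import Data.Bool using (Bool; true; false; _∨_; _∧_; T)
open import Data.Bool.Properties using (∨-comm; ∨-zeroʳ)
open import Data.Fin using (Fin; toℕ; splitAt)
open import Data.Fin.Subset using (Subset; _∈_)
open import Data.Sum using (_⊎_; inj₁; inj₂)
open import Data.Product using (Σ; _×_; _,_)
open import Data.List using (List)
open import Data.List.Relation.Unary.Any using (Any)
open import Data.Empty using (⊥)
open import Relation.Nullary using (¬_)
open import Relation.Binary.PropositionalEquality using (_≡_; _≢_; refl; trans; cong)
open import Function using (_∘_)
open import Function.Bundles using (_↔_; Inverse)
open import Function.Definitions using (Injective)

record Graph : Set where
  field
    n      : ℕ
    adj    : Fin n → Fin n → Bool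
    adj-sym    : ∀ u v → adj u v ≡ adj v u
    adj-irrefl : ∀ v → adj v v ≡ false
open Graph public

-- The subgraph of G induced on the image of an injective map f
-- (vertex i of the new graph is vertex f i of G).
induced : (G : Graph) {m : ℕ} (f : Fin m → Fin (n G)) → Graph
induced G {m} f = record
  { n = m
  ; adj = λ i j → adj G (f i) (f j)
  ; adj-sym = λ i j → adj-sym G (f i) (f j)
  ; adj-irrefl = λ i → adj-irrefl G (f i)
  }

IsInducedSubgraph : Graph → Graph → Set
IsInducedSubgraph H G =
  Σ (Fin (n H) → Fin (n G)) λ f →
    Injective _≡_ _≡_ f × (∀ u v → adj H u v ≡ adj G (f u) (f v))

Free : Graph → Graph → Set
Free H G = ¬ IsInducedSubgraph H G

ListSystem : Graph → Set
ListSystem G = Fin (n G) → Subset 3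

Colorable : (G : Graph) → ListSystem G → Set
Colorable G L =
  Σ (Fin (n G) → Fin 3) λ c →
    (∀ v → c v ∈ L v) × (∀ u v → adj G u v ≡ true → c u ≢ c v)

-- (G,L) is not colourable, but every proper induced subgraph
-- (induced on the image of an injective f : Fin m → V(G) with m < |V(G)|)
-- is colourable with the restricted lists.
MinimalListObstruction : (G : Graph) → ListSystem G → Set
MinimalListObstruction G L =
  ¬ Colorable G L ×
  (∀ (m : ℕ) (f : Fin m → Fin (n G)) → Injective _≡_ _≡_ f → m < n G →
     Colorable (induced G f) (L ∘ f))

IsoGL : (G : Graph) → ListSystem G → (G′ : Graph) → ListSystem G′ → Set
IsoGL G L G′ L′ =
  Σ (Fin (n G) ↔ Fin (n G′)) λ φ →
    (∀ u v → adj G′ (Inverse.to φ u) (Inverse.to φ v) ≡ adj G u v) ×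
    (∀ v → L′ (Inverse.to φ v) ≡ L v)

GraphWithLists : Set
GraphWithLists = Σ Graph ListSystem

isoTo : (G : Graph) → ListSystem G → GraphWithLists → Set
isoTo G L (G′ , L′) = IsoGL G L G′ L′

FinitelyManyObstructions : Graph → Set
FinitelyManyObstructions H =
  Σ (List GraphWithLists) λ Os →
    ∀ (G : Graph) (L : ListSystem G) →
      Free H G → MinimalListObstruction G L → Any (isoTo G L) Os

private
  sb≢ : ∀ a → (suc a ≡ᵇ a) ≡ false
  sb≢ zero = refl
  sb≢ (suc a) = sb≢ a

pathAdj : ∀ {t} → Fin t → Fin t → Bool
pathAdj i j = (suc (toℕ i) ≡ᵇ toℕ j) ∨ (suc (toℕ j) ≡ᵇ toℕ i)

path : ℕ → Graph
path t = record
  { n = t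
  ; adj = pathAdj
  ; adj-sym = λ i j → ∨-comm (suc (toℕ i) ≡ᵇ toℕ j) (suc (toℕ j) ≡ᵇ toℕ i)
  ; adj-irrefl = λ i → trans (cong (λ b → b ∨ b) (sb≢ (toℕ i))) refl
  }

edgeless : ℕ → Graph
edgeless k = record
  { n = k ; adj = λ _ _ → false ; adj-sym = λ _ _ → refl ; adj-irrefl = λ _ → refl }

duAdj : (G G′ : Graph) → Fin (n G + n G′) → Fin (n G + n G′) → Bool
duAdj G G′ u v with splitAt (n G) u | splitAt (n G) v
... | inj₁ a | inj₁ b = adj G a b
... | inj₂ a | inj₂ b = adj G′ a b
... | inj₁ _ | inj₂ _ = false
... | inj₂ _ | inj₁ _ = false

duSym : (G G′ : Graph) → ∀ u v → duAdj G G′ u v ≡ duAdj G G′ v u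
duSym G G′ u v with splitAt (n G) u | splitAt (n G) v
... | inj₁ a | inj₁ b = adj-sym G a b
... | inj₂ a | inj₂ b = adj-sym G′ a b
... | inj₁ _ | inj₂ _ = refl
... | inj₂ _ | inj₁ _ = refl

duIrr : (G G′ : Graph) → ∀ v → duAdj G G′ v v ≡ false
duIrr G G′ v with splitAt (n G) v
... | inj₁ a = adj-irrefl G a
... | inj₂ a = adj-irrefl G′ a

_⊕_ : Graph → Graph → Graph
G ⊕ G′ = record
  { n = n G + n G′ ; adj = duAdj G G′ ; adj-sym = duSym G G′ ; adj-irrefl = duIrr G G′ }

P4+kP1 : ℕ → Graph
P4+kP1 k = path 4 ⊕ edgeless k

{-# OPTIONS --safe #-}
-- Call an instance (live vertices S, lists L) good if it is colourable or has an obstruction of bounded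
-- size; a minimal obstruction in a class of good instances is bounded, so there are finitely many.
-- Goodness survives branching on boundedly many vertices or, simultaneously, on a whole set of literals
-- (v , c), provided each branch is good.
--
-- If all lists miss a colour, an obstruction consists of propagation chains; a shortest chain has few
-- chords, and a long one contains P6 and P4 + kP1. In a graph without P4 + kP1, a maximal
-- P4 + jP1 dominates, so branching on it leaves such lists. In a connected graph without P6, branch on
-- an induced P4 and grow the coloured connected set T so that no neighbour of T distinguishes the ends
-- of an edge outside N(T). Then the components outside N(T) can be contracted to single vertices. After a
-- further branching, two neighbours of such a vertex with different lists are adjacent, and splitting
-- the vertex into two copies gives lists that miss a colour. That the resulting chains are bounded is a
-- finite case analysis, done by a verified certificate.
--
-- Conversely, the vertices 0, ..., N - 1 coloured modulo 3, with lists {i - 1 , i} and edges i, i + 1, form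
-- a minimal obstruction, also when all chords from x down to y ≡ x + 1 (mod 3) are added for all x, or
-- only for x ≡ 0. So H embeds in each of these three graphs, and hence is an induced subgraph of a
-- path without 2P2 + P1 and 2P3.

module Submission where

open import Defs
open import Data.Bool using (Bool; true; false; _∧_; _∨_; not; if_then_else_; _xor_)
open import Data.Bool.ListAction using (any; all)
open import Data.Bool.Properties using (∧-comm; ∨-comm)
open import Data.Empty using (⊥; ⊥-elim)
open import Data.Fin using (Fin; toℕ; splitAt; join; fromℕ<; _↑ˡ_; _↑ʳ_)
open import Data.Fin.Patterns using (0F; 1F; 2F; 3F; 4F; 5F)
open import Data.Fin.Permutation using (↔⇒≡)
open import Data.Fin.Properties using (toℕ<n)
open import Data.Fin.Subset using (Subset)
open import Data.List using (List; []; _∷_; _++_; length; concatMap; map; cartesianProduct; cartesianProductWith; upTo; deduplicate; allFin)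
open import Data.List.Membership.Propositional using (_∈_; lose; find)
open import Data.List.Membership.Propositional.Properties using (∈-++⁺ˡ; ∈-++⁺ʳ; ∈-cartesianProduct⁺; ∈-map⁺; ∈-++⁻; ∈-tabulate⁺; ∈-cartesianProductWith⁺; ∈-upTo⁺; ∈-allFin; ∈-deduplicate⁺; ∈-lookup)
open import Data.List.Properties using (length-++; length-map; length-tabulate; length-deduplicate)
open import Data.List.Relation.Unary.All using (All; []; _∷_)
open import Data.List.Relation.Unary.Any using (here; there; Any; index; any?)
open import Data.List.Relation.Unary.Any.Properties using (lookup-index)
open import Data.List.Relation.Unary.Unique.DecPropositional.Properties using (deduplicate-!)
open import Data.List.Relation.Unary.Unique.Propositional using (Unique; []; _∷_)
open import Data.Maybe using (Maybe; just; nothing)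
open import Data.Nat using (ℕ; zero; suc; _+_; _*_; _≤_; z≤n; s≤s; _∸_; _<_; _<ᵇ_; _≡ᵇ_; _/_; _%_; _<?_; _≤?_; _≤ᵇ_)
open import Data.Nat.Properties using (≤-refl; ≤-trans; +-mono-≤; *-mono-≤; *-monoˡ-≤; m≤m+n; m≤n+m; +-monoʳ-≤; ≤-reflexive; *-monoʳ-≤; +-assoc; n≤1+n; +-suc; +-identityʳ; m∸n≤m; +-∸-assoc; m≤n⇒m<n∨m≡n; m≤n⇒∃[o]m+o≡n; +-cancelˡ-≤; +-comm; ≤-pred; <⇒≤; ≡ᵇ⇒≡; +-monoʳ-<; m+[n∸m]≡n; +-monoˡ-≤; *-suc; *-monoʳ-<; ≰⇒>; <-cmp; ≤-antisym; <-trans; <-irrefl; ≮⇒≥; n<1+n; ≤ᵇ⇒≤; ≤⇒≤ᵇ; ≡⇒≡ᵇ; m∸n+n≡m; ∸-monoˡ-≤; m+n∸n≡m; +-cancelʳ-≡)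
open import Data.Product using (Σ; _×_; _,_; proj₁; proj₂)
open import Data.Product.Properties using (≡-dec)
open import Data.Sum using (_⊎_; inj₁; inj₂)
open import Data.Unit using (⊤; tt)
open import Data.Vec using (Vec; []; _∷_; lookup; tabulate)
open import Data.Vec.Properties using (lookup∘tabulate; []=⇒lookup; lookup⇒[]=)
open import Function using (_∘_)
open import Function.Bundles using (_⇔_; mk⇔)
open import Function.Construct.Identity using (↔-id)
open import Function.Definitions using (Injective)
open import Relation.Binary.Definitions using (DecidableEquality; tri<; tri≈; tri>)
open import Relation.Binary.PropositionalEquality using (_≡_; _≢_; refl; sym; trans; cong; cong₂; subst; subst₂)
open import Relation.Nullary using (¬_; Dec; yes; no; does; ¬?; _→-dec_; from-yes; _×-dec_; map′)
import Data.Bool as Bool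
import Data.Bool.Properties as Boolₚ
import Data.Fin.Properties as Finₚ
import Data.List as List
import Data.List.Membership.DecPropositional as DecMem
import Data.List.Relation.Unary.All as All
import Data.Nat.Properties as ℕₚ

-- Colours, booleans and finite types

-- Bounds compose only over boundedly many nested branchings, while the sets to be treated (all
-- neighbours of a vertex of `T`, all vertices occurring in some configuration) are unbounded.
-- Simultaneous branching gets around this: an obstruction left after removing a whole set of
-- literals meets only boundedly many of them, and only those have to be refuted one by one.
--
-- The induced P4 in `T` has one purpose. A connected graph containing it is not complete bipartite,
-- and this is what tells two neighbours of `T` with different lists apart from inside `T`. Where
-- the argument restarts from a single edge, only one end of it sees live vertices, until the first
-- extension of `T` creates a P4.
--
-- The chords lost by splitting vertices are the reason why the finite case analysis is about weak
-- chains, with two kinds of exceptional chords, and not about plain propagation chains. The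
-- certificate is untrusted data: the checker evaluates the trees it decodes to, and only the
-- checker is proved sound.

Color : Set
Color = Fin 3

pattern c0 = Fin.zero
pattern c1 = Fin.suc Fin.zero
pattern c2 = Fin.suc (Fin.suc Fin.zero)

f≢t : ∀ {b} → b ≡ false → b ≡ true → ⊥
f≢t refl ()

¬t⇒f : ∀ {b} → (b ≡ true → ⊥) → b ≡ false
¬t⇒f {false} _ = refl
¬t⇒f {true} h = ⊥-elim (h refl)

bool-em : ∀ b → b ≡ true ⊎ b ≡ false
bool-em true = inj₁ refl
bool-em false = inj₂ refl

bool-ext : ∀ {a b} → (a ≡ true → b ≡ true) → (b ≡ true → a ≡ true) → a ≡ b
bool-ext {true} {b} f g = sym (f refl)
bool-ext {false} {true} f g = g refl
bool-ext {false} {false} f g = refl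

∧-l : ∀ {a b} → a ∧ b ≡ true → a ≡ true
∧-l {true} _ = refl
∧-r : ∀ {a b} → a ∧ b ≡ true → b ≡ true
∧-r {true} p = p
∧-i : ∀ {a b} → a ≡ true → b ≡ true → a ∧ b ≡ true
∧-i refl q = q
not-t : ∀ {a} → not a ≡ true → a ≡ false
not-t {false} _ = refl
not-f : ∀ {a} → a ≡ false → not a ≡ true
not-f refl = refl
∨-e : ∀ {a b} → a ∨ b ≡ true → a ≡ true ⊎ b ≡ true
∨-e {true} _ = inj₁ refl
∨-e {false} p = inj₂ p
∨-il : ∀ {a b} → a ≡ true → a ∨ b ≡ true
∨-il refl = refl
∨-ir : ∀ {a b} → b ≡ true → a ∨ b ≡ true
∨-ir {true} _ = refl
∨-ir {false} p = p

-- Opaque, like the quantifiers below, so that goals keep the form `a == b` and no search over a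
-- finite type is unfolded during type checking.
opaque
  _==_ : Color → Color → Bool
  a == b = does (a Finₚ.≟ b)

  ==-t : ∀ {a b} → (a == b) ≡ true → a ≡ b
  ==-t {a} {b} p with a Finₚ.≟ b
  ... | yes q = q
  ==-refl : ∀ a → (a == a) ≡ true
  ==-refl a with a Finₚ.≟ a
  ... | yes _ = refl
  ... | no q = ⊥-elim (q refl)

==-f : ∀ {a b} → a ≢ b → (a == b) ≡ false
==-f ne = ¬t⇒f (λ p → ne (==-t p))
==-f⁻ : ∀ {a b} → (a == b) ≡ false → a ≢ b
==-f⁻ {a} p refl = f≢t p (==-refl a)

third : Color → Color → Color
third c0 c1 = c2
third c0 c2 = c1
third c0 c0 = c1
third c1 c0 = c2
third c1 c2 = c0
third c1 c1 = c0
third c2 c0 = c1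
third c2 c1 = c0
third c2 c2 = c0

third≢l : ∀ a b → third a b ≢ a
third≢l = from-yes (Finₚ.all? λ a → Finₚ.all? λ b → ¬? (third a b Finₚ.≟ a))
third≢r : ∀ a b → third a b ≢ b
third≢r = from-yes (Finₚ.all? λ a → Finₚ.all? λ b → ¬? (third a b Finₚ.≟ b))
third-unique : ∀ a b c → a ≢ b → c ≢ a → c ≢ b → c ≡ third a b
third-unique = from-yes (Finₚ.all? λ a → Finₚ.all? λ b → Finₚ.all? λ c →
  ¬? (a Finₚ.≟ b) →-dec (¬? (c Finₚ.≟ a) →-dec (¬? (c Finₚ.≟ b) →-dec (c Finₚ.≟ third a b))))

third-of-two : ∀ {a b c d} → a ≢ b → c ≢ a → c ≢ b → d ≢ a → d ≢ b → c ≡ d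
third-of-two p q r s t = trans (third-unique _ _ _ p q r) (sym (third-unique _ _ _ p s t))

four-colours : ∀ {a b c d : Color} → a ≢ b → a ≢ c → a ≢ d → b ≢ c → b ≢ d → c ≢ d → ⊥
four-colours ab ac ad bc bd cd = cd (third-of-two ab (λ e → ac (sym e)) (λ e → bc (sym e)) (λ e → ad (sym e)) (λ e → bd (sym e)))

all-colours : (P : Color → Set) → P c0 → P c1 → P c2 → ∀ c → P c
all-colours P p q r c0 = p
all-colours P p q r c1 = q
all-colours P p q r c2 = r

opaque
  someC : (Color → Bool) → Bool
  someC P = P c0 ∨ (P c1 ∨ P c2)
  someC⇒ : ∀ (P : Color → Bool) → someC P ≡ true → Σ Color λ c → P c ≡ true
  someC⇒ P p with ∨-e p
  ... | inj₁ q = c0 , q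
  ... | inj₂ q with ∨-e q
  ... | inj₁ r = c1 , r
  ... | inj₂ r = c2 , r
  ⇒someC : ∀ (P : Color → Bool) c → P c ≡ true → someC P ≡ true
  ⇒someC P c0 p = ∨-il p
  ⇒someC P c1 p = ∨-ir {P c0} (∨-il p)
  ⇒someC P c2 p = ∨-ir {P c0} (∨-ir {P c1} p)

  everyC : (Color → Bool) → Bool
  everyC P = P c0 ∧ (P c1 ∧ P c2)
  everyC⇒ : ∀ (P : Color → Bool) → everyC P ≡ true → ∀ c → P c ≡ true
  everyC⇒ P p c0 = ∧-l p
  everyC⇒ P p c1 = ∧-l (∧-r {P c0} p)
  everyC⇒ P p c2 = ∧-r {P c1} (∧-r {P c0} p)
  ⇒everyC : ∀ (P : Color → Bool) → (∀ c → P c ≡ true) → everyC P ≡ true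
  ⇒everyC P h = ∧-i (h c0) (∧-i (h c1) (h c2))

-- Vertex sets, lists and adjacency are Boolean-valued throughout, so that every case distinction
-- and every choice of a witness below is constructive.
module Finite (V : Set) (_≟_ : DecidableEquality V) (vs : List V) (complete : ∀ v → v ∈ vs) where

  opaque
    eqb : V → V → Bool
    eqb u v = does (u ≟ v)
    eqb-t : ∀ {u v} → eqb u v ≡ true → u ≡ v
    eqb-t {u} {v} p with u ≟ v
    ... | yes q = q
    eqb-refl : ∀ u → eqb u u ≡ true
    eqb-refl u with u ≟ u
    ... | yes _ = refl
    ... | no q = ⊥-elim (q refl)

  anyL⇒ : ∀ (P : V → Bool) xs → any P xs ≡ true → Σ V λ v → v ∈ xs × P v ≡ true
  anyL⇒ P (x ∷ xs) p with ∨-e {P x} p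
  ... | inj₁ q = x , here refl , q
  ... | inj₂ q with anyL⇒ P xs q
  ... | v , m , r = v , there m , r
  ⇒anyL : ∀ (P : V → Bool) {xs v} → v ∈ xs → P v ≡ true → any P xs ≡ true
  ⇒anyL P {x ∷ xs} (here refl) p = ∨-il p
  ⇒anyL P {x ∷ xs} (there m) p = ∨-ir {P x} (⇒anyL P m p)

  opaque
    some : (V → Bool) → Bool
    some P = any P vs
    some⇒ : ∀ (P : V → Bool) → some P ≡ true → Σ V λ v → P v ≡ true
    some⇒ P p with anyL⇒ P vs p
    ... | v , _ , q = v , q
    ⇒some : ∀ (P : V → Bool) v → P v ≡ true → some P ≡ true
    ⇒some P v p = ⇒anyL P (complete v) p

  search : (P : V → Bool) → (Σ V λ v → P v ≡ true) ⊎ (∀ v → P v ≡ false)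
  search P with bool-em (some P)
  ... | inj₁ p = inj₁ (some⇒ P p)
  ... | inj₂ p = inj₂ (λ v → ¬t⇒f (λ q → f≢t p (⇒some P v q)))

  opaque
    every : (V → Bool) → Bool
    every P = not (some (λ v → not (P v)))
    every⇒ : ∀ (P : V → Bool) → every P ≡ true → ∀ v → P v ≡ true
    every⇒ P p v with bool-em (P v)
    ... | inj₁ q = q
    ... | inj₂ q = ⊥-elim (f≢t (not-t p) (⇒some (λ u → not (P u)) v (not-f q)))
    ⇒every : ∀ (P : V → Bool) → (∀ v → P v ≡ true) → every P ≡ true
    ⇒every P h = not-f (¬t⇒f λ p → let (v , q) = some⇒ (λ u → not (P u)) p in f≢t (not-t q) (h v))

  opaque
    mem : V → List V → Bool
    mem v xs = any (eqb v) xs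
    mem⇒ : ∀ {v} xs → mem v xs ≡ true → v ∈ xs
    mem⇒ xs p with anyL⇒ (eqb _) xs p
    ... | u , m , q with eqb-t q
    ... | refl = m
    ⇒mem : ∀ {v xs} → v ∈ xs → mem v xs ≡ true
    ⇒mem {v} m = ⇒anyL (eqb v) m (eqb-refl v)

-- Instances, small obstructions and reductions

length-concatMap : ∀ {A B : Set} (W : A → List B) k → (∀ x → length (W x) ≤ k) → ∀ xs → length (concatMap W xs) ≤ length xs * k
length-concatMap W k h [] = z≤n
length-concatMap W k h (x ∷ xs) = ≤-trans (≤-reflexive (length-++ (W x))) (+-mono-≤ (h x) (length-concatMap W k h xs))

∈-concatMap : ∀ {A B : Set} (W : A → List B) {x xs y} → x ∈ xs → y ∈ W x → y ∈ concatMap W xs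
∈-concatMap W (here refl) q = ∈-++⁺ˡ q
∈-concatMap W {xs = z ∷ zs} (there p) q = ∈-++⁺ʳ (W z) (∈-concatMap W p q)

opaque
  -- An obstruction of size m after the removal of literals, plus one of size m' for each of the 3
  -- literals at each of its vertices. Opaque, since the composed bounds are astronomically large.
  literalBound : ℕ → ℕ → ℕ
  literalBound m m' = m + m * (3 * m')
  literalBound-def : ∀ m m' → m + m * (3 * m') ≤ literalBound m m'
  literalBound-def m m' = ≤-refl
  ≤literalBound : ∀ m m' → m ≤ literalBound m m'
  ≤literalBound m m' = m≤m+n m _
  literalBound-mono : ∀ {m n m' n'} → m ≤ n → m' ≤ n' → literalBound m m' ≤ literalBound n n'
  literalBound-mono p q = +-mono-≤ p (*-mono-≤ p (*-mono-≤ {3} ≤-refl q))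

  -- Two vertices exhibit an immediate contradiction; otherwise each vertex of an obstruction brings
  -- along at most one deleted neighbour per colour.
  unitBound : ℕ → ℕ
  unitBound m = suc (suc (m * 4))
  unitBound-def : ∀ m → suc (suc (m * 4)) ≤ unitBound m
  unitBound-def m = ≤-refl

branch1 : ℕ → ℕ
branch1 m = literalBound 1 m

branches : ℕ → ℕ → ℕ
branches zero m = m
branches (suc k) m = branch1 (branches k m)

module Framework (V : Set) (_≟_ : DecidableEquality V) (vs : List V) (complete : ∀ v → v ∈ vs)
                 (adj : V → V → Bool) where
  open Finite V _≟_ vs complete public

  Lists Live : Set
  Lists = V → Color → Bool
  Live = V → Bool

  infix 4 _~_ _≁_
  _~_ _≁_ : V → V → Set
  u ~ v = adj u v ≡ true
  u ≁ v = adj u v ≡ false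

  -- Relative to a predicate, so that one notion covers the set of all live vertices and the live
  -- part of a finite list; `colour` is total, with arbitrary values outside `P`.
  record Col (P : V → Set) (L : Lists) : Set where
    constructor mkCol
    field
      colour : V → Color
      allowed : ∀ v → P v → L v (colour v) ≡ true
      proper : ∀ u v → P u → P v → u ~ v → colour u ≢ colour v
  open Col public

  Is : Live → V → Set
  Is S v = S v ≡ true

  On : List V → Live → V → Set
  On B S v = v ∈ B × S v ≡ true

  -- `B` may contain dead vertices and repetitions, since only its live part has to be uncolourable.
  -- An obstruction found in a part of `S` thus serves for `S` unchanged.
  Obs : ℕ → Live → Lists → Set
  Obs m S L = Σ (List V) λ B → length B ≤ m × ¬ Col (On B S) L

  Good : ℕ → Live → Lists → Set
  Good m S L = Col (Is S) L ⊎ Obs m S L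

  _⊆L_ : Lists → Lists → Set
  L ⊆L L' = ∀ v c → L v c ≡ true → L' v c ≡ true

  col-mono : ∀ {P P' L L'} → (∀ v → P' v → P v) → L ⊆L L' → Col P L → Col P' L'
  col-mono p l (mkCol f a r) = mkCol f (λ v q → l v (f v) (a v (p v q))) (λ u v q q' → r u v (p u q) (p v q'))

  good-weaken : ∀ {m m' S L} → m ≤ m' → Good m S L → Good m' S L
  good-weaken le (inj₁ c) = inj₁ c
  good-weaken le (inj₂ (B , l , n)) = inj₂ (B , ≤-trans l le , n)

  -- `W v` lists the vertices that justify the transformed instance at `v`. Backwards only a local
  -- translation is required: a colouring of the witnesses of `B` must induce one of `B`, so
  -- obstructions grow by the factor `k`.
  reduce : ∀ {m S L S' L'} k (W : V → List V) → (∀ v → length (W v) ≤ k) →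
           (Col (Is S') L' → Col (Is S) L) →
           (∀ B → Col (On (concatMap W B) S) L → Col (On B S') L') →
           Good m S' L' → Good (m * k) S L
  reduce k W h up down (inj₁ c) = inj₁ (up c)
  reduce k W h up down (inj₂ (B , l , n)) =
    inj₂ (concatMap W B , ≤-trans (length-concatMap W k h B) (*-monoˡ-≤ k l) , λ c → n (down B c))

  minus : Lists → (V → Color → Bool) → Lists
  minus L R v c = L v c ∧ not (R v c)

  set : Lists → V → Color → Lists
  set L w j v c = L v c ∧ (not (eqb v w) ∨ (c == j))

  minus⊆ : ∀ {L R} → minus L R ⊆L L
  minus⊆ v c p = ∧-l p
  set⊆ : ∀ {L w j} → set L w j ⊆L L
  set⊆ v c p = ∧-l p
  set-at : ∀ {L w j c} → set L w j w c ≡ true → c ≡ j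
  set-at {L} {w} {j} {c} p with ∨-e {not (eqb w w)} (∧-r {L w c} p)
  ... | inj₁ q = ⊥-elim (f≢t (not-t q) (eqb-refl w))
  ... | inj₂ q = ==-t q
  col-set : ∀ {P L} (c : Col P L) v → Col P (set L v (colour c v))
  col-set {P} {L} c v = mkCol (colour c)
    (λ u p → ∧-i (allowed c u p) (h u)) (proper c)
    where
    h : ∀ u → not (eqb u v) ∨ (colour c u == colour c v) ≡ true
    h u with bool-em (eqb u v)
    ... | inj₂ q = ∨-il (not-f q)
    ... | inj₁ q with eqb-t q
    ... | refl = ∨-ir {not (eqb u u)} (==-refl (colour c u))

  -- A small obstruction after the removal of R meets few literals of R, and each of them has a small
  -- obstruction of its own.
  branch-literals : ∀ {m m' S L} (R : V → Color → Bool) → Good m S (minus L R) →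
       (∀ v c → S v ≡ true → R v c ≡ true → Good m' S (set L v c)) → Good (literalBound m m') S L
  branch-literals R (inj₁ c) g = inj₁ (col-mono (λ _ p → p) minus⊆ c)
  branch-literals {m} {m'} {S} {L} R (inj₂ (B , l , n)) g = go (scan B)
    where
    Cert : V → Color → List V → Set
    Cert v c B' = S v ≡ true → R v c ≡ true → ¬ Col (On B' S) (set L v c)
    -- Literals outside `R` or at dead vertices are certified vacuously, so that all three colours
    -- of every vertex can be treated alike.
    one : ∀ v c → Col (Is S) L ⊎ (Σ (List V) λ B' → length B' ≤ m' × Cert v c B')
    one v c with bool-em (S v) | bool-em (R v c)
    ... | inj₂ sf | _ = inj₂ ([] , z≤n , λ s → ⊥-elim (f≢t sf s))
    ... | inj₁ _ | inj₂ rf = inj₂ ([] , z≤n , λ _ r → ⊥-elim (f≢t rf r))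
    ... | inj₁ s | inj₁ r with g v c s r
    ... | inj₁ cc = inj₁ (col-mono (λ _ p → p) set⊆ cc)
    ... | inj₂ (B' , l' , n') = inj₂ (B' , l' , λ _ _ → n')
    mono : ∀ {X Y L'} → (∀ {v} → v ∈ X → v ∈ Y) → ¬ Col (On X S) L' → ¬ Col (On Y S) L'
    mono i nn cc = nn (col-mono (λ v (a , b) → i a , b) (λ _ _ p → p) cc)
    three : ∀ v → Col (Is S) L ⊎ (Σ (List V) λ B' → length B' ≤ 3 * m' × (∀ c → Cert v c B'))
    three v with one v c0 | one v c1 | one v c2
    ... | inj₁ c | _ | _ = inj₁ c
    ... | inj₂ _ | inj₁ c | _ = inj₁ c
    ... | inj₂ _ | inj₂ _ | inj₁ c = inj₁ c
    ... | inj₂ (B0 , l0 , n0) | inj₂ (B1 , l1 , n1) | inj₂ (B2 , l2 , n2) =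
      inj₂ (B0 ++ (B1 ++ (B2 ++ [])) ,
            ≤-trans (≤-reflexive (length-++ B0)) (+-mono-≤ l0 (≤-trans (≤-reflexive (length-++ B1)) (+-mono-≤ l1 (≤-trans (≤-reflexive (length-++ B2)) (+-mono-≤ l2 z≤n))))) ,
            all-colours _ (λ s r → mono ∈-++⁺ˡ (n0 s r))
                          (λ s r → mono (λ i → ∈-++⁺ʳ B0 (∈-++⁺ˡ i)) (n1 s r))
                          (λ s r → mono (λ i → ∈-++⁺ʳ B0 (∈-++⁺ʳ B1 (∈-++⁺ˡ i))) (n2 s r)))
    scan : ∀ X → Col (Is S) L ⊎ (Σ (List V) λ B' → length B' ≤ length X * (3 * m') × (∀ v → v ∈ X → ∀ c → Cert v c B'))
    scan [] = inj₂ ([] , z≤n , λ _ ())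
    scan (x ∷ X) with three x | scan X
    ... | inj₁ c | _ = inj₁ c
    ... | inj₂ _ | inj₁ c = inj₁ c
    ... | inj₂ (B1 , l1 , h1) | inj₂ (B2 , l2 , h2) =
      inj₂ (B1 ++ B2 , ≤-trans (≤-reflexive (length-++ B1)) (+-mono-≤ l1 l2) ,
            λ { v (here refl) c s r → mono ∈-++⁺ˡ (h1 c s r) ; v (there i) c s r → mono (∈-++⁺ʳ B1) (h2 v i c s r) })
    go : _ → Good (literalBound m m') S L
    go (inj₁ c) = inj₁ c
    go (inj₂ (B' , l' , h)) = inj₂ (B ++ B' , ≤-trans (≤-trans (≤-reflexive (length-++ B)) (+-mono-≤ l (≤-trans l' (*-monoˡ-≤ (3 * m') l)))) (literalBound-def m m') , bad)
      where
      -- On `B` such a colouring uses no literal of `R`, because the certificate of that literal is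
      -- part of `B'`; so it would colour `B` after the removal.
      bad : ¬ Col (On (B ++ B') S) L
      bad c = n (mkCol (colour c)
         (λ v (i , s) → ∧-i (allowed c v (∈-++⁺ˡ i , s)) (not-f (¬t⇒f λ r →
             h v i (colour c v) s r (col-mono (λ u (a , b) → ∈-++⁺ʳ B a , b) (λ _ _ p → p) (col-set c v)))))
         (λ u v (i , s) (i' , s') → proper c u v (∈-++⁺ˡ i , s) (∈-++⁺ˡ i' , s')))

  -- The case of `branch-literals` where `R` is the whole list of `v`: after the removal, `v` alone
  -- is an obstruction.
  branch : ∀ {m S L} v → S v ≡ true → (∀ c → L v c ≡ true → Good m S (set L v c)) → Good (branch1 m) S L
  branch {m} {S} {L} v sv g = branch-literals {1} {m} (λ u c → eqb u v ∧ L u c)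
     (inj₂ (v ∷ [] , ≤-refl , λ c → let p = allowed c v (here refl , sv) in
        f≢t (not-t (∧-r {L v (colour c v)} p)) (∧-i (eqb-refl v) (∧-l p))))
     λ u c s e → subst (λ z → L z c ≡ true → Good m S (set L z c)) (sym (eqb-t (∧-l e))) (g c) (∧-r {eqb u v} e)

  obs-empty : ∀ {m S L} v → S v ≡ true → (∀ c → L v c ≡ false) → Good (suc m) S L
  obs-empty v sv h = inj₂ (v ∷ [] , s≤s z≤n , λ c → f≢t (h (colour c v)) (allowed c v (here refl , sv)))

  obs-edge : ∀ {m S L} u v c → S u ≡ true → S v ≡ true → u ~ v → (∀ d → L u d ≡ true → d ≡ c) → (∀ d → L v d ≡ true → d ≡ c) → Good (suc (suc m)) S L
  obs-edge {m} {S} {L} u v c su sv e hu hv = inj₂ (u ∷ v ∷ [] , s≤s (s≤s z≤n) , λ k →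
     proper k u v (here refl , su) (there (here refl) , sv) e
       (trans (hu _ (allowed k u (here refl , su))) (sym (hv _ (allowed k v (there (here refl) , sv))))))

  _∩_ _∖_ : Live → (V → Bool) → Live
  (S ∩ Q) v = S v ∧ Q v
  (S ∖ Q) v = S v ∧ not (Q v)

  obs-sub : ∀ {m S S' L} → (∀ v → S' v ≡ true → S v ≡ true) → Obs m S' L → Obs m S L
  obs-sub h (B , l , n) = B , l , λ c → n (col-mono (λ v (i , s) → i , h v s) (λ _ _ p → p) c)

  split : ∀ {m S L} Q → (∀ u v → S u ≡ true → S v ≡ true → Q u ≡ true → Q v ≡ false → u ≁ v) → (∀ u v → adj u v ≡ adj v u) →
          Good m (S ∩ Q) L → Good m (S ∖ Q) L → Good m S L
  split Q h sy (inj₂ o) _ = inj₂ (obs-sub (λ v p → ∧-l p) o)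
  split Q h sy (inj₁ _) (inj₂ o) = inj₂ (obs-sub (λ v p → ∧-l p) o)
  split {m} {S} {L} Q h sy (inj₁ a) (inj₁ b) = inj₁ (mkCol f al pr)
    where
    f : V → Color
    f v = if Q v then colour a v else colour b v
    al : ∀ v → S v ≡ true → L v (f v) ≡ true
    al v s with bool-em (Q v)
    ... | inj₁ q rewrite q = allowed a v (∧-i s q)
    ... | inj₂ q rewrite q = allowed b v (∧-i s (not-f q))
    pr : ∀ u v → S u ≡ true → S v ≡ true → u ~ v → f u ≢ f v
    pr u v s s' e with bool-em (Q u) | bool-em (Q v)
    ... | inj₁ q | inj₁ q' rewrite q | q' = proper a u v (∧-i s q) (∧-i s' q') e
    ... | inj₂ q | inj₂ q' rewrite q | q' = proper b u v (∧-i s (not-f q)) (∧-i s' (not-f q')) e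
    ... | inj₁ q | inj₂ q' = ⊥-elim (f≢t (h u v s s' q q') e)
    ... | inj₂ q | inj₁ q' = ⊥-elim (f≢t (h v u s' s q' q) (trans (sy v u) e))

  unitL : Lists → V → Set
  unitL L v = ∀ i j → L v i ≡ true → L v j ≡ true → i ≡ j

  -- Applied when the vertices of `C` have at most one colour each; then this is exact propagation
  -- of their colours.
  prune : Live → (V → Bool) → Lists → Lists
  prune S C L u j = L u j ∧ not (some (λ v → ((S v ∧ C v) ∧ adj v u) ∧ L v j))

  prune⊆ : ∀ S C L → prune S C L ⊆L L
  prune⊆ S C L v c p = ∧-l p
  prune-no : ∀ S C L u v j → S v ≡ true → C v ≡ true → v ~ u → L v j ≡ true → prune S C L u j ≡ false
  prune-no S C L u v j s c e l = ¬t⇒f λ p → f≢t (not-t (∧-r {L u j} p)) (⇒some (λ v → ((S v ∧ C v) ∧ adj v u) ∧ L v j) v (∧-i (∧-i (∧-i s c) e) l))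

  -- An empty list or an edge with equal forced colours is an obstruction of at most two vertices;
  -- otherwise the forced colouring of `C` fits every colouring of the pruned rest. The continuation
  -- receives the absence of both contradictions as hypotheses, because later steps rely on the
  -- forced colours existing and being proper.
  delete-units : ∀ {m S L} C → (∀ u v → adj u v ≡ adj v u) → (∀ v → S v ≡ true → C v ≡ true → unitL L v) →
                 ((∀ v → S v ≡ true → C v ≡ true → Σ Color λ c → L v c ≡ true) →
                  (∀ u v c → S u ≡ true → C u ≡ true → S v ≡ true → C v ≡ true → u ~ v → L u c ≡ true → L v c ≡ true → ⊥) →
                  Good m (S ∖ C) (prune S C L)) → Good (unitBound m) S L
  delete-units {m} {S} {L} C sy un g
    with search (λ v → (S v ∧ C v) ∧ not (someC (L v)))
  ... | inj₁ (v , p) = good-weaken (unitBound-def m) (obs-empty v (∧-l (∧-l p)) (λ c → ¬t⇒f (λ q → f≢t (not-t (∧-r {S v ∧ C v} p)) (⇒someC (L v) c q))))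
  ... | inj₂ ne with search (λ v → (S v ∧ C v) ∧ some (λ u → (S u ∧ C u) ∧ (adj u v ∧ someC (λ c → L u c ∧ L v c))))
  ... | inj₁ (v , p) = let (u , q) = some⇒ (λ u → (S u ∧ C u) ∧ (adj u v ∧ someC (λ c → L u c ∧ L v c))) (∧-r {S v ∧ C v} p)
                           q' = ∧-r {S u ∧ C u} q
                           (c , r) = someC⇒ (λ c → L u c ∧ L v c) (∧-r {adj u v} q')
                       in good-weaken (unitBound-def m) (obs-edge u v c (∧-l (∧-l q)) (∧-l (∧-l p)) (∧-l q')
                            (λ d e → un u (∧-l (∧-l q)) (∧-r {S u} (∧-l q)) d c e (∧-l r))
                            (λ d e → un v (∧-l (∧-l p)) (∧-r {S v} (∧-l p)) d c e (∧-r {L u c} r)))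
  ... | inj₂ nc = good-weaken (≤-trans (≤-trans (m≤n+m _ 1) (m≤n+m _ 1)) (unitBound-def m)) (reduce 4 W len up down (g (λ v s c → the v , the-ok v s c) clash))
    where
    clash : ∀ u v c → S u ≡ true → C u ≡ true → S v ≡ true → C v ≡ true → u ~ v → L u c ≡ true → L v c ≡ true → ⊥
    clash u v c su cu sv cv e lu lv = f≢t (nc v) (∧-i (∧-i sv cv) (⇒some (λ u → (S u ∧ C u) ∧ (adj u v ∧ someC (λ c → L u c ∧ L v c))) u (∧-i (∧-i su cu) (∧-i e (⇒someC (λ c → L u c ∧ L v c) c (∧-i lu lv))))))
    wit : V → Color → V → Bool
    wit u j v = ((S v ∧ C v) ∧ adj v u) ∧ L v j
    -- One neighbour in `C` is enough to justify the removal of a colour, which gives 1 + 3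
    -- witnesses per vertex.
    wl : V → Color → List V
    wl u j with search (wit u j)
    ... | inj₁ (v , _) = v ∷ []
    ... | inj₂ _ = []
    wl-len : ∀ u j → length (wl u j) ≤ 1
    wl-len u j with search (wit u j)
    ... | inj₁ _ = ≤-refl
    ... | inj₂ _ = z≤n
    W : V → List V
    W u = u ∷ wl u c0 ++ (wl u c1 ++ wl u c2)
    len : ∀ v → length (W v) ≤ 4
    len v = s≤s (≤-trans (≤-reflexive (length-++ (wl v c0))) (+-mono-≤ (wl-len v c0) (≤-trans (≤-reflexive (length-++ (wl v c1))) (+-mono-≤ (wl-len v c1) (wl-len v c2)))))
    the : V → Color
    the v with bool-em (someC (L v))
    ... | inj₁ p = proj₁ (someC⇒ (L v) p)
    ... | inj₂ _ = c0
    the-ok : ∀ v → S v ≡ true → C v ≡ true → L v (the v) ≡ true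
    the-ok v s c with bool-em (someC (L v))
    ... | inj₁ p = proj₂ (someC⇒ (L v) p)
    ... | inj₂ p = ⊥-elim (f≢t (ne v) (∧-i (∧-i s c) (not-f p)))
    up : Col (Is (S ∖ C)) (prune S C L) → Col (Is S) L
    up k = mkCol f al pr
      where
      f : V → Color
      f v = if C v then the v else colour k v
      al : ∀ v → S v ≡ true → L v (f v) ≡ true
      al v s with bool-em (C v)
      ... | inj₁ q rewrite q = the-ok v s q
      ... | inj₂ q rewrite q = ∧-l (allowed k v (∧-i s (not-f q)))
      mixed : ∀ u v → S u ≡ true → S v ≡ true → C u ≡ true → C v ≡ false → u ~ v → the u ≢ colour k v
      mixed u v s s' q q' e eq = f≢t (not-t (∧-r {L v (colour k v)} (allowed k v (∧-i s' (not-f q')))))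
            (⇒some (wit v (colour k v)) u (∧-i (∧-i (∧-i s q) e) (subst (λ z → L u z ≡ true) eq (the-ok u s q))))
      pr : ∀ u v → S u ≡ true → S v ≡ true → u ~ v → f u ≢ f v
      pr u v s s' e with bool-em (C u) | bool-em (C v)
      ... | inj₁ q | inj₂ q' rewrite q | q' = mixed u v s s' q q' e
      ... | inj₂ q | inj₁ q' rewrite q | q' = λ eq → mixed v u s' s q' q (trans (sy v u) e) (sym eq)
      ... | inj₂ q | inj₂ q' rewrite q | q' = proper k u v (∧-i s (not-f q)) (∧-i s' (not-f q')) e
      ... | inj₁ q | inj₁ q' rewrite q | q' = λ eq → f≢t (nc v) (∧-i (∧-i s' q')
             (⇒some (λ u → (S u ∧ C u) ∧ (adj u v ∧ someC (λ c → L u c ∧ L v c))) u (∧-i (∧-i s q) (∧-i e (⇒someC (λ c → L u c ∧ L v c) (the u) (∧-i (the-ok u s q) (subst (λ z → L v z ≡ true) (sym eq) (the-ok v s' q'))))))))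
    wl-in : ∀ u j → some (wit u j) ≡ true → Σ V λ v → v ∈ wl u j × wit u j v ≡ true
    wl-in u j p with search (wit u j)
    ... | inj₁ (v , q) = v , here refl , q
    ... | inj₂ q = let (v , r) = some⇒ (wit u j) p in ⊥-elim (f≢t (q v) r)
    pos : ∀ u j {v} → v ∈ wl u j → v ∈ W u
    pos u c0 i = there (∈-++⁺ˡ i)
    pos u c1 i = there (∈-++⁺ʳ (wl u c0) (∈-++⁺ˡ i))
    pos u c2 i = there (∈-++⁺ʳ (wl u c0) (∈-++⁺ʳ (wl u c1) i))
    down : ∀ B → Col (On (concatMap W B) S) L → Col (On B (S ∖ C)) (prune S C L)
    down B k = mkCol (colour k) al λ u v (i , s) (i' , s') → proper k u v (∈-concatMap W i (here refl) , ∧-l s) (∈-concatMap W i' (here refl) , ∧-l s')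
      where
      al : ∀ u → On B (S ∖ C) u → prune S C L u (colour k u) ≡ true
      al u (i , s) = ∧-i (allowed k u (∈-concatMap W i (here refl) , ∧-l s)) (not-f (¬t⇒f bad))
        where
        bad : some (wit u (colour k u)) ≡ true → ⊥
        bad p = let (v , j , q) = wl-in u (colour k u) p
                    sv = ∧-l (∧-l (∧-l q))
                    inn = ∈-concatMap W i (pos u (colour k u) j) , sv
                in proper k v u inn (∈-concatMap W i (here refl) , ∧-l s) (∧-r {S v ∧ C v} (∧-l q))
                     (un v sv (∧-r {S v} (∧-l (∧-l q))) _ _ (allowed k v inn) (∧-r {(S v ∧ C v) ∧ adj v u} q))

  -- Connectivity as induction along edges: it is used by exhibiting a closed set, and no paths have
  -- to be built or manipulated.
  Conn : Live → V → Set
  Conn S r = ∀ (Q : V → Bool) → Q r ≡ true → (∀ u v → S u ≡ true → S v ≡ true → Q u ≡ true → u ~ v → Q v ≡ true) → ∀ v → S v ≡ true → Q v ≡ true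

  count : (V → Bool) → List V → ℕ
  count P [] = 0
  count P (x ∷ xs) = if P x then suc (count P xs) else count P xs

  count-≤ : ∀ P P' xs → (∀ v → P' v ≡ true → P v ≡ true) → count P' xs ≤ count P xs
  count-≤ P P' [] h = z≤n
  count-≤ P P' (x ∷ xs) h with bool-em (P' x) | bool-em (P x)
  ... | inj₁ p | inj₁ q rewrite p | q = s≤s (count-≤ P P' xs h)
  ... | inj₁ p | inj₂ q = ⊥-elim (f≢t q (h x p))
  ... | inj₂ p | inj₁ q rewrite p | q = ≤-trans (count-≤ P P' xs h) (m≤n+m _ 1)
  ... | inj₂ p | inj₂ q rewrite p | q = count-≤ P P' xs h

  count-< : ∀ P P' xs → (∀ v → P' v ≡ true → P v ≡ true) → ∀ v → v ∈ xs → P v ≡ true → P' v ≡ false → suc (count P' xs) ≤ count P xs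
  count-< P P' (x ∷ xs) h v (here refl) p q rewrite p | q = s≤s (count-≤ P P' xs h)
  count-< P P' (x ∷ xs) h v (there i) p q with bool-em (P' x) | bool-em (P x)
  ... | inj₁ a | inj₁ b rewrite a | b = s≤s (count-< P P' xs h v i p q)
  ... | inj₁ a | inj₂ b = ⊥-elim (f≢t b (h x a))
  ... | inj₂ a | inj₁ b rewrite a | b = ≤-trans (count-< P P' xs h v i p q) (m≤n+m _ 1)
  ... | inj₂ a | inj₂ b rewrite a | b = count-< P P' xs h v i p q

  record Component (S : Live) (r : V) : Set where
    field
      K : Live
      K⊆ : ∀ v → K v ≡ true → S v ≡ true
      root : K r ≡ true
      conn : Conn K r
      closed : ∀ u v → K u ≡ true → S v ≡ true → u ~ v → K v ≡ true

  component : ∀ S r → S r ≡ true → Component S r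
  component S r sr = go (count (S ∖ K₀) vs) K₀ ≤-refl
      (λ v p → subst (λ z → S z ≡ true) (sym (eqb-t p)) sr) (eqb-refl r)
      (λ Q q _ v p → subst (λ z → Q z ≡ true) (sym (eqb-t p)) q)
    where
    K₀ : Live
    K₀ v = eqb v r
    -- The component is grown vertex by vertex; the fuel `n` bounds the number of live vertices not
    -- yet absorbed.
    go : ∀ n K → count (S ∖ K) vs ≤ n → (∀ v → K v ≡ true → S v ≡ true) → K r ≡ true → Conn K r → Component S r
    go n K le sub rt cn with search (λ v → (S v ∧ not (K v)) ∧ some (λ u → K u ∧ adj u v))
    ... | inj₂ no' = record { K = K ; K⊆ = sub ; root = rt ; conn = cn ; closed = cl }
      where
      cl : ∀ u v → K u ≡ true → S v ≡ true → u ~ v → K v ≡ true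
      cl u v ku sv e with bool-em (K v)
      ... | inj₁ p = p
      ... | inj₂ p = ⊥-elim (f≢t (no' v) (∧-i (∧-i sv (not-f p)) (⇒some (λ u → K u ∧ adj u v) u (∧-i ku e))))
    ... | inj₁ (v , p) = step n le
      where
      K' : Live
      K' x = K x ∨ eqb x v
      sv = ∧-l (∧-l p)
      nk : K v ≡ false
      nk = not-t (∧-r {S v} (∧-l p))
      smaller : suc (count (S ∖ K') vs) ≤ count (S ∖ K) vs
      smaller = count-< (S ∖ K) (S ∖ K') vs
         (λ x q → ∧-i {S x} (∧-l {S x} q) (not-f (¬t⇒f λ k → f≢t (not-t (∧-r {S x} q)) (∨-il {K x} k)))) v (complete v) (∧-i sv (not-f nk))
         (¬t⇒f λ q → f≢t (not-t (∧-r {S v} q)) (∨-ir {K v} (eqb-refl v)))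
      sub' : ∀ x → K' x ≡ true → S x ≡ true
      sub' x q with ∨-e {K x} q
      ... | inj₁ k = sub x k
      ... | inj₂ k = subst (λ z → S z ≡ true) (sym (eqb-t k)) sv
      cn' : Conn K' r
      cn' Q q cl x kx with ∨-e {K x} kx
      ... | inj₁ k = cn Q q (λ a b ka kb → cl a b (∨-il ka) (∨-il kb)) x k
      ... | inj₂ k with eqb-t k
      ... | refl = let (u , e) = some⇒ (λ u → K u ∧ adj u v) (∧-r {S v ∧ not (K v)} p)
                   in cl u v (∨-il {K u} (∧-l {K u} e)) (∨-ir {K v} (eqb-refl v)) (cn Q q (λ a b ka kb → cl a b (∨-il ka) (∨-il kb)) u (∧-l e)) (∧-r {K u} e)
      step : ∀ n → count (S ∖ K) vs ≤ n → Component S r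
      step zero le0 with ≤-trans smaller le0
      ... | ()
      step (suc n') le0 with ≤-trans smaller le0
      ... | s≤s l = go n' K' l sub' (∨-il rt) cn'

  good-ext : ∀ {m S S' L} → (∀ v → S v ≡ S' v) → Good m S L → Good m S' L
  good-ext h (inj₁ c) = inj₁ (col-mono (λ v p → trans (h v) p) (λ _ _ p → p) c)
  good-ext h (inj₂ (B , l , n)) = inj₂ (B , l , λ c → n (col-mono (λ v (i , p) → i , trans (sym (h v)) p) (λ _ _ p → p) c))

  -- The bound does not add up over the components: either one of them has an obstruction, or the
  -- colourings of all of them combine.
  by-components : ∀ {m S L} → (∀ u v → adj u v ≡ adj v u) →
    (∀ K r → (∀ v → K v ≡ true → S v ≡ true) → K r ≡ true → Conn K r → (∀ u v → K u ≡ true → S v ≡ true → u ~ v → K v ≡ true) → Good m K L) → Good m S L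
  by-components {m} {S₀} {L} sy g = go (count S₀ vs) S₀ ≤-refl (λ v p → p) (λ u v p q e → q)
    where
    go : ∀ n S → count S vs ≤ n → (∀ v → S v ≡ true → S₀ v ≡ true) → (∀ u v → S u ≡ true → S₀ v ≡ true → u ~ v → S v ≡ true) → Good m S L
    go n S le sub cl with search S
    ... | inj₂ e = inj₁ (mkCol (λ _ → c0) (λ v p → ⊥-elim (f≢t (e v) p)) (λ u v p → ⊥-elim (f≢t (e u) p)))
    ... | inj₁ (r , sr) = step n le
      where
      open Component (component S r sr)
      smaller : suc (count (S ∖ K) vs) ≤ count S vs
      smaller = count-< S (S ∖ K) vs (λ v p → ∧-l p) r (complete r) sr (¬t⇒f λ p → f≢t (not-t (∧-r {S r} p)) root)
      step : ∀ n → count S vs ≤ n → Good m S L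
      step zero l with ≤-trans smaller l
      ... | ()
      step (suc n') l with ≤-trans smaller l
      ... | s≤s l' = split K (λ u v su sv ku kv → ¬t⇒f λ e → f≢t kv (closed u v ku sv e)) sy
             (good-ext (λ v → bool-ext (λ k → ∧-i (K⊆ v k) k) (λ p → ∧-r {S v} p))
               (g K r (λ v k → sub v (K⊆ v k)) root conn (λ u v ku sv e → closed u v ku (cl u v (K⊆ u ku) sv e) e)))
             (go n' (S ∖ K) l' (λ v p → sub v (∧-l p))
               (λ u v p sv e → let sv' = cl u v (∧-l p) sv e in ∧-i sv' (not-f (¬t⇒f λ k → f≢t (not-t (∧-r {S u} p)) (closed v u k (∧-l p) (trans (sy v u) e))))))

  -- `cT` records the chosen colours. A list may have become empty on the way; only its containment
  -- in the chosen colour is asserted, and `delete-units` treats the rest.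
  branch-all : ∀ {m S} N L → (∀ n → n ∈ N → S n ≡ true) → (∀ (cT : V → Color) L' → L' ⊆L L → (∀ n → n ∈ N → ∀ c → L' n c ≡ true → c ≡ cT n) → Good m S L') → Good (branches (length N) m) S L
  branch-all [] L h g = g (λ _ → c0) L (λ _ _ p → p) (λ _ ())
  branch-all (n ∷ N) L h g = branch n (h n (here refl)) λ i _ → branch-all N (set L n i) (λ k j → h k (there j)) λ cT L' sub un →
      g (λ v → if eqb v n then i else cT v) L' (λ v c p → ∧-l (sub v c p)) (pick' i cT L' sub un)
    where
    pick' : ∀ i cT L' → L' ⊆L set L n i → (∀ k → k ∈ N → ∀ c → L' k c ≡ true → c ≡ cT k) → ∀ k → k ∈ (n ∷ N) → ∀ c → L' k c ≡ true → c ≡ (if eqb k n then i else cT k)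
    pick' i cT L' sub un k j c l with bool-em (eqb k n)
    ... | inj₁ e rewrite e = set-at {L} {n} {i} (subst (λ z → set L n i z c ≡ true) (eqb-t e) (sub k c l))
    pick' i cT L' sub un k (here refl) c l | inj₂ e = ⊥-elim (f≢t e (eqb-refl k))
    pick' i cT L' sub un k (there j) c l | inj₂ e rewrite e = un k j c l

  isP4 : Live → V → V → V → V → Bool
  isP4 U a b c d = ((U a ∧ U b) ∧ (U c ∧ U d)) ∧ (((adj a b ∧ adj b c) ∧ adj c d) ∧ ((not (adj a c) ∧ not (adj a d)) ∧ not (adj b d)))
  P4s : Live → Set
  P4s U = Σ V λ a → Σ V λ b → Σ V λ c → Σ V λ d → isP4 U a b c d ≡ true
  p4? : ∀ U → P4s U ⊎ (∀ a b c d → isP4 U a b c d ≡ false)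
  p4? U with search (λ a → some (λ b → some (λ c → some (λ d → isP4 U a b c d))))
  ... | inj₁ (a , p) = let (b , p₁) = some⇒ (λ b → some (λ c → some (λ d → isP4 U a b c d))) p
                           (c , p₂) = some⇒ (λ c → some (λ d → isP4 U a b c d)) p₁
                           (d , p₃) = some⇒ (λ d → isP4 U a b c d) p₂ in inj₁ (a , b , c , d , p₃)
  ... | inj₂ f = inj₂ λ a b c d → ¬t⇒f λ p → f≢t (f a) (⇒some (λ b → some (λ c → some (λ d → isP4 U a b c d))) b (⇒some (λ c → some (λ d → isP4 U a b c d)) c (⇒some (λ d → isP4 U a b c d) d p)))

  module P4Facts (U : Live) {a b c d} (p : isP4 U a b c d ≡ true) where
    us = ∧-l {(U a ∧ U b) ∧ (U c ∧ U d)} p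
    es = ∧-r {(U a ∧ U b) ∧ (U c ∧ U d)} p
    ua : U a ≡ true
    ua = ∧-l {U a} (∧-l {U a ∧ U b} us)
    ub : U b ≡ true
    ub = ∧-r {U a} (∧-l {U a ∧ U b} us)
    uc : U c ≡ true
    uc = ∧-l {U c} (∧-r {U a ∧ U b} us)
    ud : U d ≡ true
    ud = ∧-r {U c} (∧-r {U a ∧ U b} us)
    e₁ = ∧-l {(adj a b ∧ adj b c) ∧ adj c d} es
    e₂ = ∧-r {(adj a b ∧ adj b c) ∧ adj c d} es
    ab : a ~ b
    ab = ∧-l (∧-l e₁)
    bc : b ~ c
    bc = ∧-r {adj a b} (∧-l e₁)
    cd : c ~ d
    cd = ∧-r {adj a b ∧ adj b c} e₁
    ac : a ≁ c
    ac = not-t (∧-l (∧-l e₂))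
    ad : a ≁ d
    ad = not-t (∧-r {not (adj a c)} (∧-l e₂))
    bd : b ≁ d
    bd = not-t (∧-r {not (adj a c) ∧ not (adj a d)} e₂)

-- Lists of size two

-- In a propagation chain, c i is the colour forced on vertex i, and vertex i + 1 has the list
-- {c i , c (i + 1)}; Strong c i j is the condition for an edge between the vertices i and j + 1.
Strong : (ℕ → Color) → ℕ → ℕ → Set
Strong c i j = c i ≢ c j × c i ≢ c (suc j) × (∀ i' → i ≡ suc i' → c i' ≢ c j)

search≤ : ∀ n (P : ℕ → Bool) → (Σ ℕ λ i → i ≤ n × P i ≡ true) ⊎ (∀ i → i ≤ n → P i ≡ false)
search≤ zero P with bool-em (P 0)
... | inj₁ p = inj₁ (0 , z≤n , p)
... | inj₂ p = inj₂ λ { zero _ → p }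
search≤ (suc n) P with search≤ n P | bool-em (P (suc n))
... | inj₁ (i , l , p) | _ = inj₁ (i , ≤-trans l (n≤1+n n) , p)
... | inj₂ _ | inj₁ p = inj₁ (suc n , ≤-refl , p)
... | inj₂ h | inj₂ p = inj₂ λ i l → case' i (m≤n⇒m<n∨m≡n l)
  where
  case' : ∀ i → i < suc n ⊎ i ≡ suc n → P i ≡ false
  case' i (inj₁ (s≤s q)) = h i q
  case' i (inj₂ refl) = p

<⇒<ᵇ' : ∀ {i j} → i < j → (i <ᵇ j) ≡ true
<⇒<ᵇ' {zero} (s≤s _) = refl
<⇒<ᵇ' {suc i} (s≤s p) = <⇒<ᵇ' p
<ᵇ⇒<' : ∀ {i j} → (i <ᵇ j) ≡ true → i < j
<ᵇ⇒<' {zero} {suc j} _ = s≤s z≤n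
<ᵇ⇒<' {suc i} {suc j} p = s≤s (<ᵇ⇒<' p)

or-small : ∀ {a b x : Color} {L : Color → Bool} → (Σ Color λ m → L m ≡ false) → L a ≡ true → L b ≡ true → a ≢ b → L x ≡ true → x ≢ a → x ≡ b
or-small {a} {b} {x} {L} (m , f) la lb ab lx xa =
  third-of-two {m} {a} (λ e → f≢t f (subst (λ z → L z ≡ true) (sym e) la)) (λ e → f≢t f (subst (λ z → L z ≡ true) e lx)) xa
     (λ e → f≢t f (subst (λ z → L z ≡ true) e lb)) (λ e → ab (sym e))

-- `bound₁`: the two ends of a refuted literal and three forcing walks of `N + 2` vertices.
-- `bound₂`: a vertex and, for each of its colours, room for two such walks and one more vertex.
bound₁ bound₂ twoListBound : ℕ → ℕ
bound₁ N = 2 + 3 * suc (suc N)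
bound₂ N = 1 + 3 * (1 + (suc (suc N) + suc (suc N)))
twoListBound N = literalBound (bound₂ N) (bound₁ N)

module TwoLists (V : Set) (_≟_ : DecidableEquality V) (vs : List V) (complete : ∀ v → v ∈ vs)
                (adj : V → V → Bool) (sy : ∀ u v → adj u v ≡ adj v u) where
  open Framework V _≟_ vs complete adj

  opaque
    -- Propagation along one edge: where lists miss a colour, `c` at `u` leaves only `d` at `v`.
    step : Live → Lists → V → Color → V → Color → Bool
    step S L u c v d = ((S v ∧ adj u v) ∧ (L v c ∧ L v d)) ∧ not (c == d)

    mkStep : ∀ {S L u c v d} → S v ≡ true → u ~ v → L v c ≡ true → L v d ≡ true → c ≢ d → step S L u c v d ≡ true
    mkStep a b c d e = ∧-i (∧-i (∧-i a b) (∧-i c d)) (not-f (==-f e))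

    step-parts : ∀ {S L u c v d} → step S L u c v d ≡ true → S v ≡ true × u ~ v × L v c ≡ true × L v d ≡ true × c ≢ d
    step-parts {S} {L} {u} {c} {v} {d} p = ∧-l (∧-l (∧-l p)) , ∧-r {S v} (∧-l {S v ∧ adj u v} (∧-l p)) ,
      ∧-l (∧-r {S v ∧ adj u v} (∧-l p)) , ∧-r {L v c} (∧-r {S v ∧ adj u v} (∧-l p)) , ==-f⁻ (not-t (∧-r {(S v ∧ adj u v) ∧ (L v c ∧ L v d)} p))

  module Step {S L u c v d} (p : step S L u c v d ≡ true) where
    live : S v ≡ true
    live = proj₁ (step-parts p)
    edge : u ~ v
    edge = proj₁ (proj₂ (step-parts p))
    old : L v c ≡ true
    old = proj₁ (proj₂ (proj₂ (step-parts p)))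
    new : L v d ≡ true
    new = proj₁ (proj₂ (proj₂ (proj₂ (step-parts p))))
    diff : c ≢ d
    diff = proj₂ (proj₂ (proj₂ (proj₂ (step-parts p))))

  opaque
    -- The depth of propagation is explicit, because it bounds the size of the certificates
    -- extracted from it.
    reach : Live → Lists → ℕ → V → Color → V → Color → Bool
    via : Live → Lists → ℕ → V → Color → V → Color → V → Bool
    reach S L zero u c v d = eqb u v ∧ (c == d)
    reach S L (suc k) u c v d = reach S L k u c v d ∨ some (via S L k u c v d)
    via S L k u c v d w = someC (λ e → reach S L k u c w e ∧ step S L w e v d)

    reach-refl : ∀ S L k u c → reach S L k u c u c ≡ true
    reach-refl S L zero u c = ∧-i (eqb-refl u) (==-refl c)
    reach-refl S L (suc k) u c = ∨-il (reach-refl S L k u c)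

    reach-step : ∀ S L k u c w e v d → reach S L k u c w e ≡ true → step S L w e v d ≡ true → reach S L (suc k) u c v d ≡ true
    reach-step S L k u c w e v d p q = ∨-ir {reach S L k u c v d} (⇒some (via S L k u c v d) w (⇒someC (λ e → reach S L k u c w e ∧ step S L w e v d) e (∧-i p q)))

    reach-elim : ∀ S L k u c v d → reach S L (suc k) u c v d ≡ true → reach S L k u c v d ≡ true ⊎
       (Σ V λ w → Σ Color λ e → reach S L k u c w e ≡ true × step S L w e v d ≡ true)
    reach-elim S L k u c v d p with ∨-e {reach S L k u c v d} p
    ... | inj₁ q = inj₁ q
    ... | inj₂ q = let (w , r) = some⇒ (via S L k u c v d) q
                       (e , t) = someC⇒ (λ e → reach S L k u c w e ∧ step S L w e v d) r
                   in inj₂ (w , e , ∧-l t , ∧-r {reach S L k u c w e} t)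

    reach-zero : ∀ S L u c v d → reach S L zero u c v d ≡ true → u ≡ v × c ≡ d
    reach-zero S L u c v d p = eqb-t (∧-l {eqb u v} p) , ==-t (∧-r {eqb u v} p)

    reach-suc : ∀ S L k u c v d → reach S L k u c v d ≡ true → reach S L (suc k) u c v d ≡ true
    reach-suc S L k u c v d p = ∨-il p

  reach-≤ : ∀ S L {k k'} u c v d → k ≤ k' → reach S L k u c v d ≡ true → reach S L k' u c v d ≡ true
  reach-≤ S L {zero} {zero} u c v d _ p = p
  reach-≤ S L {k} {suc k'} u c v d l p with m≤n⇒m<n∨m≡n l
  ... | inj₂ refl = p
  ... | inj₁ (s≤s l') = reach-suc S L k' u c v d (reach-≤ S L {k} {k'} u c v d l' p)

  step-mono : ∀ {S S' L L'} → (∀ v → S v ≡ true → S' v ≡ true) → L ⊆L L' → ∀ u c v d → step S L u c v d ≡ true → step S' L' u c v d ≡ true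
  step-mono {S} {S'} {L} {L'} h l u c v d p = mkStep (h v (live)) edge (l v c old) (l v d new) diff
    where open Step {S} {L} {u} {c} {v} {d} p

  reach-live : ∀ S L k u c v d → S u ≡ true → reach S L k u c v d ≡ true → S v ≡ true
  reach-live S L zero u c v d su p with reach-zero S L u c v d p
  ... | refl , refl = su
  reach-live S L (suc k) u c v d su p with reach-elim S L k u c v d p
  ... | inj₁ q = reach-live S L k u c v d su q
  ... | inj₂ (w , e , q , r) = Step.live {S} {L} {w} {e} {v} {d} r

  reach-list : ∀ S L k u c v d → L u c ≡ true → reach S L k u c v d ≡ true → L v d ≡ true
  reach-list S L zero u c v d su p with reach-zero S L u c v d p
  ... | refl , refl = su
  reach-list S L (suc k) u c v d su p with reach-elim S L k u c v d p
  ... | inj₁ q = reach-list S L k u c v d su q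
  ... | inj₂ (w , e , q , r) = Step.new {S} {L} {w} {e} {v} {d} r

  -- Quantified over all larger lists `B'`, so that several forcing lists can be concatenated into
  -- one certificate.
  Forces : Live → Lists → V → Color → V → Color → List V → Set
  Forces S L u c v d B = u ∈ B × v ∈ B × (∀ B' → (∀ {x} → x ∈ B → x ∈ B') → (κ : Col (On B' S) L) → colour κ u ≡ c → colour κ v ≡ d)

  forces : ∀ S L → (∀ v → S v ≡ true → Σ Color λ m → L v m ≡ false) → ∀ k u c v d → S u ≡ true → reach S L k u c v d ≡ true →
     Σ (List V) λ B → length B ≤ suc k × Forces S L u c v d B
  forces S L sm zero u c v d su p with reach-zero S L u c v d p
  ... | refl , refl = u ∷ [] , ≤-refl , here refl , here refl , λ _ _ _ e → e
  forces S L sm (suc k) u c v d su p with reach-elim S L k u c v d p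
  ... | inj₁ q = let (B , l , f) = forces S L sm k u c v d su q in B , ≤-trans l (n≤1+n _) , f
  ... | inj₂ (w , e , q , r) with forces S L sm k u c w e su q
  ... | B , l , (iu , iw , h) = v ∷ B , s≤s l , there iu , here refl , λ B' sub κ eu →
      let open Step {S} {L} {w} {e} {v} {d} r
          inw = sub (there iw) , reach-live S L k u c w e su q
          inv = sub (here refl) , live
          ew = h B' (λ i → sub (there i)) κ eu
      in or-small {L = L v} (sm v live) old new diff (allowed κ v inv) (λ x → proper κ w v inw inv edge (trans ew (sym x)))

  -- Propagation along which no chord gives a shortcut or a contradiction. Only such chains can make
  -- propagation long.
  record FreeChain (S : Live) (L : Lists) (M : ℕ) : Set where
    field
      vert : ℕ → V
      col : ℕ → Color
      live : ∀ i → i ≤ M → S (vert i) ≡ true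
      edge : ∀ i → i < M → vert i ~ vert (suc i)
      diff : ∀ i → i < M → col i ≢ col (suc i)
      old : ∀ i → i < M → L (vert (suc i)) (col i) ≡ true
      new : ∀ i → i < M → L (vert (suc i)) (col (suc i)) ≡ true
      chord : ∀ i j → i < j → j < M → vert i ~ vert (suc j) → Strong col i j

  -- The greedy algorithm for lists of two colours: try a colour at a vertex, propagate it, and keep
  -- the result if no conflict arises. Certificates stay bounded because conflict-free propagation
  -- is exhausted after `N` steps.
  module Bounded (S₀ : Live) (L : Lists) (small : ∀ v → S₀ v ≡ true → Σ Color λ m → L v m ≡ false) (N : ℕ)
                 (noFree : ¬ FreeChain S₀ L (suc N)) where
    K = suc N

    forcedBy : V → Color → V → Color → Bool
    forcedBy v d u e = (S₀ u ∧ not (d == e)) ∧ everyC (λ c → not (L u c) ∨ reach S₀ L K u c v d)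
    opaque
      -- Every colour of some vertex `u` forces the same `d ≠ e` at `v`, so `e` is impossible there.
      -- Removing these literals in advance is what yields the third condition of `Strong`.
      refuted : V → Color → Bool
      refuted v e = some (λ u → someC (λ d → forcedBy v d u e))
      refuted⇒ : ∀ v e → refuted v e ≡ true → Σ V λ u → Σ Color λ d → forcedBy v d u e ≡ true
      refuted⇒ v e r = let (u , r') = some⇒ (λ u → someC (λ d → forcedBy v d u e)) r
                           (d , q) = someC⇒ (λ d → forcedBy v d u e) r' in u , d , q
      ⇒refuted : ∀ v e u d → forcedBy v d u e ≡ true → refuted v e ≡ true
      ⇒refuted v e u d q = ⇒some (λ u → someC (λ d → forcedBy v d u e)) u (⇒someC (λ d → forcedBy v d u e) d q)

    L₁ : Lists
    L₁ = minus L refuted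

    small₁ : ∀ v → S₀ v ≡ true → Σ Color λ m → L₁ v m ≡ false
    small₁ v s = let (m , p) = small v s in m , ¬t⇒f (λ q → f≢t p (∧-l q))

    refuted-good : ∀ v e → S₀ v ≡ true → refuted v e ≡ true → Good (bound₁ N) S₀ (set L v e)
    refuted-good v e sv r with refuted⇒ v e r
    ... | u , d , q = inj₂ (B , len , no')
      where
      su : S₀ u ≡ true
      su = ∧-l (∧-l q)
      de : d ≢ e
      de = ==-f⁻ (not-t (∧-r {S₀ u} (∧-l q)))
      piece : ∀ c → Σ (List V) λ B → length B ≤ suc K × (L u c ≡ true → Forces S₀ L u c v d B)
      piece c with bool-em (L u c)
      ... | inj₂ f = [] , z≤n , λ t → ⊥-elim (f≢t f t)
      ... | inj₁ t with ∨-e {not (L u c)} (everyC⇒ (λ c → not (L u c) ∨ reach S₀ L K u c v d) (∧-r {S₀ u ∧ not (d == e)} q) c)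
      ... | inj₁ z = ⊥-elim (f≢t (not-t z) t)
      ... | inj₂ z = let (B , l , f) = forces S₀ L small K u c v d su z in B , l , λ _ → f
      Bc : Color → List V
      Bc c = proj₁ (piece c)
      B : List V
      B = u ∷ v ∷ Bc c0 ++ (Bc c1 ++ (Bc c2 ++ []))
      sub : ∀ c {x} → x ∈ Bc c → x ∈ B
      sub c0 i = there (there (∈-++⁺ˡ i))
      sub c1 i = there (there (∈-++⁺ʳ (Bc c0) (∈-++⁺ˡ i)))
      sub c2 i = there (there (∈-++⁺ʳ (Bc c0) (∈-++⁺ʳ (Bc c1) (∈-++⁺ˡ i))))
      pl : ∀ c → length (Bc c) ≤ suc K
      pl c = proj₁ (proj₂ (piece c))
      len : length B ≤ bound₁ N
      len = s≤s (s≤s (≤-trans (≤-reflexive (length-++ (Bc c0))) (+-mono-≤ (pl c0) (≤-trans (≤-reflexive (length-++ (Bc c1))) (+-mono-≤ (pl c1) (≤-trans (≤-reflexive (length-++ (Bc c2))) (+-mono-≤ (pl c2) z≤n)))))))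
      no' : ¬ Col (On B S₀) (set L v e)
      no' κ = de (trans (sym (proj₂ (proj₂ f) B (sub cu) κ' refl)) (set-at {L} {v} {e} (allowed κ v (there (here refl) , sv))))
        where
        κ' : Col (On B S₀) L
        κ' = col-mono (λ _ p → p) set⊆ κ
        cu : Color
        cu = colour κ u
        f : Forces S₀ L u cu v d (Bc cu)
        f = proj₂ (proj₂ (piece cu)) (allowed κ' u (here refl , su))

    module _ (S : Live) (sub : ∀ v → S v ≡ true → S₀ v ≡ true) where
      small' : ∀ v → S v ≡ true → Σ Color λ m → L₁ v m ≡ false
      small' v s = small₁ v (sub v s)

      clash : V → Color → V → Color → Bool
      clash u c v d = (adj u v ∧ (c == d)) ∨ (eqb u v ∧ not (c == d))
      -- A step needs a second colour at its target, so no step leads to such a neighbour, and this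
      -- failure of propagation is tested separately from `clash`.
      stuck : V → Color → V → Bool
      stuck u c v = (S v ∧ adj u v) ∧ everyC (λ e → not (L₁ v e) ∨ (e == c))
      conf₂ : V → Color → V → Color → Bool
      conf₂ x a u c = reach S L₁ K x a u c ∧ (some (λ v → someC (λ d → reach S L₁ K x a v d ∧ clash u c v d)) ∨ some (stuck u c))
      opaque
        conf : V → Color → Bool
        conf x a = some (λ u → someC (conf₂ x a u))
        conf⇒ : ∀ x a → conf x a ≡ true → Σ V λ u → Σ Color λ c → conf₂ x a u c ≡ true
        conf⇒ x a p = let (u , p') = some⇒ (λ u → someC (conf₂ x a u)) p
                          (c , q) = someC⇒ (conf₂ x a u) p' in u , c , q
        ⇒conf : ∀ x a u c → conf₂ x a u c ≡ true → conf x a ≡ true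
        ⇒conf x a u c q = ⇒some (λ u → someC (conf₂ x a u)) u (⇒someC (conf₂ x a u) c q)

      module _ (x : V) (a : Color) (sx : S x ≡ true) where
        conf-cert : conf x a ≡ true → Σ (List V) λ B → length B ≤ 1 + (suc K + suc K) × x ∈ B ×
           (∀ B' → (∀ {y} → y ∈ B → y ∈ B') → (κ : Col (On B' S) L₁) → colour κ x ≢ a)
        conf-cert p with conf⇒ x a p
        ... | u , c , q with forces S L₁ small' K x a u c sx (∧-l q) | ∨-e (∧-r {reach S L₁ K x a u c} q)
        ... | B₁ , l₁ , (ix , iu , f) | inj₂ r =
            let (v , t) = some⇒ (stuck u c) r
                sv = ∧-l (∧-l t)
            in v ∷ B₁ , s≤s (≤-trans l₁ (m≤m+n (suc K) (suc K))) , there ix , λ B' s κ e →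
               let iv = s (here refl) , sv
                   cu = f B' (λ i → s (there i)) κ e
                   cv : colour κ v ≡ c
                   cv = h v (colour κ v) t (allowed κ v iv)
               in proper κ u v (s (there iu) , reach-live S L₁ K x a u c sx (∧-l q)) iv (∧-r {S v} (∧-l {S v ∧ adj u v} t)) (trans cu (sym cv))
            where
            h : ∀ v e → stuck u c v ≡ true → L₁ v e ≡ true → e ≡ c
            h v e t l with ∨-e {not (L₁ v e)} (everyC⇒ (λ e → not (L₁ v e) ∨ (e == c)) (∧-r {S v ∧ adj u v} t) e)
            ... | inj₁ z = ⊥-elim (f≢t (not-t z) l)
            ... | inj₂ z = ==-t z
        ... | B₁ , l₁ , (ix , iu , f) | inj₁ r with some⇒ (λ v → someC (λ d → reach S L₁ K x a v d ∧ clash u c v d)) r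
        ... | v , r' with someC⇒ (λ d → reach S L₁ K x a v d ∧ clash u c v d) r'
        ... | d , t with forces S L₁ small' K x a v d sx (∧-l t) | ∨-e (∧-r {reach S L₁ K x a v d} t)
        ... | B₂ , l₂ , (_ , iv , g) | inj₁ z = B₁ ++ B₂ , ≤-trans (≤-reflexive (length-++ B₁)) (≤-trans (+-mono-≤ l₁ l₂) (n≤1+n _)) , ∈-++⁺ˡ ix ,
              λ B' s κ e → proper κ u v (s (∈-++⁺ˡ iu) , reach-live S L₁ K x a u c sx (∧-l q)) (s (∈-++⁺ʳ B₁ iv) , reach-live S L₁ K x a v d sx (∧-l t)) (∧-l z)
                 (trans (f B' (λ i → s (∈-++⁺ˡ i)) κ e) (trans (==-t (∧-r {adj u v} z)) (sym (g B' (λ i → s (∈-++⁺ʳ B₁ i)) κ e))))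
        ... | B₂ , l₂ , (_ , iv , g) | inj₂ z with eqb-t (∧-l {eqb u v} z)
        ... | refl = B₁ ++ B₂ , ≤-trans (≤-reflexive (length-++ B₁)) (≤-trans (+-mono-≤ l₁ l₂) (n≤1+n _)) , ∈-++⁺ˡ ix ,
              λ B' s κ e → ==-f⁻ (not-t (∧-r {eqb u u} z)) (trans (sym (f B' (λ i → s (∈-++⁺ˡ i)) κ e)) (g B' (λ i → s (∈-++⁺ʳ B₁ i)) κ e))

        -- Indexed backwards, ending in `x`, so that a further step is added at index 0; `Forward`
        -- restores the order of propagation.
        record Walk (k : ℕ) (v : V) (d : Color) : Set where
          field
            w : ℕ → V
            e : ℕ → Color
            w0 : w 0 ≡ v
            e0 : e 0 ≡ d
            wk : w k ≡ x
            ek : e k ≡ a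
            st : ∀ i → i < k → step S L₁ (w (suc i)) (e (suc i)) (w i) (e i) ≡ true

        snoc : ∀ {k u c v d} → Walk k u c → step S L₁ u c v d ≡ true → Walk (suc k) v d
        snoc {k} {u} {c} {v} {d} W s = record { w = w' ; e = e' ; w0 = refl ; e0 = refl ; wk = wk ; ek = ek ; st = st' }
          where
          open Walk W
          w' : ℕ → V
          w' zero = v
          w' (suc i) = w i
          e' : ℕ → Color
          e' zero = d
          e' (suc i) = e i
          st' : ∀ i → i < suc k → step S L₁ (w' (suc i)) (e' (suc i)) (w' i) (e' i) ≡ true
          st' zero _ rewrite w0 | e0 = s
          st' (suc i) (s≤s l) = st i l

        walk-of : ∀ k v d → reach S L₁ k x a v d ≡ true → Σ ℕ λ k' → k' ≤ k × Walk k' v d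
        walk-of zero v d p with reach-zero S L₁ x a v d p
        ... | refl , refl = 0 , z≤n , record { w = λ _ → x ; e = λ _ → a ; w0 = refl ; e0 = refl ; wk = refl ; ek = refl ; st = λ _ () }
        walk-of (suc k) v d p with reach-elim S L₁ k x a v d p
        ... | inj₁ q = let (k' , l , W) = walk-of k v d q in k' , ≤-trans l (n≤1+n k) , W
        ... | inj₂ (u , c , q , s) = let (k' , l , W) = walk-of k u c q in suc k' , s≤s l , snoc W s

        module Forward {k v d} (W : Walk k v d) where
          open Walk W
          vert : ℕ → V
          vert i = w (k ∸ i)
          col : ℕ → Color
          col i = e (k ∸ i)
          shift : ∀ {i} → i < k → k ∸ i ≡ suc (k ∸ suc i)
          shift {i} (s≤s l) = +-∸-assoc 1 l
          fst : ∀ i → i < k → step S L₁ (vert i) (col i) (vert (suc i)) (col (suc i)) ≡ true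
          fst i l = subst (λ z → step S L₁ (w z) (e z) (vert (suc i)) (col (suc i)) ≡ true) (sym (shift l))
             (st (k ∸ suc i) (≤-trans (≤-reflexive (sym (shift l))) (m∸n≤m k i)))
          reaches : ∀ i → i ≤ k → reach S L₁ i x a (vert i) (col i) ≡ true
          reaches zero _ rewrite wk | ek = reach-refl S L₁ 0 x a
          reaches (suc i) l = reach-step S L₁ i x a (vert i) (col i) (vert (suc i)) (col (suc i)) (reaches i (≤-trans (n≤1+n i) l)) (fst i l)
          segment : ∀ i t → i + t ≤ k → reach S L₁ t (vert i) (col i) (vert (i + t)) (col (i + t)) ≡ true
          segment i zero l rewrite +-identityʳ i = reach-refl S L₁ 0 (vert i) (col i)
          segment i (suc t) l = subst (λ z → reach S L₁ (suc t) (vert i) (col i) (vert z) (col z) ≡ true) (sym (+-suc i t))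
             (reach-step S L₁ t (vert i) (col i) (vert (i + t)) (col (i + t)) (vert (suc (i + t))) (col (suc (i + t)))
                (segment i t (≤-trans (n≤1+n _) l')) (fst (i + t) l'))
             where l' = ≤-trans (≤-reflexive (sym (+-suc i t))) l
          later : ∀ r j t → reach S L₁ r x a (vert j) (col j) ≡ true → j + t ≤ k → reach S L₁ (r + t) x a (vert (j + t)) (col (j + t)) ≡ true
          later r j zero p l rewrite +-identityʳ r | +-identityʳ j = p
          later r j (suc t) p l = subst (λ z → reach S L₁ z x a (vert (j + suc t)) (col (j + suc t)) ≡ true) (sym (+-suc r t))
             (subst (λ z → reach S L₁ (suc (r + t)) x a (vert z) (col z) ≡ true) (sym (+-suc j t))
               (reach-step S L₁ (r + t) x a (vert (j + t)) (col (j + t)) (vert (suc (j + t))) (col (suc (j + t)))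
                 (later r j t p (≤-trans (n≤1+n _) l')) (fst (j + t) l')))
             where l' = ≤-trans (≤-reflexive (sym (+-suc j t))) l
          last : vert k ≡ v
          last = trans (cong w (k∸k k)) w0
            where k∸k : ∀ m → m ∸ m ≡ 0
                  k∸k zero = refl
                  k∸k (suc m) = k∸k m
          lastc : col k ≡ d
          lastc = trans (cong e (k∸k k)) e0
            where k∸k : ∀ m → m ∸ m ≡ 0
                  k∸k zero = refl
                  k∸k (suc m) = k∸k m

        -- A walk of `K = N + 1` steps is no free chain, so some chord violates `Strong`. Equality
        -- of `col i` with `col j` gives a shortcut, with `col (suc j)` a conflict; equality of the
        -- colour before `col i` with `col j` makes `col j` a refuted literal at `vert (suc j)`,
        -- which `L₁` no longer contains.
        module Long {v d} (W : Walk K v d) (nc : conf x a ≡ false) where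
          open Forward W
          prev : ℕ → ℕ → Bool
          prev zero j = false
          prev (suc i) j = col i == col j
          viol : ℕ → ℕ → Bool
          viol i j = (i <ᵇ j) ∧ (adj (vert i) (vert (suc j)) ∧ ((col i == col j) ∨ ((col i == col (suc j)) ∨ prev i j)))
          short : ∀ i j → i < j → j ≤ N → vert i ~ vert (suc j) → col i ≡ col j → reach S L₁ N x a v d ≡ true
          short i j ij jN e ce with m≤n⇒∃[o]m+o≡n jN
          ... | t , refl = subst (λ z → reach S L₁ (j + t) x a z d ≡ true) last (subst (λ z → reach S L₁ (j + t) x a (vert K) z ≡ true) lastc
               (later j (suc j) t
                 (reach-≤ S L₁ x a (vert (suc j)) (col (suc j)) ij
                   (reach-step S L₁ i x a (vert i) (col i) (vert (suc j)) (col (suc j)) (reaches i (≤-trans (<⇒≤ ij) (≤-trans jN (n≤1+n _))))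
                     (mkStep live edge' (subst (λ z → L₁ (vert (suc j)) z ≡ true) (sym ce) old) new λ q → diff (trans (sym ce) q))))
                 ≤-refl))
               where open Step (fst j (s≤s jN)) renaming (edge to edge₀)
                     edge' = e
          resolve : reach S L₁ N x a v d ≡ true
          resolve with search≤ N (λ j → any' j)
            where
            any' : ℕ → Bool
            any' j with search≤ N (λ i → viol i j)
            ... | inj₁ _ = true
            ... | inj₂ _ = false
          ... | inj₂ none = ⊥-elim (noFree record
                  { vert = vert ; col = col
                  ; live = λ i l → sub _ (reach-live S L₁ i x a (vert i) (col i) sx (reaches i l))
                  ; edge = λ i l → Step.edge (fst i l) ; diff = λ i l → Step.diff (fst i l)
                  ; old = λ i l → ∧-l (Step.old (fst i l)) ; new = λ i l → ∧-l (Step.new (fst i l))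
                  ; chord = ch })
            where
            no' : ∀ i j → i < j → j ≤ N → viol i j ≡ false
            no' i j ij jN with search≤ N (λ i → viol i j) | none j jN
            ... | inj₂ h | _ = h i (≤-trans (<⇒≤ ij) jN)
            ch : ∀ i j → i < j → j < K → vert i ~ vert (suc j) → Strong col i j
            ch i j ij (s≤s jN) e =
                (λ q → bad (∨-il (subst (λ z → (col i == z) ≡ true) q (==-refl (col i)))))
              , (λ q → bad (∨-ir {col i == col j} (∨-il (subst (λ z → (col i == z) ≡ true) q (==-refl (col i))))))
              , λ { i' refl q → bad (∨-ir {col i == col j} (∨-ir {col i == col (suc j)} (subst (λ z → (col i' == z) ≡ true) q (==-refl (col i'))))) }
              where
              bad : ((col i == col j) ∨ ((col i == col (suc j)) ∨ prev i j)) ≡ true → ⊥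
              bad p = f≢t (no' i j ij jN) (∧-i (<⇒<ᵇ' ij) (∧-i e p))
          ... | inj₁ (j , jN , p) with search≤ N (λ i → viol i j) | p
          ... | inj₁ (i , iN , q) | _ = fin (∨-e q₂)
            where
            ij : i < j
            ij = <ᵇ⇒<' (∧-l q)
            e : vert i ~ vert (suc j)
            e = ∧-l (∧-r {i <ᵇ j} q)
            q₂ : ((col i == col j) ∨ ((col i == col (suc j)) ∨ prev i j)) ≡ true
            q₂ = ∧-r {adj (vert i) (vert (suc j))} (∧-r {i <ᵇ j} q)
            iK : i ≤ K
            iK = ≤-trans (<⇒≤ ij) (≤-trans jN (n≤1+n _))
            -- At `vert i`, the colour `col i'` forces `col (suc j)` directly over the chord and
            -- `col i` forces it along the chain; the list offers no other colour.
            contra : ∀ i' → i ≡ suc i' → col i' ≡ col j → ⊥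
            contra i' refl ce = f≢t (not-t (∧-r {L (vert (suc j)) (col j)} (Step.old sj))) (⇒refuted (vert (suc j)) (col j) u (col (suc j))
                 (∧-i (∧-i su (not-f (==-f λ z → Step.diff sj (sym z)))) (⇒everyC (λ c → not (L u c) ∨ reach S₀ L K u c (vert (suc j)) (col (suc j))) each)))
              where
              u = vert i
              sj = fst j (s≤s jN)
              si = fst i' iK
              su = sub _ (Step.live si)
              to₀ : ∀ k u c v d → reach S L₁ k u c v d ≡ true → reach S₀ L k u c v d ≡ true
              to₀ zero u c v d r with reach-zero S L₁ u c v d r
              ... | refl , refl = reach-refl S₀ L 0 u c
              to₀ (suc k) u c v d r with reach-elim S L₁ k u c v d r
              ... | inj₁ r' = reach-suc S₀ L k u c v d (to₀ k u c v d r')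
              ... | inj₂ (y , f , r' , s) = reach-step S₀ L k u c y f v d (to₀ k u c y f r') (step-mono sub (minus⊆ {L} {refuted}) y f v d s)
              each : ∀ c → not (L u c) ∨ reach S₀ L K u c (vert (suc j)) (col (suc j)) ≡ true
              each c with bool-em (L u c)
              ... | inj₂ f = ∨-il (not-f f)
              ... | inj₁ l with bool-em (c == col i')
              ... | inj₁ z = ∨-ir {not (L u c)} (reach-≤ S₀ L u c (vert (suc j)) (col (suc j)) (s≤s z≤n)
                     (reach-step S₀ L 0 u c u c (vert (suc j)) (col (suc j)) (reach-refl S₀ L 0 u c)
                       (mkStep (sub _ (Step.live sj)) e (subst (λ y → L (vert (suc j)) y ≡ true) (trans (sym ce) (sym (==-t z))) (∧-l (Step.old sj))) (∧-l (Step.new sj))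
                         λ y → Step.diff sj (trans (trans (sym ce) (sym (==-t z))) y))))
              ... | inj₂ z with m≤n⇒∃[o]m+o≡n (≤-trans (<⇒≤ ij) (n≤1+n j))
              ... | t , eq = ∨-ir {not (L u c)} (reach-≤ S₀ L u c (vert (suc j)) (col (suc j)) tK
                     (subst (λ y → reach S₀ L t u y (vert (suc j)) (col (suc j)) ≡ true) (sym cc)
                       (subst (λ y → reach S₀ L t u (col i) (vert y) (col y) ≡ true) eq
                         (to₀ t u (col i) _ _ (segment i t (≤-trans (≤-reflexive eq) (s≤s jN)))))))
                where
                tK : t ≤ K
                tK = ≤-trans (m≤n+m t i) (≤-trans (≤-reflexive eq) (s≤s jN))
                cc : c ≡ col i
                cc = or-small {L = L u} (small u su) (∧-l (Step.old si)) (∧-l (Step.new si)) (Step.diff si) l (==-f⁻ z)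
            fin : (col i == col j) ≡ true ⊎ ((col i == col (suc j)) ∨ prev i j) ≡ true → reach S L₁ N x a v d ≡ true
            fin (inj₁ r) = short i j ij jN e (==-t r)
            fin (inj₂ r) with ∨-e {col i == col (suc j)} r
            ... | inj₁ r' = ⊥-elim (f≢t nc (⇒conf x a (vert i) (col i) (∧-i (reach-≤ S L₁ x a _ _ iK (reaches i iK))
                   (∨-il (⇒some (λ v → someC (λ d → reach S L₁ K x a v d ∧ clash (vert i) (col i) v d)) (vert (suc j))
                     (⇒someC (λ d → reach S L₁ K x a (vert (suc j)) d ∧ clash (vert i) (col i) (vert (suc j)) d) (col (suc j))
                       (∧-i (reach-≤ S L₁ x a _ _ (s≤s jN) (reaches (suc j) (s≤s jN))) (∨-il (∧-i e r')))))))))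
            ... | inj₂ r' = ⊥-elim (byPrev i refl r')
              where
              byPrev : ∀ i₀ → i ≡ i₀ → prev i₀ j ≡ true → ⊥
              byPrev (suc i') eq y = contra i' eq (==-t y)

        -- A walk that would need `N + 1` steps is resolved into one of at most `N`. Hence the set
        -- reached is closed, and can be coloured and deleted as a whole.
        closed-reach : conf x a ≡ false → ∀ u c v d → reach S L₁ N x a u c ≡ true → step S L₁ u c v d ≡ true → reach S L₁ N x a v d ≡ true
        closed-reach nc u c v d p s with walk-of N u c p
        ... | k , l , W with m≤n⇒m<n∨m≡n l
        ... | inj₂ refl = Long.resolve (snoc W s) nc
        ... | inj₁ k<N = reach-≤ S L₁ x a v d k<N (subst (λ z → reach S L₁ (suc k) x a z d ≡ true) (Forward.last W') (subst (λ z → reach S L₁ (suc k) x a (Forward.vert W' (suc k)) z ≡ true) (Forward.lastc W') (Forward.reaches W' (suc k) ≤-refl)))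
          where W' = snoc W s

    private
      pick : ∀ S (sub : ∀ v → S v ≡ true → S₀ v ≡ true) x →
        (Σ Color λ a → L₁ x a ≡ true × conf S sub x a ≡ false) ⊎ (∀ a → L₁ x a ≡ true → conf S sub x a ≡ true)
      pick S sub x with bool-em (someC (λ a → L₁ x a ∧ not (conf S sub x a)))
      ... | inj₁ p = let (a , q) = someC⇒ (λ a → L₁ x a ∧ not (conf S sub x a)) p in inj₁ (a , ∧-l q , not-t (∧-r {L₁ x a} q))
      ... | inj₂ p = inj₂ λ a l → h a l
        where
        h : ∀ a → L₁ x a ≡ true → conf S sub x a ≡ true
        h a l with bool-em (conf S sub x a)
        ... | inj₁ q = q
        ... | inj₂ q = ⊥-elim (f≢t p (⇒someC (λ a → L₁ x a ∧ not (conf S sub x a)) a (∧-i l (not-f q))))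

    -- A conflict-free colour of `x` colours all it reaches, and this is never revised: if an
    -- unreached vertex were given the colour of a reached neighbour, its list would contain a
    -- second colour, and one more step would reach it.
    process : ∀ xs S → (sub : ∀ v → S v ≡ true → S₀ v ≡ true) → (∀ v → S v ≡ true → v ∈ xs) → Good (bound₂ N) S L₁
    process [] S sub all = inj₁ (mkCol (λ _ → c0) (λ v s → ⊥-elim (none v s)) (λ u v s _ → ⊥-elim (none u s)))
      where none : ∀ v → S v ≡ true → ⊥
            none v s with all v s
            ... | ()
    process (x ∷ xs) S sub all with bool-em (S x)
    ... | inj₂ f = process xs S sub λ v s → tail v s (all v s)
      where tail : ∀ v → S v ≡ true → v ∈ (x ∷ xs) → v ∈ xs
            tail v s (here refl) = ⊥-elim (f≢t f s)
            tail v s (there i) = i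
    ... | inj₁ sx with pick S sub x
    ... | inj₂ allBad = inj₂ (x ∷ B c0 ++ (B c1 ++ (B c2 ++ [])) , len , λ κ → bad κ)
      where
      piece : ∀ a → Σ (List V) λ B → length B ≤ 1 + (suc K + suc K) × (L₁ x a ≡ true → ∀ B' → (∀ {y} → y ∈ B → y ∈ B') → (κ : Col (On B' S) L₁) → colour κ x ≢ a)
      piece a with bool-em (L₁ x a)
      ... | inj₂ f = [] , z≤n , λ t → ⊥-elim (f≢t f t)
      ... | inj₁ t = let (B , l , _ , h) = conf-cert S sub x a sx (allBad a t) in B , l , λ _ → h
      B : Color → List V
      B a = proj₁ (piece a)
      pl : ∀ a → length (B a) ≤ 1 + (suc K + suc K)
      pl a = proj₁ (proj₂ (piece a))
      len : length (x ∷ B c0 ++ (B c1 ++ (B c2 ++ []))) ≤ bound₂ N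
      len = s≤s (≤-trans (≤-reflexive (length-++ (B c0))) (+-mono-≤ (pl c0) (≤-trans (≤-reflexive (length-++ (B c1))) (+-mono-≤ (pl c1) (≤-trans (≤-reflexive (length-++ (B c2))) (+-mono-≤ (pl c2) z≤n))))))
      pos : ∀ a {y} → y ∈ B a → y ∈ (x ∷ B c0 ++ (B c1 ++ (B c2 ++ [])))
      pos c0 i = there (∈-++⁺ˡ i)
      pos c1 i = there (∈-++⁺ʳ (B c0) (∈-++⁺ˡ i))
      pos c2 i = there (∈-++⁺ʳ (B c0) (∈-++⁺ʳ (B c1) (∈-++⁺ˡ i)))
      bad : Col (On (x ∷ B c0 ++ (B c1 ++ (B c2 ++ []))) S) L₁ → ⊥
      bad κ = proj₂ (proj₂ (piece (colour κ x))) (allowed κ x (here refl , sx)) _ (pos (colour κ x)) κ refl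
    ... | inj₁ (a , la , nc) = lift (process xs S' (λ v s → sub v (∧-l s)) all')
      where
      F : V → Color → Bool
      F v c = reach S L₁ N x a v c
      hit : V → Bool
      hit v = someC (F v)
      S' : Live
      S' = S ∖ hit
      all' : ∀ v → S' v ≡ true → v ∈ xs
      all' v s with all v (∧-l s)
      ... | here refl = ⊥-elim (f≢t (not-t (∧-r {S x} s)) (⇒someC (F x) a (reach-refl S L₁ N x a)))
      ... | there i = i
      lift : Good (bound₂ N) S' L₁ → Good (bound₂ N) S L₁
      lift (inj₂ o) = inj₂ (obs-sub (λ v s → ∧-l s) o)
      lift (inj₁ κ) = inj₁ (mkCol f al pr)
        where
        f : V → Color
        f v with bool-em (hit v)
        ... | inj₁ p = proj₁ (someC⇒ (F v) p)
        ... | inj₂ _ = colour κ v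
        f-spec : ∀ v → (hit v ≡ true × F v (f v) ≡ true) ⊎ (hit v ≡ false × f v ≡ colour κ v)
        f-spec v with bool-em (hit v)
        ... | inj₁ p = inj₁ (p , proj₂ (someC⇒ (F v) p))
        ... | inj₂ p = inj₂ (p , refl)
        toK : ∀ v c → F v c ≡ true → reach S L₁ K x a v c ≡ true
        toK v c p = reach-suc S L₁ N x a v c p
        al : ∀ v → S v ≡ true → L₁ v (f v) ≡ true
        al v s with f-spec v
        ... | inj₁ (_ , p) = reach-list S L₁ N x a v (f v) la p
        ... | inj₂ (h , e) = subst (λ z → L₁ v z ≡ true) (sym e) (allowed κ v (∧-i s (not-f h)))
        half : ∀ u v → S u ≡ true → S v ≡ true → F u (f u) ≡ true → hit v ≡ false → u ~ v → f u ≢ colour κ v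
        half u v su sv p h e eq with bool-em (everyC (λ d → not (L₁ v d) ∨ (d == f u)))
        ... | inj₁ q = f≢t nc (⇒conf S sub x a u (f u) (∧-i (toK u (f u) p) (∨-ir {some (λ v → someC (λ d → reach S L₁ K x a v d ∧ clash S sub u (f u) v d))} (⇒some (stuck S sub u (f u)) v (∧-i (∧-i sv e) q)))))
        ... | inj₂ q with bool-em (someC (λ d → L₁ v d ∧ not (d == f u)))
        ... | inj₂ q' = f≢t q (⇒everyC _ each)
          where
          each : ∀ d → not (L₁ v d) ∨ (d == f u) ≡ true
          each d with bool-em (L₁ v d) | bool-em (d == f u)
          ... | inj₂ z | _ = ∨-il (not-f z)
          ... | inj₁ _ | inj₁ z = ∨-ir {not (L₁ v d)} z
          ... | inj₁ y | inj₂ z = ⊥-elim (f≢t q' (⇒someC (λ d → L₁ v d ∧ not (d == f u)) d (∧-i y (not-f z))))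
        ... | inj₁ q' = let (d , r) = someC⇒ (λ d → L₁ v d ∧ not (d == f u)) q' in
             f≢t h (⇒someC (F v) d (closed-reach S sub x a sx nc u (f u) v d p
               (mkStep sv e (subst (λ z → L₁ v z ≡ true) (sym eq) (allowed κ v (∧-i sv (not-f h)))) (∧-l r) λ z → ==-f⁻ (not-t (∧-r {L₁ v d} r)) (sym z))))
        pr : ∀ u v → S u ≡ true → S v ≡ true → u ~ v → f u ≢ f v
        pr u v su sv e with f-spec u | f-spec v
        ... | inj₂ (h , eu) | inj₂ (h' , ev) = λ q → proper κ u v (∧-i su (not-f h)) (∧-i sv (not-f h')) e (trans (sym eu) (trans q ev))
        ... | inj₁ (_ , p) | inj₂ (h' , ev) = λ q → half u v su sv p h' e (trans q ev)
        ... | inj₂ (h , eu) | inj₁ (_ , p) = λ q → half v u sv su p h (trans (sy v u) e) (trans (sym q) eu)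
        ... | inj₁ (_ , p) | inj₁ (_ , p') = λ q → f≢t nc (⇒conf S sub x a u (f u) (∧-i (toK u (f u) p) (∨-il
               (⇒some (λ v → someC (λ d → reach S L₁ K x a v d ∧ clash S sub u (f u) v d)) v
                 (⇒someC (λ d → reach S L₁ K x a v d ∧ clash S sub u (f u) v d) (f v) (∧-i (toK v (f v) p') (∨-il (∧-i e (subst (λ z → (f u == z) ≡ true) q (==-refl (f u)))))))))))

    two-lists : Good (twoListBound N) S₀ L
    two-lists = branch-literals refuted (process vs S₀ (λ v s → s) (λ v _ → complete v)) refuted-good

-- Propagation chains in P6-free graphs

private
  ≡ᵇ-sound : ∀ {a b} → (a ≡ᵇ b) ≡ true → a ≡ b
  ≡ᵇ-sound {a} {b} p = ≡ᵇ⇒≡ a b (subst Bool.T (sym p) tt)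

-- The negation of strength for chords at `k`: the first part denies one of the first two conditions
-- of `Strong` for chords to later vertices, the second the last condition for chords from earlier
-- ones.
Lone : (ℕ → ℕ → Bool) → (ℕ → Color) → ℕ → ℕ → Set
Lone r c M k = (∀ m → k < m → suc (suc m) ≤ M → r k (suc m) ≡ true → c k ≡ c m ⊎ c k ≡ c (suc m))
             × (∀ i j → k ≡ suc j → i < j → r i k ≡ true → ∀ i' → i ≡ suc i' → c i' ≡ c j)

-- Exceptional chords, seen only by one of the two virtual copies of a join vertex: i in Exc₁, j + 1 in Exc₂.
Exc₁ Exc₂ : (ℕ → ℕ → Bool) → (ℕ → Color) → ℕ → ℕ → ℕ → Set
Exc₁ r c M i j = suc i < j × Strong c (suc i) j × r (suc i) (suc j) ≡ true
  × (∀ i₁ → i ≡ suc i₁ → c i₁ ≡ c (suc i) × Strong c i₁ j × r i₁ (suc j) ≡ true × (∀ i₂ → i₁ ≡ suc i₂ → c i₂ ≡ c i))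
  × Lone r c M i
Exc₂ r c M i j = Σ ℕ λ j₂ → j ≡ suc j₂ × i < j₂ × c j₂ ≡ c (suc j) × c (suc (suc j)) ≡ c j
  × Strong c i j₂ × Strong c i (suc j) × r i j ≡ true × r i (suc (suc j)) ≡ true × Lone r c M (suc j)

-- What remains of a free chain when virtual vertices are projected to the graph: chords invisible
-- to the copies reappear as exceptional ones. Chords to the last vertex `M` are exempt from `rule`,
-- because `Exc₂` for a chord to j + 1 refers to j + 2.
record WeakChain (r : ℕ → ℕ → Bool) (c : ℕ → Color) (M : ℕ) : Set where
  field
    symm : ∀ i j → r i j ≡ r j i
    edge : ∀ i → i < M → r i (suc i) ≡ true
    diff : ∀ i → i < M → c i ≢ c (suc i)
    rule : ∀ i j → i < j → suc (suc j) ≤ M → r i (suc j) ≡ true → Strong c i j ⊎ (Exc₁ r c M i j ⊎ Exc₂ r c M i j)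

record P6In {A : Set} (r : A → A → Bool) : Set where
  constructor mkP6
  field
    a b c d e f : A
    ab : r a b ≡ true
    bc : r b c ≡ true
    cd : r c d ≡ true
    de : r d e ≡ true
    ef : r e f ≡ true
    ac : r a c ≡ false
    ad : r a d ≡ false
    ae : r a e ≡ false
    af : r a f ≡ false
    bd : r b d ≡ false
    be : r b e ≡ false
    bf : r b f ≡ false
    ce : r c e ≡ false
    cf : r c f ≡ false
    df : r d f ≡ false

strong-shift : ∀ {c} d {i j} → Strong c (d + i) (d + j) → Strong (λ x → c (d + x)) i j
strong-shift {c} d {i} {j} (p , q , h) = p , (λ e → q (trans e (cong c (+-suc d j)))) , λ { i' refl → h (d + i') (+-suc d i') }

-- Makes a refuted pattern applicable at every offset of a chain.
chain-shift : ∀ {r c M} d M' → d + M' ≤ M → WeakChain r c M → WeakChain (λ i j → r (d + i) (d + j)) (λ i → c (d + i)) M'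
chain-shift {r} {c} {M} d M' le ch = record
  { symm = λ i j → symm (d + i) (d + j)
  ; edge = λ i l → subst (λ z → r (d + i) z ≡ true) (sym (+-suc d i)) (edge (d + i) (up l))
  ; diff = λ i l e → diff (d + i) (up l) (trans e (cong c (+-suc d i)))
  ; rule = rl }
  where
  open WeakChain ch
  up : ∀ {i} → i < M' → d + i < M
  up {i} l = ≤-trans (≤-trans (≤-reflexive (sym (+-suc d i))) (+-monoʳ-≤ d l)) le
  up2 : ∀ {m} → suc (suc m) ≤ M' → suc (suc (d + m)) ≤ M
  up2 {m} l = ≤-trans (≤-reflexive (sym (trans (+-suc d (suc m)) (cong suc (+-suc d m))))) (≤-trans (+-monoʳ-≤ d l) le)
  r' : ℕ → ℕ → Bool
  r' i j = r (d + i) (d + j)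
  c' : ℕ → Color
  c' i = c (d + i)
  fs : ∀ {a i} → r a (suc (d + i)) ≡ true → r a (d + suc i) ≡ true
  fs {a} {i} = subst (λ z → r a z ≡ true) (sym (+-suc d i))
  fs⁻ : ∀ {a i} → r a (d + suc i) ≡ true → r a (suc (d + i)) ≡ true
  fs⁻ {a} {i} = subst (λ z → r a z ≡ true) (+-suc d i)
  gs : ∀ {a i} → r (suc (d + i)) a ≡ true → r (d + suc i) a ≡ true
  gs {a} {i} = subst (λ z → r z a ≡ true) (sym (+-suc d i))
  cs : ∀ i → c (suc (d + i)) ≡ c (d + suc i)
  cs i = cong c (sym (+-suc d i))
  lone : ∀ k → Lone r c M (d + k) → Lone r' c' M' k
  lone k (f , g) = (λ m km l e → f' (f (d + m) (+-monoʳ-< d km) (up2 l) (fs⁻ e)))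
                 , λ { i j refl ij e i' refl → g (d + i) (d + j) (+-suc d j) (+-monoʳ-< d ij) e (d + i') (+-suc d i') }
    where f' : ∀ {m} → c (d + k) ≡ c (d + m) ⊎ c (d + k) ≡ c (suc (d + m)) → c' k ≡ c' m ⊎ c' k ≡ c' (suc m)
          f' (inj₁ x) = inj₁ x
          f' {m} (inj₂ x) = inj₂ (trans x (cs m))
  st-l : ∀ {i j} → Strong c (suc (d + i)) (d + j) → Strong c' (suc i) j
  st-l {i} {j} s = strong-shift d (subst (λ z → Strong c z (d + j)) (sym (+-suc d i)) s)
  ex2 : ∀ i j → i < j → Exc₂ r c M (d + i) (d + j) → Exc₂ r' c' M' i j
  ex2 i (suc k) ij (j₂ , eq , lt , a , b , s , t , e₁ , e₂ , ln) with trans (sym (+-suc d k)) eq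
  ... | refl = k , refl , +-cancelˡ-≤ d _ _ (≤-trans (≤-reflexive (+-suc d i)) lt) ,
          trans a (cs (suc k)) ,
          trans (cong c (trans (+-suc d (suc (suc k))) (cong suc (+-suc d (suc k))))) b ,
          strong-shift d s , strong-shift d (subst (Strong c (d + i)) (sym (+-suc d (suc k))) t) , e₁ ,
          subst (λ z → r (d + i) z ≡ true) (sym (trans (+-suc d (suc (suc k))) (cong suc (+-suc d (suc k))))) e₂ ,
          lone (suc (suc k)) (subst (Lone r c M) (sym (+-suc d (suc k))) ln)
  rl : ∀ i j → i < j → suc (suc j) ≤ M' → r' i (suc j) ≡ true → Strong c' i j ⊎ (Exc₁ r' c' M' i j ⊎ Exc₂ r' c' M' i j)
  rl i j ij l e with rule (d + i) (d + j) (+-monoʳ-< d ij) (up2 l) (fs⁻ e)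
  ... | inj₁ s = inj₁ (strong-shift d s)
  ... | inj₂ (inj₁ (lt , s , e₁ , h , ln)) = inj₂ (inj₁ (+-cancelˡ-≤ d _ _ (≤-trans (≤-reflexive (trans (+-suc d (suc i)) (cong suc (+-suc d i)))) lt) , st-l s , fs (gs e₁) ,
      (λ { i₁ refl → let (a , b , f , g) = h (d + i₁) (+-suc d i₁) in
            trans a (trans (cs (suc i₁)) refl) , strong-shift d b , fs f , λ { i₂ refl → g (d + i₂) (+-suc d i₂) } }) , lone i ln))
  ... | inj₂ (inj₂ x) = inj₂ (inj₂ (ex2 i j ij x))

-- A transparent test: the opaque `==` would block the evaluation of the checker.
eqC : Color → Color → Bool
eqC c0 c0 = true
eqC c1 c1 = true
eqC c2 c2 = true
eqC _ _ = false

eqC-t : ∀ a b → eqC a b ≡ true → a ≡ b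
eqC-t c0 c0 _ = refl
eqC-t c1 c1 _ = refl
eqC-t c2 c2 _ = refl
eqC-refl : ∀ a → eqC a a ≡ true
eqC-refl c0 = refl
eqC-refl c1 = refl
eqC-refl c2 = refl
eqC-f : ∀ a b → eqC a b ≡ false → a ≢ b
eqC-f a .a p refl = f≢t p (eqC-refl a)

-- For distinct arguments, the permutation of colours taking 0 and 1 to them. It lets the checker
-- assume that every chain starts with the colours 0, 1.
rename : Color → Color → Color → Color
rename a b c0 = a
rename a b c1 = b
rename a b c2 = third a b

rename-third : ∀ a b → a ≢ b → ∀ x y → x ≢ y → rename a b (third x y) ≡ third (rename a b x) (rename a b y)
rename-third = from-yes (Finₚ.all? λ a → Finₚ.all? λ b → ¬? (a Finₚ.≟ b) →-dec (Finₚ.all? λ x → Finₚ.all? λ y →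
  ¬? (x Finₚ.≟ y) →-dec (rename a b (third x y) Finₚ.≟ third (rename a b x) (rename a b y))))
rename-inj : ∀ a b → a ≢ b → ∀ x y → rename a b x ≡ rename a b y → x ≡ y
rename-inj = from-yes (Finₚ.all? λ a → Finₚ.all? λ b → ¬? (a Finₚ.≟ b) →-dec (Finₚ.all? λ x → Finₚ.all? λ y →
  (rename a b x Finₚ.≟ rename a b y) →-dec (x Finₚ.≟ y)))

colourAt : List Color → ℕ → Color
colourAt [] _ = c0
colourAt (x ∷ xs) zero = x
colourAt (x ∷ xs) (suc i) = colourAt xs i

at-old : ∀ xs y i → i < length xs → colourAt (xs ++ y ∷ []) i ≡ colourAt xs i
at-old (x ∷ xs) y zero _ = refl
at-old (x ∷ xs) y (suc i) (s≤s l) = at-old xs y i l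
at-new : ∀ xs y → colourAt (xs ++ y ∷ []) (length xs) ≡ y
at-new [] y = refl
at-new (x ∷ xs) y = at-new xs y
length-snoc : ∀ {A : Set} (xs : List A) y → length (xs ++ y ∷ []) ≡ suc (length xs)
length-snoc [] y = refl
length-snoc (x ∷ xs) y = cong suc (length-snoc xs y)

-- Case trees and their checker

Pairs : Set
Pairs = List (ℕ × ℕ)

memP : ℕ → ℕ → Pairs → Bool
memP i j [] = false
memP i j ((a , b) ∷ ps) = ((a ≡ᵇ i) ∧ (b ≡ᵇ j)) ∨ memP i j ps

-- A leaf closes its case by an induced P6 (`p6`), by an earlier pattern at some offset (`apply`),
-- or by an exceptional chord that is present although a chord it requires is absent (`excN`) or
-- another chord contradicts its lone vertex (`excL`). Inner nodes split on a chord or on the next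
-- colour, which is either the last but one or the third colour.
data Tree : Set where
  p6 : ℕ → ℕ → ℕ → ℕ → ℕ → ℕ → Tree
  chord? : ℕ → ℕ → Tree → Tree → Tree
  nextColour : Tree → Tree → Tree
  apply : ℕ → ℕ → Tree
  excN : ℕ → ℕ → ℕ → ℕ → Tree
  excL : ℕ → ℕ → ℕ → ℕ → Tree

-- The colours of a window up to renaming (turn k is true when c (k + 2) differs from c k), with chords
-- required to be present and to be absent.
record Pattern : Set where
  constructor mkPattern
  field
    need : ℕ
    turns : List Bool
    pos neg : Pairs

module Check (db : List Pattern) (need : ℕ) where
  module _ (cs : List Color) where
    size = length cs
    eqc : ℕ → ℕ → Bool
    eqc i j = eqC (colourAt cs i) (colourAt cs j)
    prevOK : ℕ → ℕ → Bool
    prevOK zero j = true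
    prevOK (suc i) j = not (eqc i j)
    -- `sp`, `e1` and `e2` test colour conditions necessary for strong and exceptional chords. They
    -- ignore the further chords that exceptional ones require, so the checker uses only their
    -- failure.
    sp : ℕ → ℕ → Bool
    sp i j = (not (eqc i j) ∧ not (eqc i (suc j))) ∧ prevOK i j
    e1pp : ℕ → Bool
    e1pp zero = true
    e1pp (suc i) = eqc i (suc (suc i))
    e1p : ℕ → ℕ → Bool
    e1p zero j = true
    e1p (suc i) j = eqc i (suc (suc i)) ∧ (sp i j ∧ e1pp i)
    e1 : ℕ → ℕ → Bool
    e1 i j = (suc i <ᵇ j) ∧ (sp (suc i) j ∧ e1p i j)
    e2 : ℕ → ℕ → Bool
    e2 i zero = false
    e2 i (suc j) = (i <ᵇ j) ∧ ((eqc j (suc (suc j)) ∧ sp i j) ∧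
       -- A colour beyond the known window excludes nothing, so the test then succeeds.
       (if suc (suc (suc j)) <ᵇ size then eqc (suc (suc (suc j))) (suc j) ∧ sp i (suc (suc j)) else true))
    inside : ℕ → ℕ → Bool
    inside i j = (i <ᵇ j) ∧ ((suc j <ᵇ size) ∧ (suc j <ᵇ need))
    impossible : ℕ → ℕ → Bool
    impossible i zero = false
    impossible i (suc j) = inside i j ∧ (not (sp i j) ∧ (not (e1 i j) ∧ not (e2 i j)))
    module _ (tv fv : Pairs) where
      isEdge isGap : ℕ → ℕ → Bool
      isEdge i j = if i <ᵇ j then (j ≡ᵇ suc i) ∨ memP i j tv else ((i ≡ᵇ suc j) ∨ memP j i tv)
      isGap i j = if i <ᵇ j then (memP i j fv ∨ impossible i j) else (memP j i fv ∨ impossible j i)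
      okE : ℕ → ℕ → Bool
      okE i j = ((i <ᵇ need) ∧ (j <ᵇ need)) ∧ isEdge i j
      okTurns : ℕ → List Bool → Bool
      okTurns d [] = true
      okTurns d (b ∷ bs) = ((suc (suc d) <ᵇ size) ∧ (if b then not (eqc d (suc (suc d))) else eqc d (suc (suc d)))) ∧ okTurns (suc d) bs
      okPairs : ℕ → Pairs → Pairs → Bool
      okPairs d kn [] = true
      okPairs d kn ((i , j) ∷ ps) = memP (d + i) (d + j) kn ∧ okPairs d kn ps
      lookupP : ℕ → List Pattern → Maybe Pattern
      lookupP k [] = nothing
      lookupP zero (p ∷ ps) = just p
      lookupP (suc k) (p ∷ ps) = lookupP k ps
      okApply : ℕ → Maybe Pattern → Bool
      okApply d nothing = false
      okApply d (just p) = ((d + Pattern.need p) <ᵇ suc need) ∧ (okTurns d (Pattern.turns p) ∧ (okPairs d tv (Pattern.pos p) ∧ okPairs d fv (Pattern.neg p)))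
      okExcN : ℕ → ℕ → ℕ → ℕ → Bool
      okExcN i zero p q = false
      okExcN i (suc j) p q = (inside i j ∧ (memP i (suc j) tv ∧ memP p q fv)) ∧ (not (sp i j) ∧
         ( ((not (e2 i j) ∧ (q ≡ᵇ suc j)) ∧ ((suc p ≡ᵇ i) ∨ (p ≡ᵇ suc i)))
         ∨ ((not (e1 i j) ∧ (p ≡ᵇ i)) ∧ ((q ≡ᵇ j) ∨ (q ≡ᵇ suc (suc j))))))
      okLone : ℕ → ℕ → ℕ → Bool
      okLone w p zero = false
      okLone w p (suc q) = ((w ≡ᵇ p) ∧ (not (eqc p q) ∧ not (eqc p (suc q)))) ∨ ((w ≡ᵇ suc q) ∧ lateLone p q)
        where lateLone : ℕ → ℕ → Bool
              lateLone zero q = false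
              lateLone (suc p) q = not (eqc p q)
      okExcL : ℕ → ℕ → ℕ → ℕ → Bool
      okExcL i zero p q = false
      okExcL i (suc j) p zero = false
      okExcL i (suc j) p (suc q) = (inside i j ∧ (inside p q ∧ (memP i (suc j) tv ∧ memP p (suc q) tv))) ∧ (not (sp i j) ∧
         ((not (e2 i j) ∧ okLone i p (suc q)) ∨ (not (e1 i j) ∧ okLone (suc j) p (suc q))))
      okPath : ℕ → ℕ → ℕ → ℕ → ℕ → ℕ → Bool
      okPath a b c d e f = (okE a b ∧ (okE b c ∧ (okE c d ∧ (okE d e ∧ okE e f)))) ∧
        ((isGap a c ∧ (isGap a d ∧ (isGap a e ∧ isGap a f))) ∧ ((isGap b d ∧ (isGap b e ∧ isGap b f)) ∧ ((isGap c e ∧ isGap c f) ∧ isGap d f)))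

  last2 : List Color → Color × Color
  last2 (x ∷ y ∷ []) = x , y
  last2 (x ∷ xs) = last2 xs
  last2 [] = c0 , c1

  check : Tree → List Color → Pairs → Pairs → Bool
  check (p6 a b c d e f) cs tv fv = okPath cs tv fv a b c d e f
  check (chord? i j t u) cs tv fv = check t cs ((i , j) ∷ tv) fv ∧ check u cs tv ((i , j) ∷ fv)
  -- The vertex of index `length cs`, whose colour is added, must still lie within `need`.
  check (nextColour t u) cs tv fv = (length cs <ᵇ suc need) ∧ (check t (cs ++ proj₁ (last2 cs) ∷ []) tv fv ∧ check u (cs ++ third (proj₁ (last2 cs)) (proj₂ (last2 cs)) ∷ []) tv fv)
  check (apply k d) cs tv fv = okApply cs tv fv d (lookupP cs tv fv k db)
  check (excN i j p q) cs tv fv = okExcN cs tv fv i j p q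
  check (excL i j p q) cs tv fv = okExcL cs tv fv i j p q

expand : Color → Color → List Bool → List Color
expand x y [] = []
expand x y (b ∷ bs) = let z = if b then third x y else x in z ∷ expand y z bs

window : List Bool → List Color
window bs = c0 ∷ c1 ∷ expand c0 c1 bs

checkAll : List Pattern → List (Pattern × Tree) → Bool
checkAll db [] = true
checkAll db ((p , t) ∷ ps) = (length (window (Pattern.turns p)) <ᵇ suc (Pattern.need p)) ∧ (Check.check db (Pattern.need p) t (window (Pattern.turns p)) (Pattern.pos p) (Pattern.neg p) ∧ checkAll (db ++ p ∷ []) ps)

digit : ℕ → ℕ × ℕ
digit x = x % 32 , x / 32

bitsOf : ℕ → ℕ → List Bool → List Bool
bitsOf zero x k = k
bitsOf (suc m) x k = ((x % 2) ≡ᵇ 1) ∷ bitsOf m (x / 2) k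

parseTurns : ℕ → ℕ → List Bool × ℕ
parseTurns m x = go m m x
  where
  min5 : ℕ → ℕ
  min5 k = if k <ᵇ 5 then k else 5
  go : ℕ → ℕ → ℕ → List Bool × ℕ
  go fuel zero x = [] , x
  go zero (suc k) x = [] , x
  go (suc fuel) (suc k) x = let (d , x') = digit x
                                (r , x'') = go fuel (suc k ∸ 5) x'
                            in bitsOf (min5 (suc k)) d r , x''

parsePairs : ℕ → ℕ → Pairs × ℕ
parsePairs zero x = [] , x
parsePairs (suc k) x = let (i , x₁) = digit x
                           (j , x₂) = digit x₁
                           (r , x₃) = parsePairs k x₂
                       in (i , j) ∷ r , x₃

-- Whatever tree comes out is checked afterwards. The fuel makes the recursion structural; running
-- out of it yields a leaf that is checked like any other.
parseTree : ℕ → ℕ → Tree × ℕ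
parseTree zero x = apply 0 0 , x
parseTree (suc fuel) x = go (proj₁ (digit x)) (proj₂ (digit x))
  where
  go : ℕ → ℕ → Tree × ℕ
  go 0 x = let (a , x₁) = digit x
               (b , x₂) = digit x₁
               (c , x₃) = digit x₂
               (d , x₄) = digit x₃
               (e , x₅) = digit x₄
               (f , x₆) = digit x₅ in p6 a b c d e f , x₆
  go 1 x = let (i , x₁) = digit x
               (j , x₂) = digit x₁
               (t , x₃) = parseTree fuel x₂
               (u , x₄) = parseTree fuel x₃ in chord? i j t u , x₄
  go 2 x = let (t , x₃) = parseTree fuel x
               (u , x₄) = parseTree fuel x₃ in nextColour t u , x₄
  go 3 x = let (a , x₁) = digit x
               (b , x₂) = digit x₁
               (d , x₃) = digit x₂ in apply (a + 32 * b) d , x₃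
  go k x = let (a , x₁) = digit x
               (b , x₂) = digit x₁
               (c , x₃) = digit x₂
               (d , x₄) = digit x₃ in (if k ≡ᵇ 4 then excN a b c d else excL a b c d) , x₄

parseLemma : ℕ → Pattern × Tree
parseLemma x = let (n , x₁) = digit x
                   (a , x₂) = digit x₁
                   (b , x₃) = digit x₂
                   (ts , x₄) = parseTurns (n ∸ 2) x₃
                   (k , x₅) = digit x₄
                   (ps , x₆) = parsePairs k x₅
                   (l , x₇) = digit x₆
                   (qs , x₈) = parsePairs l x₇
                   (t , _) = parseTree 300 x₈
               in mkPattern (a + 32 * b) ts ps qs , t

-- Soundness of the checker

TurnsOK : (ℕ → Color) → ℕ → List Bool → Set
TurnsOK c k [] = ⊤
TurnsOK c k (true ∷ bs) = c k ≢ c (suc (suc k)) × TurnsOK c (suc k) bs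
TurnsOK c k (false ∷ bs) = c k ≡ c (suc (suc k)) × TurnsOK c (suc k) bs

-- Quantified over all weak chains, so that an accepted pattern may be used under every shift and
-- every renaming of colours.
Refuted : Pattern → Set
Refuted p = ∀ {r c M} → WeakChain r c M → ¬ P6In r → Pattern.need p ≤ M → TurnsOK c 0 (Pattern.turns p) →
  All (λ (i , j) → r i j ≡ true) (Pattern.pos p) → All (λ (i , j) → r i j ≡ false) (Pattern.neg p) → ⊥

memP-sound : ∀ {P : ℕ × ℕ → Set} i j ps → memP i j ps ≡ true → All P ps → P (i , j)
memP-sound i j ((a , b) ∷ ps) m (q ∷ qs) with ∨-e {(a ≡ᵇ i) ∧ (b ≡ᵇ j)} m
... | inj₂ m' = memP-sound i j ps m' qs
... | inj₁ e with ≡ᵇ-sound {a} (∧-l e) | ≡ᵇ-sound {b} (∧-r {a ≡ᵇ i} e)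
... | refl | refl = q

module Soundness (db : List Pattern) (dbOK : All Refuted db) (need : ℕ)
                 {r c M} (ch : WeakChain r c M) (noP6 : ¬ P6In r) (nM : need ≤ M) where
  open Check db need
  open WeakChain ch
  σ : Color → Color
  σ = rename (c 0) (c 1)

  Inv : List Color → Set
  Inv cs = (c 0 ≢ c 1) × (∀ i → i < length cs → c i ≡ σ (colourAt cs i))

  module _ (cs : List Color) (inv : Inv cs) where
    private
      L = length cs
    same : ∀ i j → i < L → j < L → eqc cs i j ≡ true → c i ≡ c j
    same i j l l' p = trans (proj₂ inv i l) (trans (cong σ (eqC-t _ _ p)) (sym (proj₂ inv j l')))
    differ : ∀ i j → i < L → j < L → eqc cs i j ≡ false → c i ≢ c j
    differ i j l l' p e = eqC-f _ _ p (rename-inj _ _ (proj₁ inv) _ _ (trans (sym (proj₂ inv i l)) (trans e (proj₂ inv j l'))))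
    agree : ∀ i j → i < L → j < L → c i ≡ c j → eqc cs i j ≡ true
    agree i j l l' e with bool-em (eqc cs i j)
    ... | inj₁ p = p
    ... | inj₂ p = ⊥-elim (differ i j l l' p e)
    distinct : ∀ i j → i < L → j < L → c i ≢ c j → not (eqc cs i j) ≡ true
    distinct i j l l' e = not-f (¬t⇒f λ p → e (same i j l l' p))

    strong-sp : ∀ i j → i < j → suc j < L → Strong c i j → sp cs i j ≡ true
    strong-sp i j ij l (p , q , h) = ∧-i (∧-i (distinct i j iL jL p) (distinct i (suc j) iL l q)) (pv i refl)
      where
      jL = ≤-trans (n≤1+n _) l
      iL = ≤-trans (≤-trans ij (n≤1+n _)) jL
      pv : ∀ k → i ≡ k → prevOK cs k j ≡ true
      pv zero _ = refl
      pv (suc k) e = distinct k j (≤-trans (n≤1+n _) (subst (_< L) e iL)) jL (h k e)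

    exc₁-e1 : ∀ i j → i < j → suc j < L → Exc₁ r c M i j → e1 cs i j ≡ true
    exc₁-e1 i j ij l (lt , s , _ , h , _) = ∧-i (<⇒<ᵇ' lt) (∧-i (strong-sp (suc i) j lt l s) (f i refl))
      where
      jL = ≤-trans (n≤1+n _) l
      siL = ≤-trans (≤-trans lt (n≤1+n _)) jL
      f : ∀ k → i ≡ k → e1p cs k j ≡ true
      f zero _ = refl
      f (suc k) refl = let (a , b , _ , g) = h k refl in
        ∧-i (agree k (suc (suc k)) (≤-trans (≤-trans (n≤1+n _) (n≤1+n _)) siL) siL a)
            (∧-i (strong-sp k j (≤-trans (n≤1+n _) ij) l b) (f' k refl g))
        where
        f' : ∀ m → k ≡ m → (∀ i₂ → k ≡ suc i₂ → c i₂ ≡ c (suc k)) → e1pp cs m ≡ true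
        f' zero _ _ = refl
        f' (suc m) refl g = agree m (suc (suc m)) (≤-trans (≤-trans (n≤1+n _) (≤-trans (n≤1+n _) (n≤1+n _))) siL) (≤-trans (n≤1+n _) siL) (g m refl)

    exc₂-e2 : ∀ i j → i < j → suc j < L → Exc₂ r c M i j → e2 cs i j ≡ true
    exc₂-e2 i (suc j) ij l (.j , refl , lt , a , b , s , t , _) =
      ∧-i (<⇒<ᵇ' lt) (∧-i (∧-i (agree j (suc (suc j)) (≤-trans (≤-trans (n≤1+n _) (n≤1+n _)) l) l a) (strong-sp i j lt (≤-trans (n≤1+n _) l) s)) tl)
      where
      tl : (if suc (suc (suc j)) <ᵇ L then eqc cs (suc (suc (suc j))) (suc j) ∧ sp cs i (suc (suc j)) else true) ≡ true
      tl with bool-em (suc (suc (suc j)) <ᵇ L)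
      ... | inj₂ f rewrite f = refl
      ... | inj₁ f rewrite f = ∧-i (agree _ _ (<ᵇ⇒<' f) (≤-trans (n≤1+n _) l) b) (strong-sp i (suc (suc j)) (≤-trans lt (≤-trans (n≤1+n _) (n≤1+n _))) (<ᵇ⇒<' f) t)

    module Inside {i j} (p : inside cs i j ≡ true) where
      lt : i < j
      lt = <ᵇ⇒<' (∧-l p)
      lL : suc j < L
      lL = <ᵇ⇒<' (∧-l (∧-r {i <ᵇ j} p))
      lM : suc (suc j) ≤ M
      lM = ≤-trans (<ᵇ⇒<' (∧-r {suc j <ᵇ L} (∧-r {i <ᵇ j} p))) nM

    impossible-sound : ∀ i j → impossible cs i j ≡ true → r i j ≡ false
    impossible-sound i (suc j) p = ¬t⇒f λ e → h (rule i j lt lM e)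
      where
      open Inside {i} {j} (∧-l p)
      q = ∧-r {inside cs i j} p
      h : Strong c i j ⊎ (Exc₁ r c M i j ⊎ Exc₂ r c M i j) → ⊥
      h (inj₁ s) = f≢t (not-t (∧-l q)) (strong-sp i j lt lL s)
      h (inj₂ (inj₁ s)) = f≢t (not-t (∧-l (∧-r {not (sp cs i j)} q))) (exc₁-e1 i j lt lL s)
      h (inj₂ (inj₂ s)) = f≢t (not-t (∧-r {not (e1 cs i j)} (∧-r {not (sp cs i j)} q))) (exc₂-e2 i j lt lL s)

    module _ (tv fv : Pairs) (tvOK : All (λ (i , j) → r i j ≡ true) tv) (fvOK : All (λ (i , j) → r i j ≡ false) fv) where
      edge-one : ∀ i j → i < need → (j ≡ᵇ suc i) ∨ memP i j tv ≡ true → r i j ≡ true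
      edge-one i j l p with ∨-e {j ≡ᵇ suc i} p
      ... | inj₂ q = memP-sound i j tv q tvOK
      ... | inj₁ q with ≡ᵇ-sound {j} q
      ... | refl = edge i (≤-trans l nM)
      okE-sound : ∀ i j → okE cs tv fv i j ≡ true → r i j ≡ true
      okE-sound i j p with bool-em (i <ᵇ j)
      ... | inj₁ q = edge-one i j (<ᵇ⇒<' (∧-l (∧-l p))) (subst (λ z → (if z then (j ≡ᵇ suc i) ∨ memP i j tv else ((i ≡ᵇ suc j) ∨ memP j i tv)) ≡ true) q (∧-r {(i <ᵇ need) ∧ (j <ᵇ need)} p))
      ... | inj₂ q = trans (symm i j) (edge-one j i (<ᵇ⇒<' (∧-r {i <ᵇ need} (∧-l p))) (subst (λ z → (if z then (j ≡ᵇ suc i) ∨ memP i j tv else ((i ≡ᵇ suc j) ∨ memP j i tv)) ≡ true) q (∧-r {(i <ᵇ need) ∧ (j <ᵇ need)} p)))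
      gap-one : ∀ i j → memP i j fv ∨ impossible cs i j ≡ true → r i j ≡ false
      gap-one i j p with ∨-e {memP i j fv} p
      ... | inj₁ q = memP-sound i j fv q fvOK
      ... | inj₂ q = impossible-sound i j q
      isGap-sound : ∀ i j → isGap cs tv fv i j ≡ true → r i j ≡ false
      isGap-sound i j p with bool-em (i <ᵇ j)
      ... | inj₁ q = gap-one i j (subst (λ z → (if z then (memP i j fv ∨ impossible cs i j) else (memP j i fv ∨ impossible cs j i)) ≡ true) q p)
      ... | inj₂ q = trans (symm i j) (gap-one j i (subst (λ z → (if z then (memP i j fv ∨ impossible cs i j) else (memP j i fv ∨ impossible cs j i)) ≡ true) q p))

      okPath-sound : ∀ a b x d e f → okPath cs tv fv a b x d e f ≡ true → ⊥
      okPath-sound a b x d e f p = noP6 (mkP6 a b x d e f (E a b e₁) (E b x e₂) (E x d e₃) (E d e e₄) (E e f e₅)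
          (G a x g₁) (G a d g₂) (G a e g₃) (G a f g₄) (G b d g₅) (G b e g₆) (G b f g₇) (G x e g₈) (G x f g₉) (G d f g₀))
        where
        E = okE-sound
        G = isGap-sound
        k = okE cs tv fv
        h = isGap cs tv fv
        es = ∧-l {k a b ∧ (k b x ∧ (k x d ∧ (k d e ∧ k e f)))} p
        gs = ∧-r {k a b ∧ (k b x ∧ (k x d ∧ (k d e ∧ k e f)))} p
        e₁ = ∧-l {k a b} es
        e₂ = ∧-l {k b x} (∧-r {k a b} es)
        e₃ = ∧-l {k x d} (∧-r {k b x} (∧-r {k a b} es))
        e₄ = ∧-l {k d e} (∧-r {k x d} (∧-r {k b x} (∧-r {k a b} es)))
        e₅ = ∧-r {k d e} (∧-r {k x d} (∧-r {k b x} (∧-r {k a b} es)))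
        ga = ∧-l {h a x ∧ (h a d ∧ (h a e ∧ h a f))} gs
        gr = ∧-r {h a x ∧ (h a d ∧ (h a e ∧ h a f))} gs
        g₁ = ∧-l {h a x} ga
        g₂ = ∧-l {h a d} (∧-r {h a x} ga)
        g₃ = ∧-l {h a e} (∧-r {h a d} (∧-r {h a x} ga))
        g₄ = ∧-r {h a e} (∧-r {h a d} (∧-r {h a x} ga))
        gb = ∧-l {h b d ∧ (h b e ∧ h b f)} gr
        gt = ∧-r {h b d ∧ (h b e ∧ h b f)} gr
        g₅ = ∧-l {h b d} gb
        g₆ = ∧-l {h b e} (∧-r {h b d} gb)
        g₇ = ∧-r {h b e} (∧-r {h b d} gb)
        g₈ = ∧-l {h x e} (∧-l {h x e ∧ h x f} gt)
        g₉ = ∧-r {h x e} (∧-l {h x e ∧ h x f} gt)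
        g₀ = ∧-r {h x e ∧ h x f} gt

      okTurns-sound : ∀ d k bs → okTurns cs tv fv (d + k) bs ≡ true → TurnsOK (λ i → c (d + i)) k bs
      okTurns-sound d k [] p = tt
      okTurns-sound d k (b ∷ bs) p = tl b (∧-l p) (okTurns-sound d (suc k) bs (subst (λ z → okTurns cs tv fv z bs ≡ true) (sym (+-suc d k)) (∧-r {(suc (suc (d + k)) <ᵇ L) ∧ (if b then not (eqc cs (d + k) (suc (suc (d + k)))) else eqc cs (d + k) (suc (suc (d + k))))} p)))
        where
        ss : c (d + suc (suc k)) ≡ c (suc (suc (d + k)))
        ss = cong c (trans (+-suc d (suc k)) (cong suc (+-suc d k)))
        tl : ∀ b → (suc (suc (d + k)) <ᵇ L) ∧ (if b then not (eqc cs (d + k) (suc (suc (d + k)))) else eqc cs (d + k) (suc (suc (d + k)))) ≡ true →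
             TurnsOK (λ i → c (d + i)) (suc k) bs → TurnsOK (λ i → c (d + i)) k (b ∷ bs)
        tl true q t = (λ e → differ (d + k) (suc (suc (d + k))) (≤-trans (≤-trans (n≤1+n _) (n≤1+n _)) l) l (not-t (∧-r {suc (suc (d + k)) <ᵇ L} q)) (trans e ss)) , t
          where l = <ᵇ⇒<' {suc (suc (d + k))} (∧-l q)
        tl false q t = trans (same (d + k) (suc (suc (d + k))) (≤-trans (≤-trans (n≤1+n _) (n≤1+n _)) l) l (∧-r {suc (suc (d + k)) <ᵇ L} q)) (sym ss) , t
          where l = <ᵇ⇒<' {suc (suc (d + k))} (∧-l q)

      okPairs-sound : ∀ {P : ℕ × ℕ → Set} d kn ps → All P kn → okPairs cs tv fv d kn ps ≡ true → All (λ (i , j) → P (d + i , d + j)) ps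
      okPairs-sound d kn [] a p = []
      okPairs-sound d kn ((i , j) ∷ ps) a p = memP-sound (d + i) (d + j) kn (∧-l p) a ∷ okPairs-sound d kn ps a (∧-r {memP (d + i) (d + j) kn} p)

      lookup-OK : ∀ k ps → All Refuted ps → ∀ d → okApply cs tv fv d (lookupP cs tv fv k ps) ≡ true →
        Σ Pattern λ p → Refuted p × okApply cs tv fv d (just p) ≡ true
      lookup-OK zero (p ∷ ps) (a ∷ _) d q = p , a , q
      lookup-OK (suc k) (p ∷ ps) (_ ∷ as) d q = lookup-OK k ps as d q

      okApply-sound : ∀ k d → okApply cs tv fv d (lookupP cs tv fv k db) ≡ true → ⊥
      okApply-sound k d q with lookup-OK k db dbOK d q
      ... | p , ref , s = ref (chain-shift d (M ∸ d) le ch)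
              (λ x → let open P6In x using (ab; bc; cd; de; ef; ac; ad; ae; af; bd; be; bf; ce; cf; df) in noP6 (mkP6 (d + P6In.a x) (d + P6In.b x) (d + P6In.c x) (d + P6In.d x) (d + P6In.e x) (d + P6In.f x) ab bc cd de ef ac ad ae af bd be bf ce cf df))
              (+-cancelˡ-≤ d _ _ (≤-trans nd (≤-reflexive (sym eqM))))
              (okTurns-sound d 0 (Pattern.turns p) (subst (λ z → okTurns cs tv fv z (Pattern.turns p) ≡ true) (sym (+-identityʳ' d)) (∧-l (∧-r {(d + Pattern.need p) <ᵇ suc need} s))))
              (okPairs-sound d tv (Pattern.pos p) tvOK (∧-l (∧-r {okTurns cs tv fv d (Pattern.turns p)} (∧-r {(d + Pattern.need p) <ᵇ suc need} s))))
              (okPairs-sound d fv (Pattern.neg p) fvOK (∧-r {okPairs cs tv fv d tv (Pattern.pos p)} (∧-r {okTurns cs tv fv d (Pattern.turns p)} (∧-r {(d + Pattern.need p) <ᵇ suc need} s))))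
        where
        +-identityʳ' : ∀ d → d + 0 ≡ d
        +-identityʳ' zero = refl
        +-identityʳ' (suc d) = cong suc (+-identityʳ' d)
        un : ∀ {a b} → suc a ≤ suc b → a ≤ b
        un (s≤s l) = l
        nd : d + Pattern.need p ≤ M
        nd = ≤-trans (un (<ᵇ⇒<' {d + Pattern.need p} (∧-l s))) nM
        eqM : d + (M ∸ d) ≡ M
        eqM = m+[n∸m]≡n (≤-trans (m≤m+n d _) nd)
        le : d + (M ∸ d) ≤ M
        le = ≤-reflexive eqM

      okExcN-sound : ∀ i j p q → okExcN cs tv fv i j p q ≡ true → ⊥
      okExcN-sound i (suc j) p q s = go (rule i j lt lM (memP-sound i (suc j) tv (∧-l mm) tvOK)) (∨-e alt)
        where
        h1 = inside cs i j ∧ (memP i (suc j) tv ∧ memP p q fv)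
        mm = ∧-r {inside cs i j} (∧-l {h1} s)
        open Inside {i} {j} (∧-l (∧-l {h1} s))
        rf : r p q ≡ false
        rf = memP-sound p q fv (∧-r {memP i (suc j) tv} mm) fvOK
        nsp = not-t (∧-l (∧-r {h1} s))
        A = ((not (e2 cs i j) ∧ (q ≡ᵇ suc j)) ∧ ((suc p ≡ᵇ i) ∨ (p ≡ᵇ suc i)))
        B = ((not (e1 cs i j) ∧ (p ≡ᵇ i)) ∧ ((q ≡ᵇ j) ∨ (q ≡ᵇ suc (suc j))))
        alt : A ∨ B ≡ true
        alt = ∧-r {not (sp cs i j)} (∧-r {h1} s)
        go : Strong c i j ⊎ (Exc₁ r c M i j ⊎ Exc₂ r c M i j) → A ≡ true ⊎ B ≡ true → ⊥
        go (inj₁ x) _ = f≢t nsp (strong-sp i j lt lL x)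
        go (inj₂ (inj₂ x)) (inj₁ a) = f≢t (not-t (∧-l (∧-l a))) (exc₂-e2 i j lt lL x)
        go (inj₂ (inj₁ x)) (inj₂ b) = f≢t (not-t (∧-l (∧-l b))) (exc₁-e1 i j lt lL x)
        go (inj₂ (inj₁ (_ , _ , e , h , _))) (inj₁ a) with ≡ᵇ-sound {q} (∧-r {not (e2 cs i j)} (∧-l a)) | ∨-e (∧-r {not (e2 cs i j) ∧ (q ≡ᵇ suc j)} a)
        ... | eq | inj₁ z = f≢t (subst (λ y → r p y ≡ false) eq rf) (proj₁ (proj₂ (proj₂ (h p (sym (≡ᵇ-sound {suc p} z))))))
        ... | eq | inj₂ z = f≢t (subst (λ y → r y (suc j) ≡ false) (≡ᵇ-sound {p} z) (subst (λ y → r p y ≡ false) eq rf)) e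
        go (inj₂ (inj₂ (_ , _ , _ , _ , _ , _ , _ , e , e' , _))) (inj₂ b) with ≡ᵇ-sound {p} (∧-r {not (e1 cs i j)} (∧-l b)) | ∨-e (∧-r {not (e1 cs i j) ∧ (p ≡ᵇ i)} b)
        ... | eq | inj₁ z = f≢t (subst (λ y → r y j ≡ false) eq (subst (λ y → r p y ≡ false) (≡ᵇ-sound {q} z) rf)) e
        ... | eq | inj₂ z = f≢t (subst (λ y → r y (suc (suc j)) ≡ false) eq (subst (λ y → r p y ≡ false) (≡ᵇ-sound {q} z) rf)) e'

      okLone-sound : ∀ w p q → Lone r c M w → inside cs p q ≡ true → r p (suc q) ≡ true → okLone cs tv fv w p (suc q) ≡ true → ⊥
      okLone-sound w p q (f , g) ins e s with ∨-e {(w ≡ᵇ p) ∧ (not (eqc cs p q) ∧ not (eqc cs p (suc q)))} s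
      ... | inj₁ a with ≡ᵇ-sound {w} (∧-l a)
      ... | refl = k (f q lt lM e)
        where
        open Inside {p} {q} ins
        qL = ≤-trans (n≤1+n _) lL
        pL = ≤-trans (≤-trans lt (n≤1+n _)) qL
        a' = ∧-r {w ≡ᵇ p} a
        k : c p ≡ c q ⊎ c p ≡ c (suc q) → ⊥
        k (inj₁ x) = differ p q pL qL (not-t (∧-l a')) x
        k (inj₂ x) = differ p (suc q) pL lL (not-t (∧-r {not (eqc cs p q)} a')) x
      okLone-sound w zero q (f , g) ins e s | inj₂ b = f≢t {false} refl (∧-r {w ≡ᵇ suc q} b)
      okLone-sound w (suc p) q (f , g) ins e s | inj₂ b with ≡ᵇ-sound {w} (∧-l b)
      ... | refl = differ p q pL qL (not-t (∧-r {w ≡ᵇ suc q} b)) (g (suc p) q refl lt e p refl)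
        where
        open Inside {suc p} {q} ins
        qL = ≤-trans (n≤1+n _) lL
        pL = ≤-trans (≤-trans (n≤1+n _) (≤-trans lt (n≤1+n _))) qL

      okExcL-sound : ∀ i j p q → okExcL cs tv fv i j p q ≡ true → ⊥
      okExcL-sound i (suc j) p (suc q) s = go (rule i j lt lM (memP-sound i (suc j) tv (∧-l (∧-r {inside cs p q} h2)) tvOK)) (∨-e alt)
        where
        h1 = inside cs i j ∧ (inside cs p q ∧ (memP i (suc j) tv ∧ memP p (suc q) tv))
        h2 = ∧-r {inside cs i j} (∧-l {h1} s)
        open Inside {i} {j} (∧-l (∧-l {h1} s))
        ins = ∧-l {inside cs p q} h2
        e : r p (suc q) ≡ true
        e = memP-sound p (suc q) tv (∧-r {memP i (suc j) tv} (∧-r {inside cs p q} h2)) tvOK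
        nsp = not-t (∧-l (∧-r {h1} s))
        A = not (e2 cs i j) ∧ okLone cs tv fv i p (suc q)
        B = not (e1 cs i j) ∧ okLone cs tv fv (suc j) p (suc q)
        alt : A ∨ B ≡ true
        alt = ∧-r {not (sp cs i j)} (∧-r {h1} s)
        go : Strong c i j ⊎ (Exc₁ r c M i j ⊎ Exc₂ r c M i j) → A ≡ true ⊎ B ≡ true → ⊥
        go (inj₁ x) _ = f≢t nsp (strong-sp i j lt lL x)
        go (inj₂ (inj₂ x)) (inj₁ a) = f≢t (not-t (∧-l a)) (exc₂-e2 i j lt lL x)
        go (inj₂ (inj₁ x)) (inj₂ b) = f≢t (not-t (∧-l b)) (exc₁-e1 i j lt lL x)
        go (inj₂ (inj₁ (_ , _ , _ , _ , ln))) (inj₁ a) = okLone-sound i p q ln ins e (∧-r {not (e2 cs i j)} a)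
        go (inj₂ (inj₂ (_ , _ , _ , _ , _ , _ , _ , _ , _ , ln))) (inj₂ b) = okLone-sound (suc j) p q ln ins e (∧-r {not (e1 cs i j)} b)

  last2-at : ∀ cs m → length cs ≡ suc (suc m) → last2 cs ≡ (colourAt cs m , colourAt cs (suc m))
  last2-at (x ∷ y ∷ []) zero e = refl
  last2-at (x ∷ y ∷ z ∷ cs) (suc m) e = last2-at (y ∷ z ∷ cs) m (suc-inj e)
    where suc-inj : ∀ {a b} → suc a ≡ suc b → a ≡ b
          suc-inj refl = refl

  inv-snoc : ∀ cs y → Inv cs → c (length cs) ≡ σ y → Inv (cs ++ y ∷ [])
  inv-snoc cs y (d , h) e = d , λ i l → go i (m≤n⇒m<n∨m≡n (un (≤-trans l (≤-reflexive (length-snoc cs y)))))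
    where
    un : ∀ {a b} → suc a ≤ suc b → a ≤ b
    un (s≤s l) = l
    go : ∀ i → i < length cs ⊎ i ≡ length cs → c i ≡ σ (colourAt (cs ++ y ∷ []) i)
    go i (inj₁ l) = trans (h i l) (cong σ (sym (at-old cs y i l)))
    go i (inj₂ refl) = trans e (cong σ (sym (at-new cs y)))

  -- The tree is followed along the branch that the given chain actually takes; the recorded window
  -- stays correct up to `σ`. As consecutive colours differ, a new colour other than the last but
  -- one is the third one.
  sound : ∀ t cs m → length cs ≡ suc (suc m) → Inv cs → ∀ tv fv → All (λ (i , j) → r i j ≡ true) tv → All (λ (i , j) → r i j ≡ false) fv →
    check t cs tv fv ≡ true → ⊥
  sound (p6 a b x d e f) cs m len inv tv fv ta fa p = okPath-sound cs inv tv fv ta fa a b x d e f p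
  sound (chord? i j t u) cs m len inv tv fv ta fa p with bool-em (r i j)
  ... | inj₁ e = sound t cs m len inv ((i , j) ∷ tv) fv (e ∷ ta) fa (∧-l p)
  ... | inj₂ e = sound u cs m len inv tv ((i , j) ∷ fv) ta (e ∷ fa) (∧-r {check t cs ((i , j) ∷ tv) fv} p)
  sound (nextColour t u) cs m len inv tv fv ta fa p with c (suc (suc m)) Finₚ.≟ c m
  ... | yes e = sound t (cs ++ proj₁ (last2 cs) ∷ []) (suc m) (trans (length-snoc cs _) (cong suc len))
        (inv-snoc cs _ inv (trans (cong c len) (trans e (trans (proj₂ inv m (≤-trans (n≤1+n _) (≤-reflexive (sym len)))) (cong (λ z → σ (proj₁ z)) (sym (last2-at cs m len)))))))
        tv fv ta fa (∧-l (∧-r {length cs <ᵇ suc need} p))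
  ... | no ne = sound u (cs ++ third x y ∷ []) (suc m) (trans (length-snoc cs _) (cong suc len))
        (inv-snoc cs _ inv (trans (cong c len) eq))
        tv fv ta fa (∧-r {check t (cs ++ proj₁ (last2 cs) ∷ []) tv fv} (∧-r {length cs <ᵇ suc need} p))
    where
    x = proj₁ (last2 cs)
    y = proj₂ (last2 cs)
    un : ∀ {a b} → suc a ≤ suc b → a ≤ b
    un (s≤s l) = l
    mM : suc (suc m) ≤ M
    mM = ≤-trans (≤-reflexive (sym len)) (≤-trans (un (<ᵇ⇒<' {length cs} (∧-l p))) nM)
    cm : c m ≡ σ x
    cm = trans (proj₂ inv m (≤-trans (n≤1+n _) (≤-reflexive (sym len)))) (cong (λ z → σ (proj₁ z)) (sym (last2-at cs m len)))
    csm : c (suc m) ≡ σ y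
    csm = trans (proj₂ inv (suc m) (≤-reflexive (sym len))) (cong (λ z → σ (proj₂ z)) (sym (last2-at cs m len)))
    dm : c m ≢ c (suc m)
    dm = diff m (≤-trans (n≤1+n _) mM)
    xy : x ≢ y
    xy e = dm (trans cm (trans (cong σ e) (sym csm)))
    eq : c (suc (suc m)) ≡ σ (third x y)
    eq = trans (third-unique _ _ _ dm ne (λ e → diff (suc m) mM (sym e))) (trans (cong₂ third cm csm) (sym (rename-third _ _ (proj₁ inv) x y xy)))
  sound (apply k d) cs m len inv tv fv ta fa p = okApply-sound cs inv tv fv ta fa k d p
  sound (excN i j a b) cs m len inv tv fv ta fa p = okExcN-sound cs inv tv fv ta fa i j a b p
  sound (excL i j a b) cs m len inv tv fv ta fa p = okExcL-sound cs inv tv fv ta fa i j a b p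

  expand-inv : ∀ bs k x y → c k ≡ σ x → c (suc k) ≡ σ y → x ≢ y → (c 0 ≢ c 1) → k + suc (length bs) < M → TurnsOK c k bs →
    ∀ i → i < length (expand x y bs) → c (suc (suc (k + i))) ≡ σ (colourAt (expand x y bs) i)
  expand-inv (b ∷ bs) k x y ck csk xy d le t i l = go b t i l
    where
    l₁ : suc k < M
    l₁ = ≤-trans (s≤s (≤-trans (s≤s (m≤m+n k (length bs))) (≤-trans (≤-reflexive (sym (+-suc k (length bs)))) (+-monoʳ-≤ k (n≤1+n _))))) le
    nz : ∀ b → TurnsOK c k (b ∷ bs) → c (suc (suc k)) ≡ σ (if b then third x y else x)
    nz true (ne , _) = trans (third-unique _ _ _ (λ e → xy (rename-inj _ _ d _ _ (trans (sym ck) (trans e csk)))) (λ e → ne (sym e)) (λ e → diff (suc k) l₁ (sym e)))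
                      (trans (cong₂ third ck csk) (sym (rename-third _ _ d x y xy)))
    nz false (e , _) = trans (sym e) ck
    yz : ∀ b → y ≢ (if b then third x y else x)
    yz true e = third≢r x y (sym e)
    yz false e = xy (sym e)
    tl : ∀ b → TurnsOK c k (b ∷ bs) → TurnsOK c (suc k) bs
    tl true (_ , t) = t
    tl false (_ , t) = t
    go : ∀ b → TurnsOK c k (b ∷ bs) → ∀ i → i < length (expand x y (b ∷ bs)) → c (suc (suc (k + i))) ≡ σ (colourAt (expand x y (b ∷ bs)) i)
    go b t zero l = trans (cong (λ z → c (suc (suc z))) (+-identityʳ k)) (nz b t)
    go b t (suc i) (s≤s l) = trans (cong (λ z → c (suc (suc z))) (+-suc k i))
       (expand-inv bs (suc k) y (if b then third x y else x) csk (nz b t) (yz b) d (≤-trans (s≤s (≤-reflexive (sym (+-suc k (suc (length bs)))))) le) (tl b t) i l)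

  length-expand : ∀ bs x y → length (expand x y bs) ≡ length bs
  length-expand [] x y = refl
  length-expand (b ∷ bs) x y = cong suc (length-expand bs y _)

  window-inv : ∀ bs → suc (suc (length bs)) ≤ need → TurnsOK c 0 bs → Inv (window bs)
  window-inv bs le t = d , λ { zero _ → refl ; (suc zero) _ → refl ; (suc (suc i)) (s≤s (s≤s l)) → expand-inv bs 0 c0 c1 refl refl (λ ()) d (≤-trans le nM) t i l }
    where d = diff 0 (≤-trans (≤-trans (s≤s z≤n) le) nM)

  pattern-sound : ∀ t p → Pattern.need p ≡ need → (length (window (Pattern.turns p)) <ᵇ suc need) ≡ true → check t (window (Pattern.turns p)) (Pattern.pos p) (Pattern.neg p) ≡ true →
    TurnsOK c 0 (Pattern.turns p) → All (λ (i , j) → r i j ≡ true) (Pattern.pos p) → All (λ (i , j) → r i j ≡ false) (Pattern.neg p) → ⊥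
  pattern-sound t p _ l ck ts pa na = sound t (window (Pattern.turns p)) (length (expand c0 c1 (Pattern.turns p))) refl
     (window-inv (Pattern.turns p) (≤-trans (≤-reflexive (cong (λ z → suc (suc z)) (sym (length-expand (Pattern.turns p) c0 c1)))) (un (<ᵇ⇒<' {length (window (Pattern.turns p))} l))) ts)
     (Pattern.pos p) (Pattern.neg p) pa na ck
    where un : ∀ {a b} → suc a ≤ suc b → a ≤ b
          un (s≤s l) = l

-- Induction along the list: a tree appeals only to patterns before it, and these are already
-- refuted.
checkAll-sound : ∀ db ls → All Refuted db → checkAll db ls ≡ true → All (λ l → Refuted (proj₁ l)) ls
checkAll-sound db [] ok p = []
checkAll-sound db ((q , t) ∷ ls) ok p = this ∷ checkAll-sound (db ++ q ∷ []) ls (snocAll ok this) (∧-r {Check.check db (Pattern.need q) t (window (Pattern.turns q)) (Pattern.pos q) (Pattern.neg q)} (∧-r {length (window (Pattern.turns q)) <ᵇ suc (Pattern.need q)} p))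
  where
  this : Refuted q
  this ch np nm = Soundness.pattern-sound db ok (Pattern.need q) ch np nm t q refl (∧-l p) (∧-l (∧-r {length (window (Pattern.turns q)) <ᵇ suc (Pattern.need q)} p))
  snocAll : ∀ {P : Pattern → Set} {xs x} → All P xs → P x → All P (xs ++ x ∷ [])
  snocAll [] a = a ∷ []
  snocAll (b ∷ bs) a = b ∷ snocAll bs a

-- Found by a conflict-driven search: each number codes, in little-endian base 32, a pattern that cannot
-- occur and a case tree refuting it from the patterns before it.
certificate : List ℕ
certificate =
  0x2520c41000a41882000800000e5 ∷
  0x4a63a12301523104004942048c249016a ∷
  0x15a92311405128a5514291052328849201ac ∷
  0x15a9233980b48c85301690a96731480289452a8a159c2000862289222a4415a8c520c05128a55142000862289222a441518210046a204c000c4048ce328861201aa ∷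
  0x14a0e610c0000469184a000c4811c423082090189 ∷
  0x14a0e311405120a541427104e3288432016a ∷
  0x14a0c520c05120a54142820506288472016a ∷
  0x2838c410008000c4038c2070168 ∷
  0x4c518820018a31040031462080071986430c2001c67184420146170166 ∷
  0xa50731480289052a0a12010349c283208228827201ea ∷
  0x1398a310404298e2080e20982128c2168128 ∷
  0x94c708860101033942038421d01a8 ∷
  0x1298e81040611c44388261142240820c8149 ∷
  0x4e620c4102087210e409847110e20a0861984331020c8149 ∷
  0x2731483100e629022008a618820018610102150127 ∷
  0x15a927190030346c59c620812a5b064030614000312ce1124c92892738c46681eb ∷
  0xa9271882042543104050206a405430812738c4e6820b ∷
  0x28398a31008000c471986228c2068168 ∷
  0x528188a601448115020810328845a016a ∷
  0x52838c41000101800f1a4a931126089270a4a138c266820a ∷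
  0x801119c66190c3080131a125188204942941c62080440006238c2028c2068208 ∷
  0x800a18014188c10946168207 ∷
  0x2a49462080e84a86402861300031012528c41e81aa ∷
  0x9cc518820398a410402184251904278127 ∷
  0x4c74244301c481110209c4148821f816a ∷
  0x141ca41040941ca31010729041024a82910509c48111020a9252082030003124a1003034882211c41394a320861f81a8 ∷
  0x9cc51882000323394271182308ca320841f81a8 ∷
  0x50728c41018e818820183434a8a31040a2854940c410094920c41029281882012481182e3120c140c26204e528c43e8209 ∷
  0x4e628c410001b1a0e51802041ca3004092a0a4414200586928442394273146208041020662040518c02e8207 ∷
  0x2629062080c520c4101466190c3088a33044068127 ∷
  0x4c520c41004081988128c20e8187 ∷
  0x881e1881d180121a5073148040d052a0a11026359cc520c0b3856a49483008c000c492844818442070620546004862044681a0a54142b524a41804080c4078d035a0ab4044b4854b3948302ce15a92520c0230003124a11206111ca1081c3100091a0e629060289052a0a1100061a50629060101a35a8c520c05128a55142700062518220306a20445120a541422418263a083100a2388a7104c820c41020c14102941cc5201073148301c6819103089494148302d482906020163594250286b520a2181885a08b404a2594ab285ac414830296c694c06942900062289652aca16202262cc74240c398a4181870a54b31480289652aca112cc152c831040b2044a405494148300949414830144a295450a92829060289452a8a1104011a88130003120a819503098e848c80415032a06148c224142200123000a311447114e20800618005188a2388a7105060a50418820000a311447114e20a0814a0e629001010691a06440c2000c691844a4a0a41816a41c6402d4838c405a9071880c42d045a02d620e32012000c4c404425202a4a0a418041010682a06540c2000c691844511c4538828284471846000c420144120246 ∷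
  0x2731483100e629062010001884107c661840048267 ∷
  0x503214c101ca82910509ca408903304419016a ∷
  0x50731420020e6284001140128420c8148 ∷
  0x4e620c4101846190c30984131021c8128 ∷
  0x13148310405094442882102066204a328440e0187 ∷
  0x4c520c4101cc418820001633842105468388642812818820029283882052507104021148341c203842818420a0c4710446204c520c41014c31040030c222042050226 ∷
  0x842519cc520c4038ce221c411040310c24188221886120d28398a402507190a0084234902241105220a111c4110463418a418808220a44142241829410620804110c49410620812820c410250418820084234902211c4132083104083050408820188e308c001884007c6510400202a6 ∷
  0x2838c410006130c4038c2130308 ∷
  0x141cc40040821c8439028204c420040c8149 ∷
  0xa507308202800312047110e20a04130820c8189 ∷
  0x14a0e61040941cc20804030821c8169 ∷
  0x4c74a961018e9584405a42b31483101660a446109275845f981ac ∷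
  0x9cc520820398a4104020104178127 ∷
  0x98a410400308a221441308401104138107 ∷
  0x230686951462081450a4862284908c25418e528c6ff820b ∷
  0x9cc520c4031483104051986430c2228c821846078127 ∷
  0xa928398a0520e61040a4054520c41028a1205e3124e831ca80942530827c81aa ∷
  0x1524e50880b3a8e451c29128445082b3a44249ce528467981ac ∷
  0x1524e5088084a8a1100a0d0d6c39422030e15b0432140c104c160c4b31483101660802b1ac21285831290151428324461202449ce52846f9824b ∷
  0x2008c68398800800140d2820c41020481910309400189040800c1a041108c22844621002c8187 ∷
  0x14a0e5088010a4610a06b52467300a198d690a9672844059c2a5886428162098261886138d4609d095044050426000624942918440394e32846198369 ∷
  0xa507188201866349c2849462081250a08912023090e328c46781ea ∷
  0x1524e61040b524e6280a168d8b3984102000189670a54b118a048942228415882211ca91092730847c81ea ∷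
  0x40180c01b0d270a0c72a4480942530827c81ea ∷
  0x421b8c2180d8b520e60358a41cc05b1a8398050b86e79d01101e70b9e2190a0788290b062725433980e4854b6b8c7038c152dae0880e0850160c4d585a80b9ac520e06b1483980e535446a82c3b4e469c2f728673018d73c6203c61580031304d111a20b9412830371c2e10ce8480a0c0dc70b8411098a0ad874044061c2b60864281820982c1896941c6202d21598a41880b3058b08ce6018ec5844061c2b60864281820982c189662906202cc15842c5a907300c168ca1a8dae3a022038e16b8432140e1052130c4d4a867301a90a96c698e06982a5b1a1101a10a400189880884a405430a928094c0124e832446110e3404a118487983ca ∷
  0x80381ad49404405a4e50880b4840158d610942c188a0d0d6c3a022030e15b0432140c104c160c4b31483101660802b1ac21282e312901525012980249c2848864281220842a1886040d0609841394e3404a1184a3983c9 ∷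
  0x5073142200c081a0c10070349cc5088093850910c85024410854310c081a0c14042941c61281073142201ca829105088472984238ca118461983c8 ∷
  0x10848331483104061186430c22310c228460c81a7 ∷
  0x803b1803319881308a111001c81a7 ∷
  0x110783087435250610c010c86c5a9041802188dac418430296c698e06982900062620210c46860c41001880b061109480a543214c050c220a8622010349c210e46910421a0c483050408c261880138ce308c001880611042303e7 ∷
  0x5070886401c67110e2084271a0812000311c613842060328 ∷
  0x200a4610f8620f46820502080c430840c8429 ∷
  0x2b524c2080e000c490852630842c81cb ∷
  0x460e0c60a8ce8490600248111c01418c31806358269 ∷
  0x881519d031040040c2039421b0249 ∷
  0xa50730820524e6104021086249c2030826c828a ∷
  0x460e0c60a8d0920c200248110c01418c31846358269 ∷
  0x56a49c6202d4938c4059d47228e1489422284138783635271880d4850130c4d620e31010130c4c4052a5b06203061400031244a111420ace14254b10c09128445082b104491052738c47983ab ∷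
  0x16b0e51880d29121101a5098ec68860688270b0623888212d2c39ca9214690983ff820d ∷
  0x56c214e8000461b0e13888212d272b089214690983ff820d ∷
  0x9cc520820003233942621c4608ca320841f81a8 ∷
  0x8c481a54530440514293a48a12424418e53046ff820b ∷
  0x231246c694c1101a50b1a2190c0688270b0626298761082604ab4a909218860943ff826d ∷
  0x152c6431c09399631000250ca0c8d8a080461b0e1008e3610242a96c080a0c8d8a080461b0e1008e36102c084c160c4b4856609c441094849d45395243116328d213055ff826c ∷
  0x1525032980a41c41001480a0ca2a8480080540ca33886ff818b ∷
  0x2a58c863812732c620084c180461b0e1008e36102c5a8a74004b485660a90a11c4411127514e5490c458ca34851ff820c ∷
  0xb58a418a073506104031346e305ae088640382140583139a830820189637182d70443201c10a02c189ab0b5014a98d2980d28545395011b14a430e93a0cc224861207fc82ce ∷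
  0x2429d0908040c8d270a481394c448467f81ea ∷
  0x46278d0a5b0850004e19c2c1898a0b0e1514e54046b4a9093a0cc2248611c3fc82cd ∷
  0x2a49cc11808160c4908527418c118487f81aa ∷
  0x5483b04100c511b1416110112d2a430e92188c1183fc820d ∷
  0x16b0e6104070b0626082b4b0e610c3fc820d ∷
  0x80491a542190c0508240b0621032349c292104908d06394c430487f820a ∷
  0x4c1e0d6c418220310159d825846a320c608c33f826d ∷
  0x14a0e5004092a0a441429284e528041f816a ∷
  0x5494182200456180551ad82190c0608270986259cc41880b3850952c8502c814254b0880b084e000c4a3044711042418c430463f838a ∷
  0x274296c200e8530220314161cc51880c384e5508e21a90c2146c0903ff81cd ∷
  0x48552d8100c511b1416102b4a8a92188c0943ff820d ∷
  0x274296c2018a298220314161cc51880c384e5508e26048a428ac214660943ff81cd ∷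
  0x20128631446c5058742485030e149ce561082604ab4a909218860943ff826d ∷
  0x15b029214001606c20569395423888a424851b0290943ff81cd ∷
  0xb16a484406292431c0c5056c3a124030e15a52761142604a92188908c3ff81cd ∷
  0x805d1805a1b08100b83604260b06200b6300b4361020164601606c205810982c189690ad49218e0124e72a8471104552145490c428d21304eff826b ∷
  0x1525062900a4a0e2080462050638843f818a ∷
  0x954b604405308341c0c5054861d421a8ac2206c0903ff81cd ∷
  0x100c0361cc51880c38548395423888a2b0881946c0943ff81cd ∷
  0x183ce61040a0b0627882e63ce610dffc8270 ∷
  0xa928314805a9071040215c6252029514c7101450a4e72a48622845419033886ff83cb ∷
  0x46318d8d29822034a16294861d276898132d2b328a60907ff842e ∷
  0x100c83634432180d104e160c431446c5058742485030e152127395842098132d2b328a9218860983ff842d ∷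
  0x402e8d6c22422030815a52750882604a92188908c3ff81cd ∷
  0x2e6a0cb501ae31d2a00c661b9e461d0018c2379c2f2052178c43194601886f38462c8c6308de70bc813a1ae788061446f685a83bc41035e732d407b42f52506281ea0bce17882617c627302e485c60b9ac3a54010c5e1b5616294869545395013350c3a4eb320cc224861207fc848e ∷
  0x4853a121010a74844049c2921c4410ce548447f816a ∷
  0x221a06b31482081660a4862182349d632087ff81ac ∷
  0x100cc300b83604260b06200b6308d23610274296c0806288d8a0b0e8490a061c201606c205810982c189690ad49218e0124ea29caa11c4411948490c428d21304cff826b ∷
  0x80551ad82098e0608270986259cc51880b3850952c2202c213800311ca710946418a330483f838b ∷
  0x549418a40102d1806b1a8c111ca621c43418a330463f838a ∷
  0x152426290042a921101450a48622844111213044ff818b ∷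
  0x231b46d29829501a509c2c1898749d453948b4b089224260943ff820d ∷
  0x40370d8731462030e149d45394e222d2c224851a4260983ff820d ∷
  0xb581490a0634a44a80d284e160c431446c505456104b4a486230290943ff820d ∷
  0x201c0601bc6c20527514e53888b4a4862146c0a42609c3ff820d ∷
  0x5cd01c43035c3214e070c280b062694a36886c51ca7134070147ff022e ∷
  0x230b86c694c1101a50b1a2098e0688270b06261cc51880c3852739584310e2604cb4a908314660943ff826d ∷
  0x1525062900b520c52012a598a400073184691b0814256c0880c084c160c4b4856608857189480a545304405142950826381420902c1880288d2709ca921887124254190328cc1184a7f83ca ∷
  0x201d069214c11012409ca621c44124254190328cc1184a7f83ca ∷
  0x261d4601886f385ab629a8521e22b98e4ad2c3a4e6119ffc8490 ∷
  0x54b1a0e602cc5208205982a420c62182458d032087ff81ac ∷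
  0x80661ad81490a008ee36102c084c178c4b4a90939caa11c4411d24310a34849ff81ec ∷
  0x29418a31000360c472988819c44418a330463f8389 ∷
  0x9d0a5b0203a14c0880c50587508e21a90c0883ff81cd ∷
  0x807a1b0e620c4061c211a46c2054539542388822a9062146c0903ff81cd ∷
  0x260686c6a121101a80b1a2190c0688270b06261cc41880c38527610e2209812ad2a418890903ff826d ∷
  0x2c5a9211018a484c5031415a54550981224260883ff81cd ∷
  0x807d1807b1b021305831007c184691b08100f63604260b0625a42b52423200493a8a72a48a11c4411d48310a3484c1184cff826b ∷
  0x2d62d28380e168cc1a8dcf4242203d0173c432180f1054130c4e52506281ca0ad8d71d0071c2b635c4281c40ad8d704407042a000626a422521275148222d28318890901ff83ed ∷
  0x2d60468380e86b0220350161da2388681b02308c7ff81ee ∷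
  0x80801b1a2190c0688270b06261cc41880c385095b08503081490e22086b498881b0230943ff820d ∷
  0x2d62d28381cd5a507031ae4a0e0305c37c10908810405f010c86040415058313d49418a07a8241a46f3850973c8503c815b1cf0880f0852160c4e605c909457189ab0b1a8484406a02c68864301a209c2c1898a4a0c50314161cc41880c3854849d4561124388826050b4acc8318890943ff842d ∷
  0x100fa35b02941c0c39883101870a121610a06102c084c178c4b4a9093a8a92284711048311213047ff81ec ∷
  0x40418d8b4a0c50007f189690a9093acca2a48a11c4412106311213049ff83ec ∷
  0xa924304405086431c0a1048160c471104908d06490c430487f81aa ∷
  0xbdcd5a50030ac383d661040d73e06382060b5cf804408042c000627ac226a1611356b4acc61107fc826f ∷
  0x981a1b1a8304406a02c68864301a209c2c1898731062030e149d8438882604ab4a908318860943ff826d ∷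
  0x14a9660880021c611a46c2040408d810982c189690a4ea29ca922847110490a148599063110328cc11851ff826c ∷
  0x2a58c863800440d660a4ea29ca922847110490a148418c458d0328cc11851ff826c ∷
  0x54941cc5025073044041926224c1120c729c4330423f818a ∷
  0x2a4a0e62800350d480a4e8328a72a84711047490c428d21304aff826b ∷
  0x152507314001f86a4048552422028a14a8432180a1048178c4939883101270a0c72a48711045310a3484c1184a7f826a ∷
  0x52839822024e620c4049c28490c1101240a0c711049090c430447f816a ∷
  0x201a0653a121100c749062024e14902621c4410ce548447f816a ∷
  0x80491a542098e0508240b06200a2349c2921c4908d06394c118487f820a ∷
  0x52839822024e608c8049c28490a6081240a0c621c49090c118447f816a ∷
  0x2024060238690846160c483188711044394c118463f8189 ∷
  0x242a96c0818a4906203141611422086a2a48c08c3ff81cd ∷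
  0x8092180611b081520e5508e2208aa2a4881946c0943ff81cd ∷
  0x28398a310003c8d0609ca622067110a330443f8389 ∷
  0x4e80886402068111020a06140427e016a ∷
  0x404a8c6160c48184e540443e0189 ∷
  0x1525061040b520c20812a598410181a1b1a8308206a0270b06200a6361c284ad82081820982c189690acc152c221900b0858b520c50316a418a06216822d015156522ca16b1061040a5b1a6381a60a96c684406842900062620230606c284425202a29062081450902c18801b0d2709ca9120250910630847c826a ∷
  0x56a4a0e60292838c4049d47228e14894222841124e83244338c27981ab ∷
  0x108783007434a0e5088000c8601146249c2848864281220842a1886040d06080391a0210068311ca138c22098623082508c22983c7 ∷
  0x2941ca41806168c84c8d4638083028c13a12a1900a184c000c492844621462394e020061f0449 ∷
  0x100a83010a3490271104908d06394c430487f820a ∷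
  0x80801b443218e0688270b06261ce22086b498881b0230943ff820d ∷
  0x16b0860880d10c86381a209c2c188e2209811ad2c218860903ff820d ∷
  0xb58b490a073563214021c0632246e305c30bdcd5a50030ac383d632140d73e03202030b000189eb0bca63a5407942213561635092140d4058d298e9034a13858310c511b141190a361c202746c20548514e528ce2209813ad293acc83248622c660a03ff82cd ∷
  0x56a2982201ccb5248000c83634432240d104e160c4c524831018a0b0e8490a061c2c214c110184080931b02118be312d215982b524263804a424e72988a11c4411d454910328d21304cff842b ∷
  0x15248531c0027c6b514c1100e65a924000731805a1b08100f4361d092140c38402c0d840b0213058312d215982b524263804a405450a4e72988a11c44119064910328d21304cff842b ∷
  0x232806d29829501a509c2c1892a61cc50314152127514e522d2c3acc833089224260a03ff848d ∷
  0xa924298e0013e3428a60880a405450a4e831ca622847110474910328d21304aff842b ∷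
  0x1192035b08941c032886d29829501a509c2f1892a61cc50314161c2c204c178c4b4a9093a8a7295664192431121304dff848c ∷
  0x54908c850254520c405142950864301420a48519043311211846ff818b ∷
  0x40520c8160c492146410d063112118487f81aa ∷
  0x15a9032140952c642800438c6470d84080811b0213058312d2158c293a8a72a48519c4411d48418c440cc1184dff826c ∷
  0x202106020c60208602746c2040408d810807f189690acc1111431007e1a901215490880a2852a10c860284120583124e620c4049c272a48711044418c440ca3484c1184e7f842a ∷
  0x15a9273140c5a446281ac12485031a531d20694270b062190a361c232946a5b0e62808170ce0d0d8a4b8c500c9e18c70198a71ad4f718a07a82f385e409857189cc0b921718280b0626ad273140d585a8488c503501211c3694270b0626282c385840b04118ae312d214254b3140d62cc74006530c0430c4d5858d41cc503501634a63a40d284e160c431446c5046428d8708ca51989418ca3180761887218c9d1bce130ea319383194237a82f385e40bc4130d83139817242e6b0e950046244631f0662386f3846380cc470de70bc814858313981010c3135616a1223140d405a531d2a034a1385831102e19c1a1b149718a0193c318e031938383d4b3141182d2e682114a98d01878198651c949398a09282624c7238522f8c517862c0c5218c1ea6340230bc383830586084a98d041014a9f0298102854160c4f6b169401ed0bd4179c2f204c2b8c4e605c90b8c1405831102e19c1a1b149718a031363309e35b5cf3a0107b56940230598e8042263a540309a38a4313056160c5182cc7400a2c8cc258e290c4c158583141c182c2c6be08482080a82c189ed0bd4179c290b0627302e485c60a02c189ab0b509118a06a029531a5301a509c2c1898a0b0e16102315c625a42b3054b0886402c2128583129073082052028328a72a02449d2431122308afc84eb ∷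
  0x40118ce620c410000d1883d1a08111846190c3088c209881c8427 ∷
  0x200ec602a466204c228440c8427 ∷
  0x222a86a4a0e628044b8c64b0d8b31d09030e62906061c260b06230343635073140d404e160c4c398a4181870982c189690acc159021114625202950c85301430882a18906414882848040d270a928398a0108635a92820c0d62d04181ab514c703561634e84a80d384e070c4952d841818408840189680a9631040058c22514220a4630f8660f06b620e62818809c261888138d6709c00189460a881120c82910508841b8c4180c64a8c84d0c4b4844180c4540d8731483030e12134312d215982b20424c0c4225c6325865250652406d7196a480a510de74116c03ce1485e312d8e4a0e07302e485c60a02f188a3a8ca368de74116c03ce148583114a01bce822d8079c290b0625b1c941c0e605c90b8c128d83135616a02d62cc8480452446523c6214c6e484a470dc60a54c6b88028a23730221486e484a470dc60b88140583135616b166424026282c398a4181870982c188c0d0ca468ca460ca458c4338dea0bce84ad8079c290bc627316a41c0e605c90b8c12914313dcd598e083da820c0522470405f0190a604061110c313da173d4b31c0f505cf3a12b03ce148583114511b981290a3724252106520c652086218871484a408e26090721b5d08a5408a42520471306240947f18a0e0c16183dc64240228fc37b42953dc6381ea0b9e74256079c290b0627316941c0e604a3c0d03c8e0e0947818876190721946f1c52128e23898312050360c507060b0c1ee4ad801146a1bda110ce37a82f3a12b601e70a42c189cc5a907039817242e304a2b8c4d585a80b1a3214c068c270b062303437358b31c070646e605ae4acc703921289e3531ae31c021386f7350a5804e605c90b8c14058311454188531b92110a0371829531ae200e0c8dcc088521b92110a037182e2050160c4d585a809c2c1898a0b0e62906061c260b0625a42b3056408445189480a543214c050c220a8622010349c2210c6b52504181ac5a083014441b561381c31254b6106061022100625a02a58c410016308841f8c4210c6b52504181ac5a083014411b08c291850b561381c31254b6106061022100625a02a58c410016308841f8c48284483050408c261880138ce308c001880030527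 ∷
  0x88aa19d04188204102309862184834a0e3104021152341829410620812838c410090408c26188e308c001880028467 ∷
  0x21094602b0622882028466 ∷
  0x4e628c410001b1a0e51882041ca3104092a0a44142005869284463a04320102088e509cc518820104081988101461e8207 ∷
  0x440f0c40e8ce81882002061108ae18042188e508001b0248 ∷
  0x84af18cad1941e1941d1a54b314405982248d22224411082348d2222441520240386231d09190091846560c48284412ac620144160547 ∷
  0x42578c6568d49414620246911122088441a901201c3118e848c8048c232b0624142209563100b0194410146160547 ∷
  0xa92730820008a31244149ce330867983aa ∷
  0x842419cc520c4011563104b019861100a91988130820c8567 ∷
  0x88ae18815198e818820195631206111c2139421a8588 ∷
  0x4c520c41004ae184151a0e2190a0115e352503104042b062120611156311c4111881095a341cc3104012d068304e810c8502041101c3110a638440384212b06230c2218420585a6 ∷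
  0x88b51a0e629060196635a92520c022c86b4854b214c702c811854312864298e050c2b524a4180a558c424942409862410240006228cc321861000e338c2228c20705e7 ∷
  0xa5031040018583100e540c43f0189 ∷
  0x2a4a0e310021b0d480a543118a042545308012a0632dc6b30464d0c4a405450a86101303100b21a4e1424432140910465b0c43020683044588c40394e33086198648 ∷
  0x2941cc52000590d270a122190a0488232d862394e421c811810341827284e33084398649 ∷
  0x1296632172362d462880250d4222841217035a42b384c130c4a1854628849e06cb ∷
  0x4e62904100c00188c228885104c20904138147 ∷
  0x27314820804570c40a8cc740c410206111ca1115a34a0e4104022d06938509190a602461181c3114c740860408222b0623902531c22180e10886109041b85c7 ∷
  0x15a8a60880a59883101660ac6a11043514c43047ff81ac ∷
  0x1524e5188002f4601346b184a160c402f46012c6b184a160c4a40545098e950860508271104249ce5490c428d21304eff826b ∷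
  0x21068602346013c653a12110005f0d4940ca6009270a481484230b06201363009e329d09088002f8640b06249c292052108c2c189060a0611058311c44108e5310a330481f8268 ∷
  0x202f46a58c8638003c0c0328c04e8d84080931b02118be312d215982b1856a490c700802f0d480a4e72a84711045515243110328d21304eff842b ∷
  0x8c941807818c751809d1b08100e23604231b0625a42b3056a490c70080350d48080c01a8a15086431c0a1048160c49398a31012709ca711043419243110328d21304e7f842a ∷
  0x262ec6d620c11014b634c7034c148003131016082a420c608c0ff820d ∷
  0x131783018436086431c0c1044939c4410d48418c43048ff868c ∷
  0x808b180c01a8a15086431c0a1048178c49398a3101270a0c729c44111243110328d21304c7f842a ∷
  0x841a1808d1808c180c41a4814842022862525060880b520c11000440d66080c3189480a545304405142950864301420902c1880288d27080851a481014e3018234902908402b8c48305030882c18805f8ce509c44108c428cc118481f8688 ∷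
  0x5281882002507110a011ca140ce220863f0169 ∷
  0x2231469214c1101240988412423418e540ca3304a7f86ca ∷
  0xa0e5208201058311c41394c420861f8168 ∷
  0x40488c2640d0608091180c71808e1a42118583120c140c28398232004621c4410ce528cc118481f86c8 ∷
  0x152c6431c0658c4100166080c458c5ff01ac ∷
  0x442c8dc62a841038c13042d5b0eb320ca2b86a11cfff824f ∷
  0x118923634a60a40d284e160c450646c50587611811ad2a424e9224260983ff826d ∷
  0x84591a5662b44011983725031040e485c628c41038c10196370c280b0626ac2d28521304611b14b4b0eb320ca29cab1a0651b44a1307ff82ae ∷
  0x42660d8d40c4103501634a31040d285a2604611b14b4a90a2a0651a8471207ff828e ∷
  0x28398232002640d0609888188e528cc118483f8189 ∷
  0xb5842a900635031040d4058a695a2604612a90a2b0881907ff81ee ∷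
  0x101a03634a31040d2858a689811848a428ac220651947ff81ee ∷
  0x203446c688653012b315a2018cf1b928188207242032c6e185cd61d2a009ab0b4a1688270b06262981484c1184ab4a90c3a4eb320ca2b0881946a12c3ff824d ∷
  0x2b315a2081ab19127035615a4c1124eb334a922c6d1187ff81ee ∷
  0x1299e3635031040d40569689811848c5290b320c81947ff822e ∷
  0x58d10ca6000d31b4a15a4c1124eb3248b1946d1187ff81ee ∷
  0x80d1180d51b44162969604c1184aa424eb328ac2248b1a0651a47ff81ee ∷
  0x80d61b58b32120100d418459180d31b4a16882d62cc84804c50569604c11848a424eb320ca29cac2248b1a0651ac3ff822d ∷
  0x242f0642ec601ac6a3044729c42418a330463f864a ∷
  0xb1a2194c0694c14a80d285450946d124260907ff81ee ∷
  0x1192830146318ea300de361023360625a42b3056a490c70086648d480a4ea29ca711106490c428d21304cff872b ∷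
  0x56c214e800cda1b507104006a0203646d104e160c4c525062818a0b0e1521454004022d293a0c72b08921467124260a83ff878d ∷
  0x48628d662904102cc128583120c62182352127514e5208aff870b ∷
  0x29508653010951461000dc1a90151428318881a42609527394a350882184cff870b ∷
  0x2c5a4262800380c46e8d840b021521664194558d0332d2939ca9218851a4260a03ff874d ∷
  0x5ac5a4e5008de1a4bc18cc21bca60a5407942213561635092140d4058d29d2a034a138583114c81b141521875158422d293acc831ca922c681a4260a83ff878d ∷
  0x14a0e629009398a3081270a0c72a48622426098a318447f816a ∷
  0x2a4a06208060c8d480a545188205142a1242308d063950328c8ff820b ∷
  0x15a9073040b31d03201660a0c622c63521033047ff81ac ∷
  0x5662b44100ce21b8c5188207182032c6e184a2f8c4d5856949cc11848c3acc8334aa2a4851b44a1247ff824e ∷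
  0x15a8a4184072a9630816309461514e51847ff81ac ∷
  0x40720ca160c4518527514e51848ff81cb ∷
  0x42278c0728d450946149d0639542184aff820b ∷
  0x20164623986c204e50ad2a424ea2a4862146c0a03ff824d ∷
  0x844f19caa484605142939462418e550921184aff820b ∷
  0x56c08885008e81b0815a4e5129093ac651904c0983ff824d ∷
  0xb1662082001a2309d23688270b062019c309ce3688270b0626282c204a65b0220302130583120c608c235a54859945394c440ca3508e22097ff828c ∷
  0x2b524263808640d690a4eb30948419213049ff81ec ∷
  0x101d6309ca35982b5242638049398825210620921304aff81eb ∷
  0x2e6a0e6201c62a841038c1418c11350a2988a110fff820f ∷
  0x80ed1a02c189063044c5350a2988a1147ff822e ∷
  0x40768dcd61d2a0098a418c11b50c3a4ea2988a1187ff820e ∷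
  0x58d2a928000ef1b50162948418c1230e93b4aa2988a1187ff820e ∷
  0x1219e36b163104063246d5840778da80b1a2194c001e036942d104e160c46314603b86d404e160c4c50587094cb604406042c5a8a74004a420c608c245a52759945394c458ca35093ff878c ∷
  0x528398a4024e608c8049c2831ca921889094c118447f816a ∷
  0x243c8603bc6d4040780da509c2f1898a5a548418c12b0e93a8a72988a1183ff820d ∷
  0x2233c6951462081450a0ca12423091273950328c8ff81cb ∷
  0x152c6131c0832d42201660a9062090658d42208c1184dff81ac ∷
  0x549214c702d451a0e001ea358c2b52426380403b06a405450a4e7298834192440ca350882484c11852ff81eb ∷
  0x549208e6000f61a84120583124e7298834192440ca338882484c118527f81ea ∷
  0x804c1a8a4104005142832848014020150328ce22088ff818b ∷
  0x109f0352c6431c0c598e8481ac3a12a0350732d4001da328be3135616a0270bc626b14940c003b86d40482f8c4c505870982f1896941c4102d215982b184a178c4a424e83242608c26515243110328d42388eff822b ∷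
  0x29418a310002f8c4622062418a338863f8189 ∷
  0x283982320007d0d0609888188a3388c118483f8189 ∷
  0x223ec6951462081450a0ca12423090e54910328c8ff81cb ∷
  0x88941a54518820514293a0c92284908c263950328c6ff83cb ∷
  0x16b163104041446d5858d28c41034a1689811846c528a72ac651947ff822e ∷
  0x109c03514820800a284c74254201d0a104005202a1048178c493a0c729c480140201cc420847f81aa ∷
  0x162cc4104023a06c2040748d810982c1898b31041008e61b08101ce3604260b0625a427298225212759945490c458ca32093ff824c ∷
  0x1189034a8a41840a2848160c493a4851a424418e518467f820a ∷
  0x1020231032349c292146908d06394c418487f820a ∷
  0x549398a3028a410400514272a8450080449ca32086ff818b ∷
  0x85031ad4839880020035982b184a160c4831ca608c245212751524310a3208eff824b ∷
  0x1524e628c09514620814509caa124230912728c4ff818b ∷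
  0x15248531c0a290683800760d480a8a120583124e729885191064910320921304c7f81ea ∷
  0x203c868490a6081240a0c729889090c118447f816a ∷
  0x15248531c0a29041001450a4e72988a11402019242084ff818b ∷
  0x445e0c45d8c64c8d2520820024a131d0910c09104a000c48204451940200cc420840f8608 ∷
  0x8c94180a318c751806e180a11b0e161023360625a42b3056a490c70086648d480a4ea29ca34192431121304aff872b ∷
  0x810a1a54531c405142939caa10d06490c438921304cff872b ∷
  0x2233c6142c601dc6b184a160c403706a405450a0c62182349ce540ca3508e2208eff874b ∷
  0x4c628d0d104c5035014a98d2980d28548419451b14b4b0e93b4460987ff874e ∷
  0x4c628da838885035014a98d2980d2840868da209c2c18948419453948c52d2c3a4e71104609c3ff874d ∷
  0x11a143434413140d405a531d2a034a16294841945394ab4b0e93b0892344609c7ff878e ∷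
  0x1121435b0e84840c3856949d811a90b320cb1a0690983ff876d ∷
  0x10a203021e3688270b0626294841945394ab4b0e93b0892284609c3ff878d ∷
  0x44368d6c214e80254b61cc001fc308e03214a30a2230a1c36ac2d405a50b441321231314161c2c2058110ca603021305831256311cc05a42b31482081660a4e83188608c25521453956340ca3508e22093ff87ac ∷
  0x8d0a1b507110a06a02d298e9501a50810f1b441385831010e1b14152106514e522d2c3a4ec22487110460a03ff878d ∷
  0x2a4a0642800530c0618c4a4052a29062028a14a8432180a1048160c42320693840428d2409ca519c4412425418c440cc1184a7f868a ∷
  0x8907180771ac61285e3129093a0c62182540ca32086ff81cb ∷
  0x1117831176319323494c110c09284c74244302441280031208111463088c430440f8608 ∷
  0x204286731542181450a4e72946711106490c450921304cff872b ∷
  0x14a843298014286b3146208166085171ac6128583100dc1a90151428318881982309527394a3508e2208cff874b ∷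
  0x2941822181090888501d0908860198a3514c110c0a2842470d420902c189270a481484272a06519c43095063108230487f86ea ∷
  0xa928190a0123233178301843317634a1822140c40460c0d850b041109480a545304405142950886381420902c1884640d2709ca92146712425418c440c82304a7f872a ∷
  0x2a49482080a130c491052520844f834a ∷
  0x88bc188bb18c991811b1a4a131d0910c09104a000c4820445184c420840f8608 ∷
  0xad4520820285831284149d452086ff81cb ∷
  0x1198a3023a3514272a84249d06490c4208aff86eb ∷
  0x811e1848e1a8412058311ca81946349d06490c4208a7f86ea ∷
  0x5073104102506208203a1241040047c6938524094c8484404842247062418272a06519c46094c420843f86e9 ∷
  0x465e0c65d8c84c8d4629041028c130003124a111886088e520841f8629 ∷
  0x42528c2850d662904102cc128583100dc1a90151428318851982449ce5508e2208aff874b ∷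
  0x98e8490600a28302443508234706249c283188819466094e5490e220887f874a ∷
  0xad49398a062d21314001c0624886c205810951c18969089231acc128583129073106052028328a72a06449d2431121304aff878b ∷
  0x20490604746a284c74a8430284112423120c72a06711127490c420921304c7f878a ∷
  0x28394820800908c4621c4608ce520841f8628 ∷
  0x213fc634986a4052a28c41028a14a843298013fc614946a405450a84109143124e8324881a42608c27394a338867f87aa ∷
  0x1024e31a40352cc710c0b3044470d630942c1886640d480a54518820514204606a10468e0c49384c7424830051a1a54518820514204606a10468b0c49385240a0c62206909823098e528ce220887f87aa ∷
  0x46598d0929061024a1204c3120851a02318422785c9 ∷
  0x465a8c2948c08d8d25098e84886048825000621188120820f8608 ∷
  0x1298e848409398a3101270a0c729c46090a348447f816a ∷
  0x2429d0908045f8d270a486209063950348487f82aa ∷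
  0x224b06b31482081660a0c6218235212751563208bff82ec ∷
  0x850118cbf1a901023a3514272988a10d27419242088ff82cb ∷
  0x214b8604b46b184a160c4831ca62182452127514a3208aff82eb ∷
  0x40828d49398a3005061812f1a9015142a10468b0c4831ca62242608c2649d2428ce2208a7f866a ∷
  0x14a8432140951483081450a48519049091421844ff818b ∷
  0x2a490a638008a8c4318c4988d840982c1884288d690851d1acc110da35b08531c0952d87301ac398a3008eb185131b50169426470626282c385840982c1896941cc502d21598a41040b3056309116189480a8a1205e3124e831ca6218254910328ce2208a7f87aa ∷
  0x220686b525073018b4a0e600d081908e1b4a1385831092f1b14161c272f0672ec6e6a5073016c6b8e8038e15000313521203036982212d214254b314024c06b48566080ca1ac61285e3108fa1a9015a9283980c5a5073008488c4978d8a0b0e118be312d2112643126035a42b3040650d630942f189483988302901514234a862125030194358c250b06219903520223f46425062454641d4624486d28486c0c4c505870b08162d453a002219235a4223f0643ec624546418c6d718e95016c6b92801914198a518d131bd4179c28424627302e485c60a02c1888288dab0b509514c06a0224486d28482f8c4c505870b08162d453a00211e83121836102c5a8a74004b48566080ca1ac612858312907310605202a2846848c493852408c2c18840d0c64a0d6a4a0e5009051b16941ca01a10319ec3694270b062120836282c3858408cd8189690acc10194358c2b52486380430646a40467d8c6838d6c214e8008f918d031b58a4a0c0220c36ad4920c0d585a80b4a120be31314161c2c204c178c424146c5a50728067b8c4820d8a0b0e16102317c625a42b3040650d630ad49218e010ccf1b16a29060299236282b61d09201870ad8429d00520ec20c0533c6e6a0c4181ae32d49039283b16011a837b9283940238c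6f385e40bdcd42960139817242e304e86b86403861405831356a490606ac2d405ac599090098a0b0e1610260b062298a35b0e520c0c384a628d483b083011021b507290606a02413c624006d405a509c2c1898a0b0e1610260b0625a42b3040650d630ad49218e012901514240b0622090319fe3629283140c5046450c4d62d27281cd59883010dd1b8c152dae1900e18525e0c6610de53212a018181bd017942213561635092140d4058d29d2a034a138583114c81b1415b0e520c0c3856c214e800cda1b507290606a023368663ec623cc623f8623546f204c2f8c4e605c909d0d70c8070c2e6b0e9500423c46d585a80b4a13858313149418a06282c3858408cd8189690acc10194358c250b06218323520223f4642506c5a92830083a0da839483035016b1494180e6a0c418087b0dc609d0d70c8070c280b06211d436ac2d405a5090d81898a0b0e16102c5a8a7400440646b48447e0d6c214e8008f918cf81b58a4a0c021ee311d436ac2d405a50905f1898a0b0e16102c5a8a7400423d06433c662506328c661d4631b8623b86f505e7098d8189cc0b921735874a802319236ac2c6a12a281a80b1a532120735065a80d718e95004798c8710dcf3948303ce111aa37902617c627302e485c609d0d70c8070c2e6b0e9500423c46d585a80b4a138583118c51b507290606a0263146e6a0cb50046b0dee6954b0088760dcc0b8c13a1ae1900e1850160c423a86d585a80b4a1385831314161c2c2058b514e8009690acc10194358c250b0625a90620c023846313c6a41d84180a678dcd41883035c63a54011a237b92762c0238c6f385e40bdcd42960108d418c5919ccf1b50779060398e3820e520c104044658e050a82c189ed0bd4179c2f205ee6a14b009cc0b92171827435c3201c30a02c189ab52483035616a02d62cc84804c505870b08130583108e118c4f1a90761060209233890339c0382d4520c10586084918d0410119b238142a0bc627b58b4a00f684c450c4337c6e7a8a4181ea08cdb1bce118e0319b6379c2f204c6c0c4e605c90b8c16b86429c0e1850160c460646d585a83948303501209e37350620c0235c6e304e86b8640386140583139a831060289e311a43119c3119a3790290b0627302e485c609d0d70c8070c280b0626ac2d405a509c2c1898a0b0e1610260b0625a42b3040650d630942c189480a8a120583124e1490230b062418202dc681844160c45184e531041f07e8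 ∷
  0x1298e81880640c410010609ca519c4340c23f0149 ∷
  0x8060188e51b0e1520e55086b4a4ea2b0881946c09c3ff820d ∷
  0x1734a4104080b0626882c534a410c7ff822e ∷
  0x2b520e208088e0c493a842521063886ff868b ∷
  0xa92838820026e3520293a84908d063884ff868b ∷
  0x204e06950864301420902c1884640d270a48412423418c438867f868a ∷
  0x429c8c08e8d450946a10927395032088ff86ab ∷
  0x234e8604d86d285066884c5290b31ca41147ff870e ∷
  0x204ec61164614d46d285a20991c18969419631b14a42cca29ca9218841203ff870d ∷
  0x40680d8d2a843034a1628a368981184aa428ac2206a1147ff81ee ∷
  0x27314820800930ce5098871182320821f8628 ∷
  0x489f0d4b31c4302cc152c6431c0952cc71004928d690acc158c244a862026e352029514c7101450a542190c0508240b0621190349c272a48410d063110338887f87ca ∷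
  0x204e8614fc662a9281808628c49c0c6278c09e8c2490c2300c0778da80b4a1688264a862027836282c38584094cb60440604260b0622996940c0b48566090c5194cb188205982b184a160c4a405450a8411a383120c519823091273952431103208c7f87ea ∷
  0x549398a3010aa1040051427290450080449ca35086ff818b ∷
  0x813d18492184601a90d610c06a02d285a20992a1898a5a50658ca3604613a90b328ac224862206a1203ff86cd ∷
  0x804c1a54531c405142950864301420902f18827d0d270a0c72a48412002018c440ca338887f81aa ∷
  0x224f868490c1101240893e1a5073146002483425451880a41cc4181480a8a102823508224846249c29205210892a18820c8d0609ca81904500805310a330463f8789 ∷
  0x429c8c0728d450946a10927395031848ff86ab ∷
  0xad483988012703028431a8a3026c369421248614d46d285a20991c1898a0b0812996c0880c084c160c4532d28181690acc10a82358c283146608c2452145490c440d42208fff870c ∷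
  0x52a10ca6010aa10400514241140200ca35084ff818b ∷
  0x201b46051c6a1048160c4921884114020150628d2130487f81aa ∷
  0xa9281882008a235202a1242308d2740ce22088ff81cb ∷
  0x8120194c740c402990310408305030882c1880640ce50946711823090c420841f86e8 ∷
  0x204e8604886a10468e0c48318851982449ce540ce2208a7f874a ∷
  0x1318a36a0e20800d4040868da209c2c1894841945400402b14b4b0e939c460983ff874d ∷
  0x8d0a1b507104006a02043c6d104e160c405306c505484194539500100cb4b0e93b08921c4609c3ff878d ∷
  0x2940c8530149208e6004a41942f18847d0d48098aa4a060127035b0853a00952d8730088a0c8528c2a68da80b4a1323831314161c2c204c160c4b4a062081690acc740c80598221b46b610a74012a5b0e601114190a5185111854c1b5616a02d284c8e0c4c505870b081305831256311cc05a42532c62081660ac6110be3129015142a1046950c4052c69385240a0c62146909823098e540ce220887f87aa ∷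
  0x11a943023a351428324862284449ce52086ff874b ∷
  0x56c088e800c851b0e1514e56106b4a4e921c4c0943ff820d ∷
  0x211b4601dc6b184a160c4a41cc5201480a8a41a0e02a7c3211a36948341c043106d405a50992a188a940dae31d0a038c140583118c81b561210a36a0204d86d2842a80da520d07010c11b5016942d104c8e0c4c505870982c18885f8d690acc740c80598204b46b184a160c4a405450a0c7298851982549d03508e2208aff884b ∷
  0x81271851918d1c189270a1241882049028484432812108c2c1882640d06098881904608c25394a338863f87a9 ∷
  0x10aa43010a3490272946711049095063110330487f87ca ∷
  0x528190a602924298e05148341c024e06b610a63812a5b0e601153181361b4a10aa034a0ec694015346d405a50b441323831314161c2c204c160c4b4a0e6281690acc740c80598273154b180a658c4102cc158c24458625202a2848178c40524605446a10468b0c49385240a0c7298851a42608c2740ce220867f884a ∷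
  0x1127c309c0312a830194358c250bc623a14520c0a405450852b1a841205e312d49398a0129e31244361025470625a42248c6b304a160c4a41cc4181480894e180ca1ac612858311d0a290605202a2844908c49385240892a1884a50c89f0c6480d6c2250700ca218d471b4a1385e31254c398a06282c385840982f18863a8c6a40c6500c6a38da509c2c1892a61cc50314161c2c2048908c4b485660912a1886648d4808cfb18d071ad844a0e061cc55240251866458626282c385840982f1884a48c6a40d87315490094619c2c1898a0b0e16102317c625a42b3040650d630912a188e85148302901514240b062198a31a8831a8635b0e92140c3846a18d0762d4500c4c19138189421893c1b98171827435c3201c30a02c188e86ad45035616a0235046d28482f8c4c505870b0812a543109401ad21598203286b184a160c47428a4181480a8a120583124e14902247062418204d0681844160c404cc6728424a0c2480d2a11cc5004a2180ca1ac61285e311d0a290605202a285420902f18823a8c2368c0650d630942c1882500d6a298e801963104005982b184a160c47428a4181480a8a1508211b06249c2920528388850082648d06080c61a06110583104c5180b71a0611058311ca138825184c420841f0888 ∷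
  0x425e0c25d8c44c8d2820c4100cb3188b919cc54882021603498221170349c29285220902618904094c740440404240006238c22208611146178687 ∷
  0x8145180e61a841205831146149d0639503184a7f86aa ∷
  0x94e84844002ae349c2519c42418e540d21184a7f86aa ∷
  0x1028a331d2a10c0a10468e0c483146710d273950318487f86aa ∷
  0x94e84844002b2349c283146710ce540d2118487f86aa ∷
  0x2b514e2080a160c4a10527514e53888ff81cb ∷
  0x58b31c410095b1b0e1611813046b4a4eb324871143ff820d ∷
  0x42ae0da522422034a131d8d10c0d104e22084c5290c3a8a92206909c7ff822e ∷
  0x2552d811000ae8ce160c4c50542388821ad2a430ea2a4881b0290a03ff822d ∷
  0x27314620802a50cc740c41008c5180e11844f1a0c5508200a8035202a285420902c188c749062024e149020238690846160c48305030851c188e5098871104608c2528c21f8808 ∷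
  0x42af8ca63a06200153185521810a1a8a41a0e0017a3199e31214361cc55240057466470626282c384c160c4331c602746c204a628c0af0d870b0213058312d215982b18488e0c4a40545081171a8412058310cc51a8a41a0e009c23109e349ccb188024e8602746c20449d0c6278c0af0d870b081604260b0625a42b305630942c189480a8a131d2a10c0a1048160c49385240a42112383120c140c220b06241ca41880023460568690846160c4026c60560690846160c48305030882c188e50946711043310c118461f8828 ∷
  0x9cc520c4001223011e3490a6088092040470d2108c2c1890608956188e50988519c44110c118441f86c8 ∷
  0x4aa4a062000e41911c189480a4e51a8434194539503184aff868b ∷
  0x4a44a0e2014893882049c272904908d2438847f816a ∷
  0xa928398a05a907104055586252029514c7101450a542190c0508240bc6209f4349c2831ca9210443110338867f872a ∷
  0x102c8302c634902831ca4124243110338867f872a ∷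
  0x40ae0c8c5a841000fe1a48c68820688270b0626282c204a65b02203021209213046122d293acca29ca922c651a8471283ff822d ∷
  0x896118554198e84a84001c430aa2358c25558625202a1048178c463a483101270a481185e3120c7298871104540ca330463f8869 ∷
  0x102be3214c710400548603f4634f86259c64580635386c20c4a4806a58d8a0b081305831212b314805a42b304aab0c4a405450a8411a543108c91a4e149062398003d06233c6142c614286b314894000b30ca8e0c4b485660ac6128583108c7190c51acc52250002cc33058312d215982b184a160c4a405450a8411a383124e149029088653012108c2c1884628d24188e6000e11844f1a0c5508200a743109e362cc52240035c6c204a65b02203021305831015c18c4f180d2180fe180cd1b441385831314161c2c204a65b022030213058312d215982b184a160c4a405450a84120583124e149025321211012108c2c189060a0610a38311ca1388210b062310823046121461f88a7 ∷
  0x85681a0e520c401a7c30ac63514204c46a1046950c42064693842b28d42190c7028411a543101591a4e149020568690846160c40408613f46a58c85381630912a18860c8d48081621a8a15086431c0a1048160c4055c6938524081581a42118583120c140c220b0623942519c4410cc418441f88c8 ∷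
  0xa0e6290604a0c520c0a490a63804b28c4b20ccb1882002cc158c244a8620ab235202a2848160c43510615886b3044278ccb1882002cc158c250b0620aae3520240b06249c292046ab0c4830409a0d030882f1882b48c05b8d0308956188e508561180c61a061105e310560180b71a06112ac311ca1388262146220821f08e8 ∷
  0x212d4602ac6220820305c6 ∷
  0x85681813319ca141c432140940c410004950c4640c41001060a061105831013319ca1388215586228c8211881f08c7 ∷
  0x4e6290620056c19ca1096c311465110a208408198810ad631056a190b51a0e628c4039505220a1118e810c80408220aaa31978319763213235a8c51880a1a844508260986251827425432014309800189250884728425b0c415a8642d4624a4602e86a304e84a864028613000310841554632f0632ec64264602e86a304e84a8640286130003124a1108e5084b6188a208408198810162311461004c3100001880000904 ∷
  0x20078615ac62015c3002a339822190012bc632b4642a0e2080cb68c48284471048b68c460844518400689c6 ∷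
  0x42b70c2568ca618820018611096d18800109e5 ∷
  0x102dc30ade31056d1880008a04 ∷
  0x856819ca4188203942519c4410c2431021f88c8 ∷
  0x8571180b71a0612ae03118851904339421f0aa8 ∷
  0x27314831000b90ce50a0e2190a04a062080065c06240c255c06202e43394271048b80c405b0662046b80c40020651844b80c405a8645c06202aa322e03118811ae03100081946112e031104102de31016d1880000ac3 ∷
  0x1099831a3a36a0204d86d285a20b14b4a90a29caa11c441207ff828e ∷
  0x286948f081af3996303da16ac2d43ceb334af22c6f09dfff8230 ∷
  0x1119e3023a3514283284249ce540ca3208aff81cb ∷
  0x8d76181361b4a15a5a21314a42cc831ca41187ff822e ∷
  0x1209e3434a41040d405a20ad2a434a41107ff826e ∷
  0x2b514820812b98c4a105452084ff8beb ∷
  0x2a484472800bc8d450a4ea108e5388824848ff8beb ∷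
  0x8d7a181781b4a1629a212d2a428a72b0841187ff8c4e ∷
  0x10214302f235142939caa10d06490c420921304cff8beb ∷
  0x109be31af236a0204d86d2842380d8d299090117c1b8c7129607182c5cc626ad493980d585a80b4a16882b5cc625a5661314a430e93a0ca29cac2248a11c441303ff8c6d ∷
  0x857618ccf181101890b1a145230201aec3299e322143395ae4840e4858b98c4b69489081ab0b5016942b5cc626282c205810a97318969088e502d215982b1852b98c493854841945395243110328ce24854ff8c4b ∷
  0x8d7a194fb1a1a5208206a02d2858a5a5a21a90c3acc8328a72b0841207ff8c4e ∷
  0x11ac2302f23514293a0c72a844490c42086ff8beb ∷
  0x17350952c072b5c9081c90b1731896d29121035615a54849c6d434a72a4890947ff8c4e ∷
  0x1220e36b0e84a8006046d405a50ad731898a5a54849c8c3a8a72a4890943ff8c4d ∷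
  0x205d8604306a1050b98c483188608d273950328ce2208c7f8bca ∷
  0xad493946001bc352e6312d210af235982a58ca7401630a5731886640d480a0ca2a06349ce5490c428d21304eff8c0b ∷
  0x10308302f23514283206a10d2739524310a3209213050ff8c0b ∷
  0x205e869508653008b08c4990d69088e502d21598295cc62520e620c0a405450a84142e63124e83206339524310a338882484e7f8bea ∷
  0x20164685148c0806ab8d8a0b0814182b4a90b328a92188c09c3ff870d ∷
  0x5cd41cc1005361b8c1419c31356d41466090fff824f ∷
  0xada83bc8013103815ac0a410285cb98c4f685480b56f5350f3b4a72bc881b0290a9fff8c90 ∷
  0x5a83996a001881b9a839880530e670c024ec654e86613c606246f505e70bc816ae63139817182e1858b98c4d585484184c5350c3a4eb334a7298881946c0a4260b47ff8c8e ∷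
  0x46880ca858ca850c0c48dea0bce17902d5cc627318a5206d5b92b4b50c3b8cb334a72b0881b0290b4fff8c8f ∷
  0x1598a44a00b48447281690a4e831883598e5490e2484bff81ac ∷
  0x24584606306b3052b98c4a424e831884514e5490e2484aff8beb ∷
  0x46b48c0bc8d450a0c72a84349cc42086ff8beb ∷
  0x2a490a63800bc8d450a4e72988a111242084ff8beb ∷
  0x2063c603d86a1050b98c4939ca620d064910328c82484c118507f8bea ∷
  0x224f86941cc51800c70c6b48c2c80d4839883029015142a1050b98c493852409d7318820c8d0609ca8188c428ce220883f8c09 ∷
  0x91691818c1acc14ae63124e831883520e5490e2484aff8beb ∷
  0x408a8c0c90d480a1731880c18d270a0c6218233952440ca338882484e7f8bea ∷
  0x102f83021430b2635142a1050b98c49398a31012709ca710906490c440ca32092130507f8c0a ∷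
  0x234f8605e46a28469f0c2c30c2c28c2c20c4ca0d660ac614ae63129015142a1050b98c42064693844c88c0bc8d450844f18cfb195611b587425400b04319c433ae230b0237242e3058b98c4d585a80ad731898a10d060314161c2a5cc62131c32ad2319ee3628434180c505870b08152e6312d21598295cc620aec3199e3121631214302fe329f631b1a319c433ad230b1437242e3058b98c4d585a80b4415ae631017718d76194cf1910b1910a1b9283b1607b9283940733c6162c6d79ccb181ed0bd4179c2d5cc627302e485c60b173188a638ce628c2c50dc90b8c162e63135616a02d285a20ad731898a0b0e16102a5cc62123c3298a302f631af434acc5688033b06d585a50b4415ae6310174185871b4415ae631314161c2c2054b98c4b485660ac614ae63129015142a1050b98c414e0644f862618626146b610a74006be0c6850d0d2904103501694235f069598ad1008c18dab0b4a16882b5cc62629283140c505870b08152e6312d215982b1852b98c430646a4040bc8d450844f1857a1884f190fb19961185821b563224e06ac2d4056b98c4c508683018a0b0e152e631057e1ad215982b1852b98c424e0654f8635e86c694c84808c00dc63894b038c162e631356a49cc06ac2d405a50ad731880be8d8a0b0e16102a5cc62203235a4215e46b3044278c4bd0c6278c0bf8c6bd0ca7d8ca838ceb08cc838dee4a96c041ea1358083d456b00741c615d470406050c04172e63135e732c607b42f505e70b573189cc21548039817242e3058b98c4d58c89381ab0b5016942d1056b98c425f86c505870b08152e6310d38181781b4a11a703327c34acc5688015f46d585a80b4a16882b5cc6228323628225e46c3846278c0bd8d8d10ca60104f1a5662b44022ec3319e31a2032a1635b507790035dc641647042844602080c0a17c04329804164615d470406050c04172e6313da179c2f205ab98c4e610aa401cc0b9217182c5cc626ac2d405a50b4415ae6310174184591904f1a5662b4400ae8310b23289e3530e670c025d0631646b6a0ef2006ba0c82c8d8e4a205011741c4ce689408982f5cc6283830406050b973189ed0bce17902d5cc627302e485c60b86162e63135616a02d285a20ad731898a0b0e16102a5cc625a42b305630a573189480a8a1508285cc6249c29204eb98c40418e53110328ce2208e3f8ca9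 ∷
  0x817b184e91b4415ae6310d571b1414182b4a90b328a72b086214641243ff8c4d ∷
  0x42810c0bc8d450988a10927418e52088ff8beb ∷
  0x205e86113c62594603d46b1852b98c403b06a405450a84142e63124e6209063952438882484c118507f8bea ∷
  0x1298a361cc55240d61cc518009b0da50b58731460209e34acc5688014ec644e86513c6a61cce180cca8dcc0b9217182e1858b98c4d585a80b4a16882b5cc626282c3854b98c4939ca25a54859906514a3208fff8d6c ∷
  0x1735073040e32d42201c60b173189063104d42cca110460947ff8c4e ∷
  0x46850c0cd0da80ad731898a521063108b4b0e93accc2248a110460a43ff8c4d ∷
  0x111f63031a3032435202a2850b98c493a0c620ce54910328ce2484c7f8bea ∷
  0x46b88c0bc8d450a0c72988a111272084ff8beb ∷
  0x1133a32ae231a0c31a5c3026c36942161c6d1056b98c4c505870b08152e63129093a0c35a566514e5490c4208fff8c2c ∷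
  0x122e23598a44a001388634b06d61cc51808278c0cd0da80b4a15ae63130e16102a5cc625a42b3052b98c493a0c7298845212428d4238882304eff8c4b ∷
  0x162cc74240c398aa4804710ccb88da83996a02da5224206ac2d405a50ad731898a0b0e152e6312d2a424e831ca55994549103484bff8c2c ∷
  0x1525062080153c613746b1852b98c4a4040bc8d450a542218e0508285cc621190349c272a48710d06310a320887f8bea ∷
  0xa0e628c2001f4341827298881982428ce218463f8189 ∷
  0x224f862688605e46a2852a10ca601161189321819e1ad21598295cc62520e620c0a405450a84142e63105a1181791a8a14a843298016506a285420a173189270a4813ae63104191a0c10b22311f6302f23514223ec645846341c6c598e84802d00c4cf8d8a0b0e16102a5cc62033c35a42b3052b98c41638645a462640624b8606586c2054b98c4b485660ac614ae63129015142a1050b98c405d86233c6142c6142862670625d86433c634286d41ccb501cd41cc4018cf1899b1b1c62a8407302e485c60b173189ab0b5015ae63105991b14161c2c2054b98c4b485660ac614ae631051e190c51899818997181961b08152e6312d215982b1852b98c4a405450a84142e63124e1490275cc62032a341828184cb98c40394c428ce2208a1f8d88 ∷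
  0x817a180e81a84142e63124e518906394e220921184c7f8bea ∷
  0x489f0c6b38cab48c8a70dac3a12a021a5208206a02d2848a70d2b315a20114b1b5616942d1056b98c49530e62818a0b0e152e6312d21598295cc6219923520293a8a728d06490c42088ff8c2b ∷
  0x1034a302f235142939caa10d06490c42088ff8c2b ∷
  0x40970c2d20c2ab8d480a84142e6311ca6209274192440ca3208c7f8c0a ∷
  0x44b88c0830c0970c2960d4520d07005571a9015142a1050b98c493852409ca6214634190320921304a7f8bca ∷
  0x819d185a81a84142e63120c72988349d2428ce2208a7f8bea ∷
  0x56a298e8001a0195711b0e62a92011c4322583033436a02d2856b98c4c505870a973189690acc14ae63129093a0c7298855152440d4220921304eff8c4b ∷
  0x853e185a218d6118532185a91a901514285cc6249cc5188093852409d731880d08c0d30c0d28c2c98d450a84142e63124e628c4049c29204eb98c48305030997318800c8ce508191184fb1850718d61189071ad4531d000b5430b3e35a42b305630a5731882d48d480a8a1508285cc62031c31ad230b2030b4e35202a285420a173189270a4813ae63104cf181a61a542194c00b3830aec3199e312163121431b3836b0e628c0533c6166c67314616686e4858b98c4d585a80b4a15ae631314161c2c2054b98c406646b485660ac614ae63129015142a1050b98c4047863314616606165c6213c626906468c6b485660ac614ae63129015142a1050b98c493852409d73189060a06132e63101a319ca1388255cc620188519043f8e07 ∷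
  0x856419caa48460514285cc620a7e301ca3514285cc6249c28314623952440d21184a7f8bca ∷
  0x14a0613140013c606b0692052109d731884d58d0609461394c440cc1184a3f8e49 ∷
  0x27104052002d58ce509042008c428ce228081f8e28 ∷
  0x1018a3035c3388255cc6220840118851982309405f8e27 ∷
  0x1119e302b63514283284249ce540ca3388aff81cb ∷
  0x40d30c0d28c2ce0c6678c4d30c4d28c6ce0c6d80da552423034a15ae631314161c2c2054b98c456bc6b485660a573189480a8a1508285cc621b5e349c2729462419243110320921184e7f8eca ∷
  0x2b514830804960c6d68d660ac614ae63120c51894849d45490c4184cff8eab ∷
  0x8d611a8a41a0e05a8a4184026a06b1852b98c4a405450a1731886b48d4520d07001b21a901514285cc6249c2831ca518d243110318487f8eaa ∷
  0x8164181b31a4813ae63120c729464110c440ce218483f8ea9 ∷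
  0x2940c853002da0c0a58d270a4813ae63120c621466090e540ce220883f8ec9 ∷
  0x46b48c4da8c0d90d480a8a142e63120c72a06519127490c418487f8f0a ∷
  0x44a50c0d30c2470d420a17318808f8d270a4813ae6311ca819463418c420863f8c29 ∷
  0x81801852b1a84142e63124e831ca819c45490c420867f8bea ∷
  0x2063c6a490a63802d60d450a84142e63124e7298834192420867f8bea ∷
  0x44b48c0dc8c0d38d270a4813ae6311ca62090640ca320883f8c09 ∷
  0x11ae235148341c00388624b0646b86b305630a573189480a8a142e63120c729885191274910330487f8eaa ∷
  0x5073148300971181b91812e1848e1a84142e63124e1490275cc6241827298881946420823f8be9 ∷
  0x429f0d0731482001ba1a0c140c265cc6200323394216f0663a1241800d48d270a4813ae63100fa1a0c112c230a0e35248531c0241c6b514c74002d50c4dd8d690acc158c295cc620b7635202a285420a1731880d48d270a4813ae63101ba1a0c140c265cc621a7c30b7030b6c35202a2850b98c416dc69384c7424830051a181791a8a14a843298016c46a285420a173189270a4813ae63104c81a0c11a7c312ce30b6c35202a2850b98c423246938447d8c2d98d450a1731880bb0c4678c2d88d450a84142e63124e1490275cc62118a30b5a3490275cc6241828184cb98c47284e2095731880d58cc409173188051904278f26 ∷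
  0x9c4101480137a33942410802310e228061f8f68 ∷
  0x112e2303723237a349c29204eb98c472988518d0620843f8fa9 ∷
  0x42b48c0da8c6de8d060a06132e631188519823394e220861f8f88 ∷
  0x449f0c2b38c4e00d270a4813ae63104c91a0c109f631ac235148341c026fc6a405450a1731886b48c6df0d450a173189270a4813ae63104cf181a6181a51859c18ccf189a6189a518d9c18db0181361b4a11b603299e3234c3234a32b3832b603399e30b163537a37b42f505e70b573189cc0b9217182c5cc62437a36ac2d405a50b4415ae631314161c2c2054b98c466f46b485660a573189480a8a1508285cc62237a349c29204eb98c4830503099731884de8ce509461310e220861f9068 ∷
  0x449f0c0dc0c4e00d270a4813ae63101b71a0c1298e81880a4a0642804db8d48081791a8a14a84431c0a1050b98c446f4693844e08d2409d73189060a06132e63109bd19ca103823388255cc6228c2621042f90a7 ∷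
  0x40b88c0df0ce209573188a3208611008621402f8f67 ∷
  0x9cc110c8041c4321408188262804e18d060a06132e63105c319ca1388255cc62310a32086121821f8fa7 ∷
  0x10378313883037e341828184cb98c415a46940c853002da0c6e10d270a4813ae6310dbd1a0c140c265cc62394255cc6203843310245cc62037a328c235cc620104139105 ∷
  0x1398a418803714672842e20c6e28ce509c412ae63109c51988122e63105c5194611ae63101c51904112e63105731880b98c4001162 ∷
  []

-- A pattern without turns and chords matches every chain of that length, so its refutation bounds
-- all weak chains. The certificate ends with such a pattern.
unconditional : ℕ → Pattern → Bool
unconditional k (mkPattern n [] [] []) = n ≡ᵇ k
unconditional k _ = false

hasUnconditional : ℕ → List (Pattern × Tree) → Bool
hasUnconditional k [] = false
hasUnconditional k ((p , _) ∷ ps) = unconditional k p ∨ hasUnconditional k ps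

use-unconditional : ∀ k ls → All (λ l → Refuted (proj₁ l)) ls → hasUnconditional k ls ≡ true →
  ∀ {r c M} → WeakChain r c M → ¬ P6In r → k ≤ M → ⊥
use-unconditional k ((p , t) ∷ ls) (a ∷ as) h ch np le with ∨-e {unconditional k p} h
... | inj₂ h' = use-unconditional k ls as h' ch np le
use-unconditional k ((mkPattern n [] [] [] , t) ∷ ls) (a ∷ as) h ch np le | inj₁ e =
  a ch np (≤-trans (≤-reflexive (≡ᵇ⇒≡ n k (subst Bool.T (sym e) tt))) le) tt [] []

lemmas : List (Pattern × Tree)
lemmas = map parseLemma certificate

opaque
  -- The length for which the certificate contains an unconditional pattern. The block is opaque, so
  -- that the certificate is evaluated only once.
  chainBound : ℕ
  chainBound = 139

  certificate-valid : checkAll [] lemmas ∧ hasUnconditional chainBound lemmas ≡ true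
  certificate-valid = refl

  no-long-chain : ∀ {r c M} → WeakChain r c M → ¬ P6In r → chainBound ≤ M → ⊥
  no-long-chain = use-unconditional chainBound lemmas
    (checkAll-sound [] lemmas [] (∧-l certificate-valid)) (∧-r {checkAll [] lemmas} certificate-valid)

-- Join vertices

-- From a projected chain of `suc chainSteps` steps two vertices are cut off at the front and one at
-- the end, so that every join vertex in between has the chain neighbours that its analysis uses.
chainSteps : ℕ
chainSteps = chainBound + 2

opaque
  -- Either a K4, or three real vertices for each virtual one.
  joinBound : ℕ
  joinBound = 4 + twoListBound chainSteps * 3
  4≤joinBound : 4 ≤ joinBound
  4≤joinBound = m≤m+n 4 _
  two≤joinBound : twoListBound chainSteps * 3 ≤ joinBound
  two≤joinBound = m≤n+m _ 4

both : ∀ b → b ∈ (false ∷ true ∷ [])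
both false = here refl
both true = there (here refl)

pinned : ∀ {m p q x : Color} → p ≢ q → p ≢ m → q ≢ m → x ≢ m → x ≡ p ⊎ x ≡ q
pinned {m} {p} {q} {x} pq pm qm xm with bool-em (x == p)
... | inj₁ e = inj₁ (==-t e)
... | inj₂ e = inj₂ (third-of-two {m} {p} (λ z → pm (sym z)) xm (==-f⁻ e) qm (λ z → pq (sym z)))

module Joins (V : Set) (_≟_ : DecidableEquality V) (vs : List V) (complete : ∀ v → v ∈ vs)
             (adj : V → V → Bool) (sy : ∀ u v → adj u v ≡ adj v u) (noP6 : ¬ P6In adj) where
  open Framework V _≟_ vs complete adj

  module Setup (S : Live) (L : Lists) (J : V → Bool) (miss : V → Color)
    (missing : ∀ v → S v ≡ true → J v ≡ false → L v (miss v) ≡ false)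
    (full : ∀ w → S w ≡ true → J w ≡ true → ∀ c → L w c ≡ true)
    (nbr : ∀ w x → S w ≡ true → S x ≡ true → J w ≡ true → w ~ x → J x ≡ false)
    (cross : ∀ w x y → S w ≡ true → S x ≡ true → S y ≡ true → J w ≡ true → w ~ x → w ~ y → miss x ≢ miss y → x ~ y)
    where

    -- A join vertex w is replaced by two virtual vertices (w , b), one for each kind of neighbours of w;
    -- these two kinds are completely joined, so each must be monochromatic.
    module Virtual (nb : V → Bool → V)
      (nb-live : ∀ w b → S w ≡ true → J w ≡ true → S (nb w b) ≡ true)
      (nb-adj : ∀ w b → S w ≡ true → J w ≡ true → w ~ nb w b)
      (nb-diff : ∀ w → S w ≡ true → J w ≡ true → miss (nb w false) ≢ miss (nb w true))
      (nb-all : ∀ w x → S w ≡ true → S x ≡ true → J w ≡ true → w ~ x → Σ Bool λ b → miss x ≡ miss (nb w b))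
      where

      V' : Set
      V' = V × Bool
      vs' : List V'
      vs' = cartesianProduct vs (false ∷ true ∷ [])
      complete' : ∀ v → v ∈ vs'
      complete' (v , b) = ∈-cartesianProduct⁺ (complete v) (both b)

      fits : V → Bool → V → Bool
      fits u i v = not (J u) ∨ (miss v == miss (nb u i))
      adj' : V' → V' → Bool
      adj' (u , i) (v , k) = adj u v ∧ (fits u i v ∧ fits v k u)
      sy' : ∀ u v → adj' u v ≡ adj' v u
      sy' (u , i) (v , k) = cong₂ _∧_ (sy u v) (Boolₚ.∧-comm (fits u i v) (fits v k u))

      module F' = Framework V' (≡-dec _≟_ Boolₚ._≟_) vs' complete' adj'
      module T' = TwoLists V' (≡-dec _≟_ Boolₚ._≟_) vs' complete' adj' sy'

      miss' : V' → Color
      miss' (v , b) = if J v then miss (nb v b) else miss v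
      -- A vertex that is no join keeps only its copy `false`.
      S' : V' → Bool
      S' (v , b) = S v ∧ (J v ∨ not b)
      -- A virtual copy misses the colour that its kind misses; whichever of the other two it takes,
      -- all neighbours of that kind are forced to the remaining one.
      L' : V' → Color → Bool
      L' (v , b) c = if J v then not (c == miss (nb v b)) else L v c

      miss-J : ∀ v b → J v ≡ true → miss' (v , b) ≡ miss (nb v b)
      miss-J v b j rewrite j = refl
      miss-n : ∀ v b → J v ≡ false → miss' (v , b) ≡ miss v
      miss-n v b j rewrite j = refl

      L'-J : ∀ v b → J v ≡ true → ∀ c → L' (v , b) c ≡ not (c == miss (nb v b))
      L'-J v b j c rewrite j = refl
      L'-n : ∀ v b → J v ≡ false → ∀ c → L' (v , b) c ≡ L v c
      L'-n v b j c rewrite j = refl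

      missing' : ∀ v → S' v ≡ true → L' v (miss' v) ≡ false
      missing' (v , b) s with bool-em (J v)
      ... | inj₁ j rewrite j = ¬t⇒f λ p → f≢t (not-t p) (==-refl (miss (nb v b)))
      ... | inj₂ j rewrite j = missing v (∧-l s) j

      -- A real chord absent from the virtual graph ends in a join vertex whose kind does not fit.
      -- Then `cross` supplies edges from the other end to both chain neighbours of the join, and
      -- the exceptional chords record exactly this.
      module Project (fc : T'.FreeChain S' L' (suc chainSteps)) where
        open T'.FreeChain fc
        M = suc chainSteps
        u : ℕ → V
        u i = proj₁ (vert i)
        r : ℕ → ℕ → Bool
        r i j = adj (u i) (u j)
        liv : ∀ {i} → i ≤ M → S (u i) ≡ true
        liv {i} l = ∧-l (live i l)
        mm : ℕ → Color
        mm i = miss' (vert i)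
        avoid-old : ∀ {i} → suc i ≤ M → col i ≢ mm (suc i)
        avoid-old {i} l e = f≢t (missing' (vert (suc i)) (live (suc i) l)) (subst (λ z → L' (vert (suc i)) z ≡ true) e (old i l))
        avoid-new : ∀ {i} → suc i ≤ M → col (suc i) ≢ mm (suc i)
        avoid-new {i} l e = f≢t (missing' (vert (suc i)) (live (suc i) l)) (subst (λ z → L' (vert (suc i)) z ≡ true) e (new i l))
        real-edge : ∀ {i} → suc i ≤ M → r i (suc i) ≡ true
        real-edge {i} l = ∧-l (edge i l)
        fits-t : ∀ w b x → J w ≡ true → fits w b x ≡ true → miss x ≡ miss (nb w b)
        fits-t w b x j p with ∨-e {not (J w)} p
        ... | inj₁ q = ⊥-elim (f≢t (not-t q) j)
        ... | inj₂ q = ==-t q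
        next-kind : ∀ {k} → suc k ≤ M → J (u k) ≡ true → J (u (suc k)) ≡ false × mm (suc k) ≡ mm k
        next-kind {k} l j = jn , trans (miss-n _ _ jn) (trans (fits-t (u k) (proj₂ (vert k)) (u (suc k)) j (∧-l (∧-r {adj (u k) (u (suc k))} (edge k l)))) (sym (miss-J _ _ j)))
          where jn = nbr (u k) (u (suc k)) (liv (<⇒≤ l)) (liv l) j (real-edge l)
        prev-kind : ∀ {k} → suc k ≤ M → J (u (suc k)) ≡ true → J (u k) ≡ false × mm k ≡ mm (suc k)
        prev-kind {k} l j = jn , trans (miss-n _ _ jn) (trans (fits-t (u (suc k)) (proj₂ (vert (suc k))) (u k) j (∧-r {fits (u k) (proj₂ (vert k)) (u (suc k))} (∧-r {adj (u k) (u (suc k))} (edge k l)))) (sym (miss-J _ _ j)))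
          where jn = nbr (u (suc k)) (u k) (liv l) (liv (<⇒≤ l)) j (trans (sy _ _) (real-edge l))
        plain : ∀ i j → J (u i) ≡ false → J (u j) ≡ false → r i j ≡ true → adj' (vert i) (vert j) ≡ true
        plain i j ji jj e = ∧-i e (∧-i (∨-il (not-f ji)) (∨-il (not-f jj)))
        crossing : ∀ w x y → w ≤ M → x ≤ M → y ≤ M → J (u w) ≡ true → r w x ≡ true → r w y ≡ true → miss (u x) ≢ miss (u y) → r x y ≡ true
        crossing w x y lw lx ly j e e' ne = cross (u w) (u x) (u y) (liv lw) (liv lx) (liv ly) j e e' ne
        rs : ∀ {i j} → r i j ≡ true → r j i ≡ true
        rs {i} {j} e = trans (sy _ _) e

        module At (p : ℕ) (l : suc (suc (suc p)) ≤ M) (j : J (u (suc (suc p))) ≡ true) where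
          k = suc (suc p)
          kM : k ≤ M
          kM = <⇒≤ l
          pM : suc p ≤ M
          pM = <⇒≤ kM
          m = mm k
          nk = next-kind l j
          pk = prev-kind kM j
          -- Around a join all three chain vertices miss the same colour `m`, so the colours
          -- alternate there between the two others.
          col-next : col (suc k) ≡ col (suc p)
          col-next = third-of-two {m} {col k} (λ e → avoid-new kM (sym e)) (λ e → avoid-new l (trans e (sym (proj₂ nk)))) (λ e → diff k l (sym e)) (avoid-old kM) (diff (suc p) kM)
          col-prev : col p ≡ col k
          col-prev = third-of-two {m} {col (suc p)} (λ e → avoid-old kM (sym e)) (λ e → avoid-old pM (trans e (sym (proj₂ pk)))) (diff p pM) (avoid-new kM) (λ e → diff (suc p) kM (sym e))
          missN : miss (u (suc k)) ≡ m
          missN = trans (sym (miss-n _ (proj₂ (vert (suc k))) (proj₁ nk))) (proj₂ nk)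
          missP : miss (u (suc p)) ≡ m
          missP = trans (sym (miss-n _ (proj₂ (vert (suc p))) (proj₁ pk))) (proj₂ pk)

          module Nbr (z : ℕ) (zM : z ≤ M) (e : r k z ≡ true) where
            jz : J (u z) ≡ false
            jz = nbr (u k) (u z) (liv kM) (liv zM) j e
            dec : (mm z ≡ m) ⊎ (mm z ≢ m)
            dec with bool-em (mm z == m)
            ... | inj₁ q = inj₁ (==-t q)
            ... | inj₂ q = inj₂ (==-f⁻ q)
            mz : mm z ≡ miss (u z)
            mz = miss-n _ _ jz
            toNext : mm z ≢ m → adj' (vert (suc k)) (vert z) ≡ true
            toNext ne = plain (suc k) z (proj₁ nk) jz (crossing k (suc k) z kM l zM j (real-edge l) e (λ q → ne (trans mz (trans (sym q) missN))))
            toPrev : mm z ≢ m → adj' (vert (suc p)) (vert z) ≡ true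
            toPrev ne = plain (suc p) z (proj₁ pk) jz (crossing k (suc p) z kM pM zM j (rs {suc p} {k} (real-edge kM)) e (λ q → ne (trans mz (trans (sym q) missP))))
            fit : adj' (vert k) (vert z) ≡ false → mm z ≢ m
            fit na q = f≢t na (∧-i e (∧-i (∨-ir {not (J (u k))} (subst (λ y → (miss (u z) == y) ≡ true) (trans (trans (sym mz) q) (miss-J _ _ j)) (==-refl (miss (u z))))) (∨-il (not-f jz))))

          -- A later neighbour of the same kind has the same two colours as the join. One of the
          -- other kind is adjacent to the predecessor of the join, and strength of that chord makes
          -- `col (suc p)` the colour missed by the neighbour; the next colour `col k` is then in
          -- its list.
          lone-late : ∀ q → k < q → suc q ≤ M → r k (suc q) ≡ true → col k ≡ col q ⊎ col k ≡ col (suc q)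
          lone-late q kq qM e with Nbr.dec (suc q) qM e
          ... | inj₁ same = pinned (diff q qM) (avoid-old qM) (avoid-new qM) (λ z → avoid-new kM (trans z same))
          ... | inj₂ ne = let (a , b , _) = chord (suc p) q (≤-trans (n≤1+n _) kq) qM (Nbr.toPrev (suc q) qM e ne)
                              x : col (suc p) ≡ mm (suc q)
                              x = third-of-two {col q} {col (suc q)} (diff q qM) a b (λ z → avoid-old qM (sym z)) (λ z → avoid-new qM (sym z))
                          in pinned (diff q qM) (avoid-old qM) (avoid-new qM) (λ z → diff (suc p) kM (trans x (sym z)))

          -- A chord of the virtual graph would be strong, contrary to the two colours available at
          -- the join. Otherwise the successor of the join sees the earlier vertex as well, and
          -- strength of that chord makes the colour of this vertex `m`.
          lone-early : ∀ (i : ℕ) → suc (suc i) ≤ suc p → r (suc i) k ≡ true → col i ≡ col (suc p)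
          lone-early i lt e with bool-em (adj' (vert (suc i)) (vert k))
          ... | inj₁ a = let (x , y , _) = chord (suc i) (suc p) lt kM a
                             m' = fits-t (u k) (proj₂ (vert k)) (u (suc i)) j (∧-r {fits (u (suc i)) (proj₂ (vert (suc i))) (u k)} (∧-r {adj (u (suc i)) (u k)} a))
                             ji = nbr (u k) (u (suc i)) (liv kM) (liv iM) j (rs {suc i} {k} e)
                             av : col (suc i) ≢ m
                             av z = avoid-new iM (trans z (trans (miss-J _ _ j) (trans (sym m') (sym (miss-n _ _ ji)))))
                         in ⊥-elim (h (pinned (diff (suc p) kM) (avoid-old kM) (avoid-new kM) av) x y)
            where
            iM : suc i ≤ M
            iM = ≤-trans (≤-trans (n≤1+n _) lt) pM
            h : col (suc i) ≡ col (suc p) ⊎ col (suc i) ≡ col k → col (suc i) ≢ col (suc p) → col (suc i) ≢ col k → ⊥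
            h (inj₁ z) x y = x z
            h (inj₂ z) x y = y z
          ... | inj₂ a = let open Nbr (suc i) iM (rs {suc i} {k} e)
                             (x , y , w) = chord (suc i) k (≤-trans lt (n≤1+n _)) l (trans (sy' (vert (suc i)) (vert (suc k))) (toNext (fit (trans (sy' (vert k) (vert (suc i))) a))))
                             im : col (suc i) ≡ m
                             im = third-of-two {col k} {col (suc p)} (λ z → diff (suc p) kM (sym z)) x (λ z → y (trans z (sym col-next))) (λ z → avoid-new kM (sym z)) (λ z → avoid-old kM (sym z))
                         in third-of-two {m} {col k} (λ z → avoid-new kM (sym z)) (λ z → diff i iM (trans z (sym im))) (w i refl) (avoid-old kM) (diff (suc p) kM)
            where
            iM : suc i ≤ M
            iM = ≤-trans (≤-trans (n≤1+n _) lt) pM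

        rW : ℕ → ℕ → Bool
        rW i j = r (2 + i) (2 + j)
        cW : ℕ → Color
        cW i = col (2 + i)
        lift : ∀ {a} → a ≤ chainBound → suc (suc (suc a)) ≤ M
        lift {a} l = s≤s (≤-trans (s≤s (s≤s l)) (≤-reflexive (+-comm 2 chainBound)))
        strongW : ∀ {i j} → Strong col (2 + i) (2 + j) → Strong cW i j
        strongW s = strong-shift {col} 2 s

        lone : ∀ k → suc k ≤ chainBound → J (u (2 + k)) ≡ true → Lone rW cW chainBound k
        lone k l j = (λ m km le e → lone-late (2 + m) (s≤s (s≤s km)) (lift (≤-trans (n≤1+n _) (≤-trans (n≤1+n _) le))) e)
                   , λ { i q refl lt e i' refl → lone-early (2 + i') (s≤s (s≤s (lt))) e }
          where open At k (lift (≤-trans (n≤1+n _) l)) j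

        weak : WeakChain rW cW chainBound
        weak = record
          { symm = λ i j → sy _ _
          ; edge = λ i l → real-edge (≤-trans (s≤s (s≤s l)) (≤-trans (n≤1+n _) (lift ≤-refl)))
          ; diff = λ i l → diff (2 + i) (≤-trans (s≤s (s≤s l)) (≤-trans (n≤1+n _) (lift ≤-refl)))
          ; rule = rule }
          where
          rule : ∀ i j → i < j → suc (suc j) ≤ chainBound → rW i (suc j) ≡ true → Strong cW i j ⊎ (Exc₁ rW cW chainBound i j ⊎ Exc₂ rW cW chainBound i j)
          rule i j ij le e with bool-em (adj' (vert (2 + i)) (vert (3 + j)))
          ... | inj₁ a = inj₁ (strongW (chord (2 + i) (2 + j) (s≤s (s≤s ij)) qM a))
            where qM : 3 + j ≤ M
                  qM = lift (≤-trans (n≤1+n _) (≤-trans (n≤1+n _) le))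
          ... | inj₂ a with bool-em (J (u (2 + i))) | bool-em (J (u (3 + j)))
          ... | inj₂ x | inj₂ y = ⊥-elim (f≢t a (plain (2 + i) (3 + j) x y e))
          ... | inj₁ x | _ = inj₂ (inj₁ (lt , strongW stN , ∧-l (toNext ne) , (λ { i₁ refl → sym col-next , strongW stP , ∧-l (toPrev ne) , λ { i₂ refl → col-prev } }) , lone i (≤-trans (≤-trans ij (n≤1+n _)) (≤-trans (n≤1+n _) le)) x))
            where
            open At i (≤-trans (s≤s (s≤s ij)) (<⇒≤ (lift (≤-trans (n≤1+n _) (≤-trans (n≤1+n _) le))))) x
            qM : 3 + j ≤ M
            qM = lift (≤-trans (n≤1+n _) (≤-trans (n≤1+n _) le))
            open Nbr (3 + j) qM e
            ne = fit a
            stP : Strong col (suc i) (2 + j)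
            stP = chord (suc i) (2 + j) (≤-trans (s≤s (s≤s (<⇒≤ ij))) ≤-refl) qM (toPrev ne)
            lt : suc i < j
            lt with m≤n⇒m<n∨m≡n ij
            ... | inj₁ z = z
            ... | inj₂ refl = ⊥-elim (proj₁ stP (sym col-next))
            stN : Strong col (3 + i) (2 + j)
            stN = chord (3 + i) (2 + j) (s≤s (s≤s lt)) qM (toNext ne)
          ... | inj₂ x | inj₁ y = inj₂ (inj₂ (ex j ij le e a y))
            where
            ex : ∀ j → i < j → suc (suc j) ≤ chainBound → rW i (suc j) ≡ true → adj' (vert (2 + i)) (vert (3 + j)) ≡ false → J (u (3 + j)) ≡ true → Exc₂ rW cW chainBound i j
            ex (suc j₂) ij le e a y = j₂ , refl , lt , col-prev , col-next , strongW stP , strongW stN , rs {3 + j₂} {2 + i} (∧-l (toPrev ne)) , rs {5 + j₂} {2 + i} (∧-l (toNext ne)) , lone (suc (suc j₂)) le y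
              where
              lN : 5 + j₂ ≤ M
              lN = lift (≤-trans (n≤1+n _) le)
              open At (suc (suc j₂)) lN y
              iM : 2 + i ≤ M
              iM = ≤-trans (≤-trans (s≤s (s≤s (<⇒≤ ij))) (n≤1+n _)) kM
              open Nbr (2 + i) iM (rs {2 + i} {k} e)
              ne = fit (trans (sy' (vert k) (vert (2 + i))) a)
              stN : Strong col (2 + i) k
              stN = chord (2 + i) k (s≤s (s≤s (≤-trans ij (n≤1+n _)))) lN (trans (sy' (vert (2 + i)) (vert (suc k))) (toNext ne))
              lt : i < j₂
              lt with m≤n⇒m<n∨m≡n ij
              ... | inj₁ (s≤s z) = z
              ... | inj₂ refl = ⊥-elim (proj₁ stN col-prev)
              stP : Strong col (2 + i) (2 + j₂)
              stP = chord (2 + i) (2 + j₂) (s≤s (s≤s lt)) (<⇒≤ kM) (trans (sy' (vert (2 + i)) (vert (suc (2 + j₂)))) (toPrev ne))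

        impossible : ⊥
        impossible = no-long-chain weak (λ x → let open P6In x in noP6 (mkP6 (u (2 + a)) (u (2 + b)) (u (2 + c)) (u (2 + d)) (u (2 + e)) (u (2 + f)) ab bc cd de ef ac ad ae af bd be bf ce cf df)) ≤-refl

      good' : F'.Good (twoListBound chainSteps) S' L'
      good' = T'.Bounded.two-lists S' L' (λ v s → miss' v , missing' v s) chainSteps (λ fc → Project.impossible fc)

      W : V' → List V
      W (v , b) = v ∷ nb v false ∷ nb v true ∷ []

      private
        other : ∀ w b → S w ≡ true → J w ≡ true → miss (nb w b) ≢ miss (nb w (not b))
        other w false s j = nb-diff w s j
        other w true s j e = nb-diff w s j (sym e)

      -- Upwards, a join takes the colour different from those of its two kinds. Downwards, the
      -- colour of one kind is read off from the join and one neighbour of the other kind, as every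
      -- neighbour of the first kind is adjacent to both; hence the two witnesses `nb`.
      push : F'.Good (twoListBound chainSteps) S' L' → Good (twoListBound chainSteps * 3) S L
      push (inj₁ κ) = inj₁ (mkCol f al pr)
        where
        g : V → Bool → Color
        g w b = third (miss (nb w b)) (F'.colour κ (w , b))
        f : V → Color
        f v = if J v then third (g v false) (g v true) else F'.colour κ (v , false)
        f-n : ∀ v → J v ≡ false → f v ≡ F'.colour κ (v , false)
        f-n v j rewrite j = refl
        f-J : ∀ v → J v ≡ true → f v ≡ third (g v false) (g v true)
        f-J v j rewrite j = refl
        inN : ∀ {v} → S v ≡ true → J v ≡ false → S' (v , false) ≡ true
        inN {v} s j = ∧-i s (∨-ir {J v} refl)
        inJ : ∀ {v} b → S v ≡ true → J v ≡ true → S' (v , b) ≡ true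
        inJ b s j = ∧-i s (∨-il j)
        al : ∀ v → S v ≡ true → L v (f v) ≡ true
        al v s with bool-em (J v)
        ... | inj₁ j = full v s j (f v)
        ... | inj₂ j = subst (λ z → L v z ≡ true) (sym (f-n v j)) (subst (λ z → (if z then not (F'.colour κ (v , false) == miss (nb v false)) else L v (F'.colour κ (v , false))) ≡ true) j (F'.allowed κ (v , false) (inN s j)))
        kind : ∀ w b x → S w ≡ true → J w ≡ true → S x ≡ true → w ~ x → miss x ≡ miss (nb w b) → f x ≡ g w b
        kind w b x sw jw sx e m = trans (f-n x jx) (third-unique _ _ _ av cm ne)
          where
          jx = nbr w x sw sx jw e
          ne : F'.colour κ (x , false) ≢ F'.colour κ (w , b)
          ne q = F'.proper κ (w , b) (x , false) (inJ b sw jw) (inN sx jx)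
             (∧-i e (∧-i (∨-ir {not (J w)} (subst (λ z → (miss x == z) ≡ true) m (==-refl (miss x)))) (∨-il (not-f jx)))) (sym q)
          av : miss (nb w b) ≢ F'.colour κ (w , b)
          av q = f≢t (missing' (w , b) (inJ b sw jw)) (subst (λ z → L' (w , b) z ≡ true) (sym (trans (miss-J w b jw) q)) (F'.allowed κ (w , b) (inJ b sw jw)))
          cm : F'.colour κ (x , false) ≢ miss (nb w b)
          cm q = f≢t (missing x sx jx) (subst (λ z → L x z ≡ true) (trans (f-n x jx) (trans q (sym m))) (al x sx))
        pr-J : ∀ w x → S w ≡ true → S x ≡ true → J w ≡ true → w ~ x → f w ≢ f x
        pr-J w x s sx j e q with nb-all w x s sx j e
        ... | false , m = third≢l (g w false) (g w true) (trans (sym (f-J w j)) (trans q (kind w false x s j sx e m)))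
        ... | true , m = third≢r (g w false) (g w true) (trans (sym (f-J w j)) (trans q (kind w true x s j sx e m)))
        pr : ∀ u v → S u ≡ true → S v ≡ true → u ~ v → f u ≢ f v
        pr u v s s' e with bool-em (J u) | bool-em (J v)
        ... | inj₁ j | _ = pr-J u v s s' j e
        ... | inj₂ _ | inj₁ j = λ q → pr-J v u s' s j (trans (sy v u) e) (sym q)
        ... | inj₂ j | inj₂ j' = λ q → F'.proper κ (u , false) (v , false) (inN s j) (inN s' j') (∧-i e (∧-i (∨-il (not-f j)) (∨-il (not-f j')))) (trans (sym (f-n u j)) (trans q (f-n v j')))
      push (inj₂ (B , l , n)) = inj₂ (concatMap W B , ≤-trans (length-concatMap W 3 (λ _ → ≤-refl) B) (*-monoˡ-≤ 3 l) , λ κ → n (down κ))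
        where
        down : Col (On (concatMap W B) S) L → F'.Col (F'.On B S') L'
        down κ = F'.mkCol f al pr
          where
          g : V → Bool → Color
          g w b = third (colour κ (nb w (not b))) (colour κ w)
          f : V' → Color
          f (v , b) = if J v then third (miss (nb v b)) (g v b) else colour κ v
          f-n : ∀ v b → J v ≡ false → f (v , b) ≡ colour κ v
          f-n v b j rewrite j = refl
          f-J : ∀ v b → J v ≡ true → f (v , b) ≡ third (miss (nb v b)) (g v b)
          f-J v b j rewrite j = refl
          at0 : ∀ {v b} → F'.On B S' (v , b) → On (concatMap W B) S v
          at0 (i , s) = ∈-concatMap W i (here refl) , ∧-l s
          atN : ∀ {v b} k → J v ≡ true → F'.On B S' (v , b) → On (concatMap W B) S (nb v k)
          atN {v} false j (i , s) = ∈-concatMap W i (there (here refl)) , nb-live v false (∧-l s) j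
          atN {v} true j (i , s) = ∈-concatMap W i (there (there (here refl))) , nb-live v true (∧-l s) j
          al : ∀ v → F'.On B S' v → L' v (f v) ≡ true
          al (v , b) p with bool-em (J v)
          ... | inj₁ j = trans (L'-J v b j (f (v , b))) (trans (cong (λ z → not (z == miss (nb v b))) (f-J v b j)) (not-f (==-f (third≢l (miss (nb v b)) (g v b)))))
          ... | inj₂ j = trans (L'-n v b j (f (v , b))) (trans (cong (L v) (f-n v b j)) (allowed κ v (at0 p)))
          pr-J : ∀ w b x k → J w ≡ true → F'.On B S' (w , b) → F'.On B S' (x , k) → adj' (w , b) (x , k) ≡ true → f (w , b) ≢ f (x , k)
          pr-J w b x k j p p' e q = third≢r (miss (nb w b)) (g w b) (trans (sym (f-J w b j)) (trans q (trans (f-n x k jx) eq)))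
            where
            sw = ∧-l (proj₂ p)
            sx = ∧-l (proj₂ p')
            ew = ∧-l {adj w x} e
            jx = nbr w x sw sx j ew
            m : miss x ≡ miss (nb w b)
            m with ∨-e {not (J w)} (∧-l (∧-r {adj w x} e))
            ... | inj₁ z = ⊥-elim (f≢t (not-t z) j)
            ... | inj₂ z = ==-t z
            y = nb w (not b)
            py = atN (not b) j p
            xy : x ~ y
            xy = cross w x y sw sx (proj₂ py) j ew (nb-adj w (not b) sw j) (λ z → other w b sw j (trans (sym m) z))
            eq : colour κ x ≡ g w b
            eq = third-unique _ _ _ (λ z → proper κ w y (at0 p) py (nb-adj w (not b) sw j) (sym z)) (proper κ x y (at0 p') py xy) (λ z → proper κ w x (at0 p) (at0 p') ew (sym z))
          pr : ∀ u v → F'.On B S' u → F'.On B S' v → adj' u v ≡ true → f u ≢ f v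
          pr (u , i) (v , k) p p' e with bool-em (J u) | bool-em (J v)
          ... | inj₁ j | _ = pr-J u i v k j p p' e
          ... | inj₂ _ | inj₁ j = λ q → pr-J v k u i j p' p (trans (sy' (v , k) (u , i)) e) (sym q)
          ... | inj₂ j | inj₂ j' = λ q → proper κ u v (at0 p) (at0 p') (∧-l e) (trans (sym (f-n u i j)) (trans q (f-n v k j')))

      good : Good (twoListBound chainSteps * 3) S L
      good = push good'

  module _ (S : Live) (L : Lists) (J : V → Bool) (miss : V → Color)
    (missing : ∀ v → S v ≡ true → J v ≡ false → L v (miss v) ≡ false)
    (full : ∀ w → S w ≡ true → J w ≡ true → ∀ c → L w c ≡ true)
    (nbr : ∀ w x → S w ≡ true → S x ≡ true → J w ≡ true → w ~ x → J x ≡ false)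
    (cross : ∀ w x y → S w ≡ true → S x ≡ true → S y ≡ true → J w ≡ true → w ~ x → w ~ y → miss x ≢ miss y → x ~ y)
    where
    private
      isKind : V → Color → V → Bool
      isKind w c x = (S x ∧ adj w x) ∧ (miss x == c)
      kinds : V → Color → Bool
      kinds w c = some (isKind w c)
      two : V → Bool
      two w = someC (λ c → kinds w c ∧ someC (λ d → kinds w d ∧ not (c == d)))
      kinds⇒ : ∀ w c → kinds w c ≡ true → Σ V λ x → S x ≡ true × w ~ x × miss x ≡ c
      kinds⇒ w c p = let (x , q) = some⇒ (isKind w c) p in x , ∧-l (∧-l q) , ∧-r {S x} (∧-l q) , ==-t (∧-r {S x ∧ adj w x} q)
      ⇒kinds : ∀ w x → S x ≡ true → w ~ x → kinds w (miss x) ≡ true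
      ⇒kinds w x s e = ⇒some (isKind w (miss x)) x (∧-i (∧-i s e) (==-refl (miss x)))
      triple : V → Bool
      triple w = (S w ∧ J w) ∧ everyC (kinds w)
      D : V → Bool
      D w = J w ∧ not (two w)

    -- Three kinds around a join give a K4. A join with at most one kind is set aside, since it can
    -- take a colour that all its neighbours miss. The remaining joins have exactly two kinds, as
    -- `Virtual` requires.
    joins : Good joinBound S L
    joins with search triple
    ... | inj₁ (w , t) = k4 (kinds⇒ w c0 (ev c0)) (kinds⇒ w c1 (ev c1)) (kinds⇒ w c2 (ev c2))
      where
      sw = ∧-l (∧-l {S w ∧ J w} t)
      jw = ∧-r {S w} (∧-l {S w ∧ J w} t)
      ev = everyC⇒ (kinds w) (∧-r {S w ∧ J w} t)
      d01 : _≢_ {A = Color} c0 c1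
      d01 ()
      d02 : _≢_ {A = Color} c0 c2
      d02 ()
      d12 : _≢_ {A = Color} c1 c2
      d12 ()
      k4 : _ → _ → _ → Good joinBound S L
      k4 (x , sx , ex , mx) (y , sy' , ey , my) (z , sz , ez , mz) = inj₂ (w ∷ x ∷ y ∷ z ∷ [] , 4≤joinBound , λ κ →
          let pw = here refl , sw
              px = there (here refl) , sx
              py = there (there (here refl)) , sy'
              pz = there (there (there (here refl))) , sz
              cr = λ a b sa sb ea eb ne → cross w a b sw sa sb jw ea eb ne
          in four-colours (proper κ w x pw px ex) (proper κ w y pw py ey) (proper κ w z pw pz ez)
               (proper κ x y px py (cr x y sx sy' ex ey (λ q → d01 (trans (sym mx) (trans q my)))))
               (proper κ x z px pz (cr x z sx sz ex ez (λ q → d02 (trans (sym mx) (trans q mz)))))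
               (proper κ y z py pz (cr y z sy' sz ey ez (λ q → d12 (trans (sym my) (trans q mz))))))
    ... | inj₂ noTriple = good-weaken two≤joinBound (restore inner)
      where
      S₁ : Live
      S₁ = S ∖ D
      sub : ∀ {v} → S₁ v ≡ true → S v ≡ true
      sub = ∧-l
      isTwo : ∀ w → S₁ w ≡ true → J w ≡ true → two w ≡ true
      isTwo w s j with bool-em (two w)
      ... | inj₁ p = p
      ... | inj₂ p = ⊥-elim (f≢t (not-t (∧-r {S w} s)) (∧-i j (not-f p)))
      pick : ∀ w → S₁ w ≡ true → J w ≡ true → Σ V λ x → Σ V λ y → (S x ≡ true × w ~ x) × (S y ≡ true × w ~ y) × miss x ≢ miss y
      pick w s j = let (c , p) = someC⇒ (λ c → kinds w c ∧ someC (λ d → kinds w d ∧ not (c == d))) (isTwo w s j)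
                       (d , q) = someC⇒ (λ d → kinds w d ∧ not (c == d)) (∧-r {kinds w c} p)
                       (x , sx , ex , mx) = kinds⇒ w c (∧-l p)
                       (y , sy' , ey , my) = kinds⇒ w d (∧-l q)
                   in x , y , (sx , ex) , (sy' , ey) , λ z → ==-f⁻ (not-t (∧-r {kinds w d} q)) (trans (sym mx) (trans z my))
      nb : V → Bool → V
      nb w b with bool-em (S₁ w) | bool-em (J w)
      ... | inj₁ s | inj₁ j = if b then proj₁ (proj₂ (pick w s j)) else proj₁ (pick w s j)
      ... | _ | _ = w
      live₁ : ∀ w x → S₁ w ≡ true → J w ≡ true → S x ≡ true → w ~ x → S₁ x ≡ true
      live₁ w x s j sx e = ∧-i sx (not-f (¬t⇒f λ p → f≢t (nbr w x (sub s) sx j e) (∧-l p)))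
      nb-spec : ∀ w b → S₁ w ≡ true → J w ≡ true → S (nb w b) ≡ true × w ~ nb w b
      nb-spec w b s j with bool-em (S₁ w) | bool-em (J w)
      ... | inj₁ s' | inj₁ j' = h b
        where h : ∀ b → S (if b then proj₁ (proj₂ (pick w s' j')) else proj₁ (pick w s' j')) ≡ true × w ~ (if b then proj₁ (proj₂ (pick w s' j')) else proj₁ (pick w s' j'))
              h false = proj₁ (proj₂ (proj₂ (pick w s' j')))
              h true = proj₁ (proj₂ (proj₂ (proj₂ (pick w s' j'))))
      ... | inj₁ _ | inj₂ f = ⊥-elim (f≢t f j)
      ... | inj₂ f | _ = ⊥-elim (f≢t f s)
      nb-diff : ∀ w → S₁ w ≡ true → J w ≡ true → miss (nb w false) ≢ miss (nb w true)
      nb-diff w s j with bool-em (S₁ w) | bool-em (J w)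
      ... | inj₁ s' | inj₁ j' = proj₂ (proj₂ (proj₂ (proj₂ (pick w s' j'))))
      ... | inj₁ _ | inj₂ f = ⊥-elim (f≢t f j)
      ... | inj₂ f | _ = ⊥-elim (f≢t f s)
      nb-all : ∀ w x → S₁ w ≡ true → S₁ x ≡ true → J w ≡ true → w ~ x → Σ Bool λ b → miss x ≡ miss (nb w b)
      nb-all w x s sx j e with bool-em (miss x == miss (nb w false)) | bool-em (miss x == miss (nb w true))
      ... | inj₁ p | _ = false , ==-t p
      ... | inj₂ _ | inj₁ p = true , ==-t p
      ... | inj₂ p | inj₂ q = ⊥-elim (f≢t (noTriple w) (∧-i (∧-i (sub s) j) (⇒everyC (kinds w) each)))
        where
        a = nb-spec w false s j
        b = nb-spec w true s j
        each : ∀ c → kinds w c ≡ true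
        each c with bool-em (c == miss (nb w false)) | bool-em (c == miss (nb w true))
        ... | inj₁ z | _ = subst (λ y → kinds w y ≡ true) (sym (==-t z)) (⇒kinds w (nb w false) (proj₁ a) (proj₂ a))
        ... | inj₂ _ | inj₁ z = subst (λ y → kinds w y ≡ true) (sym (==-t z)) (⇒kinds w (nb w true) (proj₁ b) (proj₂ b))
        ... | inj₂ z | inj₂ z' = subst (λ y → kinds w y ≡ true) (third-of-two (nb-diff w s j) (==-f⁻ p) (==-f⁻ q) (==-f⁻ z) (==-f⁻ z')) (⇒kinds w x (sub sx) e)
      inner : Good (twoListBound chainSteps * 3) S₁ L
      inner = Setup.Virtual.good S₁ L J miss (λ v s → missing v (sub s)) (λ w s → full w (sub s)) (λ w x s s' → nbr w x (sub s) (sub s'))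
               (λ w x y s s' s'' → cross w x y (sub s) (sub s') (sub s'')) nb
               (λ w b s j → live₁ w (nb w b) s j (proj₁ (nb-spec w b s j)) (proj₂ (nb-spec w b s j))) (λ w b s j → proj₂ (nb-spec w b s j)) nb-diff nb-all
      restore : ∀ {m} → Good m S₁ L → Good m S L
      restore (inj₂ o) = inj₂ (obs-sub (λ v s → sub s) o)
      restore (inj₁ κ) = inj₁ (mkCol f al pr)
        where
        free : V → Color
        free w with bool-em (someC (kinds w))
        ... | inj₁ p = proj₁ (someC⇒ (kinds w) p)
        ... | inj₂ _ = c0
        free-ok : ∀ w x → S w ≡ true → D w ≡ true → S x ≡ true → w ~ x → miss x ≡ free w
        free-ok w x s d sx e with bool-em (someC (kinds w))
        ... | inj₂ p = ⊥-elim (f≢t p (⇒someC (kinds w) (miss x) (⇒kinds w x sx e)))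
        ... | inj₁ p with bool-em (miss x == proj₁ (someC⇒ (kinds w) p))
        ... | inj₁ q = ==-t q
        ... | inj₂ q = ⊥-elim (f≢t (not-t (∧-r {J w} d)) (⇒someC (λ c → kinds w c ∧ someC (λ d → kinds w d ∧ not (c == d))) (miss x)
                 (∧-i (⇒kinds w x sx e) (⇒someC (λ d → kinds w d ∧ not (miss x == d)) (proj₁ (someC⇒ (kinds w) p)) (∧-i (proj₂ (someC⇒ (kinds w) p)) (not-f q))))))
        f : V → Color
        f v = if D v then free v else colour κ v
        f-D : ∀ v → D v ≡ true → f v ≡ free v
        f-D v d rewrite d = refl
        f-n : ∀ v → D v ≡ false → f v ≡ colour κ v
        f-n v d rewrite d = refl
        al : ∀ v → S v ≡ true → L v (f v) ≡ true
        al v s with bool-em (D v)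
        ... | inj₁ d = full v s (∧-l d) (f v)
        ... | inj₂ d = subst (λ z → L v z ≡ true) (sym (f-n v d)) (allowed κ v (∧-i s (not-f d)))
        pr-D : ∀ w x → S w ≡ true → S x ≡ true → D w ≡ true → w ~ x → f w ≢ f x
        pr-D w x s sx d e q = f≢t (missing x sx (nbr w x s sx (∧-l d) e)) (subst (λ z → L x z ≡ true) (trans (sym q) (trans (f-D w d) (sym (free-ok w x s d sx e)))) (al x sx))
        pr : ∀ u v → S u ≡ true → S v ≡ true → u ~ v → f u ≢ f v
        pr u v s s' e with bool-em (D u) | bool-em (D v)
        ... | inj₁ d | _ = pr-D u v s s' d e
        ... | inj₂ _ | inj₁ d = λ q → pr-D v u s' s d (trans (sy v u) e) (sym q)
        ... | inj₂ d | inj₂ d' = λ q → proper κ u v (∧-i s (not-f d)) (∧-i s' (not-f d')) e (trans (sym (f-n u d)) (trans q (f-n v d')))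

-- Contracting pure components

-- A vertex, its partner and, for each colour, an obstruction among its neighbours outside `X`
-- together with three further witnesses.
contractFactor : ℕ
contractFactor = 2 + 3 * (joinBound + 3)

iff : Bool → Bool → Bool
iff a b = not (a xor b)
iff-t : ∀ {a b} → iff a b ≡ true → a ≡ b
iff-t {true} {true} _ = refl
iff-t {false} {false} _ = refl
⇒iff : ∀ {a b} → a ≡ b → iff a b ≡ true
⇒iff {true} refl = refl
⇒iff {false} refl = refl

module Graph6 (V : Set) (_≟_ : DecidableEquality V) (vs : List V) (complete : ∀ v → v ∈ vs)
             (adj : V → V → Bool) (sy : ∀ u v → adj u v ≡ adj v u) (irr : ∀ v → adj v v ≡ false) (noP6 : ¬ P6In adj) where
  open Framework V _≟_ vs complete adj public
  open Joins V _≟_ vs complete adj sy noP6 public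

  first : (V → Bool) → V → List V → V
  first P d [] = d
  first P d (x ∷ xs) = if P x then x else first P d xs

  first-ok : ∀ (P : V → Bool) (d : V) xs v → v ∈ xs → P v ≡ true → P (first P d xs) ≡ true
  first-ok P d (x ∷ xs) v i p with bool-em (P x)
  ... | inj₁ q rewrite q = q
  first-ok P d (x ∷ xs) v (here refl) p | inj₂ q = ⊥-elim (f≢t q p)
  first-ok P d (x ∷ xs) v (there i) p | inj₂ q rewrite q = first-ok P d xs v i p

  first-ext : ∀ (P Q : V → Bool) (d e : V) xs v → v ∈ xs → P v ≡ true → (∀ x → P x ≡ Q x) → first P d xs ≡ first Q e xs
  first-ext P Q d e (x ∷ xs) v i p h with bool-em (P x)
  ... | inj₁ q rewrite q | trans (sym (h x)) q = refl
  first-ext P Q d e (x ∷ xs) v (here refl) p h | inj₂ q = ⊥-elim (f≢t q p)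
  first-ext P Q d e (x ∷ xs) v (there i) p h | inj₂ q rewrite q | trans (sym (h x)) q = first-ext P Q d e xs v i p h

  opaque
    -- The choice depends only on the values of a satisfiable predicate, so vertices with equal
    -- neighbourhoods choose equal representatives.
    pick : (V → Bool) → V → V
    pick P d = first P d vs
    pick-ok : ∀ (P : V → Bool) (d : V) v → P v ≡ true → P (pick P d) ≡ true
    pick-ok P d v p = first-ok P d vs v (complete v) p
    pick-ext : ∀ (P Q : V → Bool) (d e : V) v → P v ≡ true → (∀ x → P x ≡ Q x) → pick P d ≡ pick Q e
    pick-ext P Q d e v p h = first-ext P Q d e vs v (complete v) p h

  opaque
    small-lists : ∀ S L → (∀ v → S v ≡ true → Σ Color λ m → L v m ≡ false) → Good joinBound S L
    small-lists S L h = joins S L (λ _ → false) ms (λ v s _ → ok v s) (λ _ _ ()) (λ _ _ _ _ ()) (λ _ _ _ _ _ _ ())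
      where
      ms : V → Color
      ms v with bool-em (S v)
      ... | inj₁ s = proj₁ (h v s)
      ... | inj₂ _ = c0
      ok : ∀ v → S v ≡ true → L v (ms v) ≡ false
      ok v s with bool-em (S v)
      ... | inj₁ s' = proj₂ (h v s')
      ... | inj₂ f = ⊥-elim (f≢t f s)

  -- Adjacent vertices r, r' outside X have the same neighbours in X, which are therefore monochromatic;
  -- so one representative per neighbourhood suffices, once each colour of x that its neighbours cannot
  -- extend is removed from the list of x.
  module Contraction (S : Live) (L : Lists) (X : V → Bool)
    (smallX : ∀ x → S x ≡ true → X x ≡ true → Σ Color λ m → L x m ≡ false)
    (pure : ∀ x w w' → S x ≡ true → S w ≡ true → S w' ≡ true → X x ≡ true → X w ≡ false → X w' ≡ false → w ~ w' → x ~ w → x ~ w')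
    (hasX : ∀ r → S r ≡ true → X r ≡ false → Σ V λ x → S x ≡ true × X x ≡ true × x ~ r) where

    inR inX : V → Bool
    inR v = S v ∧ not (X v)
    inX v = S v ∧ X v
    nbX : V → V → Bool
    nbX r x = inX x ∧ adj x r

    opaque
      partner : V → V → Bool
      partner r r' = inR r' ∧ adj r r'
      single : V → Bool
      single r = not (some (partner r))
      NS : V → Bool
      NS r = inR r ∧ not (single r)
      same : V → V → Bool
      same r r' = every (λ x → iff (nbX r x) (nbX r' x))
      x₀ ptn : V → V
      x₀ r = pick (nbX r) r
      ptn r = pick (partner r) r
      rep : V → V
      rep r = pick (λ r' → NS r' ∧ same r r') r
      isRep : V → Bool
      isRep r = eqb (rep r) r


      -- The neighbours of a nonsingle `r` in `X` share one colour, so `x` cannot use a colour that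
      -- another of them lacks.
      bad₂ : V → Color → Bool
      lacks : V → Color → V → Bool
      lacks r j x' = nbX r x' ∧ not (L x' j)
      block : V → Color → V → Bool
      block x j r = (NS r ∧ adj x r) ∧ some (lacks r j)
      bad₂ x j = some (block x j)

      lackC : V → Color → Bool
      lackC r j = some (lacks r j)
      -- A colour lacking at some neighbour of `r` in `X`, hence used by none of them, since they
      -- are monochromatic. Giving the representative the other two colours enforces in turn that
      -- they are monochromatic.
      α : V → Color
      α r with bool-em (someC (lackC r))
      ... | inj₁ p = proj₁ (someC⇒ (lackC r) p)
      ... | inj₂ _ = c0


      NS-live : ∀ {r} → NS r ≡ true → S r ≡ true
      NS-live p = ∧-l (∧-l p)
      NS-X : ∀ {r} → NS r ≡ true → X r ≡ false
      NS-X {r} p = not-t (∧-r {S r} (∧-l p))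
      NS-s : ∀ {r} → NS r ≡ true → single r ≡ false
      NS-s {r} p = not-t (∧-r {inR r} p)
      mkNS : ∀ {r} → S r ≡ true → X r ≡ false → single r ≡ false → NS r ≡ true
      mkNS s x n = ∧-i (∧-i s (not-f x)) (not-f n)

      α-ok : ∀ r → NS r ≡ true → lackC r (α r) ≡ true
      α-ok r p with bool-em (someC (lackC r))
      ... | inj₁ q = proj₂ (someC⇒ (lackC r) q)
      ... | inj₂ q = let (x , sx , xx , e) = hasX r (NS-live p) (NS-X p)
                         (m , f) = smallX x sx xx
                     in ⊥-elim (f≢t q (⇒someC (lackC r) m (⇒some (lacks r m) x (∧-i (∧-i (∧-i sx xx) e) (not-f f)))))

      ptn-ok : ∀ r → NS r ≡ true → (S (ptn r) ≡ true × X (ptn r) ≡ false) × r ~ ptn r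
      ptn-ok r p = let (v , q) = some⇒ (partner r) (h (NS-s {r} p))
                       z = pick-ok (partner r) r v q
                   in (∧-l (∧-l z) , not-t (∧-r {S (ptn r)} (∧-l z))) , ∧-r {inR (ptn r)} z
        where h : not (some (partner r)) ≡ false → some (partner r) ≡ true
              h e with bool-em (some (partner r))
              ... | inj₁ y = y
              ... | inj₂ y = ⊥-elim (f≢t e (not-f y))
      x₀-ok : ∀ r → S r ≡ true → X r ≡ false → (S (x₀ r) ≡ true × X (x₀ r) ≡ true) × x₀ r ~ r
      x₀-ok r s xf = let (x , sx , xx , e) = hasX r s xf
                         z = pick-ok (nbX r) r x (∧-i (∧-i sx xx) e)
                     in (∧-l (∧-l z) , ∧-r {S (x₀ r)} (∧-l z)) , ∧-r {inX (x₀ r)} z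

      edge-same : ∀ r r' → S r ≡ true → S r' ≡ true → X r ≡ false → X r' ≡ false → r ~ r' → ∀ x → nbX r x ≡ nbX r' x
      edge-same r r' s s' a b e x = bool-ext (λ p → ∧-i (∧-l p) (pure x r r' (∧-l (∧-l p)) s s' (∧-r {S x} (∧-l p)) a b e (∧-r {inX x} p)))
                                             (λ p → ∧-i (∧-l p) (pure x r' r (∧-l (∧-l p)) s' s (∧-r {S x} (∧-l p)) b a (trans (sy r' r) e) (∧-r {inX x} p)))
      same⇒ : ∀ r r' → same r r' ≡ true → ∀ x → nbX r x ≡ nbX r' x
      same⇒ r r' p x = iff-t (every⇒ (λ x → iff (nbX r x) (nbX r' x)) p x)
      ⇒same : ∀ r r' → (∀ x → nbX r x ≡ nbX r' x) → same r r' ≡ true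
      ⇒same r r' h = ⇒every (λ x → iff (nbX r x) (nbX r' x)) (λ x → ⇒iff (h x))

      rep-ok : ∀ r → NS r ≡ true → NS (rep r) ≡ true × (∀ x → nbX r x ≡ nbX (rep r) x)
      rep-ok r p = let z = pick-ok (λ r' → NS r' ∧ same r r') r r (∧-i p (⇒same r r (λ _ → refl)))
                   in ∧-l z , same⇒ r (rep r) (∧-r {NS (rep r)} z)
      rep-eq : ∀ r r' → NS r ≡ true → (∀ x → nbX r x ≡ nbX r' x) → rep r ≡ rep r'
      rep-eq r r' p h = pick-ext (λ q → NS q ∧ same r q) (λ q → NS q ∧ same r' q) r r' r (∧-i p (⇒same r r (λ _ → refl)))
         λ q → cong (NS q ∧_) (bool-ext (λ z → ⇒same r' q (λ x → trans (sym (h x)) (same⇒ r q z x))) (λ z → ⇒same r q (λ x → trans (h x) (same⇒ r' q z x))))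
      rep-rep : ∀ r → NS r ≡ true → isRep (rep r) ≡ true
      rep-rep r p = let (q , h) = rep-ok r p in subst (λ z → eqb z (rep r) ≡ true) (rep-eq r (rep r) p h) (eqb-refl (rep r))

      x₀-eq : ∀ u v → S u ≡ true → X u ≡ false → (∀ x → nbX u x ≡ nbX v x) → x₀ u ≡ x₀ v
      x₀-eq u v s xf h = let ((a , b) , e₀) = x₀-ok u s xf in pick-ext (nbX u) (nbX v) u v (x₀ u) (∧-i (∧-i a b) e₀) h
      isRep⇒ : ∀ r → isRep r ≡ true → rep r ≡ r
      isRep⇒ r p = eqb-t p
      partner-NS : ∀ r r' → S r ≡ true → S r' ≡ true → X r ≡ false → X r' ≡ false → r ~ r' → NS r ≡ true
      partner-NS r r' s s' a b e = mkNS s a (¬t⇒f λ p → f≢t (not-t p) (⇒some (partner r) r' (∧-i (∧-i s' (not-f b)) e)))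


      wit₂ : V → Color → List V
      wit₂ x j = let r = pick (block x j) x in r ∷ ptn r ∷ pick (lacks r j) x ∷ []
      wit₂-len : ∀ x j → length (wit₂ x j) ≤ 3
      wit₂-len x j = ≤-refl
      α-bad : ∀ r x → NS r ≡ true → x ~ r → bad₂ x (α r) ≡ true
      α-bad r x p e = ⇒some (block x (α r)) r (∧-i (∧-i p e) (α-ok r p))
      bad₂-wit : ∀ x j → bad₂ x j ≡ true → Σ V λ r → Σ V λ x' → (NS r ≡ true × x ~ r) × (nbX r x' ≡ true × L x' j ≡ false) × (r ∈ wit₂ x j × (ptn r ∈ wit₂ x j × x' ∈ wit₂ x j))
      bad₂-wit x j q = r , x' , (∧-l (∧-l {NS r ∧ adj x r} z) , ∧-r {NS r} (∧-l {NS r ∧ adj x r} z)) , (∧-l z' , not-t (∧-r {nbX r x'} z')) , (here refl , (there (here refl) , there (there (here refl))))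
        where
        r : V
        r = pick (block x j) x
        x' : V
        x' = pick (lacks r j) x
        z : block x j r ≡ true
        z = let (r₀ , p) = some⇒ (block x j) q in pick-ok (block x j) x r₀ p
        z' : lacks r j x' ≡ true
        z' = let (x₁ , p) = some⇒ (lacks r j) (∧-r {NS r ∧ adj x r} z) in pick-ok (lacks r j) x x₁ p

    drop : Color → Lists
    drop j v c = L v c ∧ not (c == j)
    -- Once `x` has colour `j`, the lists of its neighbours outside `X` miss `j`, and for such lists
    -- colourability is already known to be decided by bounded obstructions.
    res : ∀ x j → Good joinBound (λ r → inR r ∧ adj x r) (drop j)
    res x j = small-lists _ _ (λ v _ → j , ¬t⇒f λ p → f≢t (not-t (∧-r {L v j} p)) (==-refl j))
    isObs : ∀ {A B : Set} → A ⊎ B → Bool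
    isObs (inj₁ _) = false
    isObs (inj₂ _) = true
    obsList : ∀ {m S L} → Good m S L → List V
    obsList (inj₁ _) = []
    obsList (inj₂ (B , _)) = B
    obsList-len : ∀ {m S L} (g : Good m S L) → length (obsList g) ≤ m
    obsList-len (inj₁ _) = z≤n
    obsList-len (inj₂ (B , l , _)) = l
    obs-bad : ∀ {m S L} (g : Good m S L) → isObs g ≡ true → ¬ Col (On (obsList g) S) L
    obs-bad (inj₂ (B , l , n)) _ = n
    colOf : ∀ {m S L} → Good m S L → V → Color
    colOf (inj₁ κ) = colour κ
    colOf (inj₂ _) _ = c0
    col-al : ∀ {m S L} (g : Good m S L) → isObs g ≡ false → ∀ v → S v ≡ true → L v (colOf g v) ≡ true
    col-al (inj₁ κ) _ = allowed κ
    col-pr : ∀ {m S L} (g : Good m S L) → isObs g ≡ false → ∀ u v → S u ≡ true → S v ≡ true → u ~ v → colOf g u ≢ colOf g v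
    col-pr (inj₁ κ) _ = proper κ

    bad₁ : V → Color → Bool
    bad₁ x j = isObs (res x j)

    S' : Live
    S' v = S v ∧ (X v ∨ (single v ∨ isRep v))
    L' : Lists
    L' v j = if X v then L v j ∧ (not (bad₁ v j) ∧ not (bad₂ v j)) else (if single v then L v j else not (j == α v))

    L'-X : ∀ v j → X v ≡ true → L' v j ≡ L v j ∧ (not (bad₁ v j) ∧ not (bad₂ v j))
    L'-X v j x rewrite x = refl
    L'-s : ∀ v j → X v ≡ false → single v ≡ true → L' v j ≡ L v j
    L'-s v j x s rewrite x | s = refl
    L'-r : ∀ v j → X v ≡ false → single v ≡ false → L' v j ≡ not (j == α v)
    L'-r v j x s rewrite x | s = refl

    indep : ∀ u v → S' u ≡ true → S' v ≡ true → X u ≡ false → X v ≡ false → u ≁ v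
    indep u v su sv a b = ¬t⇒f λ e →
      let pu = partner-NS u v (∧-l su) (∧-l sv) a b e
          pv = partner-NS v u (∧-l sv) (∧-l su) b a (trans (sy v u) e)
          ru = isrep u su a (NS-s {u} pu)
          rv = isrep v sv b (NS-s {v} pv)
          eq = trans (sym (isRep⇒ u ru)) (trans (rep-eq u v pu (edge-same u v (∧-l su) (∧-l sv) a b e)) (isRep⇒ v rv))
      in f≢t (irr v) (subst (λ z → z ~ v) eq e)
      where
      isrep : ∀ v → S' v ≡ true → X v ≡ false → single v ≡ false → isRep v ≡ true
      isrep v s x n with ∨-e {X v} (∧-r {S v} s)
      ... | inj₁ p = ⊥-elim (f≢t x p)
      ... | inj₂ p with ∨-e {single v} p
      ... | inj₁ q = ⊥-elim (f≢t n q)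
      ... | inj₂ q = q

    α-gone : ∀ r x → NS r ≡ true → S x ≡ true → X x ≡ true → x ~ r → L' x (α r) ≡ false
    α-gone r x p sx xx e = ¬t⇒f λ q → f≢t (not-t (∧-r {not (bad₁ x (α r))} (∧-r {L x (α r)} (trans (sym (L'-X x (α r) xx)) q))))
        (α-bad r x p e)

    -- A contracted vertex `v` is coloured by the colouring stored for `x₀ v` and its colour.
    -- Adjacent contracted vertices have the same `x₀`, so they use the same stored colouring.
    up : Col (Is S') L' → Col (Is S) L
    up κ = mkCol g al pr
      where
      f = colour κ
      plain : V → Bool
      plain v = X v ∨ single v
      g : V → Color
      g v = if plain v then f v else colOf (res (x₀ v) (f (x₀ v))) v
      g-p : ∀ v → plain v ≡ true → g v ≡ f v
      g-p v p rewrite p = refl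
      g-n : ∀ v → plain v ≡ false → g v ≡ colOf (res (x₀ v) (f (x₀ v))) v
      g-n v p rewrite p = refl
      nX : ∀ v → plain v ≡ false → X v ≡ false
      nX v p = ¬t⇒f λ x → f≢t p (∨-il x)
      nS : ∀ v → plain v ≡ false → single v ≡ false
      nS v p = ¬t⇒f λ x → f≢t p (∨-ir {X v} x)
      inS' : ∀ v → S v ≡ true → plain v ≡ true → S' v ≡ true
      inS' v s p with ∨-e {X v} p
      ... | inj₁ q = ∧-i s (∨-il q)
      ... | inj₂ q = ∧-i s (∨-ir {X v} (∨-il q))
      inX' : ∀ v → S v ≡ true → X v ≡ true → S' v ≡ true
      inX' v s q = ∧-i s (∨-il q)
      okL : ∀ v → S v ≡ true → X v ≡ true → L v (f v) ∧ (not (bad₁ v (f v)) ∧ not (bad₂ v (f v))) ≡ true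
      okL v s x = trans (sym (L'-X v (f v) x)) (allowed κ v (inX' v s x))
      good₀ : ∀ v → S v ≡ true → plain v ≡ false → isObs (res (x₀ v) (f (x₀ v))) ≡ false
      good₀ v s p = let ((a , b) , _) = x₀-ok v s (nX v p) in not-t (∧-l (∧-r {L (x₀ v) (f (x₀ v))} (okL (x₀ v) a b)))
      in₀ : ∀ v → S v ≡ true → plain v ≡ false → inR v ∧ adj (x₀ v) v ≡ true
      in₀ v s p = ∧-i (∧-i s (not-f (nX v p))) (proj₂ (x₀-ok v s (nX v p)))
      al : ∀ v → S v ≡ true → L v (g v) ≡ true
      al v s with bool-em (plain v)
      ... | inj₂ p = subst (λ z → L v z ≡ true) (sym (g-n v p)) (∧-l (col-al (res (x₀ v) (f (x₀ v))) (good₀ v s p) v (in₀ v s p)))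
      ... | inj₁ p with bool-em (X v)
      ... | inj₁ x = subst (λ z → L v z ≡ true) (sym (g-p v p)) (∧-l (okL v s x))
      ... | inj₂ x with ∨-e {X v} p
      ... | inj₁ x' = ⊥-elim (f≢t x x')
      ... | inj₂ si = subst (λ z → L v z ≡ true) (sym (g-p v p)) (trans (sym (L'-s v (f v) x si)) (allowed κ v (inS' v s p)))
      mono : ∀ r x x' → NS r ≡ true → nbX r x ≡ true → nbX r x' ≡ true → f x ≡ f x'
      mono r x x' p q q' = third-of-two {α ρ} {f ρ} (λ z → f≢t (not-t okρ) (subst (λ y → (y == α ρ) ≡ true) z (==-refl (α ρ))))
           (av x qx) (pr' x qx) (av x' qx') (pr' x' qx')
        where
        ρ = rep r
        pρ = proj₁ (rep-ok r p)
        qx = trans (sym (proj₂ (rep-ok r p) x)) q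
        qx' = trans (sym (proj₂ (rep-ok r p) x')) q'
        inρ : S' ρ ≡ true
        inρ = ∧-i (NS-live pρ) (∨-ir {X ρ} (∨-ir {single ρ} (rep-rep r p)))
        okρ : not (f ρ == α ρ) ≡ true
        okρ = trans (sym (L'-r ρ (f ρ) (NS-X pρ) (NS-s pρ))) (allowed κ ρ inρ)
        av : ∀ x → nbX ρ x ≡ true → f x ≢ α ρ
        av x qx e = f≢t (α-gone ρ x pρ (∧-l (∧-l qx)) (∧-r {S x} (∧-l qx)) (∧-r {inX x} qx)) (subst (λ z → L' x z ≡ true) e (allowed κ x (inX' x (∧-l (∧-l qx)) (∧-r {S x} (∧-l qx)))))
        pr' : ∀ x → nbX ρ x ≡ true → f x ≢ f ρ
        pr' x qx = proper κ x ρ (inX' x (∧-l (∧-l qx)) (∧-r {S x} (∧-l qx))) inρ (∧-r {inX x} qx)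
      nsOf : ∀ v → S v ≡ true → plain v ≡ false → NS v ≡ true
      nsOf v s p = mkNS s (nX v p) (nS v p)
      half : ∀ u v → S u ≡ true → S v ≡ true → plain u ≡ true → plain v ≡ false → u ~ v → g u ≢ g v
      half u v s s' p p' e q with bool-em (X u)
      ... | inj₁ x = let ((a , b) , e₀) = x₀-ok v s' (nX v p')
                         eq = mono v u (x₀ v) (nsOf v s' p') (∧-i (∧-i s x) e) (∧-i (∧-i a b) e₀)
                         ok = col-al (res (x₀ v) (f (x₀ v))) (good₀ v s' p') v (in₀ v s' p')
                         q' = trans (sym eq) (trans (sym (g-p u p)) (trans q (g-n v p')))
                     in f≢t (not-t (∧-r {L v (colOf (res (x₀ v) (f (x₀ v))) v)} ok)) (subst (λ z → (z == f (x₀ v)) ≡ true) q' (==-refl (f (x₀ v))))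
      ... | inj₂ x with ∨-e {X u} p
      ... | inj₁ x' = f≢t x x'
      ... | inj₂ si = f≢t (NS-s {u} (partner-NS u v s s' x (nX v p') e)) si
      pr : ∀ u v → S u ≡ true → S v ≡ true → u ~ v → g u ≢ g v
      pr u v s s' e with bool-em (plain u) | bool-em (plain v)
      ... | inj₁ p | inj₁ p' = λ q → proper κ u v (inS' u s p) (inS' v s' p') e (trans (sym (g-p u p)) (trans q (g-p v p')))
      ... | inj₁ p | inj₂ p' = half u v s s' p p' e
      ... | inj₂ p | inj₁ p' = λ q → half v u s' s p' p (trans (sy v u) e) (sym q)
      ... | inj₂ p | inj₂ p' = λ q → col-pr (res (x₀ u) (f (x₀ u))) (good₀ u s p) u v (in₀ u s p) (subst (λ z → inR v ∧ adj z v ≡ true) (sym x₀eq) (in₀ v s' p')) e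
              (trans (sym (g-n u p)) (trans q (trans (g-n v p') (cong (λ z → colOf (res z (f z)) v) (sym x₀eq)))))
        where
        x₀eq : x₀ u ≡ x₀ v
        x₀eq = x₀-eq u v s (nX u p) (edge-same u v s s' (nX u p) (nX v p') e)

    cert : V → Color → List V
    cert x j = obsList (res x j) ++ wit₂ x j
    cert-len : ∀ x j → length (cert x j) ≤ joinBound + 3
    cert-len x j = ≤-trans (≤-reflexive (length-++ (obsList (res x j)))) (+-mono-≤ (obsList-len (res x j)) (wit₂-len x j))
    W : V → List V
    W v = v ∷ ptn v ∷ cert v c0 ++ (cert v c1 ++ (cert v c2 ++ []))
    W-len : ∀ v → length (W v) ≤ contractFactor
    W-len v = s≤s (s≤s (≤-trans (≤-reflexive (length-++ (cert v c0))) (+-mono-≤ (cert-len v c0) (≤-trans (≤-reflexive (length-++ (cert v c1))) (+-mono-≤ (cert-len v c1) (≤-trans (≤-reflexive (length-++ (cert v c2))) (+-mono-≤ (cert-len v c2) z≤n)))))))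
    W-cert : ∀ v j {y} → y ∈ cert v j → y ∈ W v
    W-cert v c0 i = there (there (∈-++⁺ˡ i))
    W-cert v c1 i = there (there (∈-++⁺ʳ (cert v c0) (∈-++⁺ˡ i)))
    W-cert v c2 i = there (there (∈-++⁺ʳ (cert v c0) (∈-++⁺ʳ (cert v c1) (∈-++⁺ˡ i))))

    -- The adjacent vertices `v` and `ptn v` determine the colour of all their common neighbours in
    -- `X`; the representative avoids this colour and `α v`.
    down : ∀ B → Col (On (concatMap W B) S) L → Col (On B S') L'
    down B κ = mkCol g al pr
      where
      f = colour κ
      plain : V → Bool
      plain v = X v ∨ single v
      g : V → Color
      g v = if plain v then f v else third (α v) (third (f v) (f (ptn v)))
      g-p : ∀ v → plain v ≡ true → g v ≡ f v
      g-p v p rewrite p = refl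
      g-n : ∀ v → plain v ≡ false → g v ≡ third (α v) (third (f v) (f (ptn v)))
      g-n v p rewrite p = refl
      nX : ∀ v → plain v ≡ false → X v ≡ false
      nX v p = ¬t⇒f λ x → f≢t p (∨-il x)
      nS : ∀ v → plain v ≡ false → single v ≡ false
      nS v p = ¬t⇒f λ x → f≢t p (∨-ir {X v} x)
      at0 : ∀ {v} → On B S' v → On (concatMap W B) S v
      at0 (i , s) = ∈-concatMap W i (here refl) , ∧-l s
      atC : ∀ {v} j {y} → On B S' v → y ∈ cert v j → S y ≡ true → On (concatMap W B) S y
      atC {v} j (i , _) m s = ∈-concatMap W i (W-cert v j m) , s
      squeeze : ∀ {r r' x x'} → On (concatMap W B) S r → On (concatMap W B) S r' → On (concatMap W B) S x → On (concatMap W B) S x' →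
        r ~ r' → x ~ r → x ~ r' → x' ~ r → x' ~ r' → f x ≡ f x'
      squeeze pr pr' px px' e a b a' b' = third-of-two (proper κ _ _ pr pr' e) (proper κ _ _ px pr a) (proper κ _ _ px pr' b) (proper κ _ _ px' pr a') (proper κ _ _ px' pr' b')
      ptnX : ∀ r → NS r ≡ true → ∀ x → nbX r x ≡ true → x ~ ptn r
      ptnX r p x q = let ((a , b) , e) = ptn-ok r p in ∧-r {inX x} (trans (sym (edge-same r (ptn r) (NS-live p) a (NS-X p) b e x)) q)
      okX : ∀ x → On B S' x → X x ≡ true → L' x (f x) ≡ true
      okX x p xx = trans (L'-X x (f x) xx) (∧-i (allowed κ x (at0 p)) (∧-i (not-f (¬t⇒f b₁)) (not-f (¬t⇒f b₂))))
        where
        j = f x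
        b₁ : bad₁ x j ≡ true → ⊥
        b₁ q = obs-bad (res x j) q (mkCol f
             (λ v (i , s) → let pv = atC j p (∈-++⁺ˡ i) (∧-l (∧-l s)) in
                ∧-i (allowed κ v pv) (not-f (==-f λ e → proper κ x v (at0 p) pv (∧-r {inR v} s) (sym e))))
             (λ u v (i , s) (i' , s') → proper κ u v (atC j p (∈-++⁺ˡ i) (∧-l (∧-l s))) (atC j p (∈-++⁺ˡ i') (∧-l (∧-l s')))))
        b₂ : bad₂ x j ≡ true → ⊥
        b₂ q with bad₂-wit x j q
        ... | r , x' , (p' , e) , (nx' , lf) , (ir , ip , ix) = f≢t lf (subst (λ y → L x' y ≡ true) (sym eq) (allowed κ x' px'))
          where
          nx : nbX r x ≡ true
          nx = ∧-i (∧-i (∧-l (proj₂ p)) xx) e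
          pt = ptn-ok r p'
          in' : ∀ {y} → y ∈ wit₂ x j → S y ≡ true → On (concatMap W B) S y
          in' i = atC j p (∈-++⁺ʳ (obsList (res x j)) i)
          px' : On (concatMap W B) S x'
          px' = in' ix (∧-l (∧-l nx'))
          eq : j ≡ f x'
          eq = squeeze (in' ir (NS-live p')) (in' ip (proj₁ (proj₁ pt))) (at0 p) px' (proj₂ pt) e (ptnX r p' x nx) (∧-r {inX x'} nx') (ptnX r p' x' nx')
      al : ∀ v → On B S' v → L' v (g v) ≡ true
      al v p with bool-em (plain v)
      ... | inj₂ q = trans (L'-r v (g v) (nX v q) (nS v q)) (not-f (==-f λ e → third≢l (α v) _ (trans (sym (g-n v q)) e)))
      ... | inj₁ q with bool-em (X v)
      ... | inj₁ x = subst (λ z → L' v z ≡ true) (sym (g-p v q)) (okX v p x)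
      ... | inj₂ x with ∨-e {X v} q
      ... | inj₁ x' = ⊥-elim (f≢t x x')
      ... | inj₂ si = subst (λ z → L' v z ≡ true) (sym (g-p v q)) (trans (L'-s v (f v) x si) (allowed κ v (at0 p)))
      half : ∀ u v → On B S' u → On B S' v → plain u ≡ true → plain v ≡ false → u ~ v → g u ≢ g v
      half u v p p' q q' e eq with bool-em (X u)
      ... | inj₂ x = f≢t (indep u v (proj₂ p) (proj₂ p') x (nX v q')) e
      ... | inj₁ x = third≢r (α v) (third (f v) (f (ptn v))) (trans (sym (g-n v q')) (trans (sym eq) (trans (g-p u q) fu)))
        where
        pv = mkNS (∧-l (proj₂ p')) (nX v q') (nS v q')
        pt = ptn-ok v pv
        inPtn = ∈-concatMap W (proj₁ p') (there (here refl)) , proj₁ (proj₁ pt)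
        fu : f u ≡ third (f v) (f (ptn v))
        fu = third-unique _ _ _ (proper κ v (ptn v) (at0 p') inPtn (proj₂ pt)) (proper κ u v (at0 p) (at0 p') e)
               (proper κ u (ptn v) (at0 p) inPtn (ptnX v pv u (∧-i (∧-i (∧-l (proj₂ p)) x) e)))
      pr : ∀ u v → On B S' u → On B S' v → u ~ v → g u ≢ g v
      pr u v p p' e with bool-em (plain u) | bool-em (plain v)
      ... | inj₁ q | inj₁ q' = λ z → proper κ u v (at0 p) (at0 p') e (trans (sym (g-p u q)) (trans z (g-p v q')))
      ... | inj₁ q | inj₂ q' = half u v p p' q q' e
      ... | inj₂ q | inj₁ q' = λ z → half v u p' p q' q (trans (sy v u) e) (sym z)
      ... | inj₂ q | inj₂ q' = ⊥-elim (f≢t (indep u v (proj₂ p) (proj₂ p') (nX u q) (nX v q')) e)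

    contract : ∀ {m} → Good m S' L' → Good (m * contractFactor) S L
    contract = reduce contractFactor W W-len up down

-- Vertices with full lists

-- Each kind of configuration costs one simultaneous branching, with one more vertex branched on in
-- the case of a single literal.
killBound : ℕ → ℕ → ℕ
killBound zero m = m
killBound (suc k) m = literalBound (killBound k m) (branch1 (killBound k m))

killBound-mono : ∀ {k k'} m → k ≤ k' → killBound k m ≤ killBound k' m
killBound-mono {zero} {zero} m _ = ≤-refl
killBound-mono {zero} {suc k'} m _ = ≤-trans (killBound-mono {zero} {k'} m z≤n) (≤literalBound _ _)
killBound-mono {suc k} {suc k'} m (s≤s l) = literalBound-mono h (literalBound-mono {1} ≤-refl h)
  where h = killBound-mono {k} {k'} m l

-- A pair `a`, `b` of vertices of `T`, and either no `p` or one of `ℓ` choices for it.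
comboCount : ℕ → ℕ
comboCount ℓ = ℓ * (ℓ * suc ℓ)

opaque
  comboBound : ℕ → ℕ
  comboBound ℓ = killBound (comboCount ℓ) (joinBound * 4 * 4)

  comboBound-mono : ∀ {ℓ ℓ'} → ℓ ≤ ℓ' → comboBound ℓ ≤ comboBound ℓ'
  comboBound-mono l = killBound-mono _ (*-mono-≤ l (*-mono-≤ l (s≤s l)))

  comboBound-kill : ∀ {k} ℓ → k ≤ comboCount ℓ → killBound k (joinBound * 4 * 4) ≤ comboBound ℓ
  comboBound-kill ℓ l = killBound-mono _ l

module Combos (V : Set) (_≟_ : DecidableEquality V) (vs : List V) (complete : ∀ v → v ∈ vs)
             (adj : V → V → Bool) (sy : ∀ u v → adj u v ≡ adj v u) (irr : ∀ v → adj v v ≡ false) (noP6 : ¬ P6In adj) where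
  open Graph6 V _≟_ vs complete adj sy irr noP6 public

  onlyC : Lists → Color → V → Bool
  onlyC L c u = everyC (λ d → not (L u d) ∨ (d == c))
  ⇒only : ∀ L c u → (∀ d → L u d ≡ true → d ≡ c) → onlyC L c u ≡ true
  ⇒only L c u h = ⇒everyC _ each
    where
    each : ∀ d → not (L u d) ∨ (d == c) ≡ true
    each d with bool-em (L u d)
    ... | inj₂ f = ∨-il (not-f f)
    ... | inj₁ t = ∨-ir {not (L u d)} (subst (λ z → (d == z) ≡ true) (h d t) (==-refl d))
  only⇒ : ∀ L c u → onlyC L c u ≡ true → ∀ d → L u d ≡ true → d ≡ c
  only⇒ L c u p d l with ∨-e {not (L u d)} (everyC⇒ (λ d → not (L u d) ∨ (d == c)) p d)
  ... | inj₁ q = ⊥-elim (f≢t (not-t q) l)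
  ... | inj₂ q = ==-t q

  module Prop (S : Live) where
    forcer : Lists → V → Color → V → Bool
    forcer L v c u = (S u ∧ adj u v) ∧ onlyC L c u
    opaque
      -- One simultaneous round of propagation from vertices with at most one colour, which stay
      -- live. It costs the factor 4: a vertex and one forcing neighbour per colour.
      prop : Lists → Lists
      prop L v c = L v c ∧ not (some (forcer L v c))
      prop⊆ : ∀ L → prop L ⊆L L
      prop⊆ L v c p = ∧-l p
      prop-no : ∀ L v c u → S u ≡ true → u ~ v → (∀ d → L u d ≡ true → d ≡ c) → prop L v c ≡ false
      prop-no L v c u s e h = ¬t⇒f λ p → f≢t (not-t (∧-r {L v c} p)) (⇒some (forcer L v c) u (∧-i (∧-i s e) (⇒only L c u h)))
      prop-mono : ∀ L L' → L ⊆L L' → prop L ⊆L prop L'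
      prop-mono L L' h v c p = ∧-i (h v c (∧-l p)) (not-f (¬t⇒f λ q → let (u , z) = some⇒ (forcer L' v c) q in
         f≢t (not-t (∧-r {L v c} p)) (⇒some (forcer L v c) u (∧-i (∧-l z) (⇒only L c u λ d l → only⇒ L' c u (∧-r {S u ∧ adj u v} z) d (h u d l))))))
      prop-good : ∀ {m} L → Good m S (prop L) → Good (m * 4) S L
      prop-good L = reduce 4 W (λ _ → ≤-refl) (col-mono (λ _ p → p) (prop⊆ L)) down
        where
        wit : V → Color → V
        wit v c = pick (forcer L v c) v
        W : V → List V
        W v = v ∷ wit v c0 ∷ wit v c1 ∷ wit v c2 ∷ []
        inW : ∀ v c → wit v c ∈ W v
        inW v c0 = there (here refl)
        inW v c1 = there (there (here refl))
        inW v c2 = there (there (there (here refl)))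
        down : ∀ B → Col (On (concatMap W B) S) L → Col (On B S) (prop L)
        down B κ = mkCol (colour κ) al (λ u v (i , s) (i' , s') → proper κ u v (∈-concatMap W i (here refl) , s) (∈-concatMap W i' (here refl) , s'))
          where
          al : ∀ v → On B S v → prop L v (colour κ v) ≡ true
          al v (i , s) = ∧-i (allowed κ v pv) (not-f (¬t⇒f bad))
            where
            pv : On (concatMap W B) S v
            pv = ∈-concatMap W i (here refl) , s
            c : Color
            c = colour κ v
            bad : some (forcer L v c) ≡ true → ⊥
            bad q = let (u₀ , z₀) = some⇒ (forcer L v c) q
                        z = pick-ok (forcer L v c) v u₀ z₀
                        pu = ∈-concatMap W i (inW v c) , ∧-l (∧-l z)
                    in proper κ (wit v c) v pu pv (∧-r {S (wit v c)} (∧-l {S (wit v c) ∧ adj (wit v c) v} z)) (only⇒ L c (wit v c) (∧-r {S (wit v c) ∧ adj (wit v c) v} z) _ (allowed κ (wit v c) pu))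

  -- Neighbours a, b in T of two nonadjacent neighbours x, y of a vertex with full list: either a ≁ b, or
  -- p is a neighbour of b in T that x misses.
  record Combo : Set where
    constructor mkCombo
    field
      a b : V
      p : Maybe V

  module Singles (S : Live) (X : V → Bool) (T : List V) (cT : V → Color)
    (proper-T : ∀ t t' → t ∈ T → t' ∈ T → t ~ t' → cT t ≢ cT t')
    (mono-T : ∀ x t t' → S x ≡ true → t ∈ T → t' ∈ T → x ~ t → x ~ t' → cT t ≡ cT t')
    (near : ∀ x → S x ≡ true → X x ≡ true → Σ V λ t → t ∈ T × x ~ t)
    (far : ∀ w t → S w ≡ true → X w ≡ false → t ∈ T → w ≁ t)
    (indep : ∀ u v → S u ≡ true → S v ≡ true → X u ≡ false → X v ≡ false → u ≁ v)
    (separate : ∀ x y t t' → S x ≡ true → S y ≡ true → t ∈ T → t' ∈ T → x ~ t → y ~ t' → cT t ≢ cT t' →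
       (Σ V λ a → Σ V λ b → (a ∈ T × b ∈ T) × (x ~ a × y ~ b) × (cT a ≢ cT b × a ≁ b))
     ⊎ ((Σ V λ a → Σ V λ b → Σ V λ p → (a ∈ T × b ∈ T × p ∈ T) × (x ~ a × y ~ b) × (cT a ≢ cT b × p ~ b × x ≁ p))
     ⊎  (Σ V λ a → Σ V λ b → Σ V λ p → (a ∈ T × b ∈ T × p ∈ T) × (x ~ a × y ~ b) × (cT a ≢ cT b × p ~ a × y ≁ p))))
    where
    open Prop S

    List-ok : Lists → Set
    List-ok L = ∀ x t → S x ≡ true → t ∈ T → x ~ t → L x (cT t) ≡ false

    -- The second round reads off the first: if it removes nothing from `w`, then after the first
    -- round each neighbour of `w` that sees `T` still has two colours (`keeps`).
    Open : Lists → V → Set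
    Open L w = ∀ c → prop (prop L) w c ≡ true
    openB : Lists → V → Bool
    openB L w = everyC (prop (prop L) w)

    avoids : Maybe V → V → Bool
    avoids nothing x = true
    avoids (just p) x = not (adj x p)

    record Tri (L : Lists) (k : Combo) (w x y : V) : Set where
      field
        sw : S w ≡ true
        nw : X w ≡ false
        sx : S x ≡ true
        xx : X x ≡ true
        sy' : S y ≡ true
        xy : X y ≡ true
        wx : w ~ x
        wy : w ~ y
        xny : x ≁ y
        xa : x ~ Combo.a k
        yb : y ~ Combo.b k
        av : avoids (Combo.p k) x ≡ true
        op : Open L w

    opaque
      tri : Lists → Combo → V → V → V → Bool
      tri L (mkCombo a b p) w x y = (((S w ∧ not (X w)) ∧ ((S x ∧ X x) ∧ (S y ∧ X y))) ∧ ((adj w x ∧ adj w y) ∧ not (adj x y))) ∧ (((adj x a ∧ adj y b) ∧ avoids p x) ∧ openB L w)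

      tri⇒ : ∀ L k w x y → tri L k w x y ≡ true → Tri L k w x y
      tri⇒ L (mkCombo a b p) w x y q = record { sw = ∧-l (∧-l q₁) ; nw = not-t (∧-r {S w} (∧-l q₁)) ; sx = ∧-l (∧-l q₂) ; xx = ∧-r {S x} (∧-l q₂) ; sy' = ∧-l (∧-r {S x ∧ X x} q₂) ; xy = ∧-r {S y} (∧-r {S x ∧ X x} q₂)
             ; wx = ∧-l (∧-l q₃) ; wy = ∧-r {adj w x} (∧-l q₃) ; xny = not-t (∧-r {adj w x ∧ adj w y} q₃) ; xa = ∧-l (∧-l (∧-l q₄)) ; yb = ∧-r {adj x a} (∧-l (∧-l q₄)) ; av = ∧-r {adj x a ∧ adj y b} (∧-l q₄)
             ; op = everyC⇒ (prop (prop L) w) (∧-r {(adj x a ∧ adj y b) ∧ avoids p x} q₄) }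
        where
        A B C D : Bool
        A = (S w ∧ not (X w)) ∧ ((S x ∧ X x) ∧ (S y ∧ X y))
        B = (adj w x ∧ adj w y) ∧ not (adj x y)
        C = ((adj x a ∧ adj y b) ∧ avoids p x) ∧ openB L w
        D = A ∧ B
        q₁ : A ≡ true
        q₁ = ∧-l (∧-l {D} q)
        q₂ : (S x ∧ X x) ∧ (S y ∧ X y) ≡ true
        q₂ = ∧-r {S w ∧ not (X w)} q₁
        q₃ : B ≡ true
        q₃ = ∧-r {A} (∧-l {D} q)
        q₄ : C ≡ true
        q₄ = ∧-r {D} q
      ⇒tri : ∀ L k w x y → Tri L k w x y → tri L k w x y ≡ true
      ⇒tri L (mkCombo a b p) w x y t = ∧-i (∧-i (∧-i (∧-i sw (not-f nw)) (∧-i (∧-i sx xx) (∧-i sy' xy))) (∧-i (∧-i wx wy) (not-f xny))) (∧-i (∧-i (∧-i xa yb) av) (⇒everyC (prop (prop L) w) op))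
        where open Tri t

    Dead : Lists → Combo → Set
    Dead L k = ∀ w x y → Tri L k w x y → ⊥

    open-mono : ∀ {L L'} → L' ⊆L L → ∀ w → Open L' w → Open L w
    open-mono {L} {L'} h w o c = prop-mono (prop L') (prop L) (prop-mono L' L h) w c (o c)

    tri-mono : ∀ {L L' k w x y} → L' ⊆L L → Tri L' k w x y → Tri L k w x y
    tri-mono {w = w} h t = record { sw = sw ; nw = nw ; sx = sx ; xx = xx ; sy' = sy' ; xy = xy ; wx = wx ; wy = wy ; xny = xny ; xa = xa ; yb = yb ; av = av ; op = open-mono h w op }
      where open Tri t

    Valid : Combo → Set
    Valid (mkCombo a b nothing) = (a ∈ T × b ∈ T) × cT a ≢ cT b × a ≁ b
    Valid (mkCombo a b (just p)) = (a ∈ T × b ∈ T) × cT a ≢ cT b × (p ∈ T × p ~ b)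

    valid-T : ∀ k → Valid k → (Combo.a k ∈ T × Combo.b k ∈ T) × cT (Combo.a k) ≢ cT (Combo.b k)
    valid-T (mkCombo a b nothing) (i , d , _) = i , d
    valid-T (mkCombo a b (just p)) (i , d , _) = i , d

    keeps : ∀ {L} → List-ok L → ∀ w u t → Open L w → S u ≡ true → w ~ u → t ∈ T → u ~ t → ∀ c → c ≢ cT t → prop L u c ≡ true
    keeps {L} ok w u t o su e it ut c ne with bool-em (prop L u c)
    ... | inj₁ p = p
    ... | inj₂ p = ⊥-elim (f≢t (prop-no (prop L) w d u su (trans (sy u w) e) h) (o d))
      where
      d : Color
      d = third (cT t) c
      h : ∀ d' → prop L u d' ≡ true → d' ≡ d
      h d' q = third-unique _ _ _ (λ z → ne (sym z)) (λ z → f≢t (ok u t su it ut) (subst (λ y → L u y ≡ true) z (prop⊆ L u d' q))) (λ z → f≢t p (subst (λ y → prop L u y ≡ true) z q))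

    apart : ∀ {L} u c v → S v ≡ true → prop L u c ≡ true → (∀ d → L v d ≡ true → d ≡ c) → u ≁ v
    apart {L} u c v sv p h = ¬t⇒f λ e → f≢t (prop-no L u c v sv (trans (sy v u) e) h) p

    -- `s` is the one colour available to both `x` and `y`. If no such `y` may take `s`, each is
    -- forced to the colour of `a`, and `w` is not open. Otherwise some `y₁` takes `s` and the
    -- colour of its `x₁` is fixed too; in a further configuration `w` and `x` then avoid both
    -- vertices and `y` avoids `y₁`, which gives a P6.
    module Kill (k : Combo) (val : Valid k) (L : Lists) (ok : List-ok L) where
      open Combo k
      ia = proj₁ (proj₁ (valid-T k val))
      ib = proj₂ (proj₁ (valid-T k val))
      ab = proj₂ (valid-T k val)
      s : Color
      s = third (cT a) (cT b)
      witY : V → V → Bool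
      witY y w = some (λ x → tri L k w x y)
      occurs : V → Bool
      occurs y = some (witY y)
      occurs⇒ : ∀ y → occurs y ≡ true → Σ V λ w → Σ V λ x → Tri L k w x y
      occurs⇒ y p = let (w , q) = some⇒ (witY y) p
                        (x , r) = some⇒ (λ x → tri L k w x y) q in w , x , tri⇒ L k w x y r
      ⇒occurs : ∀ w x y → Tri L k w x y → occurs y ≡ true
      ⇒occurs w x y t = ⇒some (witY y) w (⇒some (λ x → tri L k w x y) x (⇒tri L k w x y t))

      R : V → Color → Bool
      R y c = occurs y ∧ (c == s)

      dead-minus : Dead (minus L R) k
      dead-minus w x y t = f≢t (apart' ) (trans (sy y w) wy)
        where
        open Tri t
        occ : occurs y ≡ true
        occ = ⇒occurs w x y (tri-mono (minus⊆ {L} {R}) t)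
        only : ∀ d → minus L R y d ≡ true → d ≡ cT a
        only d l = third-of-two {cT b} {s} (λ z → third≢r (cT a) (cT b) (sym z)) (λ z → f≢t (ok y b sy' ib yb) (subst (λ q → L y q ≡ true) z (∧-l l)))
            (λ z → f≢t (not-t (∧-r {L y d} l)) (∧-i occ (subst (λ q → (d == q) ≡ true) z (==-refl d)))) ab (λ z → third≢l (cT a) (cT b) (sym z))
        apart' : y ≁ w
        apart' = ¬t⇒f λ e → f≢t (prop-no (prop (minus L R)) w (cT a) y sy' e (λ d q → only d (prop⊆ (minus L R) y d q))) (op (cT a))

      module Branch (w₁ x₁ y₁ : V) (t₁ : Tri L k w₁ x₁ y₁) (i : Color) where
        module F = Tri t₁
        L₂ : Lists
        L₂ = set (set L y₁ s) x₁ i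
        sub : L₂ ⊆L L
        sub v c p = ∧-l (∧-l p)
        ok₂ : List-ok L₂
        ok₂ x t sx it xt = ¬t⇒f λ p → f≢t (ok x t sx it xt) (sub x (cT t) p)
        only-y : ∀ d → L₂ y₁ d ≡ true → d ≡ s
        only-y d p = set-at {L} {y₁} {s} (set⊆ {set L y₁ s} {x₁} {i} y₁ d p)
        only-x : ∀ d → L₂ x₁ d ≡ true → d ≡ i
        only-x d p = set-at {set L y₁ s} {x₁} {i} p
        dead : Dead L₂ k
        dead w x y t = split' k refl
          where
          open Tri t
          px : ∀ c → c ≢ cT a → prop L₂ x c ≡ true
          px = keeps {L₂} ok₂ w x a op sx wx ia xa
          py : ∀ c → c ≢ cT b → prop L₂ y c ≡ true
          py = keeps {L₂} ok₂ w y b op sy' wy ib yb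
          xy₁ : x ≁ y₁
          xy₁ = apart {L₂} x s y₁ F.sy' (px s (third≢l _ _)) only-y
          yy₁ : y ≁ y₁
          yy₁ = apart {L₂} y s y₁ F.sy' (py s (third≢r _ _)) only-y
          wy₁ : w ≁ y₁
          wy₁ = apart {L₂} w s y₁ F.sy' (prop⊆ (prop L₂) w s (op s)) only-y
          wx₁ : w ≁ x₁
          wx₁ = apart {L₂} w i x₁ F.sx (prop⊆ (prop L₂) w i (op i)) only-x
          xx₁ : x ≁ x₁
          xx₁ with bool-em (i == cT a)
          ... | inj₂ q = apart {L₂} x i x₁ F.sx (px i (==-f⁻ q)) only-x
          -- Here the list of `x₁` is empty, so it forces any colour, in particular `s`.
          ... | inj₁ q = apart {L₂} x s x₁ F.sx (px s (third≢l _ _)) λ d p → ⊥-elim (f≢t (ok₂ x₁ a F.sx ia F.xa) (subst (λ z → L₂ x₁ z ≡ true) (trans (only-x d p) (==-t q)) p))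
          y₁a : y₁ ≁ a
          y₁a = ¬t⇒f λ e → ab (mono-T y₁ a b F.sy' ia ib e F.yb)
          xb : x ≁ b
          xb = ¬t⇒f λ e → ab (mono-T x a b sx ia ib xa e)
          ya : y ≁ a
          ya = ¬t⇒f λ e → ab (mono-T y a b sy' ia ib e yb)
          sw' : ∀ {u v} → u ~ v → v ~ u
          sw' {u} {v} e = trans (sy v u) e
          sn : ∀ {u v} → u ≁ v → v ≁ u
          sn {u} {v} e = trans (sy v u) e
          split' : ∀ k' → k ≡ k' → ⊥
          split' (mkCombo _ _ nothing) refl = noP6 (mkP6 y₁ b y w x a
              F.yb (sw' yb) (sw' wy) wx xa
              (sn yy₁) (sn wy₁) (sn xy₁) y₁a
              (sn (far w b sw nw ib)) (sn xb) (sn (proj₂ (proj₂ val)))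
              (sn xny) ya (far w a sw nw ia))
          -- Without the edge from `x` to `w₁` the two configurations are joined through `a`; with
          -- it, the path runs from `w` over `x`, `w₁` and `y₁` to `b` and `p`, which `x` misses.
          split' (mkCombo _ _ (just p)) refl with bool-em (adj x w₁)
          ... | inj₂ n = noP6 (mkP6 w x a x₁ w₁ y₁
              wx xa (sw' F.xa) (sw' F.wx) F.wy
              (far w a sw nw ia) wx₁ (indep w w₁ sw F.sw nw F.nw) wy₁
              xx₁ n xy₁
              (sn (far w₁ a F.sw F.nw ia)) (sn y₁a)
              F.xny)
          ... | inj₁ e = noP6 (mkP6 w x w₁ y₁ b p
              wx e F.wy F.yb (sw' (proj₂ (proj₂ (proj₂ val))))
              (indep w w₁ sw F.sw nw F.nw) wy₁ (far w b sw nw ib) (far w p sw nw ip)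
              xy₁ xb (not-t av)
              (far w₁ b F.sw F.nw ib) (far w₁ p F.sw F.nw ip)
              (¬t⇒f λ z → proper-T p b ip ib (proj₂ (proj₂ (proj₂ val))) (mono-T y₁ p b F.sy' ip ib z F.yb)))
            where ip = proj₁ (proj₂ (proj₂ val))

      kill : ∀ {m} → (∀ L' → L' ⊆L L → Dead L' k → Good m S L') → Good (literalBound m (branch1 m)) S L
      kill {m} g = branch-literals R (g (minus L R) (minus⊆ {L} {R}) dead-minus) lit
        where
        lit : ∀ y c → S y ≡ true → R y c ≡ true → Good (branch1 m) S (set L y c)
        lit y c _ r with ==-t (∧-r {occurs y} r) | occurs⇒ y (∧-l r)
        ... | refl | w₁ , x₁ , t₁ = branch x₁ (Tri.sx t₁) λ i _ → g _ (λ v d q → ∧-l (∧-l q)) (Branch.dead w₁ x₁ y t₁ i)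

    combos : List Combo
    combos = concatMap (λ a → concatMap (λ b → mkCombo a b nothing ∷ map (λ p → mkCombo a b (just p)) T) T) T

    combos-len : length combos ≤ comboCount (length T)
    combos-len = length-concatMap _ _ (λ a → length-concatMap _ _ (λ b → s≤s (≤-reflexive (length-map _ T))) T) T

    in-nothing : ∀ {a b} → a ∈ T → b ∈ T → mkCombo a b nothing ∈ combos
    in-nothing ia ib = ∈-concatMap _ ia (∈-concatMap _ ib (here refl))
    in-just : ∀ {a b p} → a ∈ T → b ∈ T → p ∈ T → mkCombo a b (just p) ∈ combos
    in-just {a} {b} ia ib ip = ∈-concatMap _ ia (∈-concatMap _ ib (there (∈-map⁺ (λ p → mkCombo a b (just p)) ip)))

    valid? : ∀ k → Valid k ⊎ ¬ Valid k
    valid? (mkCombo a b p) with bool-em (mem a T) | bool-em (mem b T) | bool-em (cT a == cT b)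
    ... | inj₂ f | _ | _ = inj₂ λ v → f≢t f (⇒mem (proj₁ (proj₁ (valid-T (mkCombo a b p) v))))
    ... | inj₁ _ | inj₂ f | _ = inj₂ λ v → f≢t f (⇒mem (proj₂ (proj₁ (valid-T (mkCombo a b p) v))))
    ... | inj₁ _ | inj₁ _ | inj₁ e = inj₂ λ v → proj₂ (valid-T (mkCombo a b p) v) (==-t e)
    valid? (mkCombo a b nothing) | inj₁ x | inj₁ y | inj₂ d with bool-em (adj a b)
    ... | inj₁ e = inj₂ λ (_ , _ , n) → f≢t n e
    ... | inj₂ n = inj₁ ((mem⇒ T x , mem⇒ T y) , ==-f⁻ d , n)
    valid? (mkCombo a b (just p)) | inj₁ x | inj₁ y | inj₂ d with bool-em (mem p T) | bool-em (adj p b)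
    ... | inj₁ z | inj₁ e = inj₁ ((mem⇒ T x , mem⇒ T y) , ==-f⁻ d , (mem⇒ T z , e))
    ... | inj₂ f | _ = inj₂ λ (_ , _ , (i , _)) → f≢t f (⇒mem i)
    ... | inj₁ _ | inj₂ f = inj₂ λ (_ , _ , (_ , e)) → f≢t f e

    kill-all : ∀ {m} ks L → List-ok L → (∀ L' → L' ⊆L L → (∀ k → k ∈ ks → Valid k → Dead L' k) → Good m S L') → Good (killBound (length ks) m) S L
    kill-all [] L ok g = g L (λ _ _ p → p) (λ _ ())
    kill-all {m} (k ∷ ks) L ok g with valid? k
    ... | inj₁ v = Kill.kill k v L ok λ L' h dead → kill-all ks L' (λ x t sx it xt → ¬t⇒f λ p → f≢t (ok x t sx it xt) (h x (cT t) p))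
              λ L'' h' rest → g L'' (λ u c p → h u c (h' u c p)) λ { k' (here refl) _ w x y t → dead w x y (tri-mono h' t) ; k' (there i) v' → rest k' i v' }
    ... | inj₂ nv = good-weaken (≤literalBound _ _) (kill-all ks L ok λ L' h rest → g L' h λ { k' (here refl) v' → ⊥-elim (nv v') ; k' (there i) v' → rest k' i v' })

    -- With all configurations dead, `separate` leaves no nonadjacent neighbours of an open vertex
    -- with different colours in `T`. So the open vertices are joins, and every other vertex misses
    -- a colour.
    finish : ∀ L → List-ok L → (∀ k → k ∈ combos → Valid k → Dead L k) → Good (joinBound * 4 * 4) S L
    finish L ok dead = prop-good L (prop-good (prop L) (joins S L₂ J miss missing full nbr cross))
      where
      L₂ : Lists
      L₂ = prop (prop L)
      J : V → Bool
      J w = not (X w) ∧ openB L w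
      missX : V → Color
      missX x = cT (pick (λ t → mem t T ∧ adj x t) x)
      missR : V → Color
      missR w with bool-em (someC (λ c → not (L₂ w c)))
      ... | inj₁ p = proj₁ (someC⇒ (λ c → not (L₂ w c)) p)
      ... | inj₂ _ = c0
      missR-ok : ∀ w → openB L w ≡ false → L₂ w (missR w) ≡ false
      missR-ok w f with bool-em (someC (λ c → not (L₂ w c)))
      ... | inj₁ p = not-t (proj₂ (someC⇒ (λ c → not (L₂ w c)) p))
      ... | inj₂ p = ⊥-elim (f≢t f (⇒everyC (L₂ w) λ c → un c (bool-em (L₂ w c))))
        where un : ∀ c → L₂ w c ≡ true ⊎ L₂ w c ≡ false → L₂ w c ≡ true
              un c (inj₁ q) = q
              un c (inj₂ q) = ⊥-elim (f≢t p (⇒someC (λ c → not (L₂ w c)) c (not-f q)))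
      miss : V → Color
      miss v = if X v then missX v else missR v
      miss-X : ∀ v → X v ≡ true → miss v ≡ missX v
      miss-X v x rewrite x = refl
      miss-R : ∀ v → X v ≡ false → miss v ≡ missR v
      miss-R v x rewrite x = refl
      tOf : ∀ x → S x ≡ true → X x ≡ true → Σ V λ t → t ∈ T × x ~ t × missX x ≡ cT t
      tOf x sx xx = let (t , it , e) = near x sx xx
                        z = pick-ok (λ t → mem t T ∧ adj x t) x t (∧-i (⇒mem it) e)
                    in pick (λ t → mem t T ∧ adj x t) x , mem⇒ T (∧-l z) , ∧-r {mem (pick (λ t → mem t T ∧ adj x t) x) T} z , refl
      missing : ∀ v → S v ≡ true → J v ≡ false → L₂ v (miss v) ≡ false
      missing v s j with bool-em (X v)
      ... | inj₁ x = let (t , it , e , q) = tOf v s x in ¬t⇒f λ p → f≢t (ok v t s it e) (subst (λ z → L v z ≡ true) (trans (miss-X v x) q) (prop⊆ L v _ (prop⊆ (prop L) v _ p)))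
      ... | inj₂ x = subst (λ z → L₂ v z ≡ false) (sym (miss-R v x)) (missR-ok v (¬t⇒f λ p → f≢t j (∧-i (not-f x) p)))
      full : ∀ w → S w ≡ true → J w ≡ true → ∀ c → L₂ w c ≡ true
      full w s j = everyC⇒ (L₂ w) (∧-r {not (X w)} j)
      Xnbr : ∀ w x → S w ≡ true → S x ≡ true → J w ≡ true → w ~ x → X x ≡ true
      Xnbr w x s sx j e with bool-em (X x)
      ... | inj₁ p = p
      ... | inj₂ p = ⊥-elim (f≢t (indep w x s sx (not-t (∧-l j)) p) e)
      nbr : ∀ w x → S w ≡ true → S x ≡ true → J w ≡ true → w ~ x → J x ≡ false
      nbr w x s sx j e = ¬t⇒f λ p → f≢t (not-t (∧-l p)) (Xnbr w x s sx j e)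
      cross : ∀ w x y → S w ≡ true → S x ≡ true → S y ≡ true → J w ≡ true → w ~ x → w ~ y → miss x ≢ miss y → x ~ y
      cross w x y s sx sy' j wx wy ne with bool-em (adj x y)
      ... | inj₁ e = e
      ... | inj₂ n = ⊥-elim (go (separate x y _ _ sx sy' (proj₁ (proj₂ tx)) (proj₁ (proj₂ ty)) (proj₁ (proj₂ (proj₂ tx))) (proj₁ (proj₂ (proj₂ ty)))
                 λ z → ne (trans (miss-X x xx) (trans (proj₂ (proj₂ (proj₂ tx))) (trans z (trans (sym (proj₂ (proj₂ (proj₂ ty)))) (sym (miss-X y xy))))))))
        where
        xx = Xnbr w x s sx j wx
        xy = Xnbr w y s sy' j wy
        tx = tOf x sx xx
        ty = tOf y sy' xy
        mk : ∀ k → x ~ Combo.a k → y ~ Combo.b k → avoids (Combo.p k) x ≡ true → Tri L k w x y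
        mk k xa yb av = record { sw = s ; nw = not-t (∧-l j) ; sx = sx ; xx = xx ; sy' = sy' ; xy = xy ; wx = wx ; wy = wy ; xny = n ; xa = xa ; yb = yb ; av = av ; op = full w s j }
        mk' : ∀ k → y ~ Combo.a k → x ~ Combo.b k → avoids (Combo.p k) y ≡ true → Tri L k w y x
        mk' k ya xb av = record { sw = s ; nw = not-t (∧-l j) ; sx = sy' ; xx = xy ; sy' = sx ; xy = xx ; wx = wy ; wy = wx ; xny = trans (sy y x) n ; xa = ya ; yb = xb ; av = av ; op = full w s j }
        go : _ → ⊥
        go (inj₁ (a , b , (ia , ib) , (xa , yb) , (d , nab))) = dead (mkCombo a b nothing) (in-nothing ia ib) ((ia , ib) , d , nab) w x y (mk _ xa yb refl)
        go (inj₂ (inj₁ (a , b , p , (ia , ib , ip) , (xa , yb) , (d , pb , np)))) = dead (mkCombo a b (just p)) (in-just ia ib ip) ((ia , ib) , d , (ip , pb)) w x y (mk _ xa yb (not-f np))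
        go (inj₂ (inj₂ (a , b , p , (ia , ib , ip) , (xa , yb) , (d , pa , np)))) = dead (mkCombo b a (just p)) (in-just ib ia ip) ((ib , ia) , (λ z → d (sym z)) , (ip , pa)) w y x (mk' _ yb xa (not-f np))

    singles : ∀ L → List-ok L → Good (comboBound (length T)) S L
    singles L ok = good-weaken (comboBound-kill (length T) combos-len) (kill-all combos L ok λ L' h d → finish L' (λ x t sx it xt → ¬t⇒f λ p → f≢t (ok x t sx it xt) (h x (cT t) p)) d)

-- Pure states

pureBound : ℕ → ℕ → ℕ
pureBound ℓ m = comboBound ℓ * contractFactor + m

module States (V : Set) (_≟_ : DecidableEquality V) (vs : List V) (complete : ∀ v → v ∈ vs)
             (adj : V → V → Bool) (sy : ∀ u v → adj u v ≡ adj v u) (irr : ∀ v → adj v v ≡ false) (noP6 : ¬ P6In adj) where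
  open Combos V _≟_ vs complete adj sy irr noP6 public

  sw~ : ∀ {u v} → u ~ v → v ~ u
  sw~ {u} {v} e = trans (sy v u) e
  sw≁ : ∀ {u v} → u ≁ v → v ≁ u
  sw≁ {u} {v} e = trans (sy v u) e

  opaque
    nT : List V → V → Bool
    nT T x = any (adj x) T
    nT⇒ : ∀ T x → nT T x ≡ true → Σ V λ t → t ∈ T × x ~ t
    nT⇒ T x p = anyL⇒ (adj x) T p
    ⇒nT : ∀ {T x t} → t ∈ T → x ~ t → nT T x ≡ true
    ⇒nT {T} {x} i e = ⇒anyL (adj x) i e
  nT-f : ∀ {T x t} → nT T x ≡ false → t ∈ T → x ≁ t
  nT-f p i = ¬t⇒f λ e → f≢t p (⇒nT i e)
  nT-mono : ∀ {T T' x} → (∀ {t} → t ∈ T → t ∈ T') → nT T x ≡ true → nT T' x ≡ true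
  nT-mono {T} {T'} {x} h p = let (t , i , e) = nT⇒ T x p in ⇒nT (h i) e
  nT-mono-f : ∀ {T T' x} → (∀ {t} → t ∈ T → t ∈ T') → nT T' x ≡ false → nT T x ≡ false
  nT-mono-f h p = ¬t⇒f λ q → f≢t p (nT-mono h q)

  ConnT : List V → Set
  ConnT T = ∀ (Q : V → Bool) t₀ → t₀ ∈ T → Q t₀ ≡ true → (∀ t t' → t ∈ T → t' ∈ T → Q t ≡ true → t ~ t' → Q t' ≡ true) → ∀ t → t ∈ T → Q t ≡ true

  -- The colour that a deleted vertex has passed on to its live neighbours; with it the vertex can
  -- later replace `T`.
  Coloured : Live → Lists → V → Set
  Coloured S L v = Σ Color λ j → ∀ u → S u ≡ true → u ~ v → L u j ≡ false
  -- Deleted vertices stay within distance two of `T`, so from a component attached to one of them a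
  -- short path leads back into `T`.
  Loc : Live → List V → V → Set
  Loc U T v = nT T v ≡ true ⊎ (Σ V λ x → U x ≡ true × nT T x ≡ true × x ~ v)

  record Core (U : Live) (T : List V) (cT : V → Color) (S : Live) (L : Lists) : Set where
    field
      proper-T : ∀ t t' → t ∈ T → t' ∈ T → t ~ t' → cT t ≢ cT t'
      mono-T : ∀ x t t' → S x ≡ true → t ∈ T → t' ∈ T → x ~ t → x ~ t' → cT t ≡ cT t'
      list-ok : ∀ x t → S x ≡ true → t ∈ T → x ~ t → L x (cT t) ≡ false
      disjoint : ∀ t → t ∈ T → S t ≡ false
      S⊆U : ∀ v → S v ≡ true → U v ≡ true
      deleted : ∀ v → U v ≡ true → S v ≡ false → mem v T ≡ false → Coloured S L v × Loc U T v

  -- The three outcomes are the data of a `Combo`, the last two differing by the roles of `x` and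
  -- `y`.
  Separate : List V → (V → Color) → Live → Set
  Separate T cT S = ∀ x y t t' → S x ≡ true → S y ≡ true → t ∈ T → t' ∈ T → x ~ t → y ~ t' → cT t ≢ cT t' →
       (Σ V λ a → Σ V λ b → (a ∈ T × b ∈ T) × (x ~ a × y ~ b) × (cT a ≢ cT b × a ≁ b))
     ⊎ ((Σ V λ a → Σ V λ b → Σ V λ p → (a ∈ T × b ∈ T × p ∈ T) × (x ~ a × y ~ b) × (cT a ≢ cT b × p ~ b × x ≁ p))
     ⊎  (Σ V λ a → Σ V λ b → Σ V λ p → (a ∈ T × b ∈ T × p ∈ T) × (x ~ a × y ~ b) × (cT a ≢ cT b × p ~ a × y ≁ p)))

  Pure : List V → Live → Set
  Pure T S = ∀ x w w' → S x ≡ true → S w ≡ true → S w' ≡ true → nT T x ≡ true → nT T w ≡ false → nT T w' ≡ false → w ~ w' → x ~ w → x ~ w'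

  module PureState (T : List V) (cT : V → Color) (S : Live) (L : Lists)
    (proper-T : ∀ t t' → t ∈ T → t' ∈ T → t ~ t' → cT t ≢ cT t')
    (mono-T : ∀ x t t' → S x ≡ true → t ∈ T → t' ∈ T → x ~ t → x ~ t' → cT t ≡ cT t')
    (list-ok : ∀ x t → S x ≡ true → t ∈ T → x ~ t → L x (cT t) ≡ false)
    (pure : Pure T S) (separate : Separate T cT S) where

    lone : V → Bool
    lone r = not (nT T r) ∧ not (some (λ x → (S x ∧ nT T x) ∧ adj x r))

    reached : (∀ r → S r ≡ true → nT T r ≡ false → Σ V λ x → S x ≡ true × nT T x ≡ true × x ~ r) → Good (comboBound (length T) * contractFactor) S L
    reached hasX = contract (singles L' ok)
      where
      missing : ∀ x → S x ≡ true → nT T x ≡ true → Σ Color λ m → L x m ≡ false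
      missing x sx xx = let (t , it , e) = nT⇒ T x xx in cT t , list-ok x t sx it e
      open Contraction S L (nT T) missing pure hasX
      sub : ∀ {v} → S' v ≡ true → S v ≡ true
      sub = ∧-l
      open Singles S' (nT T) T cT proper-T (λ x t t' s → mono-T x t t' (sub s)) (λ x _ xx → nT⇒ T x xx) (λ w t _ nw it → nT-f nw it) indep
                   (λ x y t t' s s' → separate x y t t' (sub s) (sub s'))
      ok : List-ok L'
      ok x t s it e = ¬t⇒f λ p → f≢t (list-ok x t (sub s) it e) (∧-l (trans (sym (L'-X x (cT t) (⇒nT it e))) p))

    -- By purity, a neighbour of `T` that sees `r'` would also see the lone vertex `r`. So lone
    -- vertices form a union of components.
    lone-closed : ∀ r r' → S r ≡ true → S r' ≡ true → lone r ≡ true → r ~ r' → lone r' ≡ true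
    lone-closed r r' s s' p e = ∧-i (not-f (¬t⇒f λ q → f≢t (not-t (∧-r {not (nT T r)} p)) (⇒some (λ x → (S x ∧ nT T x) ∧ adj x r) r' (∧-i (∧-i s' q) (sw~ e)))))
        (not-f (¬t⇒f λ q → let (x , z) = some⇒ (λ x → (S x ∧ nT T x) ∧ adj x r') q in
           f≢t (not-t (∧-r {not (nT T r)} p)) (⇒some (λ x → (S x ∧ nT T x) ∧ adj x r) x
             (∧-i (∧-l z) (pure x r' r (∧-l (∧-l z)) s' s (∧-r {S x} (∧-l z)) (n' ) (not-t (∧-l p)) (sw~ e) (∧-r {S x ∧ nT T x} z))))))
      where
      n' : nT T r' ≡ false
      n' = ¬t⇒f λ q → f≢t (not-t (∧-r {not (nT T r)} p)) (⇒some (λ x → (S x ∧ nT T x) ∧ adj x r) r' (∧-i (∧-i s' q) (sw~ e)))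

  pure-good : ∀ {m} T cT S L →
    (pT : ∀ t t' → t ∈ T → t' ∈ T → t ~ t' → cT t ≢ cT t') →
    (mT : ∀ x t t' → S x ≡ true → t ∈ T → t' ∈ T → x ~ t → x ~ t' → cT t ≡ cT t') →
    (lk : ∀ x t → S x ≡ true → t ∈ T → x ~ t → L x (cT t) ≡ false) →
    (pu : Pure T S) → (se : Separate T cT S) →
    Good m (S ∩ PureState.lone T cT S L pT mT lk pu se) L → Good (pureBound (length T) m) S L
  pure-good {m} T cT S L pT mT lk pu se g = split lone
      (λ u v su sv lu lv → ¬t⇒f λ e → f≢t lv (lone-closed u v su sv lu e)) sy
      (good-weaken (m≤n+m m _) g)
      (good-weaken (m≤m+n _ m) (PureState.reached T cT (S ∖ lone) L pT (λ x t t' s → mT x t t' (∧-l s)) (λ x t s → lk x t (∧-l s))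
          (λ x w w' s s' s'' → pu x w w' (∧-l s) (∧-l s') (∧-l s'')) (λ x y t t' s s' → se x y t t' (∧-l s) (∧-l s')) hasX))
    where
    open PureState T cT S L pT mT lk pu se
    hasX : ∀ r → (S ∖ lone) r ≡ true → nT T r ≡ false → Σ V λ x → (S ∖ lone) x ≡ true × nT T x ≡ true × x ~ r
    hasX r s nr with bool-em (some (λ x → (S x ∧ nT T x) ∧ adj x r))
    ... | inj₂ f = ⊥-elim (f≢t (not-t (∧-r {S r} s)) (∧-i (not-f nr) (not-f f)))
    ... | inj₁ p = let (x , z) = some⇒ (λ x → (S x ∧ nT T x) ∧ adj x r) p
                       xx = ∧-r {S x} (∧-l {S x ∧ nT T x} z)
                   in x , ∧-i (∧-l (∧-l z)) (not-f (¬t⇒f λ q → f≢t (not-t (∧-l q)) xx)) , xx , ∧-r {S x ∧ nT T x} z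

  conn-any : ∀ {K r} → Conn K r → ∀ w → K w ≡ true → Conn K w
  conn-any {K} {r} cn w kw Q qw cl u ku with bool-em (Q r)
  ... | inj₁ q = cn Q q cl u ku
  ... | inj₂ q = ⊥-elim (f≢t (not-t (cn (λ z → not (Q z)) (not-f q) (λ a b ka kb na e → not-f (¬t⇒f λ qb → f≢t (not-t na) (cl b a kb ka qb (sw~ e)))) w kw)) qw)

  -- With one vertex in `T` there are no two colours to separate. A lone vertex would make all of
  -- the connected set `K` lone, contrary to the neighbour of `v` in `K`.
  pure-single : ∀ K r v j L → Conn K r → K r ≡ true → (Σ V λ u → K u ≡ true × u ~ v) → (∀ u → K u ≡ true → u ~ v → L u j ≡ false) →
    (∀ x w w' → K x ≡ true → K w ≡ true → K w' ≡ true → x ~ v → w ≁ v → w' ≁ v → w ~ w' → x ~ w → x ~ w') →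
    Good (comboBound 1 * contractFactor) K L
  pure-single K r v j L cn kr (u₀ , ku₀ , eu₀) col nomix = reached hasX
    where
    T : List V
    T = v ∷ []
    only : ∀ {t} → t ∈ T → t ≡ v
    only (here e) = e
    near⇒ : ∀ x → nT T x ≡ true → x ~ v
    near⇒ x p = let (t , i , e) = nT⇒ T x p in subst (λ z → x ~ z) (only i) e
    open PureState T (λ _ → j) K L
      (λ t t' i i' e _ → f≢t (irr v) (subst (λ z → v ~ z) (only i') (subst (λ z → z ~ t') (only i) e)))
      (λ _ _ _ _ _ _ _ _ → refl) (λ x t kx i e → col x kx (subst (λ z → x ~ z) (only i) e))
      (λ x w w' kx kw kw' nx nw nw' → nomix x w w' kx kw kw' (near⇒ x nx) (nT-f nw (here refl)) (nT-f nw' (here refl)))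
      (λ x y t t' _ _ _ _ _ _ ne → ⊥-elim (ne refl))
    hasX : ∀ r → K r ≡ true → nT T r ≡ false → Σ V λ x → K x ≡ true × nT T x ≡ true × x ~ r
    hasX w kw nw with bool-em (some (λ x → (K x ∧ nT T x) ∧ adj x w))
    ... | inj₁ p = let (x , z) = some⇒ (λ x → (K x ∧ nT T x) ∧ adj x w) p in x , ∧-l (∧-l z) , ∧-r {K x} (∧-l z) , ∧-r {K x ∧ nT T x} z
    ... | inj₂ f = ⊥-elim (f≢t (not-t (∧-l (all' u₀ ku₀))) (⇒nT (here refl) eu₀))
      where
      lw : lone w ≡ true
      lw = ∧-i (not-f nw) (not-f f)
      all' : ∀ u → K u ≡ true → lone u ≡ true
      all' = conn-any cn w kw lone lw lone-closed

  -- Adds vertices of fixed colour to `T`. After deleting `N`, the vertices that see two colours of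
  -- `T'` have at most one colour left; their deletion restores `mono-T`.
  module Advance (U : Live) (T : List V) (cT : V → Color) (S : Live) (L : Lists)
    (pT : ∀ t t' → t ∈ T → t' ∈ T → t ~ t' → cT t ≢ cT t')
    (lk : ∀ x t → S x ≡ true → t ∈ T → x ~ t → L x (cT t) ≡ false)
    (dj : ∀ t → t ∈ T → S t ≡ false)
    (S⊆U : ∀ v → S v ≡ true → U v ≡ true)
    (dl : ∀ v → U v ≡ true → S v ≡ false → mem v T ≡ false → Coloured S L v × Loc U T v)
    (N : List V) (sN : ∀ n → n ∈ N → S n ≡ true) (un : ∀ n → n ∈ N → ∀ c → L n c ≡ true → c ≡ cT n) where

    T' : List V
    T' = N ++ T
    C₁ C₂ : V → Bool
    C₁ v = mem v N
    sees : V → V → V → Bool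
    sees v t t' = (mem t' T' ∧ adj v t') ∧ not (cT t == cT t')
    seesB : V → V → Bool
    seesB v t = (mem t T' ∧ adj v t) ∧ some (sees v t)
    C₂ v = some (seesB v)
    S₁ S₂ : Live
    S₁ = S ∖ C₁
    S₂ = S₁ ∖ C₂
    L₁ L₂ : Lists
    L₁ = prune S C₁ L
    L₂ = prune S₁ C₂ L₁

    C₂⇒ : ∀ v → C₂ v ≡ true → Σ V λ t → Σ V λ t' → (t ∈ T' × v ~ t) × (t' ∈ T' × v ~ t') × cT t ≢ cT t'
    C₂⇒ v p = let (t , q) = some⇒ (seesB v) p
                  (t' , z) = some⇒ (sees v t) (∧-r {mem t T' ∧ adj v t} q)
              in t , t' , (mem⇒ T' (∧-l (∧-l q)) , ∧-r {mem t T'} (∧-l q)) , (mem⇒ T' (∧-l (∧-l z)) , ∧-r {mem t' T'} (∧-l z)) , ==-f⁻ (not-t (∧-r {mem t' T' ∧ adj v t'} z))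
    ⇒C₂ : ∀ v t t' → t ∈ T' → v ~ t → t' ∈ T' → v ~ t' → cT t ≢ cT t' → C₂ v ≡ true
    ⇒C₂ v t t' i e i' e' ne = ⇒some (seesB v) t (∧-i (∧-i (⇒mem i) e) (⇒some (sees v t) t' (∧-i (∧-i (⇒mem i') e') (not-f (==-f ne)))))

    advance : ∀ {m} → (Core U T' cT S₂ L₂ → Good m S₂ L₂) → Good (unitBound (unitBound m)) S L
    advance g = delete-units C₁ sy (λ n s p i j li lj → trans (un n (mem⇒ N p) i li) (sym (un n (mem⇒ N p) j lj))) λ ne nc →
        let val : ∀ n → n ∈ N → L n (cT n) ≡ true
            val n i = let (c , l) = ne n (sN n i) (⇒mem i) in subst (λ z → L n z ≡ true) (un n i c l) l
            lk₁ : ∀ x t → S₁ x ≡ true → t ∈ T' → x ~ t → L₁ x (cT t) ≡ false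
            lk₁ x t s i e = go x t s (∈-++⁻ N i) e val
        in delete-units C₂ sy (λ v s p i j li lj → let (t , t' , (it , et) , (it' , et') , d) = C₂⇒ v p in
                third-of-two d (λ z → f≢t (lk₁ v t s it et) (subst (λ y → L₁ v y ≡ true) z li)) (λ z → f≢t (lk₁ v t' s it' et') (subst (λ y → L₁ v y ≡ true) z li))
                               (λ z → f≢t (lk₁ v t s it et) (subst (λ y → L₁ v y ≡ true) z lj)) (λ z → f≢t (lk₁ v t' s it' et') (subst (λ y → L₁ v y ≡ true) z lj)))
             λ ne₂ nc₂ → g record
               { proper-T = λ t t' i i' e → prT t t' (∈-++⁻ N i) (∈-++⁻ N i') e val nc
               ; mono-T = mono
               ; list-ok = λ x t s i e → ¬t⇒f λ p → f≢t (lk₁ x t (∧-l s) i e) (prune⊆ S₁ C₂ L₁ x (cT t) p)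
               ; disjoint = λ t i → dis t (∈-++⁻ N i)
               ; S⊆U = λ v s → S⊆U v (∧-l (∧-l s))
               ; deleted = λ v uv s nm → del v uv s nm ne₂ }
      where
      go : ∀ x t → S₁ x ≡ true → t ∈ N ⊎ t ∈ T → x ~ t → (∀ n → n ∈ N → L n (cT n) ≡ true) → L₁ x (cT t) ≡ false
      go x t s (inj₁ i) e val = prune-no S C₁ L x t (cT t) (sN t i) (⇒mem i) (sw~ e) (val t i)
      go x t s (inj₂ i) e val = ¬t⇒f λ p → f≢t (lk x t (∧-l s) i e) (prune⊆ S C₁ L x (cT t) p)
      prT : ∀ t t' → t ∈ N ⊎ t ∈ T → t' ∈ N ⊎ t' ∈ T → t ~ t' → (∀ n → n ∈ N → L n (cT n) ≡ true) →
        (∀ u v c → S u ≡ true → C₁ u ≡ true → S v ≡ true → C₁ v ≡ true → u ~ v → L u c ≡ true → L v c ≡ true → ⊥) → cT t ≢ cT t'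
      prT t t' (inj₂ i) (inj₂ i') e val nc = pT t t' i i' e
      prT t t' (inj₁ i) (inj₂ i') e val nc q = f≢t (lk t t' (sN t i) i' e) (subst (λ z → L t z ≡ true) q (val t i))
      prT t t' (inj₂ i) (inj₁ i') e val nc q = f≢t (lk t' t (sN t' i') i (sw~ e)) (subst (λ z → L t' z ≡ true) (sym q) (val t' i'))
      prT t t' (inj₁ i) (inj₁ i') e val nc q = nc t t' (cT t) (sN t i) (⇒mem i) (sN t' i') (⇒mem i') e (val t i) (subst (λ z → L t' z ≡ true) (sym q) (val t' i'))
      mono : ∀ x t t' → S₂ x ≡ true → t ∈ T' → t' ∈ T' → x ~ t → x ~ t' → cT t ≡ cT t'
      mono x t t' s i i' e e' with bool-em (cT t == cT t')
      ... | inj₁ q = ==-t q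
      ... | inj₂ q = ⊥-elim (f≢t (not-t (∧-r {S₁ x} s)) (⇒C₂ x t t' i e i' e' (==-f⁻ q)))
      dis : ∀ t → t ∈ N ⊎ t ∈ T → S₂ t ≡ false
      dis t (inj₁ i) = ¬t⇒f λ s → f≢t (not-t (∧-r {S t} (∧-l s))) (⇒mem i)
      dis t (inj₂ i) = ¬t⇒f λ s → f≢t (dj t i) (∧-l (∧-l s))
      del : ∀ v → U v ≡ true → S₂ v ≡ false → mem v T' ≡ false → (∀ v → S₁ v ≡ true → C₂ v ≡ true → Σ Color λ c → L₁ v c ≡ true) → Coloured S₂ L₂ v × Loc U T' v
      del v uv s nm ne₂ with bool-em (S v)
      ... | inj₂ f = let ((j , h) , l) = dl v uv f (¬t⇒f λ p → f≢t nm (⇒mem (∈-++⁺ʳ N (mem⇒ T p)))) in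
             (j , λ u su e → ¬t⇒f λ p → f≢t (h u (∧-l (∧-l su)) e) (∧-l (∧-l p))) , loc l
        where
        loc : Loc U T v → Loc U T' v
        loc (inj₁ p) = inj₁ (nT-mono (∈-++⁺ʳ N) p)
        loc (inj₂ (x , ux , p , e)) = inj₂ (x , ux , nT-mono (∈-++⁺ʳ N) p , e)
      ... | inj₁ t with bool-em (C₂ v)
      ... | inj₂ c = ⊥-elim (f≢t s (∧-i (∧-i t (not-f (¬t⇒f λ p → f≢t nm (⇒mem (∈-++⁺ˡ (mem⇒ N p)))))) (not-f c)))
      ... | inj₁ c = let s₁ = ∧-i t (not-f (¬t⇒f λ p → f≢t nm (⇒mem (∈-++⁺ˡ (mem⇒ N p)))))
                         (j , l) = ne₂ v s₁ c
                         (t₁ , _ , (i₁ , e₁) , _) = C₂⇒ v c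
                     in (j , λ u su e → prune-no S₁ C₂ L₁ u v j s₁ c (sw~ e) l) , inj₁ (⇒nT i₁ e₁)

-- Removing mixed edges

-- One deletion if all literals are removed; for a single literal a branching on `x` followed by the
-- two deletions of `Advance`.
mixBound : ℕ → ℕ
mixBound m = literalBound (unitBound m) (branch1 (unitBound (unitBound m)))

mixBounds : ℕ → ℕ → ℕ
mixBounds zero m = m
mixBounds (suc k) m = mixBound (mixBounds k m)

module Kills (V : Set) (_≟_ : DecidableEquality V) (vs : List V) (complete : ∀ v → v ∈ vs)
             (adj : V → V → Bool) (sy : ∀ u v → adj u v ≡ adj v u) (irr : ∀ v → adj v v ≡ false) (noP6 : ¬ P6In adj) where
  open States V _≟_ vs complete adj sy irr noP6 public

  record P4In (T : List V) : Set where
    field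
      a b c d : V
      ia : a ∈ T
      ib : b ∈ T
      ic : c ∈ T
      id : d ∈ T
      ab : a ~ b
      bc : b ~ c
      cd : c ~ d
      ac : a ≁ c
      ad : a ≁ d
      bd : b ≁ d

  -- If nothing separates `x` from `y`, their neighbourhoods in `T` are completely joined, and every
  -- neighbour of the one lies in the other. By connectivity `T` is then covered by these two sides,
  -- which a P4 excludes.
  separate-P4 : ∀ T cT S → ConnT T → (∀ t t' → t ∈ T → t' ∈ T → t ~ t' → cT t ≢ cT t') →
    (∀ x t t' → S x ≡ true → t ∈ T → t' ∈ T → x ~ t → x ~ t' → cT t ≡ cT t') → P4In T → Separate T cT S
  separate-P4 T cT S cn pT mT p4 x y t t' sx sy' it it' xt yt ne
    with search (λ a → (mem a T ∧ adj x a) ∧ some (λ b → (mem b T ∧ adj y b) ∧ not (adj a b)))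
  ... | inj₁ (a , p) = let (b , q) = some⇒ (λ b → (mem b T ∧ adj y b) ∧ not (adj a b)) (∧-r {mem a T ∧ adj x a} p)
                           ia = mem⇒ T (∧-l (∧-l p))
                           xa = ∧-r {mem a T} (∧-l p)
                           ib = mem⇒ T (∧-l (∧-l q))
                           yb = ∧-r {mem b T} (∧-l q)
                       in inj₁ (a , b , (ia , ib) , (xa , yb) , ((λ e → ne (trans (mT x t a sx it ia xt xa) (trans e (mT y b t' sy' ib it' yb yt)))) , not-t (∧-r {mem b T ∧ adj y b} q)))
  ... | inj₂ n₁ with search (λ b → (mem b T ∧ adj y b) ∧ some (λ p → (mem p T ∧ adj p b) ∧ not (adj x p)))
  ... | inj₁ (b , q) = let (p , r) = some⇒ (λ p → (mem p T ∧ adj p b) ∧ not (adj x p)) (∧-r {mem b T ∧ adj y b} q)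
                           ib = mem⇒ T (∧-l (∧-l q))
                           yb = ∧-r {mem b T} (∧-l q)
                       in inj₂ (inj₁ (t , b , p , (it , ib , mem⇒ T (∧-l (∧-l r))) , (xt , yb) , ((λ e → ne (trans e (mT y b t' sy' ib it' yb yt))) , ∧-r {mem p T} (∧-l {mem p T ∧ adj p b} r) , not-t (∧-r {mem p T ∧ adj p b} r))))
  ... | inj₂ n₂ with search (λ a → (mem a T ∧ adj x a) ∧ some (λ p → (mem p T ∧ adj p a) ∧ not (adj y p)))
  ... | inj₁ (a , q) = let (p , r) = some⇒ (λ p → (mem p T ∧ adj p a) ∧ not (adj y p)) (∧-r {mem a T ∧ adj x a} q)
                           ia = mem⇒ T (∧-l (∧-l q))
                           xa = ∧-r {mem a T} (∧-l q)
                       in inj₂ (inj₂ (a , t' , p , (ia , it' , mem⇒ T (∧-l (∧-l r))) , (xa , yt) , ((λ e → ne (trans (mT x t a sx it ia xt xa) e)) , ∧-r {mem p T} (∧-l {mem p T ∧ adj p a} r) , not-t (∧-r {mem p T ∧ adj p a} r))))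
  ... | inj₂ n₃ = ⊥-elim (fin (∨-e (all' _ ia)))
    where
    open P4In p4
    full : ∀ {z z'} → z ∈ T → z' ∈ T → x ~ z → y ~ z' → z ~ z'
    full {z} {z'} i i' e e' with bool-em (adj z z')
    ... | inj₁ q = q
    ... | inj₂ q = ⊥-elim (f≢t (n₁ z) (∧-i (∧-i (⇒mem i) e) (⇒some (λ b → (mem b T ∧ adj y b) ∧ not (adj z b)) z' (∧-i (∧-i (⇒mem i') e') (not-f q)))))
    toX : ∀ {z z'} → z ∈ T → z' ∈ T → y ~ z → z ~ z' → x ~ z'
    toX {z} {z'} i i' e e' with bool-em (adj x z')
    ... | inj₁ q = q
    ... | inj₂ q = ⊥-elim (f≢t (n₂ z) (∧-i (∧-i (⇒mem i) e) (⇒some (λ p → (mem p T ∧ adj p z) ∧ not (adj x p)) z' (∧-i (∧-i (⇒mem i') (sw~ e')) (not-f q)))))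
    toY : ∀ {z z'} → z ∈ T → z' ∈ T → x ~ z → z ~ z' → y ~ z'
    toY {z} {z'} i i' e e' with bool-em (adj y z')
    ... | inj₁ q = q
    ... | inj₂ q = ⊥-elim (f≢t (n₃ z) (∧-i (∧-i (⇒mem i) e) (⇒some (λ p → (mem p T ∧ adj p z) ∧ not (adj y p)) z' (∧-i (∧-i (⇒mem i') (sw~ e')) (not-f q)))))
    cl : ∀ z z' → z ∈ T → z' ∈ T → adj x z ∨ adj y z ≡ true → z ~ z' → adj x z' ∨ adj y z' ≡ true
    cl z z' i i' q e with ∨-e {adj x z} q
    ... | inj₁ e' = ∨-ir {adj x z'} (toY i i' e' e)
    ... | inj₂ e' = ∨-il (toX i i' e' e)
    all' : ∀ z → z ∈ T → adj x z ∨ adj y z ≡ true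
    all' = cn (λ z → adj x z ∨ adj y z) t it (∨-il xt) cl
    -- The path alternates between the sides, so its ends lie on different sides and would be
    -- adjacent.
    fin : x ~ a ⊎ y ~ a → ⊥
    fin (inj₁ e) = f≢t ad (full ia id e (toY ic id (toX ib ic (toY ia ib e ab) bc) cd))
    fin (inj₂ e) = f≢t ad (sw~ (full id ia (toX ic id (toY ib ic (toX ia ib e ab) bc) cd) e))

  -- `T₀` is the original set. By `base`, edges are mixed only by neighbours of `T₀`, so one step
  -- per vertex of `T₀` is enough although `T` keeps growing.
  record State (U : Live) (T₀ T : List V) (cT : V → Color) (S : Live) (L : Lists) : Set where
    field
      core : Core U T cT S L
      conn : ConnT T
      T⊆U : ∀ t → t ∈ T → U t ≡ true
      T₀⊆T : ∀ {t} → t ∈ T₀ → t ∈ T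
      hasNb : ∀ p → p ∈ T₀ → Σ V λ p' → p' ∈ T × p ~ p'
      base : ∀ x w w' → S x ≡ true → S w ≡ true → S w' ≡ true → nT T x ≡ true → nT T w ≡ false → nT T w' ≡ false → w ~ w' → x ~ w → x ≁ w' → Σ V λ p → p ∈ T₀ × x ~ p
      separate : Separate T cT S
    open Core core public

  DeadAt : Live → List V → V → Set
  DeadAt S T p = ∀ x w w' → S x ≡ true → x ~ p → S w ≡ true → S w' ≡ true → nT T w ≡ false → nT T w' ≡ false → w ~ w' → x ~ w → x ≁ w' → ⊥

  dead-mono : ∀ {S S' T T' p} → (∀ v → S' v ≡ true → S v ≡ true) → (∀ {t} → t ∈ T → t ∈ T') → DeadAt S T p → DeadAt S' T' p
  dead-mono hs ht d x w w' sx xp sw sw' nw nw' = d x w w' (hs x sx) xp (hs w sw) (hs w' sw') (nT-mono-f ht nw) (nT-mono-f ht nw')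

  -- After x and w have joined T, an edge mixed by a further neighbour of p extends w, x, p to a P6.
  module KillStep {U T₀ T cT S L} (st : State U T₀ T cT S L) (p : V) (ip₀ : p ∈ T₀) where
    open State st
    ip : p ∈ T
    ip = T₀⊆T ip₀
    p' : V
    p' = proj₁ (hasNb p ip₀)
    ip' : p' ∈ T
    ip' = proj₁ (proj₂ (hasNb p ip₀))
    pp' : p ~ p'
    pp' = proj₂ (proj₂ (hasNb p ip₀))

    m₁ : V → V → Bool
    m₁ w x = (S x ∧ adj x p) ∧ adj x w
    m₂ : V → V → V → Bool
    m₂ w x w' = (S w' ∧ not (nT T w')) ∧ (adj w w' ∧ not (adj x w'))
    opaque
      C : V → Bool
      C w = (S w ∧ not (nT T w)) ∧ some (λ x → m₁ w x ∧ some (m₂ w x))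
      C⇒ : ∀ w → C w ≡ true → (S w ≡ true × nT T w ≡ false) × (Σ V λ x → S x ≡ true × x ~ p × x ~ w)
      C⇒ w c = let (x , z) = some⇒ (λ x → m₁ w x ∧ some (m₂ w x)) (∧-r {S w ∧ not (nT T w)} c)
                   m = ∧-l {m₁ w x} z
               in (∧-l (∧-l c) , not-t (∧-r {S w} (∧-l c))) , x , ∧-l (∧-l m) , ∧-r {S x} (∧-l m) , ∧-r {S x ∧ adj x p} m
      ⇒C : ∀ x w w' → S x ≡ true → x ~ p → S w ≡ true → S w' ≡ true → nT T w ≡ false → nT T w' ≡ false → w ~ w' → x ~ w → x ≁ w' → C w ≡ true
      ⇒C x w w' sx xp sw sw' nw nw' e xw xw' = ∧-i (∧-i sw (not-f nw)) (⇒some (λ x → m₁ w x ∧ some (m₂ w x)) x (∧-i (∧-i (∧-i sx xp) xw) (⇒some (m₂ w x) w' (∧-i (∧-i sw' (not-f nw')) (∧-i e (not-f xw'))))))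

    R : V → Color → Bool
    R w c = C w ∧ not (c == cT p)

    -- With all literals of `R` removed, each `w` in `C` has at most the colour of `p`; deleting all
    -- of `C` deletes an end of every edge mixed by a neighbour of `p`.
    module Refined where
      L₁ L₂ : Lists
      L₁ = minus L R
      S₂ : Live
      S₂ = S ∖ C
      L₂ = prune S C L₁
      only : ∀ w → C w ≡ true → ∀ c → L₁ w c ≡ true → c ≡ cT p
      only w cw c l with bool-em (c == cT p)
      ... | inj₁ e = ==-t e
      ... | inj₂ e = ⊥-elim (f≢t (not-t (∧-r {L w c} l)) (∧-i cw (not-f e)))
      L₂⊆ : ∀ v c → L₂ v c ≡ true → L v c ≡ true
      L₂⊆ v c q = ∧-l (∧-l q)
      state : (∀ v → S v ≡ true → C v ≡ true → Σ Color λ c → L₁ v c ≡ true) → State U T₀ T cT S₂ L₂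
      state ne = record
        { core = record
            { proper-T = proper-T
            ; mono-T = λ x t t' s → mono-T x t t' (∧-l s)
            ; list-ok = λ x t s i e → ¬t⇒f λ q → f≢t (list-ok x t (∧-l s) i e) (L₂⊆ x (cT t) q)
            ; disjoint = λ t i → ¬t⇒f λ s → f≢t (disjoint t i) (∧-l s)
            ; S⊆U = λ v s → S⊆U v (∧-l s)
            ; deleted = del }
        ; conn = conn ; T⊆U = T⊆U ; T₀⊆T = T₀⊆T ; hasNb = hasNb
        ; base = λ x w w' sx sw sw' → base x w w' (∧-l sx) (∧-l sw) (∧-l sw')
        ; separate = λ x y t t' s s' → separate x y t t' (∧-l s) (∧-l s') }
        where
        del : ∀ v → U v ≡ true → S₂ v ≡ false → mem v T ≡ false → Coloured S₂ L₂ v × Loc U T v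
        del v uv s nm with bool-em (S v)
        ... | inj₂ f = let ((j , h) , l) = deleted v uv f nm in (j , λ u su e → ¬t⇒f λ q → f≢t (h u (∧-l su) e) (L₂⊆ u j q)) , l
        ... | inj₁ t with bool-em (C v)
        ... | inj₂ c = ⊥-elim (f≢t s (∧-i t (not-f c)))
        ... | inj₁ c = let (j , l) = ne v t c
                           (_ , x , sx , xp , xv) = C⇒ v c
                       in (j , λ u su e → prune-no S C L₁ u v j t c (sw~ e) l) , inj₂ (x , S⊆U x sx , ⇒nT ip xp , xv)
      dead : DeadAt S₂ T p
      dead x w w' sx xp sw sw' nw nw' e xw xw' = f≢t (not-t (∧-r {S w} sw)) (⇒C x w w' (∧-l sx) xp (∧-l sw) (∧-l sw') nw nw' e xw xw')

    -- As `γ` differs from the colour of `p`, no live vertex sees both `w` and `p` afterwards; the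
    -- same holds for `x` and `p`, which are adjacent.
    module Literal (w : V) (γ : Color) (γp : γ ≢ cT p) (sw : S w ≡ true) (nw : nT T w ≡ false) (x : V) (sx : S x ≡ true) (xp : x ~ p) (xw : x ~ w) (i : Color) where
      L* : Lists
      L* = set (set L w γ) x i
      L*⊆ : ∀ v c → L* v c ≡ true → L v c ≡ true
      L*⊆ v c q = ∧-l (∧-l q)
      cT' : V → Color
      cT' v = if eqb v x then i else (if eqb v w then γ else cT v)
      x≢w : eqb w x ≡ false
      x≢w = ¬t⇒f λ q → f≢t nw (subst (λ z → nT T z ≡ true) (sym (eqb-t q)) (⇒nT ip xp))
      c-x : cT' x ≡ i
      c-x rewrite eqb-refl x = refl
      c-w : cT' w ≡ γ
      c-w rewrite x≢w | eqb-refl w = refl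
      not-T : ∀ t → t ∈ T → ∀ y → S y ≡ true → eqb t y ≡ false
      not-T t it y s = ¬t⇒f λ q → f≢t (disjoint t it) (subst (λ z → S z ≡ true) (sym (eqb-t q)) s)
      c-t : ∀ t → t ∈ T → cT' t ≡ cT t
      c-t t it rewrite not-T t it x sx | not-T t it w sw = refl
      N : List V
      N = x ∷ w ∷ []
      un : ∀ n → n ∈ N → ∀ c → L* n c ≡ true → c ≡ cT' n
      un n (here refl) c l = trans (set-at {set L w γ} l) (sym c-x)
      un n (there (here refl)) c l = trans (set-at {L} (∧-l l)) (sym c-w)
      sN : ∀ n → n ∈ N → S n ≡ true
      sN n (here refl) = sx
      sN n (there (here refl)) = sw
      open Advance U T cT' S L*
        (λ t t' it it' e q → proper-T t t' it it' e (trans (sym (c-t t it)) (trans q (c-t t' it'))))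
        (λ y t s it e → ¬t⇒f λ q → f≢t (list-ok y t s it e) (subst (λ z → L y z ≡ true) (c-t t it) (L*⊆ y (cT' t) q)))
        disjoint S⊆U
        (λ v uv s nm → (proj₁ (proj₁ (deleted v uv s nm)) , λ u su e → ¬t⇒f λ q → f≢t (proj₂ (proj₁ (deleted v uv s nm)) u su e) (L*⊆ u _ q)) , proj₂ (deleted v uv s nm))
        N sN un public
      x≁p' : x ≁ p'
      x≁p' = ¬t⇒f λ e → proper-T p p' ip ip' pp' (mono-T x p p' sx ip ip' xp e)
      w≁ : ∀ {t} → t ∈ T → w ≁ t
      w≁ = nT-f nw
      old : ∀ {t} → t ∈ T → t ∈ T'
      old k = there (there k)
      conn' : ConnT T'
      conn' Q t₀ i₀ q cl = all'
        where
        onT : ∀ t₁ → t₁ ∈ T → Q t₁ ≡ true → ∀ t → t ∈ T → Q t ≡ true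
        onT t₁ i₁ q₁ = conn Q t₁ i₁ q₁ (λ t t' k k' → cl t t' (old k) (old k'))
        qp : Q p ≡ true
        qp = toP t₀ i₀ q
          where
          fx : Q x ≡ true → Q p ≡ true
          fx z = cl x p (here refl) (old ip) z xp
          toP : ∀ t → t ∈ T' → Q t ≡ true → Q p ≡ true
          toP t (here refl) z = fx z
          toP t (there (here refl)) z = fx (cl w x (there (here refl)) (here refl) z (sw~ xw))
          toP t (there (there k)) z = onT t k z p ip
        qx : Q x ≡ true
        qx = cl p x (old ip) (here refl) qp (sw~ xp)
        all' : ∀ t → t ∈ T' → Q t ≡ true
        all' t (here refl) = qx
        all' t (there (here refl)) = cl x w (here refl) (there (here refl)) qx xw
        all' t (there (there k)) = onT p ip qp t k
      p4 : P4In T'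
      p4 = record { a = w ; b = x ; c = p ; d = p' ; ia = there (here refl) ; ib = here refl ; ic = old ip ; id = old ip'
                  ; ab = sw~ xw ; bc = xp ; cd = pp' ; ac = w≁ ip ; ad = w≁ ip' ; bd = x≁p' }
      S₂⊆ : ∀ v → S₂ v ≡ true → S v ≡ true
      S₂⊆ v s = ∧-l (∧-l s)
      module _ (co : Core U T' cT' S₂ L₂) where
        private module K = Core co
        farX : ∀ {y} → nT T' y ≡ false → y ≁ x
        farX n = nT-f n (here refl)
        farW : ∀ {y} → nT T' y ≡ false → y ≁ w
        farW n = nT-f n (there (here refl))
        farT : ∀ {y t} → nT T' y ≡ false → t ∈ T → y ≁ t
        farT n k = nT-f n (old k)
        -- A mixing vertex that sees `x` or `w` but nothing of the old `T` would prolong the path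
        -- over `x` and `p` to a P6.
        base' : ∀ x₃ w₃ w₃' → S₂ x₃ ≡ true → S₂ w₃ ≡ true → S₂ w₃' ≡ true → nT T' x₃ ≡ true → nT T' w₃ ≡ false → nT T' w₃' ≡ false → w₃ ~ w₃' → x₃ ~ w₃ → x₃ ≁ w₃' → Σ V λ p → p ∈ T₀ × x₃ ~ p
        base' x₃ w₃ w₃' s₁ s₂ s₃ n₁ n₂ n₃ e e₁ e₂ with bool-em (nT T x₃)
        ... | inj₁ q = base x₃ w₃ w₃' (S₂⊆ x₃ s₁) (S₂⊆ w₃ s₂) (S₂⊆ w₃' s₃) q (nT-mono-f old n₂) (nT-mono-f old n₃) e e₁ e₂
        ... | inj₂ q with bool-em (adj x₃ x)
        ... | inj₁ a = ⊥-elim (noP6 (mkP6 w₃' w₃ x₃ x p p' (sw~ e) (sw~ e₁) a xp pp'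
                 (sw≁ e₂) (farX n₃) (farT n₃ ip) (farT n₃ ip') (farX n₂) (farT n₂ ip) (farT n₂ ip') (nT-f q ip) (nT-f q ip') x≁p'))
        ... | inj₂ a with nT⇒ T' x₃ n₁
        ... | _ , here refl , b = ⊥-elim (f≢t a b)
        ... | _ , there (there k) , b = ⊥-elim (f≢t (nT-f q k) b)
        ... | _ , there (here refl) , b = ⊥-elim (noP6 (mkP6 w₃' w₃ x₃ w x p (sw~ e) (sw~ e₁) b (sw~ xw) xp
                 (sw≁ e₂) (farW n₃) (farX n₃) (farT n₃ ip) (farW n₂) (farX n₂) (farT n₂ ip) a (nT-f q ip) (w≁ ip)))
        dead' : DeadAt S₂ T' p
        dead' x₃ w₃ w₃' s₁ x₃p s₂ s₃ n₂ n₃ e e₁ e₂ = noP6 (mkP6 w₃' w₃ x₃ p x w (sw~ e) (sw~ e₁) x₃p (sw~ xp) xw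
            (sw≁ e₂) (farT n₃ ip) (farX n₃) (farW n₃) (farT n₂ ip) (farX n₂) (farW n₂)
            (¬t⇒f λ a → K.proper-T x p (here refl) (old ip) xp (K.mono-T x₃ x p s₁ (here refl) (old ip) a x₃p))
            (¬t⇒f λ a → γp (trans (sym c-w) (trans (K.mono-T x₃ w p s₁ (there (here refl)) (old ip) a x₃p) (c-t p ip))))
            (sw≁ (w≁ ip)))
        state : State U T₀ T' cT' S₂ L₂
        state = record { core = co ; conn = conn'
          ; T⊆U = λ { t (here refl) → S⊆U x sx ; t (there (here refl)) → S⊆U w sw ; t (there (there k)) → T⊆U t k }
          ; T₀⊆T = λ k → old (T₀⊆T k) ; hasNb = λ q k → let (q' , j , e) = hasNb q k in q' , old j , e
          ; base = base' ; separate = separate-P4 T' cT' S₂ conn' K.proper-T K.mono-T p4 }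

    kill : ∀ {m} → (∀ T' cT' S' L' → State U T₀ T' cT' S' L' → length T' ≤ 2 + length T → (∀ v → S' v ≡ true → S v ≡ true) → (∀ {t} → t ∈ T → t ∈ T') → DeadAt S' T' p → Good m S' L') →
      Good (mixBound m) S L
    kill {m} g = branch-literals R (delete-units C sy (λ v s c i j li lj → trans (Refined.only v c i li) (sym (Refined.only v c j lj)))
                   λ ne _ → g T cT Refined.S₂ Refined.L₂ (Refined.state ne) (m≤n+m _ 2) (λ v s → ∧-l s) (λ k → k) Refined.dead)
        λ w γ _ r → let ((sw , nw) , x , sx , xp , xw) = C⇒ w (∧-l r)
                        γp = ==-f⁻ (not-t (∧-r {C w} r))
                    in branch x sx λ i _ → let open Literal w γ γp sw nw x sx xp xw i in
                         advance λ co → g T' cT' S₂ L₂ (state co) ≤-refl S₂⊆ old (dead' co)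

  kills : ∀ {m ℓ U T₀} ps → (∀ {p} → p ∈ ps → p ∈ T₀) → ∀ {T cT S L} → State U T₀ T cT S L → length T ≤ ℓ →
    (∀ T' cT' S' L' → State U T₀ T' cT' S' L' → length T' ≤ length ps + length ps + ℓ → (∀ v → S' v ≡ true → S v ≡ true) → (∀ {t} → t ∈ T → t ∈ T') → (∀ p → p ∈ ps → DeadAt S' T' p) → Good m S' L') →
    Good (mixBounds (length ps) m) S L
  kills [] inn st le g = g _ _ _ _ st le (λ _ s → s) (λ k → k) (λ _ ())
  kills {m} {ℓ} (p ∷ ps) inn st le g = KillStep.kill st p (inn (here refl)) λ T' cT' S' L' st' le' hs ht dead →
    kills {m} {2 + ℓ} ps (λ k → inn (there k)) st' (≤-trans le' (s≤s (s≤s le))) λ T'' cT'' S'' L'' st'' le'' hs' ht' deads →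
      g T'' cT'' S'' L'' st'' (≤-trans le'' (≤-reflexive (eq (length ps) ℓ))) (λ v s → hs v (hs' v s)) (λ k → ht' (ht k))
        λ { q (here refl) → dead-mono hs' ht' dead ; q (there k) → deads q k }
    where
    eq : ∀ k ℓ → k + k + (2 + ℓ) ≡ suc k + suc k + ℓ
    eq k ℓ rewrite +-suc k k | +-suc (k + k) (suc ℓ) | +-suc (k + k) ℓ = refl

-- P6-free graphs

-- The sizes 12 and 6 of `T` used below are 4 + 2 · 4 and 2 + 2 · 2: each vertex of the initial set
-- causes at most two additions.
singleBound rootedBound : ℕ
finalBound : ℕ → ℕ → ℕ
singleBound = comboBound 1 * contractFactor
finalBound ℓ m = pureBound ℓ (singleBound + m)
rootedBound = singleBound + mixBounds 2 (finalBound 6 0)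

withP4Bound withoutP4Bound : ℕ
withP4Bound = branches 4 (unitBound (unitBound (mixBounds 4 (finalBound 12 rootedBound))))
withoutP4Bound = branch1 (unitBound singleBound)

opaque
  p6Bound : ℕ
  p6Bound = withoutP4Bound + withP4Bound
  with≤p6Bound : withP4Bound ≤ p6Bound
  with≤p6Bound = m≤n+m _ _
  without≤p6Bound : withoutP4Bound ≤ p6Bound
  without≤p6Bound = m≤m+n _ _

module P6Free (V : Set) (_≟_ : DecidableEquality V) (vs : List V) (complete : ∀ v → v ∈ vs)
             (adj : V → V → Bool) (sy : ∀ u v → adj u v ≡ adj v u) (irr : ∀ v → adj v v ≡ false) (noP6 : ¬ P6In adj) where
  open Kills V _≟_ vs complete adj sy irr noP6 public

  -- An induced path `v`, `q`, `q'` leads away from `K`; an edge of `K` mixed by a neighbour of `v`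
  -- would prolong it to a P6. So the single vertex `v` can replace `T`.
  tail : ∀ {m} K r v j q q' L → Conn K r → K r ≡ true → (Σ V λ u → K u ≡ true × u ~ v) → (∀ u → K u ≡ true → u ~ v → L u j ≡ false) →
    v ~ q → q ~ q' → v ≁ q' → (∀ u → K u ≡ true → u ≁ q) → (∀ u → K u ≡ true → u ≁ q') → Good (singleBound + m) K L
  tail {m} K r v j q q' L cn kr un col vq qq' vq' nq nq' = good-weaken (m≤m+n singleBound m) (pure-single K r v j L cn kr un col mix)
    where
    mix : ∀ x w w' → K x ≡ true → K w ≡ true → K w' ≡ true → x ~ v → w ≁ v → w' ≁ v → w ~ w' → x ~ w → x ~ w'
    mix x w w' kx kw kw' xv wv wv' e xw with bool-em (adj x w')
    ... | inj₁ p = p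
    ... | inj₂ n = ⊥-elim (noP6 (mkP6 w' w x v q q' (sw~ e) (sw~ xw) xv vq qq' (sw≁ n) wv' (nq w' kw') (nq' w' kw') wv (nq w kw) (nq' w kw) (nq x kx) (nq' x kx) vq'))

  -- Once all of `T₀` is dead the state is pure, and lone components remain. By connectivity of `U`,
  -- such a component is attached to a deleted vertex, and `tail` applies to that vertex, or to a
  -- neighbour of it, unless a vertex complete to `T` is met; this case is left to `handler`.
  final : ∀ {m ℓ U T₀ T cT S L r} → State U T₀ T cT S L → Conn U r → (t₀ : V) → t₀ ∈ T → length T ≤ ℓ → (∀ p → p ∈ T₀ → DeadAt S T p) →
    (∀ K r v → Conn K r → K r ≡ true → (∀ u → K u ≡ true → S u ≡ true × nT T u ≡ false) → U v ≡ true → S v ≡ false → mem v T ≡ false → (∀ t → t ∈ T → v ~ t) → (Σ V λ u → K u ≡ true × u ~ v) → Coloured K L v → Good m K L) →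
    Good (finalBound ℓ m) S L
  final {m} {ℓ} {U} {T₀} {T} {cT} {S} {L} {r} st cn t₀ it₀ le dead handler =
      good-weaken (+-mono-≤ (*-monoˡ-≤ contractFactor (comboBound-mono le)) ≤-refl)
        (pure-good T cT S L proper-T mono-T list-ok pure separate (by-components sy comp))
    where
    open State st
    pure : Pure T S
    pure x w w' sx sw sw' nx nw nw' e xw with bool-em (adj x w')
    ... | inj₁ p = p
    ... | inj₂ n = let (p , ip , xp) = base x w w' sx sw sw' nx nw nw' e xw n in ⊥-elim (dead p ip x w w' sx xp sw sw' nw nw' e xw n)
    open PureState T cT S L proper-T mono-T list-ok pure separate using (lone; lone-closed)
    comp : ∀ K k → (∀ v → K v ≡ true → (S ∩ lone) v ≡ true) → K k ≡ true → Conn K k → (∀ u v → K u ≡ true → (S ∩ lone) v ≡ true → u ~ v → K v ≡ true) → Good (singleBound + m) K L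
    comp K k sub kk ck cl with search (λ v → (U v ∧ not (K v)) ∧ some (λ u → K u ∧ adj u v))
    ... | inj₂ no' = ⊥-elim (f≢t (disjoint t₀ it₀) (∧-l (sub t₀ (conn-any cn k (S⊆U k (∧-l (sub k kk))) K kk clU t₀ (T⊆U t₀ it₀)))))
      where
      clU : ∀ a b → U a ≡ true → U b ≡ true → K a ≡ true → a ~ b → K b ≡ true
      clU a b ua ub ka e with bool-em (K b)
      ... | inj₁ p = p
      ... | inj₂ p = ⊥-elim (f≢t (no' b) (∧-i (∧-i ub (not-f p)) (⇒some (λ u → K u ∧ adj u b) a (∧-i ka e))))
    ... | inj₁ (v , p) = dispatch v (∧-l (∧-l p)) (not-t (∧-r {U v} (∧-l p)))
            (let (u , z) = some⇒ (λ u → K u ∧ adj u v) (∧-r {U v ∧ not (K v)} p) in u , ∧-l z , ∧-r {K u} z)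
      where
      kS : ∀ {u} → K u ≡ true → S u ≡ true
      kS {u} ku = ∧-l (sub u ku)
      kn : ∀ {u} → K u ≡ true → nT T u ≡ false
      kn {u} ku = not-t (∧-l (∧-r {S u} (sub u ku)))
      gone : ∀ v u → U v ≡ true → K v ≡ false → K u ≡ true → u ~ v → S v ≡ false × mem v T ≡ false
      gone v u uv kv ku e = ¬t⇒f inS , ¬t⇒f (λ q → f≢t (nT-f (kn ku) (mem⇒ T q)) e)
        where
        inS : S v ≡ true → ⊥
        inS sv = f≢t kv (cl u v ku (∧-i sv (lone-closed u v (kS ku) sv (∧-r {S u} (sub u ku)) e)) e)
      near : ∀ v → U v ≡ true → K v ≡ false → (Σ V λ u → K u ≡ true × u ~ v) → nT T v ≡ true → Good (singleBound + m) K L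
      near v uv kv (u , ku , e) nv with search (λ t → (mem t T ∧ adj v t) ∧ some (λ t' → (mem t' T ∧ adj t t') ∧ not (adj v t')))
      ... | inj₁ (t , q) = let (t' , z) = some⇒ (λ t' → (mem t' T ∧ adj t t') ∧ not (adj v t')) (∧-r {mem t T ∧ adj v t} q)
                               (sf , mf) = gone v u uv kv ku e
                               ((j , h) , _) = deleted v uv sf mf
                           in tail K k v j t t' L ck kk (u , ku , e) (λ y ky → h y (kS ky)) (∧-r {mem t T} (∧-l q)) (∧-r {mem t' T} (∧-l {mem t' T ∧ adj t t'} z)) (not-t (∧-r {mem t' T ∧ adj t t'} z))
                                (λ y ky → nT-f (kn ky) (mem⇒ T (∧-l (∧-l q)))) (λ y ky → nT-f (kn ky) (mem⇒ T (∧-l (∧-l z))))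
      ... | inj₂ none = let (sf , mf) = gone v u uv kv ku e
                            ((j , h) , _) = deleted v uv sf mf
                            (t₁ , i₁ , e₁) = nT⇒ T v nv
                        in good-weaken (m≤n+m m singleBound) (handler K k v ck kk (λ y ky → kS ky , kn ky) uv sf mf (conn (λ t → adj v t) t₁ i₁ e₁ step) (u , ku , e) (j , λ y ky → h y (kS ky)))
        where
        step : ∀ t t' → t ∈ T → t' ∈ T → v ~ t → t ~ t' → v ~ t'
        step t t' i i' a b with bool-em (adj v t')
        ... | inj₁ c = c
        ... | inj₂ c = ⊥-elim (f≢t (none t) (∧-i (∧-i (⇒mem i) a) (⇒some (λ t' → (mem t' T ∧ adj t t') ∧ not (adj v t')) t' (∧-i (∧-i (⇒mem i') b) (not-f c)))))
      dispatch : ∀ v → U v ≡ true → K v ≡ false → (Σ V λ u → K u ≡ true × u ~ v) → Good (singleBound + m) K L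
      dispatch v uv kv un with bool-em (nT T v)
      ... | inj₁ nv = near v uv kv un nv
      ... | inj₂ nv with gone v (proj₁ un) uv kv (proj₁ (proj₂ un)) (proj₂ (proj₂ un))
      ... | sf , mf with deleted v uv sf mf
      ... | _ , inj₁ q = ⊥-elim (f≢t nv q)
      -- `v` does not see `T`, but its neighbour `x` does. If `x` sees the component it takes the
      -- place of `v`; otherwise `v`, `x`, `t` is the path for `tail`.
      ... | (j , h) , inj₂ (x , ux , nx , xv) with search (λ u → K u ∧ adj u x)
      ... | inj₁ (u , z) = near x ux (¬t⇒f λ kx → f≢t (kn kx) nx) (u , ∧-l z , ∧-r {K u} z) nx
      ... | inj₂ none = let (t , it , xt) = nT⇒ T x nx in
             tail K k v j x t L ck kk un (λ y ky → h y (kS ky)) (sw~ xv) xt (nT-f nv it)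
               (λ y ky → ¬t⇒f λ a → f≢t (none y) (∧-i ky a)) (λ y ky → nT-f (kn ky) it)

  -- Treats a vertex `v` complete to `T`: the argument restarts from the edge `v q` with `q` in the
  -- old `T`. The exceptional case cannot recur, because no vertex of `K` sees `q`.
  rooted : ∀ K r v q L → Conn K r → K r ≡ true → K v ≡ false → K q ≡ false → (∀ u → K u ≡ true → u ≁ q) → v ~ q → (Σ V λ u → K u ≡ true × u ~ v) → Coloured K L v → Good (mixBounds 2 (finalBound 6 0)) K L
  rooted K r v q L cn kr kv kq nq vq (u₀ , ku₀ , eu₀) (j , col) = kills (v ∷ q ∷ []) (λ k → k) st ≤-refl
      λ T' cT' S' L' st' le hs ht dead → final st' cnU v (ht (here refl)) le dead (handler st' hs ht)
    where
    U : Live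
    U z = K z ∨ (eqb z v ∨ eqb z q)
    uK : ∀ {z} → K z ≡ true → U z ≡ true
    uK = ∨-il
    uv : U v ≡ true
    uv = ∨-ir {K v} (∨-il (eqb-refl v))
    uq : U q ≡ true
    uq = ∨-ir {K q} (∨-ir {eqb q v} (eqb-refl q))
    U⇒ : ∀ z → U z ≡ true → K z ≡ true ⊎ (z ≡ v ⊎ z ≡ q)
    U⇒ z p with ∨-e {K z} p
    ... | inj₁ k = inj₁ k
    ... | inj₂ p' with ∨-e {eqb z v} p'
    ... | inj₁ e = inj₂ (inj₁ (eqb-t e))
    ... | inj₂ e = inj₂ (inj₂ (eqb-t e))
    cnU : Conn U r
    cnU Q qr cl z uz with U⇒ z uz
    ... | inj₁ k = onK z k
      where onK = cn Q qr (λ a b ka kb → cl a b (uK ka) (uK kb))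
    ... | inj₂ (inj₁ refl) = cl u₀ v (uK ku₀) uv (cn Q qr (λ a b ka kb → cl a b (uK ka) (uK kb)) u₀ ku₀) eu₀
    ... | inj₂ (inj₂ refl) = cl v q uv uq (cl u₀ v (uK ku₀) uv (cn Q qr (λ a b ka kb → cl a b (uK ka) (uK kb)) u₀ ku₀) eu₀) vq
    T : List V
    T = v ∷ q ∷ []
    cT : V → Color
    -- `third j j` stands for some colour other than `j`; no vertex of `K` sees `q`, so no list has
    -- to match it.
    cT z = if eqb z v then j else third j j
    cv : cT v ≡ j
    cv rewrite eqb-refl v = refl
    cq : cT q ≡ third j j
    cq with bool-em (eqb q v)
    ... | inj₁ e = ⊥-elim (f≢t (irr v) (subst (λ z → v ~ z) (eqb-t e) vq))
    ... | inj₂ e rewrite e = refl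
    seeV : ∀ {x t} → K x ≡ true → t ∈ T → x ~ t → t ≡ v
    seeV kx (here e) _ = e
    seeV {x} kx (there (here refl)) e = ⊥-elim (f≢t (nq x kx) e)
    st : State U (v ∷ q ∷ []) T cT K L
    st = record
      { core = record
          { proper-T = pT
          ; mono-T = λ x t t' kx i i' e e' → trans (cong cT (seeV kx i e)) (sym (cong cT (seeV kx i' e')))
          ; list-ok = λ x t kx i e → subst (λ z → L x z ≡ false) (sym (trans (cong cT (seeV kx i e)) cv)) (col x kx (subst (λ z → x ~ z) (seeV kx i e) e))
          ; disjoint = λ { t (here refl) → kv ; t (there (here refl)) → kq }
          ; S⊆U = λ z k → uK k
          ; deleted = λ z uz kz nm → ⊥-elim (noD z (U⇒ z uz) kz nm) }
      ; conn = cnT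
      ; T⊆U = λ { t (here refl) → uv ; t (there (here refl)) → uq }
      ; T₀⊆T = λ k → k
      ; hasNb = λ { p (here refl) → q , there (here refl) , vq ; p (there (here refl)) → v , here refl , sw~ vq }
      ; base = λ x w w' _ _ _ nx _ _ _ _ _ → nT⇒ T x nx
      ; separate = λ x y t t' kx ky i i' e e' ne → ⊥-elim (ne (trans (cong cT (seeV kx i e)) (sym (cong cT (seeV ky i' e'))))) }
      where
      pT : ∀ t t' → t ∈ T → t' ∈ T → t ~ t' → cT t ≢ cT t'
      pT t t' (here refl) (here refl) e _ = f≢t (irr v) e
      pT t t' (here refl) (there (here refl)) e z = third≢l j j (trans (sym cq) (trans (sym z) cv))
      pT t t' (there (here refl)) (here refl) e z = third≢l j j (trans (sym cq) (trans z cv))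
      pT t t' (there (here refl)) (there (here refl)) e _ = f≢t (irr q) e
      noD : ∀ z → K z ≡ true ⊎ (z ≡ v ⊎ z ≡ q) → K z ≡ false → mem z T ≡ false → ⊥
      noD z (inj₁ k) kz _ = f≢t kz k
      noD z (inj₂ (inj₁ refl)) _ nm = f≢t nm (⇒mem (here refl))
      noD z (inj₂ (inj₂ refl)) _ nm = f≢t nm (⇒mem (there (here refl)))
      cnT : ConnT T
      cnT Q t₀ i₀ q₀ cl = all' (toV t₀ i₀ q₀)
        where
        toV : ∀ t → t ∈ T → Q t ≡ true → Q v ≡ true
        toV t (here refl) z = z
        toV t (there (here refl)) z = cl q v (there (here refl)) (here refl) z (sw~ vq)
        all' : Q v ≡ true → ∀ t → t ∈ T → Q t ≡ true
        all' z t (here refl) = z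
        all' z t (there (here refl)) = cl v q (here refl) (there (here refl)) z vq
    handler : ∀ {T' cT' S' L'} → State U (v ∷ q ∷ []) T' cT' S' L' → (∀ z → S' z ≡ true → K z ≡ true) → (∀ {t} → t ∈ T → t ∈ T') →
      ∀ K' r' v' → Conn K' r' → K' r' ≡ true → (∀ u → K' u ≡ true → S' u ≡ true × nT T' u ≡ false) → U v' ≡ true → S' v' ≡ false → mem v' T' ≡ false → (∀ t → t ∈ T' → v' ~ t) → (Σ V λ u → K' u ≡ true × u ~ v') → Coloured K' L' v' → Good 0 K' L'
    handler st' hs ht K' r' v' _ _ _ uv' _ nm full _ _ = ⊥-elim (go (U⇒ v' uv'))
      where
      go : K v' ≡ true ⊎ (v' ≡ v ⊎ v' ≡ q) → ⊥
      go (inj₁ k) = f≢t (nq v' k) (full q (ht (there (here refl))))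
      go (inj₂ (inj₁ refl)) = f≢t nm (⇒mem (ht (here refl)))
      go (inj₂ (inj₂ refl)) = f≢t nm (⇒mem (ht (there (here refl))))

  module Top (U : Live) (L : Lists) (r : V) (ur : U r ≡ true) (cn : Conn U r) where
    module With (a b c d : V) (p : isP4 U a b c d ≡ true) where
      open P4Facts U p
      N : List V
      N = a ∷ b ∷ c ∷ d ∷ []
      pattern at-a = here refl
      pattern at-b = there (here refl)
      pattern at-c = there (there (here refl))
      pattern at-d = there (there (there (here refl)))
      uN : ∀ n → n ∈ N → U n ≡ true
      uN n at-a = ua
      uN n at-b = ub
      uN n at-c = uc
      uN n at-d = ud
      cnN : ConnT N
      cnN Q t₀ i₀ q₀ cl = all' (toA t₀ i₀ q₀)
        where
        toA : ∀ t → t ∈ N → Q t ≡ true → Q a ≡ true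
        fb : Q b ≡ true → Q a ≡ true
        fb z = cl b a at-b at-a z (sw~ ab)
        fc : Q c ≡ true → Q a ≡ true
        fc z = fb (cl c b at-c at-b z (sw~ bc))
        toA t at-a z = z
        toA t at-b z = fb z
        toA t at-c z = fc z
        toA t at-d z = fc (cl d c at-d at-c z (sw~ cd))
        all' : Q a ≡ true → ∀ t → t ∈ N → Q t ≡ true
        all' z t at-a = z
        all' z t at-b = cl a b at-a at-b z ab
        all' z t at-c = cl b c at-b at-c (cl a b at-a at-b z ab) bc
        all' z t at-d = cl c d at-c at-d (cl b c at-b at-c (cl a b at-a at-b z ab) bc) cd
      p4 : P4In N
      p4 = record { a = a ; b = b ; c = c ; d = d ; ia = at-a ; ib = at-b ; ic = at-c ; id = at-d ; ab = ab ; bc = bc ; cd = cd ; ac = ac ; ad = ad ; bd = bd }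
      good : Good withP4Bound U L
      good = branch-all N L uN λ cT L' sub un →
          let module A = Advance U [] cT U L' (λ _ _ ()) (λ _ _ _ ()) (λ _ ()) (λ _ u → u) (λ v u f → ⊥-elim (f≢t f u)) N uN un
          in A.advance λ co →
               let st : State U N N cT A.S₂ A.L₂
                   st = record { core = co ; conn = cnN ; T⊆U = uN ; T₀⊆T = λ k → k
                               ; hasNb = λ { n at-a → b , at-b , ab ; n at-b → a , at-a , sw~ ab ; n at-c → d , at-d , cd ; n at-d → c , at-c , sw~ cd }
                               ; base = λ x w w' _ _ _ nx _ _ _ _ _ → nT⇒ N x nx
                               ; separate = separate-P4 N cT A.S₂ cnN (Core.proper-T co) (Core.mono-T co) p4 }
               in kills N (λ k → k) st ≤-refl λ T' cT' S' L'' st' le hs ht dead →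
                    final st' cn a (ht at-a) le dead λ K k v ck kk h uv sv mv full un' col →
                      good-weaken (m≤n+m _ singleBound) (rooted K k v a L'' ck kk
                         (¬t⇒f λ kv → f≢t sv (proj₁ (h v kv))) (¬t⇒f λ ka → f≢t (Core.disjoint (State.core st') a (ht at-a)) (proj₁ (h a ka)))
                         (λ u ku → nT-f (proj₂ (h u ku)) (ht at-a)) (full a (ht at-a)) un' col)

    -- Here a single vertex `r` serves as `T`: an edge mixed by a neighbour of `r` would form an
    -- induced P4 with this neighbour and `r`.
    without : (∀ a b c d → isP4 U a b c d ≡ false) → Good withoutP4Bound U L
    without none = branch r ur λ i _ →
        delete-units C sy (λ v _ cv x y lx ly → trans (unit i v cv x lx) (sym (unit i v cv y ly))) λ ne _ →
          by-components sy λ K k sub kk ck cl →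
            let (u , ku , e) = touch K k sub kk ck cl in
            pure-single K k r i _ ck kk (u , ku , e)
              (λ y ky ey → prune-no U C (set L r i) y r i ur (eqb-refl r) (sw~ ey) (let (c , l) = ne r ur (eqb-refl r) in subst (λ z → set L r i r z ≡ true) (set-at {L} {r} {i} l) l))
              (λ x w w' kx kw kw' xr wr wr' ww' xw → mix x w w' (∧-l (sub x kx)) (∧-l (sub w kw)) (∧-l (sub w' kw')) xr wr wr' ww' xw)
      where
      C : V → Bool
      C v = eqb v r
      unit : ∀ i v → C v ≡ true → ∀ c → set L r i v c ≡ true → c ≡ i
      unit i v cv c l = set-at {L} {r} {i} (subst (λ z → set L r i z c ≡ true) (eqb-t cv) l)
      touch : ∀ K k → (∀ v → K v ≡ true → (U ∖ C) v ≡ true) → K k ≡ true → Conn K k → (∀ u v → K u ≡ true → (U ∖ C) v ≡ true → u ~ v → K v ≡ true) → Σ V λ u → K u ≡ true × u ~ r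
      touch K k sub kk ck cl with search (λ u → K u ∧ adj u r)
      ... | inj₁ (u , z) = u , ∧-l z , ∧-r {K u} z
      ... | inj₂ no' = ⊥-elim (f≢t (not-t (∧-r {U r} (sub r (conn-any cn k (∧-l (sub k kk)) K kk clU r ur)))) (eqb-refl r))
        where
        clU : ∀ a b → U a ≡ true → U b ≡ true → K a ≡ true → a ~ b → K b ≡ true
        clU a b _ ub ka e with bool-em (C b)
        ... | inj₁ q = ⊥-elim (f≢t (no' a) (∧-i ka (subst (λ z → a ~ z) (eqb-t q) e)))
        ... | inj₂ q = cl a b ka (∧-i ub (not-f q)) e
      mix : ∀ x w w' → U x ≡ true → U w ≡ true → U w' ≡ true → x ~ r → w ≁ r → w' ≁ r → w ~ w' → x ~ w → x ~ w'
      mix x w w' ux uw uw' xr wr wr' e xw with bool-em (adj x w')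
      ... | inj₁ q = q
      ... | inj₂ n = ⊥-elim (f≢t (none w' w x r) (∧-i (∧-i (∧-i uw' uw) (∧-i ux ur)) (∧-i (∧-i (∧-i (sw~ e) (sw~ xw)) xr) (∧-i (∧-i (not-f (sw≁ n)) (not-f wr')) (not-f wr)))))

    top : Good p6Bound U L
    top with p4? U
    ... | inj₁ (a , b , c , d , p) = good-weaken with≤p6Bound (With.good a b c d p)
    ... | inj₂ none = good-weaken without≤p6Bound (without none)

  p6-good : ∀ S L → Good p6Bound S L
  p6-good S L = by-components sy λ K r _ kr cn _ → Top.top K L r kr cn

-- P4 + kP1-free graphs

record P4kIn {A : Set} (r : A → A → Bool) (k : ℕ) : Set where
  field
    a b c d : A
    ab : r a b ≡ true
    bc : r b c ≡ true
    cd : r c d ≡ true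
    ac : r a c ≡ false
    ad : r a d ≡ false
    bd : r b d ≡ false
    iso : Fin k → A
    far-a : ∀ i → r a (iso i) ≡ false
    far-b : ∀ i → r b (iso i) ≡ false
    far-c : ∀ i → r c (iso i) ≡ false
    far-d : ∀ i → r d (iso i) ≡ false
    sep : ∀ i j → toℕ i < toℕ j → r (iso i) (iso j) ≡ false
    distinct : ∀ i j → toℕ i < toℕ j → iso i ≢ iso j

all-or : ∀ n {A : ℕ → Set} {B : Set} → (∀ t → t < n → A t ⊎ B) → (∀ t → t < n → A t) ⊎ B
all-or zero h = inj₁ λ _ ()
all-or (suc n) h with h 0 (s≤s z≤n) | all-or n (λ t l → h (suc t) (s≤s l))
... | inj₂ b | _ = inj₂ b
... | inj₁ _ | inj₂ b = inj₂ b
... | inj₁ x | inj₁ f = inj₁ λ { zero _ → x ; (suc t) (s≤s l) → f t l }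

-- Counts edges: an induced path of this length contains P4 + kP1 on its vertices 0, 1, 2, 3 and 5,
-- 7, 9 and so on.
pathLength : ℕ → ℕ
pathLength k = 4 + 2 * k

-- The blocks begin behind the window searched for a chord; the distance between two blocks keeps
-- vertices chosen in different blocks from being consecutive.
blockStart : ℕ → ℕ → ℕ
blockStart W t = 3 + W + t * (2 + W)

chainLength : ℕ → ℕ
chainLength k = blockStart (pathLength k) k

module _ {A : Set} (r : A → A → Bool) (sy : ∀ u v → r u v ≡ r v u) where

  induced-path-P4k : ∀ k (u : ℕ → A) → (∀ i → i < pathLength k → r (u i) (u (suc i)) ≡ true) →
    (∀ i j → i < j → j < pathLength k → r (u i) (u (suc j)) ≡ false) → P4kIn r k
  induced-path-P4k k u e f = record
    { a = u 0 ; b = u 1 ; c = u 2 ; d = u 3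
    ; ab = e 0 (s≤s z≤n) ; bc = e 1 (s≤s (s≤s z≤n)) ; cd = e 2 (s≤s (s≤s (s≤s z≤n)))
    ; ac = f 0 1 (s≤s z≤n) (s≤s (s≤s z≤n))
    ; ad = f 0 2 (s≤s z≤n) (s≤s (s≤s (s≤s z≤n)))
    ; bd = f 1 2 (s≤s (s≤s z≤n)) (s≤s (s≤s (s≤s z≤n)))
    ; iso = λ t → u (suc (p t))
    ; far-a = λ t → f 0 (p t) (s≤s z≤n) (p<W t)
    ; far-b = λ t → f 1 (p t) (s≤s (s≤s z≤n)) (p<W t)
    ; far-c = λ t → f 2 (p t) (s≤s (s≤s (s≤s z≤n))) (p<W t)
    ; far-d = λ t → f 3 (p t) (s≤s (s≤s (s≤s (s≤s z≤n)))) (p<W t)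
    ; sep = λ i j l → f (suc (p i)) (p j) (gap l) (p<W j)
    ; distinct = λ i j l eq → f≢t (f (p i) (p j) (<⇒≤ (gap l)) (p<W j)) (subst (λ z → r (u (p i)) z ≡ true) eq (e (p i) (p<W i)))
    }
    where
    p : Fin k → ℕ
    p t = 4 + 2 * toℕ t
    p<W : ∀ t → p t < pathLength k
    p<W t = +-monoʳ-< 4 (*-monoʳ-< 2 (toℕ<n t))
    gap : ∀ {i j : Fin k} → toℕ i < toℕ j → suc (p i) < p j
    gap {i} {j} l = ≤-trans (≤-reflexive (cong (λ z → suc (suc (suc (suc z)))) (sym (*-suc 2 (toℕ i))))) (+-monoʳ-≤ 4 (*-monoʳ-≤ 2 l))

  module _ (k : ℕ) (v : ℕ → A) (c : ℕ → Color)
           (edge : ∀ i → i < chainLength k → r (v i) (v (suc i)) ≡ true)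
           (diff : ∀ i → i < chainLength k → c i ≢ c (suc i))
           (chord : ∀ i j → i < j → j < chainLength k → r (v i) (v (suc j)) ≡ true → Strong c i j) where
    private
      W M : ℕ
      W = pathLength k
      M = chainLength k
      b : ℕ → ℕ
      b = blockStart W
      b-mono : ∀ {s t} → s ≤ t → b s ≤ b t
      b-mono l = +-monoʳ-≤ (3 + W) (*-monoˡ-≤ (2 + W) l)
      b-suc : ∀ t → b (suc t) ≡ 2 + W + b t
      b-suc t = trans (sym (+-assoc (3 + W) (2 + W) (t * (2 + W)))) (trans (cong (_+ t * (2 + W)) (+-comm (3 + W) (2 + W))) (+-assoc (2 + W) (3 + W) (t * (2 + W))))
      b-next : ∀ {s t} → s < t → 2 + W + b s ≤ b t
      b-next {s} l = ≤-trans (≤-reflexive (sym (b-suc s))) (b-mono l)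

      -- A vertex entered by colour x sees no later vertex entered by colour x.
      apart : ∀ i j → suc i < j → j < M → c i ≡ c j → r (v (suc i)) (v (suc j)) ≡ false
      apart i j l m e = ¬t⇒f λ p → proj₂ (proj₂ (chord (suc i) j l m p)) i refl e
      apart' : ∀ i j → i < j → j < M → c i ≡ c j → r (v i) (v (suc j)) ≡ false
      apart' i j l m e = ¬t⇒f λ p → proj₁ (chord i j l m p) e

      -- With `x` absent, a chord would require four colours: the two around its start, the one
      -- entering its end, and `x`. So the block is an induced path.
      two-colour-block : ∀ s → suc (s + W) ≤ M → (x : Color) → (∀ m → m ≤ W → c (s + m) ≢ x) → P4kIn r k
      two-colour-block s le x nx = induced-path-P4k k (λ o → v (suc s + o))
        (λ o l → subst (λ z → r (v (suc s + o)) (v z) ≡ true) (sym (+-suc (suc s) o)) (edge (suc s + o) (<M l)))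
        (λ o o' l l' → ¬t⇒f λ p → bad o o' l l' (chord (suc s + o) (suc s + o') (+-monoʳ-< (suc s) l) (<M l')
            (subst (λ z → r (v (suc s + o)) (v z) ≡ true) (+-suc (suc s) o') p)))
        where
        <M : ∀ {o} → o < W → suc s + o < M
        <M l = ≤-trans (s≤s (+-monoʳ-< s l)) le
        nx' : ∀ o → o < W → c (suc s + o) ≢ x
        nx' o l e = nx (suc o) l (trans (cong c (+-suc s o)) e)
        bad : ∀ o o' → o < o' → o' < W → Strong c (suc s + o) (suc s + o') → ⊥
        bad o o' l l' (p , q , h) = four-colours (diff (s + o) (≤-trans (n≤1+n _) (<M lo))) (h (s + o) refl) (nx o (<⇒≤ lo)) p (nx' o lo) (nx' o' l')
          where lo = ≤-trans l (<⇒≤ l')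

      -- Strength forces `c i` to equal `x = c J`, which makes `v i`, `v (suc i)`, `v J`,
      -- `v (suc J)` an induced P4. Vertices entered by `x` in later blocks see neither this P4 nor
      -- each other, and a block without `x` is an induced path.
      at-chord : ∀ i j → i < j → j < W → r (v (suc i)) (v (suc (suc j))) ≡ true → P4kIn r k
      at-chord i j i<j j<W e with chord (suc i) (suc j) (s≤s i<j) (inM (s≤s (≤-trans (<⇒≤ j<W) (n≤1+n W)))) e
        where
        inM : ∀ {o} → o ≤ 2 + W → o < M
        inM l = ≤-trans (s≤s l) (m≤m+n (3 + W) _)
      ... | p , q , h = finish (all-or k block)
        where
        inM : ∀ {o} → o ≤ 2 + W → o < M
        inM l = ≤-trans (s≤s l) (m≤m+n (3 + W) _)
        J = suc (suc j)
        J≤ : J ≤ 1 + W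
        J≤ = s≤s j<W
        x = c J
        i<J : suc i < J
        i<J = s≤s (≤-trans i<j (n≤1+n j))
        i<M : i < M
        i<M = inM (≤-trans (n≤1+n i) (≤-trans (<⇒≤ i<J) (≤-trans J≤ (n≤1+n _))))
        ci : c i ≡ x
        ci = third-of-two {c (suc i)} {c (suc j)} p (diff i i<M)
               (h i refl) (λ z → q (sym z)) (λ z → diff (suc j) (inM (s≤s (≤-trans (<⇒≤ j<W) (n≤1+n W)))) (sym z))
        Hit : ℕ → Set
        Hit t = Σ ℕ λ m → b t ≤ m × m ≤ b t + W × c m ≡ x
        block : ∀ t → t < k → Hit t ⊎ P4kIn r k
        block t l with search≤ W (λ o → c (b t + o) == x)
        ... | inj₁ (o , o≤ , z) = inj₁ (b t + o , m≤m+n _ _ , +-monoʳ-≤ (b t) o≤ , ==-t z)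
        ... | inj₂ nx = inj₂ (two-colour-block (b t)
                (≤-trans (≤-trans (≤-reflexive (cong suc (+-comm (b t) W))) (n≤1+n _)) (b-next l))
                x λ m m≤ → ==-f⁻ (nx m m≤))
        finish : (∀ t → t < k → Hit t) ⊎ P4kIn r k → P4kIn r k
        finish (inj₂ P) = P
        finish (inj₁ hit) = record
          { a = v i ; b = v (suc i) ; c = v J ; d = v (suc J)
          ; ab = edge i i<M
          ; bc = e
          ; cd = edge J (inM (≤-trans J≤ (n≤1+n _)))
          ; ac = ¬t⇒f λ z → proj₁ (proj₂ (chord i (suc j) (≤-trans i<j (n≤1+n j)) (inM (s≤s (≤-trans (<⇒≤ j<W) (n≤1+n W)))) z)) ci
          ; ad = apart' i J (<⇒≤ i<J) (inM (≤-trans J≤ (n≤1+n _))) ci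
          ; bd = apart i J i<J (inM (≤-trans J≤ (n≤1+n _))) ci
          ; iso = λ t → v (suc (m t))
          ; far-a = λ t → apart' i (m t) (≤-trans (<⇒≤ i<J) (late t)) (m<M t) (trans ci (sym (mx t)))
          ; far-b = λ t → apart i (m t) (≤-trans i<J (late t)) (m<M t) (trans ci (sym (mx t)))
          ; far-c = λ t → apart' J (m t) (late' t) (m<M t) (sym (mx t))
          ; far-d = λ t → apart J (m t) (late'' t) (m<M t) (sym (mx t))
          ; sep = λ s t l → apart (m s) (m t) (gap s t l) (m<M t) (trans (mx s) (sym (mx t)))
          ; distinct = λ s t l eq → f≢t (apart' (m s) (m t) (<⇒≤ (gap s t l)) (m<M t) (trans (mx s) (sym (mx t))))
                                        (subst (λ z → r (v (m s)) z ≡ true) eq (edge (m s) (m<M s)))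
          }
          where
          m : Fin k → ℕ
          m t = proj₁ (hit (toℕ t) (toℕ<n t))
          mx : ∀ t → c (m t) ≡ x
          mx t = proj₂ (proj₂ (proj₂ (hit (toℕ t) (toℕ<n t))))
          lo : ∀ t → b (toℕ t) ≤ m t
          lo t = proj₁ (proj₂ (hit (toℕ t) (toℕ<n t)))
          hi : ∀ t → m t ≤ b (toℕ t) + W
          hi t = proj₁ (proj₂ (proj₂ (hit (toℕ t) (toℕ<n t))))
          late'' : ∀ t → suc J < m t
          late'' t = ≤-trans (s≤s (s≤s J≤)) (≤-trans (m≤m+n (3 + W) _) (lo t))
          late' : ∀ t → J < m t
          late' t = <⇒≤ (late'' t)
          late : ∀ t → J ≤ m t
          late t = <⇒≤ (late' t)
          above : ∀ s {t} → toℕ s < t → 2 + m s ≤ b t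
          above s l = ≤-trans (s≤s (s≤s (≤-trans (hi s) (≤-reflexive (+-comm (b (toℕ s)) W))))) (b-next l)
          m<M : ∀ t → m t < M
          m<M t = <⇒≤ (above t (toℕ<n t))
          gap : ∀ s t → toℕ s < toℕ t → suc (m s) < m t
          gap s t l = ≤-trans (above s l) (lo t)

    chain-P4k : P4kIn r k
    chain-P4k with all-or W {λ i → ∀ j → j < W → i < j → r (v (suc i)) (v (suc (suc j))) ≡ false} {P4kIn r k}
                     (λ i _ → all-or W λ j l → check i j l)
      where
      check : ∀ i j → j < W → (i < j → r (v (suc i)) (v (suc (suc j))) ≡ false) ⊎ P4kIn r k
      check i j l with bool-em (r (v (suc i)) (v (suc (suc j)))) | i <? j
      ... | inj₂ n | _ = inj₁ λ _ → n
      ... | inj₁ _ | no i≮j = inj₁ λ i<j → ⊥-elim (i≮j i<j)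
      ... | inj₁ e | yes i<j = inj₂ (at-chord i j i<j l e)
    ... | inj₂ P = P
    ... | inj₁ f = induced-path-P4k k (λ o → v (suc o))
                     (λ o l → edge (suc o) (≤-trans (s≤s l) (≤-trans (m≤n+m (suc W) 2) (m≤m+n (3 + W) _))))
                     (λ o o' l l' → f o (≤-trans l (<⇒≤ l')) o' l' l)

reachBound : ℕ → ℕ
reachBound k = unitBound (twoListBound (2 + pathLength k + k * (2 + pathLength k)))

extendBound : ℕ → ℕ → ℕ → ℕ
extendBound k zero j = 0
extendBound k (suc d) j = branches (4 + j) (reachBound k) + extendBound k d (suc j)

opaque
  p4kBound : ℕ → ℕ
  p4kBound k = p6Bound + extendBound k k 0
  p6≤p4k : ∀ k → p6Bound ≤ p4kBound k
  p6≤p4k k = m≤m+n _ _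
  extend≤p4k : ∀ k → extendBound k k 0 ≤ p4kBound k
  extend≤p4k k = m≤n+m _ _

module P4kFree (V : Set) (_≟_ : DecidableEquality V) (vs : List V) (complete : ∀ v → v ∈ vs)
               (adj : V → V → Bool) (sy : ∀ u v → adj u v ≡ adj v u) (irr : ∀ v → adj v v ≡ false)
               (k : ℕ) (free : ¬ P4kIn adj k) where
  open Framework V _≟_ vs complete adj
  module TL = TwoLists V _≟_ vs complete adj sy
  open P4kIn

  full : Live
  full _ = true

  support : ∀ {j} → P4kIn adj j → List V
  support P = a P ∷ b P ∷ c P ∷ d P ∷ List.tabulate (iso P)

  support-length : ∀ {j} (P : P4kIn adj j) → length (support P) ≡ 4 + j
  support-length P = cong (4 +_) (length-tabulate (iso P))

  touches : ∀ {j} → P4kIn adj j → V → Bool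
  touches P v = mem v (support P) ∨ any (adj v) (support P)

  add : ∀ {j} (P : P4kIn adj j) v → touches P v ≡ false → P4kIn adj (suc j)
  add {j} P v t = record
    { a = a P ; b = b P ; c = c P ; d = d P ; ab = ab P ; bc = bc P ; cd = cd P ; ac = ac P ; ad = ad P ; bd = bd P
    ; iso = iso'
    ; far-a = λ { Fin.zero → away (here refl) ; (Fin.suc i) → far-a P i }
    ; far-b = λ { Fin.zero → away (there (here refl)) ; (Fin.suc i) → far-b P i }
    ; far-c = λ { Fin.zero → away (there (there (here refl))) ; (Fin.suc i) → far-c P i }
    ; far-d = λ { Fin.zero → away (there (there (there (here refl)))) ; (Fin.suc i) → far-d P i }
    ; sep = λ { Fin.zero (Fin.suc i) _ → trans (sy _ _) (away (on i)) ; (Fin.suc i) (Fin.suc i') (s≤s l) → sep P i i' l }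
    ; distinct = λ { Fin.zero (Fin.suc i) _ e → f≢t t (∨-il (⇒mem (subst (_∈ support P) (sym e) (on i)))) ; (Fin.suc i) (Fin.suc i') (s≤s l) → distinct P i i' l }
    }
    where
    iso' : Fin (suc j) → V
    iso' Fin.zero = v
    iso' (Fin.suc i) = iso P i
    on : ∀ i → iso P i ∈ support P
    on i = there (there (there (there (∈-tabulate⁺ i))))
    away : ∀ {q} → q ∈ support P → adj q v ≡ false
    away {q} i = ¬t⇒f λ e → f≢t t (∨-ir {mem v (support P)} (⇒anyL (adj v) i (trans (sy v q) e)))

  dominated : ∀ {j} (P : P4kIn adj j) → (∀ v → touches P v ≡ true) → ∀ L → Good (branches (4 + j) (reachBound k)) full L
  dominated P dom L = subst (λ ℓ → Good (branches ℓ (reachBound k)) full L) (support-length P)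
    (branch-all (support P) L (λ _ _ → refl) λ cT L' sub un →
      delete-units C sy (λ v _ m x y lx ly → trans (un v (mem⇒ _ m) x lx) (sym (un v (mem⇒ _ m) y ly))) λ ne _ →
        TL.Bounded.two-lists _ _ (small L' ne) _ λ ch → let open TL.FreeChain ch in
          free (chain-P4k adj sy k vert col edge diff chord))
    where
    C : V → Bool
    C v = mem v (support P)
    small : ∀ L' → (∀ v → true ≡ true → C v ≡ true → Σ Color λ c → L' v c ≡ true) →
            ∀ v → (full ∖ C) v ≡ true → Σ Color λ m → prune full C L' v m ≡ false
    small L' ne v s with ∨-e {C v} (dom v)
    ... | inj₁ m = ⊥-elim (f≢t (not-t s) m)
    ... | inj₂ n = let (q , i , e) = anyL⇒ (adj v) (support P) n
                       (x , l) = ne q refl (⇒mem i)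
                   in x , prune-no full C L' v q x refl (⇒mem i) (trans (sy q v) e) l

  -- The first argument counts the isolated vertices still missing; at 0 the graph would contain P4
  -- + kP1.
  extend : ∀ e j → e + j ≡ k → P4kIn adj j → ∀ L → Good (extendBound k e j) full L
  extend zero j refl P L = ⊥-elim (free P)
  extend (suc e) j eq P L with search (λ v → not (touches P v))
  ... | inj₁ (v , t) = good-weaken (m≤n+m _ _) (extend e (suc j) (trans (+-suc e j) eq) (add P v (not-t t)) L)
  ... | inj₂ dom = good-weaken (m≤m+n _ _) (dominated P (λ v → ¬f⇒t (λ p → f≢t (dom v) (not-f p))) L)
    where
    ¬f⇒t : ∀ {b} → (b ≡ false → ⊥) → b ≡ true
    ¬f⇒t {true} _ = refl
    ¬f⇒t {false} h = ⊥-elim (h refl)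

  p4k-good : ∀ L → Good (p4kBound k) full L
  p4k-good L with p4? full
  ... | inj₁ (_ , _ , _ , _ , p) = let module F = P4Facts full p in
        good-weaken (extend≤p4k k) (extend k 0 (+-identityʳ k)
          (record { ab = F.ab ; bc = F.bc ; cd = F.cd ; ac = F.ac ; ad = F.ad ; bd = F.bd ; iso = λ () ; far-a = λ () ; far-b = λ () ; far-c = λ () ; far-d = λ () ; sep = λ () ; distinct = λ () }) L)
  -- A graph without induced P4 has no induced P6 either.
  ... | inj₂ none = good-weaken (p6≤p4k k) (P6Free.p6-good V _≟_ vs complete adj sy irr noP6 full L)
    where
    noP6 : ¬ P6In adj
    noP6 P = f≢t (none (P6In.a P) (P6In.b P) (P6In.c P) (P6In.d P))
        (∧-i (∧-i (∧-i (P6In.ab P) (P6In.bc P)) (P6In.cd P)) (∧-i (∧-i (not-f (P6In.ac P)) (not-f (P6In.ad P))) (not-f (P6In.bd P))))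

-- From bounded obstructions to a finite list

vectors : ∀ {A : Set} → List A → ∀ k → List (Vec A k)
vectors xs zero = [] ∷ []
vectors xs (suc k) = cartesianProductWith _∷_ xs (vectors xs k)

∈-vectors : ∀ {A : Set} {xs : List A} → (∀ x → x ∈ xs) → ∀ {k} (v : Vec A k) → v ∈ vectors xs k
∈-vectors h [] = here refl
∈-vectors h (x ∷ v) = ∈-cartesianProductWith⁺ _∷_ (h x) (∈-vectors h v)

bools : List Bool
bools = true ∷ false ∷ []

∈-bools : ∀ b → b ∈ bools
∈-bools true = here refl
∈-bools false = there (here refl)

-- The matrix is symmetrised and its diagonal erased, so that every matrix codes a graph.
decode : ∀ {k} → Vec (Vec Bool k) k → Graph
decode {k} M = record
  { n = k
  ; adj = λ u v → not (does (u Finₚ.≟ v)) ∧ (entry u v ∧ entry v u)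
  ; adj-sym = λ u v → cong₂ _∧_ (cong not (≟-sym u v)) (∧-comm (entry u v) (entry v u))
  ; adj-irrefl = irrefl
  }
  where
  entry : Fin k → Fin k → Bool
  entry u v = lookup (lookup M u) v
  ≟-sym : ∀ u v → does (u Finₚ.≟ v) ≡ does (v Finₚ.≟ u)
  ≟-sym u v with u Finₚ.≟ v | v Finₚ.≟ u
  ... | yes _ | yes _ = refl
  ... | no _ | no _ = refl
  ... | yes p | no q = ⊥-elim (q (sym p))
  ... | no q | yes p = ⊥-elim (q (sym p))
  irrefl : ∀ v → not (does (v Finₚ.≟ v)) ∧ (entry v v ∧ entry v v) ≡ false
  irrefl v with v Finₚ.≟ v
  ... | yes _ = refl
  ... | no q = ⊥-elim (q refl)

coded : ∀ k → Vec (Vec Bool k) k → Vec (Subset 3) k → GraphWithLists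
coded k M Ls = decode M , lookup Ls

ofSize : ℕ → List GraphWithLists
ofSize k = cartesianProductWith (coded k) (vectors (vectors bools k) k) (vectors (vectors bools 3) k)

up-to-size : ℕ → List GraphWithLists
up-to-size m = concatMap ofSize (upTo (suc m))

-- Every small instance is tabulated with its own vertex numbering, so the identity is the
-- isomorphism.
listed : ∀ m (G : Graph) (L : ListSystem G) → n G ≤ m → Any (isoTo G L) (up-to-size m)
listed m G L le = lose (∈-concatMap ofSize (∈-upTo⁺ (s≤s le))
    (∈-cartesianProductWith⁺ (coded (n G)) (∈-vectors (∈-vectors ∈-bools) M) (∈-vectors (∈-vectors ∈-bools) Ls)))
  (↔-id _ , same , lookup∘tabulate L)
  where
  M : Vec (Vec Bool (n G)) (n G)
  M = tabulate λ u → tabulate (adj G u)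
  Ls : Vec (Subset 3) (n G)
  Ls = tabulate L
  entry : ∀ u v → lookup (lookup M u) v ≡ adj G u v
  entry u v = trans (cong (λ row → lookup row v) (lookup∘tabulate (λ u → tabulate (adj G u)) u)) (lookup∘tabulate (adj G u) v)
  same : ∀ u v → adj (decode M) u v ≡ adj G u v
  same u v with u Finₚ.≟ v
  ... | yes refl = sym (adj-irrefl G u)
  ... | no _ = trans (cong₂ _∧_ (entry u v) (trans (entry v u) (adj-sym G v u))) (∧-idem (adj G u v))
    where open Boolₚ using (∧-idem)

finite-of-bounded : ∀ {H} m → (∀ G L → Free H G → MinimalListObstruction G L → n G ≤ m) → FinitelyManyObstructions H
finite-of-bounded m h = up-to-size m , λ G L fr mo → listed m G L (h G L fr mo)

unique-lookup-injective : ∀ {A : Set} {xs : List A} → Unique xs → Injective _≡_ _≡_ (List.lookup xs)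
unique-lookup-injective (_ ∷ _) {Fin.zero} {Fin.zero} _ = refl
unique-lookup-injective (p ∷ _) {Fin.zero} {Fin.suc j} e = ⊥-elim (All.lookup p (∈-lookup j) e)
unique-lookup-injective (p ∷ _) {Fin.suc i} {Fin.zero} e = ⊥-elim (All.lookup p (∈-lookup i) (sym e))
unique-lookup-injective (_ ∷ u) {Fin.suc i} {Fin.suc j} e = cong Fin.suc (unique-lookup-injective u e)

module OnGraph (G : Graph) (L : ListSystem G) where
  open Framework (Fin (n G)) Finₚ._≟_ (allFin (n G)) ∈-allFin (adj G)

  table : Lists
  table v c = lookup (L v) c

  -- If `G` had more than m vertices, the list `B` without repetitions would induce a proper
  -- subgraph, which is colourable by minimality.
  obstruction-size : ∀ {m} → Good m (λ _ → true) table → MinimalListObstruction G L → n G ≤ m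
  obstruction-size (inj₁ κ) (nc , _) =
    ⊥-elim (nc (colour κ , (λ v → lookup⇒[]= (colour κ v) (L v) (allowed κ v refl)) , λ u v → proper κ u v refl refl))
  obstruction-size {m} (inj₂ (B , l , bad)) (_ , colourable) with n G ≤? m
  ... | yes le = le
  ... | no gt = ⊥-elim (bad (extendCol (colourable (length D) (List.lookup D) inj small)))
    where
    open DecMem (Finₚ._≟_ {n G}) using (_∈?_)
    D : List (Fin (n G))
    D = deduplicate Finₚ._≟_ B
    inj : Injective _≡_ _≡_ (List.lookup D)
    inj = unique-lookup-injective (deduplicate-! Finₚ._≟_ B)
    small : length D < n G
    small = ≤-trans (s≤s (≤-trans (length-deduplicate Finₚ._≟_ B) l)) (≰⇒> gt)
    extendCol : Colorable (induced G (List.lookup D)) (L ∘ List.lookup D) → Col (On B (λ _ → true)) table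
    extendCol (f , al , pr) = mkCol g
        (λ v (i , _) → let (p , e , q) = at v i in
            trans (cong₂ lookup (cong L q) e) ([]=⇒lookup (al p)))
        (λ u v (i , _) (j , _) e eq → let (p , e₁ , q) = at u i ; (p' , e₂ , q') = at v j in
            pr p p' (trans (sym (cong₂ (adj G) q q')) e) (trans (sym e₁) (trans eq e₂)))
      where
      g : Fin (n G) → Color
      g v with v ∈? D
      ... | yes i = f (index i)
      ... | no _ = c0
      at : ∀ v → v ∈ B → Σ (Fin (length D)) λ p → g v ≡ f p × v ≡ List.lookup D p
      at v i with v ∈? D
      ... | yes j = index j , refl , lookup-index j
      ... | no q = ⊥-elim (q (∈-deduplicate⁺ Finₚ._≟_ i))

-- Embeddings of P6 and P4 + kP1

induced-trans : ∀ {H K G} → IsInducedSubgraph H K → IsInducedSubgraph K G → IsInducedSubgraph H G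
induced-trans (f , fi , fh) (g , gi , gh) = (λ v → g (f v)) , (λ e → fi (gi e)) , λ u v → trans (fh u v) (gh (f u) (f v))

-- Vertices are determined by their neighbourhoods, so injectivity of an embedding follows from
-- preservation of adjacency.
twinless6 : ∀ i j → (∀ w → adj (path 6) i w ≡ adj (path 6) j w) → i ≡ j
twinless6 = from-yes (Finₚ.all? λ i → Finₚ.all? λ j → Finₚ.all? (λ w → adj (path 6) i w Boolₚ.≟ adj (path 6) j w) →-dec (i Finₚ.≟ j))
twinless4 : ∀ i j → (∀ w → adj (path 4) i w ≡ adj (path 4) j w) → i ≡ j
twinless4 = from-yes (Finₚ.all? λ i → Finₚ.all? λ j → Finₚ.all? (λ w → adj (path 4) i w Boolₚ.≟ adj (path 4) j w) →-dec (i Finₚ.≟ j))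

hom-injective : ∀ {H G : Graph} (f : Fin (n H) → Fin (n G)) → (∀ u v → adj H u v ≡ adj G (f u) (f v)) →
                (∀ i j → (∀ w → adj H i w ≡ adj H j w) → i ≡ j) → Injective _≡_ _≡_ f
hom-injective {H} {G} f hom tw {i} {j} e = tw i j λ w → trans (hom i w) (trans (cong (λ z → adj G z (f w)) e) (sym (hom j w)))

P6-embeds : ∀ G → P6In (adj G) → IsInducedSubgraph (path 6) G
P6-embeds G P = f , hom-injective {path 6} {G} f hom twinless6 , hom
  where
    module P = P6In P
    f : Fin 6 → Fin (n G)
    f = lookup (P.a ∷ P.b ∷ P.c ∷ P.d ∷ P.e ∷ P.f ∷ [])
    hom : ∀ u v → adj (path 6) u v ≡ adj G (f u) (f v)
    hom 0F 0F = sym (adj-irrefl G _)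
    hom 0F 1F = sym P.ab
    hom 0F 2F = sym P.ac
    hom 0F 3F = sym P.ad
    hom 0F 4F = sym P.ae
    hom 0F 5F = sym P.af
    hom 1F 0F = sym (trans (adj-sym G _ _) P.ab)
    hom 1F 1F = sym (adj-irrefl G _)
    hom 1F 2F = sym P.bc
    hom 1F 3F = sym P.bd
    hom 1F 4F = sym P.be
    hom 1F 5F = sym P.bf
    hom 2F 0F = sym (trans (adj-sym G _ _) P.ac)
    hom 2F 1F = sym (trans (adj-sym G _ _) P.bc)
    hom 2F 2F = sym (adj-irrefl G _)
    hom 2F 3F = sym P.cd
    hom 2F 4F = sym P.ce
    hom 2F 5F = sym P.cf
    hom 3F 0F = sym (trans (adj-sym G _ _) P.ad)
    hom 3F 1F = sym (trans (adj-sym G _ _) P.bd)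
    hom 3F 2F = sym (trans (adj-sym G _ _) P.cd)
    hom 3F 3F = sym (adj-irrefl G _)
    hom 3F 4F = sym P.de
    hom 3F 5F = sym P.df
    hom 4F 0F = sym (trans (adj-sym G _ _) P.ae)
    hom 4F 1F = sym (trans (adj-sym G _ _) P.be)
    hom 4F 2F = sym (trans (adj-sym G _ _) P.ce)
    hom 4F 3F = sym (trans (adj-sym G _ _) P.de)
    hom 4F 4F = sym (adj-irrefl G _)
    hom 4F 5F = sym P.ef
    hom 5F 0F = sym (trans (adj-sym G _ _) P.af)
    hom 5F 1F = sym (trans (adj-sym G _ _) P.bf)
    hom 5F 2F = sym (trans (adj-sym G _ _) P.cf)
    hom 5F 3F = sym (trans (adj-sym G _ _) P.df)
    hom 5F 4F = sym (trans (adj-sym G _ _) P.ef)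
    hom 5F 5F = sym (adj-irrefl G _)

P4k-embeds : ∀ G k → P4kIn (adj G) k → IsInducedSubgraph (P4+kP1 k) G
P4k-embeds G k P = (λ u → h (splitAt 4 u)) , inj , hom'
  where
    module P = P4kIn P
    f : Fin 4 → Fin (n G)
    f = lookup (P.a ∷ P.b ∷ P.c ∷ P.d ∷ [])
    hom : ∀ u v → adj (path 4) u v ≡ adj G (f u) (f v)
    hom 0F 0F = sym (adj-irrefl G _)
    hom 0F 1F = sym P.ab
    hom 0F 2F = sym P.ac
    hom 0F 3F = sym P.ad
    hom 1F 0F = sym (trans (adj-sym G _ _) P.ab)
    hom 1F 1F = sym (adj-irrefl G _)
    hom 1F 2F = sym P.bc
    hom 1F 3F = sym P.bd
    hom 2F 0F = sym (trans (adj-sym G _ _) P.ac)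
    hom 2F 1F = sym (trans (adj-sym G _ _) P.bc)
    hom 2F 2F = sym (adj-irrefl G _)
    hom 2F 3F = sym P.cd
    hom 3F 0F = sym (trans (adj-sym G _ _) P.ad)
    hom 3F 1F = sym (trans (adj-sym G _ _) P.bd)
    hom 3F 2F = sym (trans (adj-sym G _ _) P.cd)
    hom 3F 3F = sym (adj-irrefl G _)
    h : Fin 4 ⊎ Fin k → Fin (n G)
    h (inj₁ u) = f u
    h (inj₂ i) = P.iso i
    far : ∀ u i → adj G (f u) (P.iso i) ≡ false
    far 0F = P.far-a
    far 1F = P.far-b
    far 2F = P.far-c
    far 3F = P.far-d
    apart : ∀ i j → adj G (P.iso i) (P.iso j) ≡ false
    apart i j with <-cmp (toℕ i) (toℕ j)
    ... | tri< l _ _ = P.sep i j l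
    ... | tri≈ _ e _ = subst (λ z → adj G (P.iso i) (P.iso z) ≡ false) (Finₚ.toℕ-injective e) (adj-irrefl G _)
    ... | tri> _ _ l = trans (adj-sym G _ _) (P.sep j i l)
    hom' : ∀ u v → adj (P4+kP1 k) u v ≡ adj G (h (splitAt 4 u)) (h (splitAt 4 v))
    hom' u v with splitAt 4 u | splitAt 4 v
    ... | inj₁ a | inj₁ b = hom a b
    ... | inj₁ a | inj₂ i = sym (far a i)
    ... | inj₂ i | inj₁ a = sym (trans (adj-sym G _ _) (far a i))
    ... | inj₂ i | inj₂ j = sym (apart i j)
    touched : ∀ u i → f u ≢ P.iso i
    touched u i e = let (w , q) = nb u in f≢t (far w i) (subst (λ z → adj G (f w) z ≡ true) e q)
      where
      nb : ∀ u → Σ (Fin 4) λ w → adj G (f w) (f u) ≡ true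
      nb 0F = 1F , sym (hom 1F 0F)
      nb 1F = 0F , sym (hom 0F 1F)
      nb 2F = 1F , sym (hom 1F 2F)
      nb 3F = 2F , sym (hom 2F 3F)
    h-inj : ∀ x y → h x ≡ h y → x ≡ y
    h-inj (inj₁ a) (inj₁ b) e = cong inj₁ (hom-injective {path 4} {G} f hom twinless4 e)
    h-inj (inj₁ a) (inj₂ i) e = ⊥-elim (touched a i e)
    h-inj (inj₂ i) (inj₁ a) e = ⊥-elim (touched a i (sym e))
    h-inj (inj₂ i) (inj₂ j) e with <-cmp (toℕ i) (toℕ j)
    ... | tri< l _ _ = ⊥-elim (P.distinct i j l e)
    ... | tri≈ _ q _ = cong inj₂ (Finₚ.toℕ-injective q)
    ... | tri> _ _ l = ⊥-elim (P.distinct j i l (sym e))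
    inj : Injective _≡_ _≡_ (λ u → h (splitAt 4 u))
    inj {u} {v} e = trans (sym (Finₚ.join-splitAt 4 k u)) (trans (cong (join 4 k) (h-inj (splitAt 4 u) (splitAt 4 v) e)) (Finₚ.join-splitAt 4 k v))

P6-finite : ∀ H → IsInducedSubgraph H (path 6) → FinitelyManyObstructions H
P6-finite H sub = finite-of-bounded {H} p6Bound λ G L fr →
  OnGraph.obstruction-size G L
    (P6Free.p6-good _ Finₚ._≟_ _ ∈-allFin (adj G) (adj-sym G) (adj-irrefl G) (λ P → fr (induced-trans {H} {path 6} {G} sub (P6-embeds G P))) _ _)

P4k-finite : ∀ H k → IsInducedSubgraph H (P4+kP1 k) → FinitelyManyObstructions H
P4k-finite H k sub = finite-of-bounded {H} (p4kBound k) λ G L fr →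
  OnGraph.obstruction-size G L
    (P4kFree.p4k-good _ Finₚ._≟_ _ ∈-allFin (adj G) (adj-sym G) (adj-irrefl G) k (λ P → fr (induced-trans {H} {P4+kP1 k} {G} sub (P4k-embeds G k P))) _)

-- Three infinite families of minimal obstructions

next : Color → Color
next c0 = c1
next c1 = c2
next c2 = c0

next³ : ∀ κ → next (next (next κ)) ≡ κ
next³ c0 = refl
next³ c1 = refl
next³ c2 = refl

next≢ : ∀ κ → next κ ≢ κ
next≢ c0 ()
next≢ c1 ()
next≢ c2 ()

next²≢ : ∀ κ → next (next κ) ≢ κ
next²≢ c0 ()
next²≢ c1 ()
next²≢ c2 ()

next-injective : ∀ {κ μ} → next κ ≡ next μ → κ ≡ μ
next-injective {κ} {μ} e = trans (sym (next³ κ)) (trans (cong (λ z → next (next z)) e) (next³ μ))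

turns : ∀ κ μ → μ ≡ κ ⊎ (μ ≡ next κ ⊎ μ ≡ next (next κ))
turns c0 c0 = inj₁ refl
turns c0 c1 = inj₂ (inj₁ refl)
turns c0 c2 = inj₂ (inj₂ refl)
turns c1 c1 = inj₁ refl
turns c1 c2 = inj₂ (inj₁ refl)
turns c1 c0 = inj₂ (inj₂ refl)
turns c2 c2 = inj₁ refl
turns c2 c0 = inj₂ (inj₁ refl)
turns c2 c1 = inj₂ (inj₂ refl)

-- The residue modulo 3, as a colour.
cls : ℕ → Color
cls zero = c0
cls (suc p) = next (cls p)

T⇒≡ : ∀ {b} → Bool.T b → b ≡ true
T⇒≡ {true} _ = refl
≡⇒T : ∀ {b} → b ≡ true → Bool.T b
≡⇒T refl = _

-- `full` selects the classes whose vertices have all their backward chords: the constant `false`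
-- gives the path, the constant `true` and `OneFull.only₀` the two other families.
module Family (full : Color → Bool) where

  -- Path edges and backward chords under one condition: both lead to the next class, and to a
  -- vertex at most one further on.
  arrow link : ℕ → ℕ → Bool
  arrow x y = (cls y == next (cls x)) ∧ (if full (cls x) then y ≤ᵇ suc x else y ≡ᵇ suc x)
  link x y = arrow x y ∨ arrow y x

  arrow-cls : ∀ x y → arrow x y ≡ true → cls y ≡ next (cls x)
  arrow-cls x y p = ==-t (∧-l p)

  arrow-≤ : ∀ x y → arrow x y ≡ true → y ≤ suc x
  arrow-≤ x y p with full (cls x) | ∧-r {cls y == next (cls x)} p
  ... | true | q = ≤ᵇ⇒≤ y (suc x) (≡⇒T q)
  ... | false | q = ≤-reflexive (≡ᵇ⇒≡ y (suc x) (≡⇒T q))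

  arrow-≡ : ∀ x y → full (cls x) ≡ false → arrow x y ≡ true → y ≡ suc x
  arrow-≡ x y f p with full (cls x) | f | ∧-r {cls y == next (cls x)} p
  ... | false | refl | q = ≡ᵇ⇒≡ y (suc x) (≡⇒T q)

  ⇒arrow : ∀ x y → full (cls x) ≡ true → cls y ≡ next (cls x) → y ≤ suc x → arrow x y ≡ true
  ⇒arrow x y f e l with full (cls x) | f
  ... | true | refl = ∧-i (trans (cong (_== next (cls x)) e) (==-refl _)) (T⇒≡ (≤⇒≤ᵇ l))

  arrow-suc : ∀ x → arrow x (suc x) ≡ true
  arrow-suc x with full (cls x)
  ... | true = ∧-i (==-refl _) (T⇒≡ (≤⇒≤ᵇ {suc x} ≤-refl))
  ... | false = ∧-i (==-refl _) (T⇒≡ (≡⇒≡ᵇ (suc x) (suc x) refl))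

  link-suc : ∀ x → link x (suc x) ≡ true
  link-suc x = ∨-il (arrow-suc x)

  link-irrefl : ∀ x → link x x ≡ false
  link-irrefl x = ¬t⇒f λ p → no-loop (∨-e p)
    where
    no-loop : arrow x x ≡ true ⊎ arrow x x ≡ true → ⊥
    no-loop (inj₁ q) = next≢ _ (sym (arrow-cls x x q))
    no-loop (inj₂ q) = next≢ _ (sym (arrow-cls x x q))

  link-cls : ∀ x y → link x y ≡ true → cls x ≢ cls y
  link-cls x y p e with ∨-e p
  ... | inj₁ q = next≢ _ (trans (sym (arrow-cls x y q)) (sym e))
  ... | inj₂ q = next≢ _ (trans (sym (arrow-cls y x q)) e)

  link-chord : ∀ x y → x < y → y ≢ suc x → link x y ≡ true → cls x ≡ next (cls y)
  link-chord x y l ne p with ∨-e p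
  ... | inj₁ q = ⊥-elim (ne (≤-antisym (arrow-≤ x y q) l))
  ... | inj₂ q = arrow-cls y x q

  graph : ℕ → Graph
  graph N = record
    { n = N
    ; adj = λ u v → link (toℕ u) (toℕ v)
    ; adj-sym = λ u v → ∨-comm (arrow (toℕ u) (toℕ v)) _
    ; adj-irrefl = λ v → link-irrefl (toℕ v)
    }

  previous : ℕ → Color → Bool
  previous zero c = false
  previous (suc i) c = cls i == c

  -- The first vertex has no predecessor and the last is denied its own class, so propagation starts
  -- with class 0 and fails exactly at the end.
  allows : ℕ → ℕ → Color → Bool
  allows N i c = ((cls i == c) ∧ not (suc i ≡ᵇ N)) ∨ previous i c

  lists : ∀ N → ListSystem (graph N)
  lists N i = tabulate (allows N (toℕ i))

  minimal : ∀ N → MinimalListObstruction (graph (suc N)) (lists (suc N))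
  minimal N = uncolourable , λ m f inj lt → colour-rest m f (missed m f inj lt)
    where
    M = suc N
    uncolourable : ¬ Colorable (graph M) (lists M)
    uncolourable (f , al , pr) = last-forced
      where
      ok : ∀ i → allows M (toℕ i) (f i) ≡ true
      ok i = trans (sym (lookup∘tabulate (allows M (toℕ i)) (f i))) ([]=⇒lookup (al i))
      step : ∀ p (l : p < M) → f (fromℕ< l) ≡ cls p × suc p ≢ M
      step p l with ∨-e (subst (λ z → allows M z (f (fromℕ< l)) ≡ true) (Finₚ.toℕ-fromℕ< l) (ok (fromℕ< l)))
      step p l | inj₁ q = sym (==-t (∧-l q)) , λ e → f≢t (not-t (∧-r {cls p == f (fromℕ< l)} q)) (T⇒≡ (≡⇒≡ᵇ (suc p) M e))
      step (suc p) l | inj₂ q = ⊥-elim (pr (fromℕ< (<-trans (n<1+n p) l)) (fromℕ< l)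
          (subst (λ z → link z (toℕ (fromℕ< l)) ≡ true) (sym (Finₚ.toℕ-fromℕ< (<-trans (n<1+n p) l)))
             (subst (λ z → link p z ≡ true) (sym (Finₚ.toℕ-fromℕ< l)) (link-suc p)))
          (trans (proj₁ (step p (<-trans (n<1+n p) l))) (==-t q)))
      last-forced : ⊥
      last-forced = proj₂ (step N ≤-refl) refl
    missed : ∀ m (f : Fin m → Fin M) → Injective _≡_ _≡_ f → m < M → Σ (Fin M) λ k → ∀ i → f i ≢ k
    missed m f inj lt with Finₚ.any? (λ k → Finₚ.all? (λ i → ¬? (f i Finₚ.≟ k)))
    ... | yes r = r
    ... | no none = ⊥-elim (<-irrefl refl (≤-trans lt (Finₚ.injective⇒≤ {f = λ k → proj₁ (pre k)} (λ {k} {k'} e → trans (sym (proj₂ (pre k))) (trans (cong f e) (proj₂ (pre k')))))))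
      where
      pre : ∀ k → Σ (Fin m) λ i → f i ≡ k
      pre k with Finₚ.any? (λ i → f i Finₚ.≟ k)
      ... | yes r = r
      ... | no q = ⊥-elim (none (k , λ i e → q (i , e)))
    -- Before the deleted vertex k every vertex takes its own class, after k that of its predecessor.
    colour-rest : ∀ m (f : Fin m → Fin M) → (Σ (Fin M) λ k → ∀ i → f i ≢ k) → Colorable (induced (graph M) f) (λ i → lists M (f i))
    colour-rest m f (k , avoid) = (λ i → κ (toℕ (f i)))
        , (λ i → lookup⇒[]= _ _ (trans (lookup∘tabulate (allows M (toℕ (f i))) _) (al (toℕ (f i)) (Finₚ.toℕ<n (f i)) (off i))))
        , λ i j → pr (toℕ (f i)) (toℕ (f j)) (off i) (off j)
      where
      off : ∀ i → toℕ (f i) ≢ toℕ k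
      off i e = avoid i (Finₚ.toℕ-injective e)
      before : ℕ → Color
      before zero = c0
      before (suc p) = cls p
      κ : ℕ → Color
      κ p with p <? toℕ k
      ... | yes _ = cls p
      ... | no _ = before p
      al : ∀ p → p < M → p ≢ toℕ k → allows M p (κ p) ≡ true
      al p l ne with p <? toℕ k
      ... | yes q = ∨-il (∧-i (==-refl (cls p)) (not-f (¬t⇒f λ e → <-irrefl (≡ᵇ⇒≡ (suc p) M (≡⇒T e)) (≤-trans (s≤s q) (Finₚ.toℕ<n k)))))
      al zero l ne | no q = ⊥-elim (ne (≤-antisym z≤n (≮⇒≥ q)))
      al (suc p) l ne | no q = ∨-ir {(cls (suc p) == cls p) ∧ not (suc (suc p) ≡ᵇ M)} (==-refl (cls p))
      pr< : ∀ p q → p < q → p ≢ toℕ k → q ≢ toℕ k → link p q ≡ true → κ p ≢ κ q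
      pr< p q l np nq e with p <? toℕ k | q <? toℕ k
      ... | yes _ | yes _ = link-cls p q e
      ... | no a | yes b = ⊥-elim (a (<-trans l b))
      pr< zero q l np nq e | no a | no b = ⊥-elim (np (≤-antisym z≤n (≮⇒≥ a)))
      pr< (suc p) (suc q) l np nq e | no a | no b = λ z → link-cls (suc p) (suc q) e (cong next z)
      -- Across the deleted vertex there is no path edge, so this is a chord; the colours of its
      -- ends are two applications of `next` apart.
      pr< p (suc q) l np nq e | yes a | no b = λ z → next²≢ (cls q) (trans (sym (link-chord p (suc q) l between e)) z)
        where
        between : suc q ≢ suc p
        between refl = nq (≤-antisym a (≮⇒≥ b))
      pr : ∀ p q → p ≢ toℕ k → q ≢ toℕ k → link p q ≡ true → κ p ≢ κ q
      pr p q np nq e with <-cmp p q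
      ... | tri< l _ _ = pr< p q l np nq e
      ... | tri≈ _ refl _ = ⊥-elim (f≢t (link-irrefl p) e)
      ... | tri> _ _ l = λ z → pr< q p l nq np (trans (∨-comm (arrow q p) (arrow p q)) e) (sym z)

-- Embedding a graph into large members of the families

induced? : ∀ H G → Dec (IsInducedSubgraph H G)
induced? H G = map′ to from (any? (λ f → inj? f ×-dec hom? f) (vectors (allFin (n G)) (n H)))
  where
  Inj Hom : Vec (Fin (n G)) (n H) → Set
  Inj f = ∀ u v → lookup f u ≡ lookup f v → u ≡ v
  Hom f = ∀ u v → adj H u v ≡ adj G (lookup f u) (lookup f v)
  inj? : ∀ f → Dec (Inj f)
  inj? f = Finₚ.all? λ u → Finₚ.all? λ v → (lookup f u Finₚ.≟ lookup f v) →-dec (u Finₚ.≟ v)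
  hom? : ∀ f → Dec (Hom f)
  hom? f = Finₚ.all? λ u → Finₚ.all? λ v → adj H u v Boolₚ.≟ adj G (lookup f u) (lookup f v)
  to : Any (λ f → Inj f × Hom f) (vectors (allFin (n G)) (n H)) → IsInducedSubgraph H G
  to h = let (f , _ , i , e) = find h in lookup f , (λ {u} {v} → i u v) , e
  from : IsInducedSubgraph H G → Any (λ f → Inj f × Hom f) (vectors (allFin (n G)) (n H))
  from (f , i , e) = lose (∈-vectors ∈-allFin (tabulate f))
    ((λ u v q → i (trans (sym (lookup∘tabulate f u)) (trans q (lookup∘tabulate f v)))) ,
     λ u v → trans (e u v) (sym (cong₂ (adj G) (lookup∘tabulate f u) (lookup∘tabulate f v))))

totalSize : List GraphWithLists → ℕ
totalSize [] = 0
totalSize ((G , _) ∷ Os) = n G + totalSize Os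

size≤total : ∀ G L Os → Any (isoTo G L) Os → n G ≤ totalSize Os
size≤total G L ((G′ , _) ∷ Os) (here (φ , _)) = ≤-trans (≤-reflexive (↔⇒≡ φ)) (m≤m+n _ _)
size≤total G L ((G′ , _) ∷ Os) (there a) = ≤-trans (size≤total G L Os a) (m≤n+m _ _)

-- A member with more vertices than all listed obstructions together is isomorphic to none of them,
-- so it is not `H`-free; decidability turns this into an actual embedding.
embeds-in-family : ∀ H → FinitelyManyObstructions H → ∀ full → Σ ℕ λ N → IsInducedSubgraph H (Family.graph full N)
embeds-in-family H (Os , listed-all) full with induced? H (Family.graph full (suc (totalSize Os)))
... | yes s = _ , s
... | no free = ⊥-elim (<-irrefl refl (size≤total G L Os (listed-all G L free (Family.minimal full (totalSize Os)))))
  where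
  G = Family.graph full (suc (totalSize Os))
  L = Family.lists full (suc (totalSize Os))

module AllFull where
  open Family (λ _ → true) public

  -- Otherwise there would be an arrow from `x` to `y`. Nonadjacency thus orders vertices of
  -- consecutive classes.
  gap : ∀ x y → link x y ≡ false → cls y ≡ next (cls x) → suc x < y
  gap x y p e with y ≤? suc x
  ... | yes l = ⊥-elim (f≢t p (∨-il (⇒arrow x y refl e l)))
  ... | no l = ≰⇒> l

  gap′ : ∀ x y → link x y ≡ false → cls x ≡ next (cls y) → suc y < x
  gap′ x y p e = gap y x (trans (∨-comm (arrow y x) (arrow x y)) p) e

  record Apart (a b c d e : ℕ) : Set where
    constructor mkApart
    field
      ac : link a c ≡ false
      ad : link a d ≡ false
      bc : link b c ≡ false
      bd : link b d ≡ false
      ea : link e a ≡ false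
      eb : link e b ≡ false
      ec : link e c ≡ false
      ed : link e d ≡ false

  -- Consecutive classes force b < d < a < c, and then no class is left for e.
  shifted : ∀ {a b c d e} → Apart a b c d e → arrow a b ≡ true → arrow c d ≡ true → cls c ≡ next (cls a) → ⊥
  shifted {a} {b} {c} {d} {e} A ab cd h with turns (cls a) (cls e)
    where open Apart A
  ... | t = by t
    where
    open Apart A
    cb : cls b ≡ next (cls a)
    cb = arrow-cls a b ab
    cd' : cls d ≡ next (next (cls a))
    cd' = trans (arrow-cls c d cd) (cong next h)
    cycle : ∀ {x y z : ℕ} → suc x < y → suc y < z → suc z < x → ⊥
    cycle p q r = <-irrefl refl (<-trans (<-trans (<⇒≤ p) (<⇒≤ q)) (<⇒≤ r))
    back : cls a ≡ next (cls d)
    back = sym (trans (cong next cd') (next³ (cls a)))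
    b<d : suc b < d
    b<d = gap b d bd (trans cd' (cong next (sym cb)))
    d<a : suc d < a
    d<a = gap′ a d ad back
    by : cls e ≡ cls a ⊎ (cls e ≡ next (cls a) ⊎ cls e ≡ next (next (cls a))) → ⊥
    by (inj₁ q) = cycle b<d (gap′ e d ed (trans q back)) (gap e b eb (trans cb (cong next (sym q))))
    by (inj₂ (inj₁ q)) = cycle d<a (gap′ e a ea q) (gap e d ed (trans cd' (cong next (sym q))))
    by (inj₂ (inj₂ q)) = cycle (gap a c ac h) (gap′ e c ec (trans q (cong next (sym h)))) (gap e a ea (sym (trans (cong next q) (next³ (cls a)))))

  swap : ∀ {a b c d e} → Apart a b c d e → Apart c d a b e
  swap {a} {b} {c} {d} (mkApart ac ad bc bd ea eb ec ed) = mkApart (s a c ac) (s b c bc) (s a d ad) (s b d bd) ec ed ea eb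
    where
    s : ∀ x y → link x y ≡ false → link y x ≡ false
    s x y p = trans (∨-comm (arrow y x) (arrow x y)) p
  flip₁ : ∀ {a b c d e} → Apart a b c d e → Apart b a c d e
  flip₁ (mkApart ac ad bc bd ea eb ec ed) = mkApart bc bd ac ad eb ea ec ed
  flip₂ : ∀ {a b c d e} → Apart a b c d e → Apart a b d c e
  flip₂ (mkApart ac ad bc bd ea eb ec ed) = mkApart ad ac bd bc ea eb ed ec

  -- If `a` and `c` have equal classes, each of them would be smaller than the other; if not, the
  -- classes are consecutive up to exchanging the edges.
  oriented : ∀ {a b c d e} → Apart a b c d e → arrow a b ≡ true → arrow c d ≡ true → ⊥
  oriented {a} {b} {c} {d} A ab cd with turns (cls a) (cls c)
  ... | inj₂ (inj₁ h) = shifted A ab cd h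
  ... | inj₂ (inj₂ h) = shifted (swap A) cd ab (sym (trans (cong next h) (next³ (cls a))))
  ... | inj₁ h = <-irrefl refl (≤-trans (gap a d (Apart.ad A) (trans (arrow-cls c d cd) (cong next h)))
                  (≤-trans (arrow-≤ c d cd) (<⇒≤ (≤-trans (gap′ b c (Apart.bc A) (trans (arrow-cls a b ab) (cong next (sym h)))) (arrow-≤ a b ab)))))

  no-2P2+P1 : ∀ {a b c d e} → Apart a b c d e → link a b ≡ true → link c d ≡ true → ⊥
  no-2P2+P1 A p q with ∨-e p | ∨-e q
  ... | inj₁ ab | inj₁ cd = oriented A ab cd
  ... | inj₁ ab | inj₂ dc = oriented (flip₂ A) ab dc
  ... | inj₂ ba | inj₁ cd = oriented (flip₁ A) ba cd
  ... | inj₂ ba | inj₂ dc = oriented (flip₂ (flip₁ A)) ba dc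

Consecutive : ℕ → ℕ → Set
Consecutive x y = y ≡ suc x ⊎ x ≡ suc y

module OneFull where
  only₀ : Color → Bool
  only₀ c0 = true
  only₀ _ = false

  open Family only₀ public

  record Long (x y : ℕ) : Set where
    constructor mkLong
    field
      cls-x : cls x ≡ c0
      cls-y : cls y ≡ c1
      y≤ : y ≤ suc x

  Short : ℕ → ℕ → Set
  Short x y = Consecutive x y × (cls x ≡ c2 ⊎ cls y ≡ c2)

  -- Only class 0 has chords; every other arrow is a path step, and its start or its end has class
  -- 2.
  arrow-kind : ∀ x y → arrow x y ≡ true → Long x y ⊎ (y ≡ suc x × (cls x ≡ c2 ⊎ cls y ≡ c2))
  arrow-kind x y p with turns c0 (cls x)
  ... | inj₁ q = inj₁ (mkLong q (trans (arrow-cls x y p) (cong next q)) (arrow-≤ x y p))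
  ... | inj₂ (inj₁ q) = inj₂ (arrow-≡ x y (cong only₀ q) p , inj₂ (trans (arrow-cls x y p) (cong next q)))
  ... | inj₂ (inj₂ q) = inj₂ (arrow-≡ x y (cong only₀ q) p , inj₁ q)

  swap-⊎ : ∀ {A B : Set} → A ⊎ B → B ⊎ A
  swap-⊎ (inj₁ a) = inj₂ a
  swap-⊎ (inj₂ b) = inj₁ b

  link-kind : ∀ x y → link x y ≡ true → Long x y ⊎ (Long y x ⊎ Short x y)
  link-kind x y p with ∨-e p
  ... | inj₁ q with arrow-kind x y q
  ... | inj₁ l = inj₁ l
  ... | inj₂ (e , s) = inj₂ (inj₂ (inj₁ e , s))
  link-kind x y p | inj₂ q with arrow-kind y x q
  ... | inj₁ l = inj₂ (inj₁ l)
  ... | inj₂ (e , s) = inj₂ (inj₂ (inj₂ e , swap-⊎ s))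

  -- x, x + 1, x + 2 with middle class 2 span a triangle, and class 2 recurs only after three steps.
  short-middle : ∀ x → cls (suc x) ≡ c2 → link x (suc (suc x)) ≡ true
  short-middle x e = ∨-ir {arrow x (suc (suc x))} (⇒arrow (suc (suc x)) x (cong only₀ (cong next e))
      (trans (next-injective e) (sym (cong next (cong next e)))) (≤-trans (m≤n+m x 3) ≤-refl))

  short-short : ∀ x y z → x ≢ z → link x z ≡ false → Short x y → Short y z → ⊥
  short-short x y z ne nl (inj₁ refl , _) (inj₂ refl , _) = ne refl
  short-short x y z ne nl (inj₂ refl , _) (inj₁ refl , _) = ne refl
  short-short x y z ne nl (inj₁ refl , inj₂ m) (inj₁ refl , _) = f≢t nl (short-middle x m)
  short-short x y z ne nl (inj₁ refl , inj₁ m) (inj₁ refl , inj₁ m') = f≢t nl (short-middle x m')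
  short-short x y z ne nl (inj₁ refl , inj₁ m) (inj₁ refl , inj₂ m') = next²≢ _ (trans m' (sym m))
  short-short x y z ne nl (inj₂ refl , inj₂ m) (inj₂ refl , _) = f≢t nl (trans (∨-comm (arrow x z) (arrow z x)) (short-middle z m))
  short-short x y z ne nl (inj₂ refl , inj₁ m) (inj₂ refl , inj₁ m') = f≢t nl (trans (∨-comm (arrow x z) (arrow z x)) (short-middle z m'))
  short-short x y z ne nl (inj₂ refl , inj₁ m) (inj₂ refl , inj₂ m') = next²≢ _ (trans m (sym m'))

  record InducedP3 (t : Fin 3 → ℕ) : Set where
    constructor mkP3
    field
      e₁ : link (t 0F) (t 1F) ≡ true
      e₂ : link (t 1F) (t 2F) ≡ true
      ne : t 0F ≢ t 2F
      nl : link (t 0F) (t 2F) ≡ false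

  P3-long : ∀ t → InducedP3 t → Σ (Fin 3) λ i → Σ (Fin 3) λ j → Long (t i) (t j)
  P3-long t (mkP3 e₁ e₂ ne nl) with link-kind (t 0F) (t 1F) e₁ | link-kind (t 1F) (t 2F) e₂
  ... | inj₁ l | _ = 0F , 1F , l
  ... | inj₂ (inj₁ l) | _ = 1F , 0F , l
  ... | inj₂ (inj₂ _) | inj₁ l = 1F , 2F , l
  ... | inj₂ (inj₂ _) | inj₂ (inj₁ l) = 2F , 1F , l
  ... | inj₂ (inj₂ s) | inj₂ (inj₂ s') = ⊥-elim (short-short _ _ _ ne nl s s')

  long-gap : ∀ x y → link x y ≡ false → cls x ≡ c0 → cls y ≡ c1 → suc x < y
  long-gap x y p ex ey with y ≤? suc x
  ... | yes l = ⊥-elim (f≢t p (∨-il (⇒arrow x y (cong only₀ ex) (trans ey (sym (cong next ex))) l)))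
  ... | no l = ≰⇒> l

  -- Each P3 contains a long edge. For two long edges with no edge between them, the start of each
  -- would have to precede the start of the other.
  no-2P3 : ∀ t t' → InducedP3 t → InducedP3 t' → (∀ i j → link (t i) (t' j) ≡ false) → ⊥
  no-2P3 t t' p p' cross with P3-long t p | P3-long t' p'
  ... | i , j , mkLong x y l | i' , j' , mkLong x' y' l' =
    <-irrefl refl (≤-trans (long-gap (t i) (t' j') (cross i j') x y')
      (≤-trans l' (<⇒≤ (≤-trans (long-gap (t' i') (t j) (trans (∨-comm (arrow (t' i') (t j)) _) (cross j i')) x' y) l))))

-- Linear forests without 2P2 + P1 and 2P3

offset : ∀ k p x → p ≤ x → x ≤ k + p → Σ (Fin (suc k)) λ i → x ≡ toℕ i + p
offset k p x l h = fromℕ< lt , trans (sym (m∸n+n≡m l)) (cong (_+ p) (sym (Finₚ.toℕ-fromℕ< lt)))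
  where
  lt : x ∸ p < suc k
  lt = s≤s (≤-trans (∸-monoˡ-≤ p h) (≤-reflexive (m+n∸n≡m k p)))

pathAdj⇒ : ∀ {t} (i j : Fin t) → pathAdj i j ≡ true → Consecutive (toℕ i) (toℕ j)
pathAdj⇒ i j p with ∨-e p
... | inj₁ q = inj₁ (sym (≡ᵇ⇒≡ (suc (toℕ i)) (toℕ j) (≡⇒T q)))
... | inj₂ q = inj₂ (sym (≡ᵇ⇒≡ (suc (toℕ j)) (toℕ i) (≡⇒T q)))

⇒pathAdj : ∀ {t} (i j : Fin t) → Consecutive (toℕ i) (toℕ j) → pathAdj i j ≡ true
⇒pathAdj i j (inj₁ e) = ∨-il (T⇒≡ (≡⇒≡ᵇ (suc (toℕ i)) (toℕ j) (sym e)))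
⇒pathAdj i j (inj₂ e) = ∨-ir {suc (toℕ i) ≡ᵇ toℕ j} (T⇒≡ (≡⇒≡ᵇ (suc (toℕ j)) (toℕ i) (sym e)))

consecutive-far : ∀ {x y} → suc x < y → ¬ Consecutive x y
consecutive-far l (inj₁ refl) = <-irrefl refl l
consecutive-far l (inj₂ refl) = <-irrefl refl (≤-trans (n≤1+n _) (≤-trans (n≤1+n _) l))

least : ∀ {P : ℕ → Set} → (∀ i → Dec (P i)) → ∀ M → (∀ i → i < M → ¬ P i) ⊎ (Σ ℕ λ p → P p × (∀ i → i < p → ¬ P i))
least P? zero = inj₁ λ _ ()
least P? (suc M) with least P? M | P? M
... | inj₂ r | _ = inj₂ r
... | inj₁ h | yes p = inj₂ (M , p , h)
... | inj₁ h | no q = inj₁ λ i l → below i (m≤n⇒m<n∨m≡n (≤-pred l))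
  where
  below : ∀ i → i < M ⊎ i ≡ M → ¬ _
  below i (inj₁ l) = h i l
  below i (inj₂ refl) = q

greatest : ∀ {P : ℕ → Set} → (∀ i → Dec (P i)) → ∀ M → (∀ i → M ≤ i → ¬ P i) → (∀ i → ¬ P i) ⊎ (Σ ℕ λ q → P q × (∀ i → q < i → ¬ P i))
greatest P? zero h = inj₁ λ i → h i z≤n
greatest P? (suc M) h with P? M
... | yes p = inj₂ (M , p , h)
... | no q = greatest P? M λ i l → above i (m≤n⇒m<n∨m≡n l)
  where
  above : ∀ i → M < i ⊎ M ≡ i → ¬ _
  above i (inj₁ l) = h i l
  above i (inj₂ refl) = q

bridge : ∀ (i j : Fin 3) → (i ≡ 2F × j ≡ 0F) ⊎ pathAdj (i ↑ˡ 3) (3 ↑ʳ j) ≡ false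
bridge 2F 0F = inj₁ (refl , refl)
bridge 0F 0F = inj₂ refl
bridge 0F 1F = inj₂ refl
bridge 0F 2F = inj₂ refl
bridge 1F 0F = inj₂ refl
bridge 1F 1F = inj₂ refl
bridge 1F 2F = inj₂ refl
bridge 2F 1F = inj₂ refl
bridge 2F 2F = inj₂ refl

-- `g` gives the positions of the vertices of `H` on a path containing it as an induced subgraph.
module Linear (H : Graph) (N : ℕ) (g : Fin (n H) → ℕ) (g<N : ∀ u → g u < N) (g-inj : ∀ u v → g u ≡ g v → u ≡ v)
              (adj⇒ : ∀ u v → adj H u v ≡ true → Consecutive (g u) (g v))
              (⇒adj : ∀ u v → Consecutive (g u) (g v) → adj H u v ≡ true) where

  nonadjacent : ∀ u v → ¬ Consecutive (g u) (g v) → adj H u v ≡ false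
  nonadjacent u v h = ¬t⇒f λ p → h (adj⇒ u v p)

  shift-hom : ∀ {t} p u v (i j : Fin t) → g u ≡ toℕ i + p → g v ≡ toℕ j + p → adj H u v ≡ pathAdj i j
  shift-hom p u v i j eu ev = bool-ext (λ a → ⇒pathAdj i j (down (subst₂ Consecutive eu ev (adj⇒ u v a))))
                                       (λ a → ⇒adj u v (subst₂ Consecutive (sym eu) (sym ev) (up (pathAdj⇒ i j a))))
    where
    down : Consecutive (toℕ i + p) (toℕ j + p) → Consecutive (toℕ i) (toℕ j)
    down (inj₁ e) = inj₁ (+-cancelʳ-≡ p _ _ e)
    down (inj₂ e) = inj₂ (+-cancelʳ-≡ p _ _ e)
    up : Consecutive (toℕ i) (toℕ j) → Consecutive (toℕ i + p) (toℕ j + p)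
    up (inj₁ e) = inj₁ (cong (_+ p) e)
    up (inj₂ e) = inj₂ (cong (_+ p) e)

  shift-inj : ∀ {t} p u v (i j : Fin t) → g u ≡ toℕ i + p → g v ≡ toℕ j + p → i ≡ j → u ≡ v
  shift-inj p u v i j eu ev refl = g-inj u v (trans eu (sym ev))

  window-P6 : ∀ p → (∀ u → p ≤ g u × g u ≤ 5 + p) → IsInducedSubgraph H (path 6)
  window-P6 p h = (λ u → proj₁ (at u)) , (λ {u} {v} → shift-inj p u v _ _ (proj₂ (at u)) (proj₂ (at v)))
                  , λ u v → shift-hom p u v _ _ (proj₂ (at u)) (proj₂ (at v))
    where
    at : ∀ u → Σ (Fin 6) λ i → g u ≡ toℕ i + p
    at u = offset 5 p (g u) (proj₁ (h u)) (proj₂ (h u))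

  -- Vertices outside the window lie on no edge and become isolated ones; providing `n H` of these
  -- lets each vertex serve as its own index.
  window-P4 : ∀ p → (∀ u v → adj H u v ≡ true → p ≤ g u × g u ≤ 3 + p) → IsInducedSubgraph H (P4+kP1 (n H))
  window-P4 p h = (λ u → join 4 (n H) (place u (spot u))) , inj , λ u v → trans (hom u v (spot u) (spot v)) (sym (du-join (place u (spot u)) (place v (spot v))))
    where
    Spot : Fin (n H) → Set
    Spot u = (Σ (Fin 4) λ i → g u ≡ toℕ i + p) ⊎ ¬ (p ≤ g u × g u ≤ 3 + p)
    spot : ∀ u → Spot u
    spot u with (p ≤? g u) ×-dec (g u ≤? 3 + p)
    ... | yes (l , m) = inj₁ (offset 3 p (g u) l m)
    ... | no q = inj₂ q
    place : ∀ u → Spot u → Fin 4 ⊎ Fin (n H)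
    place u (inj₁ (i , _)) = inj₁ i
    place u (inj₂ _) = inj₂ u
    D : Fin 4 ⊎ Fin (n H) → Fin 4 ⊎ Fin (n H) → Bool
    D (inj₁ i) (inj₁ j) = pathAdj i j
    D (inj₁ _) (inj₂ _) = false
    D (inj₂ _) _ = false
    du-join : ∀ x y → adj (P4+kP1 (n H)) (join 4 (n H) x) (join 4 (n H) y) ≡ D x y
    du-join x y rewrite Finₚ.splitAt-join 4 (n H) x | Finₚ.splitAt-join 4 (n H) y with x | y
    ... | inj₁ _ | inj₁ _ = refl
    ... | inj₁ _ | inj₂ _ = refl
    ... | inj₂ _ | inj₁ _ = refl
    ... | inj₂ _ | inj₂ _ = refl
    hom : ∀ u v (s : Spot u) (s' : Spot v) → adj H u v ≡ D (place u s) (place v s')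
    hom u v (inj₁ (i , e)) (inj₁ (j , e')) = shift-hom p u v i j e e'
    hom u v (inj₁ _) (inj₂ q) = ¬t⇒f λ a → q (h v u (trans (adj-sym H v u) a))
    hom u v (inj₂ q) _ = ¬t⇒f λ a → q (h u v a)
    place-inj : ∀ u v (s : Spot u) (s' : Spot v) → place u s ≡ place v s' → u ≡ v
    place-inj u v (inj₁ (i , e)) (inj₁ (.i , e')) refl = shift-inj p u v i i e e' refl
    place-inj u v (inj₂ _) (inj₂ _) refl = refl
    inj : Injective _≡_ _≡_ (λ u → join 4 (n H) (place u (spot u)))
    inj {u} {v} e = place-inj u v (spot u) (spot v)
      (trans (sym (Finₚ.splitAt-join 4 (n H) _)) (trans (cong (splitAt 4) e) (Finₚ.splitAt-join 4 (n H) _)))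

  -- The windows are pushed together to the positions 0, 1, 2 and 3, 4, 5. Only 2 and 3 become newly
  -- adjacent, and they are not both occupied.
  two-windows-P6 : ∀ p s → (∀ u → (Σ (Fin 3) λ i → g u ≡ toℕ i + p) ⊎ (Σ (Fin 3) λ i → g u ≡ toℕ i + (4 + s + p))) →
    (∀ u v → g u ≡ 2 + p → g v ≡ 4 + s + p → ⊥) → IsInducedSubgraph H (path 6)
  two-windows-P6 p s spot gapped = (λ u → join 3 3 (place (spot u))) , (λ {u} {v} e → place-inj u v (spot u) (spot v)
      (trans (sym (Finₚ.splitAt-join 3 3 _)) (trans (cong (splitAt 3) e) (Finₚ.splitAt-join 3 3 _)))) , λ u v → hom u v (spot u) (spot v)
    where
    Spot : Fin (n H) → Set
    Spot u = (Σ (Fin 3) λ i → g u ≡ toℕ i + p) ⊎ (Σ (Fin 3) λ i → g u ≡ toℕ i + (4 + s + p))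
    place : ∀ {u} → Spot u → Fin 3 ⊎ Fin 3
    place (inj₁ (i , _)) = inj₁ i
    place (inj₂ (i , _)) = inj₂ i
    left : ∀ {u} i → g u ≡ toℕ i + p → g u ≡ toℕ (i ↑ˡ 3) + p
    left i e = trans e (cong (_+ p) (sym (Finₚ.toℕ-↑ˡ i 3)))
    right : ∀ {u} (i : Fin 3) → g u ≡ toℕ i + (4 + s + p) → g u ≡ toℕ (3 ↑ʳ i) + (1 + s + p)
    right i e = trans e (trans (+-suc³ (toℕ i)) (cong (_+ (1 + s + p)) (sym (Finₚ.toℕ-↑ʳ 3 i))))
      where
      +-suc³ : ∀ x → x + (4 + s + p) ≡ 3 + x + (1 + s + p)
      +-suc³ x = trans (+-suc x _) (cong suc (trans (+-suc x _) (cong suc (+-suc x _))))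
    place-inj : ∀ u v (a : Spot u) (b : Spot v) → place a ≡ place b → u ≡ v
    place-inj u v (inj₁ (i , e)) (inj₁ (.i , e')) refl = g-inj u v (trans e (sym e'))
    place-inj u v (inj₂ (i , e)) (inj₂ (.i , e')) refl = g-inj u v (trans e (sym e'))
    cross : ∀ u v i j → g u ≡ toℕ i + p → g v ≡ toℕ j + (4 + s + p) → adj H u v ≡ pathAdj (i ↑ˡ 3) (3 ↑ʳ j)
    cross u v i j e e' with bridge i j
    ... | inj₁ (refl , refl) = ⊥-elim (gapped u v e e')
    ... | inj₂ q = trans (nonadjacent u v (subst₂ (λ x y → ¬ Consecutive x y) (sym e) (sym e') (consecutive-far far))) (sym q)
      where
      far : suc (toℕ i + p) < toℕ j + (4 + s + p)
      far = ≤-trans (s≤s (s≤s (+-mono-≤ (≤-pred (Finₚ.toℕ<n i)) (m≤n+m p s)))) (m≤n+m _ (toℕ j))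
    hom : ∀ u v (a : Spot u) (b : Spot v) → adj H u v ≡ pathAdj (join 3 3 (place a)) (join 3 3 (place b))
    hom u v (inj₁ (i , e)) (inj₁ (j , e')) = shift-hom p u v (i ↑ˡ 3) (j ↑ˡ 3) (left i e) (left j e')
    hom u v (inj₁ (i , e)) (inj₂ (j , e')) = cross u v i j e e'
    hom u v (inj₂ (i , e)) (inj₁ (j , e')) = trans (adj-sym H u v) (trans (cross v u j i e' e) (adj-sym (path 6) (j ↑ˡ 3) (3 ↑ʳ i)))
    hom u v (inj₂ (i , e)) (inj₂ (j , e')) = shift-hom (1 + s + p) u v (3 ↑ʳ i) (3 ↑ʳ j) (right i e) (right j e')

  Edge : ℕ → Set
  Edge p = Σ (Fin (n H)) λ u → Σ (Fin (n H)) λ v → g u ≡ p × g v ≡ suc p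

  edge? : ∀ p → Dec (Edge p)
  edge? p = Finₚ.any? λ u → Finₚ.any? λ v → (g u ℕₚ.≟ p) ×-dec (g v ℕₚ.≟ suc p)

  module Forbidden
    (no-2P2+P1 : ∀ a b c d e → adj H a b ≡ true → adj H c d ≡ true → adj H a c ≡ false → adj H a d ≡ false → adj H b c ≡ false → adj H b d ≡ false →
       adj H e a ≡ false → adj H e b ≡ false → adj H e c ≡ false → adj H e d ≡ false → ⊥)
    (no-2P3 : ∀ (t t' : Fin 3 → Fin (n H)) → adj H (t 0F) (t 1F) ≡ true → adj H (t 1F) (t 2F) ≡ true → t 0F ≢ t 2F → adj H (t 0F) (t 2F) ≡ false →
       adj H (t' 0F) (t' 1F) ≡ true → adj H (t' 1F) (t' 2F) ≡ true → t' 0F ≢ t' 2F → adj H (t' 0F) (t' 2F) ≡ false →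
       (∀ i j → adj H (t i) (t' j) ≡ false) → ⊥) where

    far-windows : ∀ p s u₀ u₁ u₂ v₀ v₁ v₂ → g u₀ ≡ p → g u₁ ≡ 1 + p → g u₂ ≡ 2 + p →
      g v₀ ≡ 4 + s + p → g v₁ ≡ 5 + s + p → g v₂ ≡ 6 + s + p → ⊥
    far-windows p s u₀ u₁ u₂ v₀ v₁ v₂ a₀ a₁ a₂ b₀ b₁ b₂ = no-2P3 t t' (e t p at 0F 1F (inj₁ refl)) (e t p at 1F 2F (inj₁ refl)) (d t p at) (f t p at)
        (e t' q at' 0F 1F (inj₁ refl)) (e t' q at' 1F 2F (inj₁ refl)) (d t' q at') (f t' q at') cross
      where
      q = 4 + s + p
      t t' : Fin 3 → Fin (n H)
      t 0F = u₀
      t 1F = u₁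
      t 2F = u₂
      t' 0F = v₀
      t' 1F = v₁
      t' 2F = v₂
      at : ∀ i → g (t i) ≡ toℕ i + p
      at 0F = a₀
      at 1F = a₁
      at 2F = a₂
      at' : ∀ i → g (t' i) ≡ toℕ i + q
      at' 0F = b₀
      at' 1F = b₁
      at' 2F = b₂
      e : ∀ (t : Fin 3 → Fin (n H)) p → (∀ i → g (t i) ≡ toℕ i + p) → ∀ i j → Consecutive (toℕ i + p) (toℕ j + p) → adj H (t i) (t j) ≡ true
      e t p at i j c = ⇒adj _ _ (subst₂ Consecutive (sym (at i)) (sym (at j)) c)
      d : ∀ (t : Fin 3 → Fin (n H)) p → (∀ i → g (t i) ≡ toℕ i + p) → t 0F ≢ t 2F
      d t p at z = <-irrefl (trans (sym (at 0F)) (trans (cong g z) (at 2F))) (s≤s (n≤1+n p))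
      f : ∀ (t : Fin 3 → Fin (n H)) p → (∀ i → g (t i) ≡ toℕ i + p) → adj H (t 0F) (t 2F) ≡ false
      f t p at = nonadjacent _ _ (subst₂ (λ x y → ¬ Consecutive x y) (sym (at 0F)) (sym (at 2F)) (consecutive-far ≤-refl))
      cross : ∀ i j → adj H (t i) (t' j) ≡ false
      cross i j = nonadjacent _ _ (subst₂ (λ x y → ¬ Consecutive x y) (sym (at i)) (sym (at' j)) (consecutive-far
         (≤-trans (s≤s (s≤s (+-mono-≤ (≤-pred (Finₚ.toℕ<n i)) (m≤n+m p s)))) (m≤n+m _ (toℕ j)))))

    module Extremes (p q : ℕ) (ep : Edge p) (eq : Edge q) (low : ∀ i → i < p → ¬ Edge i) (high : ∀ i → q < i → ¬ Edge i) where
      inside : ∀ u v → adj H u v ≡ true → p ≤ g u × g u ≤ suc q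
      inside u v a with adj⇒ u v a
      ... | inj₁ e = ≮⇒≥ (λ l → low _ l (u , v , refl , e)) , ≤-trans (≮⇒≥ (λ l → high _ l (u , v , refl , e))) (n≤1+n q)
      ... | inj₂ e = ≤-trans (≮⇒≥ (λ l → low _ l (v , u , refl , e))) (≤-trans (n≤1+n _) (≤-reflexive (sym e)))
                   , ≤-trans (≤-reflexive e) (s≤s (≮⇒≥ (λ l → high _ l (v , u , refl , e))))

      -- At this distance the first and the last edge form 2P2, so every vertex is adjacent to an
      -- end of one of them; `inside` bounds the position on the other side.
      near : 3 + p ≤ q → Edge p → Edge q → ∀ w → (p ≤ g w × g w ≤ 2 + p) ⊎ (q ≤ suc (g w) × g w ≤ suc q)
      near p<q (u₀ , u₁ , a₀ , a₁) (v₀ , v₁ , b₀ , b₁) w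
          with bool-em (adj H w u₀) | bool-em (adj H w u₁) | bool-em (adj H w v₀) | bool-em (adj H w v₁)
      ... | inj₁ a | _ | _ | _ = inj₁ (proj₁ (inside w u₀ a) , near-p (subst (Consecutive (g w)) a₀ (adj⇒ w u₀ a)))
        where
        near-p : Consecutive (g w) p → g w ≤ 2 + p
        near-p (inj₁ e) = ≤-trans (n≤1+n _) (≤-trans (≤-reflexive (sym e)) (m≤n+m p 2))
        near-p (inj₂ e) = ≤-trans (≤-reflexive e) (n≤1+n _)
      ... | inj₂ _ | inj₁ a | _ | _ = inj₁ (proj₁ (inside w u₁ a) , near-p (subst (Consecutive (g w)) a₁ (adj⇒ w u₁ a)))
        where
        near-p : Consecutive (g w) (suc p) → g w ≤ 2 + p
        near-p (inj₁ e) = ≤-trans (n≤1+n _) (≤-trans (≤-reflexive (sym e)) (n≤1+n _))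
        near-p (inj₂ e) = ≤-reflexive e
      ... | inj₂ _ | inj₂ _ | inj₁ a | _ = inj₂ (near-q (subst (Consecutive (g w)) b₀ (adj⇒ w v₀ a)) , proj₂ (inside w v₀ a))
        where
        near-q : Consecutive (g w) q → q ≤ suc (g w)
        near-q (inj₁ e) = ≤-reflexive e
        near-q (inj₂ e) = ≤-trans (m≤n+m q 2) (s≤s (≤-reflexive (sym e)))
      ... | inj₂ _ | inj₂ _ | inj₂ _ | inj₁ a = inj₂ (near-q (subst (Consecutive (g w)) b₁ (adj⇒ w v₁ a)) , proj₂ (inside w v₁ a))
        where
        near-q : Consecutive (g w) (suc q) → q ≤ suc (g w)
        near-q (inj₁ e) = ≤-trans (n≤1+n q) (≤-reflexive e)
        near-q (inj₂ e) = ≤-trans (m≤n+m q 3) (s≤s (≤-reflexive (sym e)))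
      ... | inj₂ n₁ | inj₂ n₂ | inj₂ n₃ | inj₂ n₄ = ⊥-elim (no-2P2+P1 u₀ u₁ v₀ v₁ w
          (⇒adj u₀ u₁ (inj₁ (trans a₁ (cong suc (sym a₀))))) (⇒adj v₀ v₁ (inj₁ (trans b₁ (cong suc (sym b₀)))))
          (away a₀ b₀ (≤-trans (n≤1+n _) p<q)) (away a₀ b₁ (≤-trans (n≤1+n _) (≤-trans p<q (n≤1+n q)))) (away a₁ b₀ p<q) (away a₁ b₁ (≤-trans p<q (n≤1+n q)))
          n₁ n₂ n₃ n₄)
        where
        away : ∀ {u v x y} → g u ≡ x → g v ≡ y → suc x < y → adj H u v ≡ false
        away refl refl l = nonadjacent _ _ (consecutive-far l)

      -- By the distance of the extreme edges, all edges lie in four positions, or all vertices in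
      -- six, or all vertices in two windows of three. In the last case positions `2 + p` and
      -- `4 + s + p` are not both occupied, since this would complete 2P3.
      conclusion : IsInducedSubgraph H (path 6) ⊎ Σ ℕ (λ k → IsInducedSubgraph H (P4+kP1 k))
      conclusion with q ≤? 2 + p
      ... | yes l = inj₂ (n H , window-P4 p λ u v a → proj₁ (inside u v a) , ≤-trans (proj₂ (inside u v a)) (s≤s l))
      ... | no far with q ≤? 4 + p
      ... | yes l = inj₁ (window-P6 p λ u → fits u (near (≰⇒> far) ep eq u))
        where
        fits : ∀ u → (p ≤ g u × g u ≤ 2 + p) ⊎ (q ≤ suc (g u) × g u ≤ suc q) → p ≤ g u × g u ≤ 5 + p
        fits u (inj₁ (a , b)) = a , ≤-trans b (+-monoˡ-≤ p {2} {5} (s≤s (s≤s z≤n)))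
        fits u (inj₂ (a , b)) = ≤-trans (m≤n+m p 2) (≤-pred (≤-trans (≰⇒> far) a)) , ≤-trans b (s≤s l)
      ... | no farther = inj₁ (separated (m≤n⇒∃[o]m+o≡n (≰⇒> farther)))
        where
        separated : (Σ ℕ λ s → 5 + p + s ≡ q) → IsInducedSubgraph H (path 6)
        separated (s , e) = two-windows-P6 p s spot λ u v a b →
            let (u₀ , u₁ , a₀ , a₁) = ep ; (v₁ , v₂ , b₁ , b₂) = eq in
            far-windows p s u₀ u₁ u v v₁ v₂ a₀ a₁ a b (trans b₁ q≡) (trans b₂ (cong suc q≡))
          where
          q≡ : q ≡ 5 + s + p
          q≡ = trans (sym e) (cong (5 +_) (+-comm p s))
          spot : ∀ u → (Σ (Fin 3) λ i → g u ≡ toℕ i + p) ⊎ (Σ (Fin 3) λ i → g u ≡ toℕ i + (4 + s + p))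
          spot u with near (≰⇒> far) ep eq u
          ... | inj₁ (a , b) = inj₁ (offset 2 p (g u) a b)
          ... | inj₂ (a , b) = inj₂ (offset 2 (4 + s + p) (g u) (≤-pred (≤-trans (≤-reflexive (sym q≡)) a)) (≤-trans b (≤-reflexive (cong suc q≡))))

    conclusion : IsInducedSubgraph H (path 6) ⊎ Σ ℕ (λ k → IsInducedSubgraph H (P4+kP1 k))
    conclusion with greatest edge? N (λ { i l (u , _ , refl , _) → <-irrefl refl (≤-trans (g<N u) l) })
    -- Without edges the window may lie anywhere.
    ... | inj₁ none = inj₂ (n H , window-P4 0 λ u v a → ⊥-elim (edgeless-H u v (adj⇒ u v a)))
      where
      edgeless-H : ∀ u v → Consecutive (g u) (g v) → ⊥
      edgeless-H u v (inj₁ e) = none _ (u , v , refl , e)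
      edgeless-H u v (inj₂ e) = none _ (v , u , refl , e)
    ... | inj₂ (q , eq , high) with least edge? (suc q)
    ... | inj₁ none = ⊥-elim (none q ≤-refl eq)
    ... | inj₂ (p , ep , low) = Extremes.conclusion p q ep eq low high

-- The path family puts `H` on a line; the two other embeddings serve to exclude 2P2 + P1 and 2P3.
necessary : ∀ H → FinitelyManyObstructions H → IsInducedSubgraph H (path 6) ⊎ Σ ℕ (λ k → IsInducedSubgraph H (P4+kP1 k))
necessary H fin with embeds-in-family H fin (λ _ → false) | embeds-in-family H fin (λ _ → true) | embeds-in-family H fin OneFull.only₀
... | N , f , f-inj , f-hom | _ , f₂ , _ , hom₂ | _ , f₃ , inj₃ , hom₃ =
  Linear.Forbidden.conclusion H N (λ u → toℕ (f u)) (λ u → Finₚ.toℕ<n (f u)) (λ u v e → f-inj (Finₚ.toℕ-injective e)) adj⇒ ⇒adj no-2P2+P1 no-2P3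
  where
  open Family (λ _ → false)
  adj⇒ : ∀ u v → adj H u v ≡ true → Consecutive (toℕ (f u)) (toℕ (f v))
  adj⇒ u v a with ∨-e (trans (sym (f-hom u v)) a)
  ... | inj₁ p = inj₁ (arrow-≡ (toℕ (f u)) (toℕ (f v)) refl p)
  ... | inj₂ p = inj₂ (arrow-≡ (toℕ (f v)) (toℕ (f u)) refl p)
  ⇒adj : ∀ u v → Consecutive (toℕ (f u)) (toℕ (f v)) → adj H u v ≡ true
  ⇒adj u v (inj₁ e) = trans (f-hom u v) (subst (λ z → link (toℕ (f u)) z ≡ true) (sym e) (link-suc (toℕ (f u))))
  ⇒adj u v (inj₂ e) = trans (adj-sym H u v) (trans (f-hom v u) (subst (λ z → link (toℕ (f v)) z ≡ true) (sym e) (link-suc (toℕ (f v)))))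
  via₂ : ∀ {b} u v → adj H u v ≡ b → AllFull.link (toℕ (f₂ u)) (toℕ (f₂ v)) ≡ b
  via₂ u v e = trans (sym (hom₂ u v)) e
  via₃ : ∀ {b} u v → adj H u v ≡ b → OneFull.link (toℕ (f₃ u)) (toℕ (f₃ v)) ≡ b
  via₃ u v e = trans (sym (hom₃ u v)) e
  no-2P2+P1 : ∀ a b c d e → adj H a b ≡ true → adj H c d ≡ true → adj H a c ≡ false → adj H a d ≡ false → adj H b c ≡ false → adj H b d ≡ false →
       adj H e a ≡ false → adj H e b ≡ false → adj H e c ≡ false → adj H e d ≡ false → ⊥
  no-2P2+P1 a b c d e ab cd ac ad bc bd ea eb ec ed = AllFull.no-2P2+P1 {toℕ (f₂ a)} {toℕ (f₂ b)} {toℕ (f₂ c)} {toℕ (f₂ d)} {toℕ (f₂ e)}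
    (AllFull.mkApart (via₂ a c ac) (via₂ a d ad) (via₂ b c bc) (via₂ b d bd) (via₂ e a ea) (via₂ e b eb) (via₂ e c ec) (via₂ e d ed)) (via₂ a b ab) (via₂ c d cd)
  no-2P3 : ∀ (t t' : Fin 3 → Fin (n H)) → adj H (t 0F) (t 1F) ≡ true → adj H (t 1F) (t 2F) ≡ true → t 0F ≢ t 2F → adj H (t 0F) (t 2F) ≡ false →
       adj H (t' 0F) (t' 1F) ≡ true → adj H (t' 1F) (t' 2F) ≡ true → t' 0F ≢ t' 2F → adj H (t' 0F) (t' 2F) ≡ false →
       (∀ i j → adj H (t i) (t' j) ≡ false) → ⊥
  no-2P3 t t' a b c d a' b' c' d' x = OneFull.no-2P3 (λ i → toℕ (f₃ (t i))) (λ i → toℕ (f₃ (t' i)))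
    (OneFull.mkP3 (via₃ (t 0F) (t 1F) a) (via₃ (t 1F) (t 2F) b) (λ e → c (inj₃ (Finₚ.toℕ-injective e))) (via₃ (t 0F) (t 2F) d))
    (OneFull.mkP3 (via₃ (t' 0F) (t' 1F) a') (via₃ (t' 1F) (t' 2F) b') (λ e → c' (inj₃ (Finₚ.toℕ-injective e))) (via₃ (t' 0F) (t' 2F) d'))
    (λ i j → via₃ (t i) (t' j) (x i j))

theorem3 : (H : Graph) →
    FinitelyManyObstructions H ⇔
    (IsInducedSubgraph H (path 6) ⊎ Σ ℕ (λ k → IsInducedSubgraph H (P4+kP1 k)))
theorem3 H = mk⇔ (necessary H) sufficient
  where
  sufficient : IsInducedSubgraph H (path 6) ⊎ Σ ℕ (λ k → IsInducedSubgraph H (P4+kP1 k)) → FinitelyManyObstructions H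
  sufficient (inj₁ sub) = P6-finite H sub
  sufficient (inj₂ (k , sub)) = P4k-finite H k sub
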